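{- Let $r > 2$ be a prime and let $A_r$ be the quaternion algebra over $\mathbb{Q}$ ramified exactly at $r$ and $\infty$. Let $m$ be a positive integer coprime to $r$, and set $C(r) = r^2/16$. If $m > C(r)$, then $m$ is not an outlier for $A_r$.
   Context: An element of $A_r$ is an integer if its monic minimal polynomial over $\mathbb{Q}$ has coefficients in $\mathbb{Z}$. A positive integer $m$ is an outlier for $A_r$ if it is not the reduced norm of any integer of $A_r$ (every positive integer is a reduced norm of some element of $A_r$). -}

module Defs where

open import Data.Nat as ℕ using (ℕ)
open import Data.Integer as ℤ using (ℤ; +_)
open import Data.Integer.Divisibility as ℤD using ()
open import Data.Rational as ℚ using (ℚ)
open import Data.Rational.Properties as ℚP using ()
open import Data.Product using (Σ; _×_; ∃)
open import Data.Empty using (⊥)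
open import Data.List using (List; []; _∷_)
open import Data.List.Relation.Unary.All using (All)
open import Relation.Nullary using (¬_; Dec; yes; no)
open import Relation.Binary.PropositionalEquality using (_≡_)

-- Local splitting / ramification of the quaternion algebra (a,b)_ℚ.
-- (a,b)_ℚ splits at the prime p iff the ternary form a x² + b y² − z²
-- has a nontrivial zero over ℚ_p, i.e. (by scaling and compactness of ℤ_p)
-- iff for every k it has a primitive zero modulo p^k.

SplitsAtPrime : ℤ → ℤ → ℕ → Set
SplitsAtPrime a b p =
  (k : ℕ) → Σ ℤ λ x → Σ ℤ λ y → Σ ℤ λ z →
    ¬ ((+ p ℤD.∣ x) × (+ p ℤD.∣ y) × (+ p ℤD.∣ z)) ×
    (+ (p ℕ.^ k) ℤD.∣ ((a ℤ.* (x ℤ.* x) ℤ.+ b ℤ.* (y ℤ.* y)) ℤ.- z ℤ.* z))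

RamifiedAtPrime : ℤ → ℤ → ℕ → Set
RamifiedAtPrime a b p = ¬ SplitsAtPrime a b p

-- (a,b)_ℚ ⊗ ℝ is a division algebra (Hamilton quaternions) iff a < 0 and b < 0.
RamifiedAtInfinity : ℤ → ℤ → Set
RamifiedAtInfinity a b = (a ℤ.< + 0) × (b ℤ.< + 0)

RamifiedExactlyAt : ℤ → ℤ → ℕ → Set
RamifiedExactlyAt a b r =
  RamifiedAtInfinity a b ×
  ((p : ℕ) → Prime p → (RamifiedAtPrime a b p → p ≡ r) × (p ≡ r → RamifiedAtPrime a b p))
  where open import Data.Nat.Primality using (Prime)

-- The quaternion algebra (a,b)_ℚ with basis 1, i, j, k = ij,
-- i² = a, j² = b, ij = −ji.  Elements x₀ + x₁ i + x₂ j + x₃ k.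

record Quat : Set where
  constructor quat
  field
    x₀ x₁ x₂ x₃ : ℚ
open Quat public

ℤ→ℚ : ℤ → ℚ
ℤ→ℚ z = z ℚ./ 1

trd : Quat → ℚ
trd x = ℤ→ℚ (+ 2) ℚ.* x₀ x

nrd : ℤ → ℤ → Quat → ℚ
nrd a b x =
  ((x₀ x ℚ.* x₀ x ℚ.- ℤ→ℚ a ℚ.* (x₁ x ℚ.* x₁ x))
     ℚ.- ℤ→ℚ b ℚ.* (x₂ x ℚ.* x₂ x))
     ℚ.+ ℤ→ℚ (a ℤ.* b) ℚ.* (x₃ x ℚ.* x₃ x)

IsScalar : Quat → Set
IsScalar x = (x₁ x ≡ ℚ.0ℚ) × (x₂ x ≡ ℚ.0ℚ) × (x₃ x ≡ ℚ.0ℚ)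

isScalar? : (x : Quat) → Dec (IsScalar x)
isScalar? x with x₁ x ℚP.≟ ℚ.0ℚ | x₂ x ℚP.≟ ℚ.0ℚ | x₃ x ℚP.≟ ℚ.0ℚ
... | yes p | yes q | yes s = yes (p Data.Product., q Data.Product., s)
  where import Data.Product
... | no ¬p | _ | _ = no λ h → ¬p (Data.Product.proj₁ h)
  where import Data.Product
... | yes _ | no ¬q | _ = no λ h → ¬q (Data.Product.proj₁ (Data.Product.proj₂ h))
  where import Data.Product
... | yes _ | yes _ | no ¬s = no λ h → ¬s (Data.Product.proj₂ (Data.Product.proj₂ h))
  where import Data.Product

-- Non-leading coefficients of the monic minimal polynomial of x over ℚ:
--   scalar x = x₀ :       t − x₀
--   otherwise     :       t² − trd(x) t + nrd(x)
minPolyCoeffs : ℤ → ℤ → Quat → List ℚ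
minPolyCoeffs a b x with isScalar? x
... | yes _ = ℚ.- x₀ x ∷ []
... | no  _ = nrd a b x ∷ ℚ.- trd x ∷ []

IsRationalInteger : ℚ → Set
IsRationalInteger q = Σ ℤ λ z → q ≡ ℤ→ℚ z

IsInteger : ℤ → ℤ → Quat → Set
IsInteger a b x = All IsRationalInteger (minPolyCoeffs a b x)

IsOutlier : ℤ → ℤ → ℕ → Set
IsOutlier a b m = ¬ (Σ Quat λ x → IsInteger a b x × (nrd a b x ≡ ℤ→ℚ (+ m)))

{-# OPTIONS --safe #-}
-- A non-scalar quaternion of trace t and reduced norm m exists as soon as the form ⟨a, b, −ab, −d⟩ with d = t² − 4m
-- is isotropic.  As 16m > r², one can choose 0 ≤ t < r/2 such that d is a non-residue mod r, and d < 0.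
--
-- Let c = −rn with n a product of primes splitting in ℚ(√d), such that c is a square modulo the odd primes dividing d.
-- Then (d, c) and (a, b) are both ramified exactly at r and ∞, so the Albert form ⟨a, b, −ab, −d, −c, dc⟩ has
-- trivial residues and signature 0.  Eliminating the largest prime again and again (Milnor), it vanishes in the Witt
-- group of ℚ.  Hence it has a totally isotropic subspace of dimension 3, which meets the subspace ⟨a, b, −ab, −d⟩.
--
-- That such an n exists replaces the appeal to Dirichlet's theorem.  Otherwise, by duality over 𝔽₂ and quadratic
-- reciprocity, there are two real characters, both −1 at −r, that are never both −1 at a prime.  Then their convolution is
-- nonnegative, and at least 1 at squares, so that Σ χ₁(α) χ₂(β) max(0, X − αβ) ≫ X √X; but summation by parts in both
-- variables shows that this sum is o(X √X).
--
-- The conclusion is a negation, so excluded middle may be used throughout.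
module Submission where

open import Defs
open import Data.Nat as ℕ using (ℕ; zero; suc)
import Data.Nat.Properties as ℕP
import Data.Nat.Divisibility as ℕD
import Data.Nat.Tactic.RingSolver as ℕRing
open import Data.Nat.Primality using (Prime)
import Data.Integer.Properties as ℤP
open import Data.Sign as Sign using (Sign; opposite)
import Data.Sign.Properties as SignP
open import Data.Bool using (Bool; true; false)
open import Data.Product using (Σ; ∃; _×_; _,_; proj₁; proj₂)
open import Data.Sum using (_⊎_; inj₁; inj₂)
open import Data.Empty using (⊥; ⊥-elim)
open import Relation.Nullary using (¬_; Dec; yes; no)
open import Data.Integer.Tactic.RingSolver using (solve-∀)
open import Relation.Binary.PropositionalEquality

-- In place of one prime n a product of split primes is enough: (d, c) is unramified at every prime
-- where d is a nonzero square. The sign vectors of such products at the odd primes dividing d form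
-- a group, so only one membership has to be decided. If it fails, duality gives χ₁ with value 1 at
-- all split primes and -1 at -r. Put ψ = (d/·) and χ₂ = ψ χ₁. Where χ₁ is -1 at a prime, ψ is -1 as
-- well, so χ₂ is 1; and ψ(-r) = (-1)(-1) = 1, because d < 0 and r is inert, so χ₂(-r) = -1 too.
-- This common value makes both characters nontrivial, hence of sum 0 over a period, which is all
-- that the estimate uses about cancellation.
--
-- On the algebraic side nothing compares Hilbert symbols globally: the product formula is absorbed
-- in the vanishing of a Witt class. The residue at 2 is a mere parity, so only symbols at odd
-- primes are ever evaluated. Forms are kept diagonal over ℤ, and isometries over ℚ are replaced by
-- integral maps that scale the form by a nonzero square.

-- Congruences in ℤ.

module Congruence where

  open import Data.Nat.Primality using (euclidsLemma; prime⇒nonTrivial)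
  open import Data.Integer hiding (suc)
  open import Data.Integer.DivMod using (_%ℕ_; _/ℕ_; n%ℕd<d; a≡a%ℕn+[a/ℕn]*n)
  open import Data.Integer.Divisibility.Signed
  open import Data.Sum using ([_,_]′)
  open import Function using (_$_)

  infix 4 _≋_mod_

  -- A record instead of a synonym for `+ p ∣ (x - y)`: a difference does not determine its two
  -- terms, so unification could not recover `x` and `y` from the unfolded type.
  record _≋_mod_ (x y : ℤ) (p : ℕ) : Set where
    constructor cong∣
    field ∣diff : + p ∣ (x - y)
  open _≋_mod_ public

  module _ {p : ℕ} where

    ≋-reflexive : ∀ {x y} → x ≡ y → x ≋ y mod p
    ≋-reflexive {x} refl = cong∣ (divides (+ 0) (ℤP.+-inverseʳ x))

    ≋-refl : ∀ {x} → x ≋ x mod p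
    ≋-refl = ≋-reflexive refl

    ≋-sym : ∀ {x y} → x ≋ y mod p → y ≋ x mod p
    ≋-sym {x} {y} (cong∣ h) = cong∣ (subst (+ p ∣_) (sym (lem x y)) (∣m⇒∣-m h))
      where lem : ∀ x y → y - x ≡ - (x - y)
            lem = solve-∀

    ≋-trans : ∀ {x y z} → x ≋ y mod p → y ≋ z mod p → x ≋ z mod p
    ≋-trans {x} {y} {z} (cong∣ h) (cong∣ k) = cong∣ $ subst (+ p ∣_) (lem x y z) (∣m∣n⇒∣m+n h k)
      where lem : ∀ x y z → (x - y) + (y - z) ≡ x - z
            lem = solve-∀

    ≋-+ : ∀ {x y u v} → x ≋ y mod p → u ≋ v mod p → x + u ≋ y + v mod p
    ≋-+ {x} {y} {u} {v} (cong∣ h) (cong∣ k) = cong∣ $ subst (+ p ∣_) (lem x y u v) (∣m∣n⇒∣m+n h k)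
      where lem : ∀ x y u v → (x - y) + (u - v) ≡ (x + u) - (y + v)
            lem = solve-∀

    ≋-* : ∀ {x y u v} → x ≋ y mod p → u ≋ v mod p → x * u ≋ y * v mod p
    ≋-* {x} {y} {u} {v} (cong∣ h) (cong∣ k) = cong∣ $ subst (+ p ∣_) (lem x y u v) (∣m∣n⇒∣m+n (∣n⇒∣m*n u h) (∣n⇒∣m*n y k))
      where lem : ∀ x y u v → u * (x - y) + y * (u - v) ≡ x * u - y * v
            lem = solve-∀

    ≋-*ˡ : ∀ c {x y} → x ≋ y mod p → c * x ≋ c * y mod p
    ≋-*ˡ c = ≋-* {c} {c} ≋-refl

    ≋-neg : ∀ {x y} → x ≋ y mod p → - x ≋ - y mod p
    ≋-neg {x} {y} (cong∣ h) = cong∣ $ subst (+ p ∣_) (lem x y) (∣n⇒∣m*n (- 1ℤ) h)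
      where lem : ∀ x y → - 1ℤ * (x - y) ≡ - x - - y
            lem = solve-∀

    ≋-- : ∀ {x y u v} → x ≋ y mod p → u ≋ v mod p → x - u ≋ y - v mod p
    ≋-- h k = ≋-+ h (≋-neg k)

    ∣⇒≋0 : ∀ {x} → + p ∣ x → x ≋ + 0 mod p
    ∣⇒≋0 {x} h = cong∣ (subst (+ p ∣_) (sym (ℤP.+-identityʳ x)) h)

    ≋0⇒∣ : ∀ {x} → x ≋ + 0 mod p → + p ∣ x
    ≋0⇒∣ {x} (cong∣ h) = subst (+ p ∣_) (ℤP.+-identityʳ x) h

    ≋-∣ : ∀ {x y} → x ≋ y mod p → + p ∣ y → + p ∣ x
    ≋-∣ h k = ≋0⇒∣ (≋-trans h (∣⇒≋0 k))

    ∣? : ∀ x → Dec (+ p ∣ x)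
    ∣? x with p ℕD.∣? ∣ x ∣
    ... | yes h = yes (∣ᵤ⇒∣ h)
    ... | no h  = no (λ k → h (∣⇒∣ᵤ k))

  ≋-%ℕ : ∀ p .{{_ : ℕ.NonZero p}} x → x ≋ + (x %ℕ p) mod p
  ≋-%ℕ p x = cong∣ $ divides (x /ℕ p) (trans (cong (_- + (x %ℕ p)) (a≡a%ℕn+[a/ℕn]*n x p)) (lem (+ (x %ℕ p)) (x /ℕ p * + p)))
    where lem : ∀ a b → a + b - a ≡ b
          lem = solve-∀

  ∣∣<⇒0 : ∀ {p} {x : ℤ} → + p ∣ x → ∣ x ∣ ℕ.< p → x ≡ + 0
  ∣∣<⇒0 {p} {x} h l with ∣ x ∣ in e
  ... | zero = ℤP.∣i∣≡0⇒i≡0 e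
  ... | suc k = ⊥-elim (ℕP.<⇒≱ l (ℕD.∣⇒≤ (subst (p ℕD.∣_) e (∣⇒∣ᵤ h))))

  ∣m⊖n∣< : ∀ {m n p} → m ℕ.< p → n ℕ.< p → ∣ + m - + n ∣ ℕ.< p
  ∣m⊖n∣< {m} {n} {p} l k with ℕP.≤-total m n
  ... | inj₁ m≤n = subst (ℕ._< p) (sym (trans (cong ∣_∣ (ℤP.m-n≡m⊖n m n)) (trans (ℤP.∣m⊖n∣≡∣n⊖m∣ m n) (cong ∣_∣ (ℤP.⊖-≥ m≤n))))) (ℕP.≤-<-trans (ℕP.m∸n≤m n m) k)
  ... | inj₂ n≤m = subst (ℕ._< p) (sym (trans (cong ∣_∣ (ℤP.m-n≡m⊖n m n)) (cong ∣_∣ (ℤP.⊖-≥ n≤m)))) (ℕP.≤-<-trans (ℕP.m∸n≤m m n) l)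

  <∧≋⇒≡ : ∀ {m n p} → m ℕ.< p → n ℕ.< p → + m ≋ + n mod p → m ≡ n
  <∧≋⇒≡ {m} {n} l k (cong∣ h) = ℤP.+-injective (ℤP.i-j≡0⇒i≡j (+ m) (+ n) (∣∣<⇒0 h (∣m⊖n∣< l k)))

  ≋⇒%ℕ≡ : ∀ p .{{_ : ℕ.NonZero p}} {x y} → x ≋ y mod p → x %ℕ p ≡ y %ℕ p
  ≋⇒%ℕ≡ p {x} {y} h = <∧≋⇒≡ (n%ℕd<d x p) (n%ℕd<d y p) (≋-trans (≋-sym (≋-%ℕ p x)) (≋-trans h (≋-%ℕ p y)))

  ≋-small : ∀ {p q x y} → p ℕD.∣ q → x ≋ y mod q → x ≋ y mod p
  ≋-small h (cong∣ k) = cong∣ (∣-trans (∣ᵤ⇒∣ h) k)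

  euclid : ∀ {p} → Prime p → ∀ x y → + p ∣ x * y → (+ p ∣ x) ⊎ (+ p ∣ y)
  euclid {p} pp x y h with euclidsLemma ∣ x ∣ ∣ y ∣ pp (subst (p ℕD.∣_) (ℤP.abs-* x y) (∣⇒∣ᵤ h))
  ... | inj₁ k = inj₁ (∣ᵤ⇒∣ k)
  ... | inj₂ k = inj₂ (∣ᵤ⇒∣ k)

  ∤-* : ∀ {p} → Prime p → ∀ {x y} → ¬ (+ p ∣ x) → ¬ (+ p ∣ y) → ¬ (+ p ∣ x * y)
  ∤-* pp {x} {y} h k l with euclid pp x y l
  ... | inj₁ m = h m
  ... | inj₂ m = k m

  ∤-neg : ∀ {p x} → ¬ (+ p ∣ x) → ¬ (+ p ∣ - x)
  ∤-neg {p} {x} h k = h (subst (+ p ∣_) (ℤP.neg-involutive x) (∣m⇒∣-m k))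

  ≋-cancelˡ : ∀ {p} → Prime p → ∀ {c x y} → ¬ (+ p ∣ c) → c * x ≋ c * y mod p → x ≋ y mod p
  ≋-cancelˡ {p} pp {c} {x} {y} h (cong∣ k) =
    [ (λ m → ⊥-elim (h m)) , cong∣ ]′ (euclid pp c (x - y) (subst (+ p ∣_) (lem c x y) k))
    where lem : ∀ c x y → c * x - c * y ≡ c * (x - y)
          lem = solve-∀

  ∤-small : ∀ {p k} → 0 ℕ.< k → k ℕ.< p → ¬ (+ p ∣ + k)
  ∤-small l m h with ∣∣<⇒0 h m
  ∤-small () m h | refl

  ∤-≋ : ∀ {p x y} → x ≋ y mod p → ¬ (+ p ∣ x) → ¬ (+ p ∣ y)
  ∤-≋ h k l = k (≋-∣ h l)

  ∤1 : ∀ {p} → Prime p → ¬ (+ p ∣ + 1)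
  ∤1 pp = ∤-small (ℕ.s≤s ℕ.z≤n) (ℕ.nonTrivial⇒n>1 _ {{prime⇒nonTrivial pp}})

  ∤⇒≢0 : ∀ {p x} → ¬ (+ p ∣ x) → x ≢ + 0
  ∤⇒≢0 h refl = h (divides (+ 0) refl)

-- Iterated operations over lists and their reindexing.

module BigOp where

  open import Data.List using (List; []; _∷_; _++_; map; length; applyUpTo)
  open import Data.List.Properties using (length-map; length-applyUpTo)
  open import Data.List.Membership.Propositional using (_∈_)
  open import Data.List.Membership.Propositional.Properties using (∈-∃++; ∈-applyUpTo⁻; ∈-applyUpTo⁺; ∈-map⁻)
  open import Data.List.Relation.Unary.Any using (here; there)
  import Data.List.Relation.Unary.All as All
  open All using (All; []; _∷_)
  open import Data.List.Relation.Unary.AllPairs using ([]; _∷_)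
  open import Data.List.Relation.Unary.Unique.Propositional using (Unique)
  open import Data.List.Relation.Unary.Unique.Propositional.Properties using (applyUpTo⁺₁)
  open import Data.List.Relation.Binary.Permutation.Propositional using (_↭_; prep; swap; ↭-refl; ↭-sym; ↭-trans)
  import Data.List.Relation.Binary.Permutation.Propositional as P
  open import Data.List.Relation.Binary.Permutation.Propositional.Properties using (shift; ∈-resp-↭; ↭-length)

  ∈⇒↭∷ : ∀ {A : Set} {x : A} {ys} → x ∈ ys → ∃ λ zs → ys ↭ x ∷ zs
  ∈⇒↭∷ {x = x} h with ∈-∃++ h
  ... | us , vs , refl = us ++ vs , shift x us vs

  unique-⊆⇒↭ : ∀ {A : Set} {xs ys : List A} → Unique xs → (∀ {x} → x ∈ xs → x ∈ ys) →
               length ys ℕ.≤ length xs → xs ↭ ys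
  unique-⊆⇒↭ {xs = []} {[]} u s l = ↭-refl
  unique-⊆⇒↭ {xs = x ∷ xs} {ys} (x∉ ∷ u) s l with ∈⇒↭∷ (s (here refl))
  ... | zs , π = ↭-trans (prep x (unique-⊆⇒↭ u sub (ℕP.≤-pred (subst (ℕ._≤ suc (length xs)) (↭-length π) l)))) (↭-sym π)
    where
    sub : ∀ {y} → y ∈ xs → y ∈ zs
    sub y∈ with ∈-resp-↭ π (s (there y∈))
    ... | here refl = ⊥-elim (All.lookup x∉ y∈ refl)
    ... | there k   = k

  map-unique : ∀ {A B : Set} (f : A → B) {xs} → Unique xs →
               (∀ {x y} → x ∈ xs → y ∈ xs → f x ≡ f y → x ≡ y) → Unique (map f xs)
  map-unique f [] inj = []
  map-unique f {x ∷ xs} (x∉ ∷ u) inj =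
    All.tabulate (λ k e → sub k e) ∷ map-unique f u (λ a b → inj (there a) (there b))
    where
    sub : ∀ {z} → z ∈ map f xs → f x ≡ z → _
    sub k e with ∈-map⁻ f k
    ... | y , y∈ , refl = All.lookup x∉ y∈ (inj (here refl) (there y∈) e)

  -- An injective self-map of a finite set is onto. Reindexing along it drives both Gauss's lemma
  -- and the vanishing of character sums.
  permutes : ∀ {A : Set} (f : A → A) {xs} → Unique xs → (∀ {x} → x ∈ xs → f x ∈ xs) →
             (∀ {x y} → x ∈ xs → y ∈ xs → f x ≡ f y → x ≡ y) → map f xs ↭ xs
  permutes f {xs} u into inj =
    unique-⊆⇒↭ (map-unique f u inj) sub (ℕP.≤-reflexive (sym (length-map f xs)))
    where
    sub : ∀ {z} → z ∈ map f xs → z ∈ xs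
    sub k with ∈-map⁻ f k
    ... | y , y∈ , refl = into y∈

  [1⋯_] : ℕ → List ℕ
  [1⋯ h ] = applyUpTo suc h

  [1⋯]-unique : ∀ h → Unique [1⋯ h ]
  [1⋯]-unique h = applyUpTo⁺₁ suc h (λ i<j _ e → ℕP.<⇒≢ i<j (ℕP.suc-injective e))

  ∈[1⋯]⁻ : ∀ {h k} → k ∈ [1⋯ h ] → 0 ℕ.< k × k ℕ.≤ h
  ∈[1⋯]⁻ k∈ with ∈-applyUpTo⁻ suc k∈
  ... | i , i<h , refl = ℕ.s≤s ℕ.z≤n , i<h

  ∈[1⋯]⁺ : ∀ {h k} → 0 ℕ.< k → k ℕ.≤ h → k ∈ [1⋯ h ]
  ∈[1⋯]⁺ {k = suc k} _ l = ∈-applyUpTo⁺ suc l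

  length-[1⋯] : ∀ h → length [1⋯ h ] ≡ h
  length-[1⋯] = length-applyUpTo suc

  -- Stated for any commutative monoid, because it serves products of integers, products of signs,
  -- sums of integers and the Witt groups of the residue fields.
  module Big {A : Set} (_∙_ : A → A → A) (ε : A)
             (assoc : ∀ x y z → (x ∙ y) ∙ z ≡ x ∙ (y ∙ z))
             (comm : ∀ x y → x ∙ y ≡ y ∙ x)
             (idˡ : ∀ x → ε ∙ x ≡ x) where

    big : ∀ {I : Set} → (I → A) → List I → A
    big f []       = ε
    big f (x ∷ xs) = f x ∙ big f xs

    interchange : ∀ a b c d → (a ∙ b) ∙ (c ∙ d) ≡ (a ∙ c) ∙ (b ∙ d)
    interchange a b c d = begin
      (a ∙ b) ∙ (c ∙ d) ≡⟨ assoc a b (c ∙ d) ⟩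
      a ∙ (b ∙ (c ∙ d)) ≡⟨ cong (a ∙_) (sym (assoc b c d)) ⟩
      a ∙ ((b ∙ c) ∙ d) ≡⟨ cong (λ t → a ∙ (t ∙ d)) (comm b c) ⟩
      a ∙ ((c ∙ b) ∙ d) ≡⟨ cong (a ∙_) (assoc c b d) ⟩
      a ∙ (c ∙ (b ∙ d)) ≡⟨ sym (assoc a c (b ∙ d)) ⟩
      (a ∙ c) ∙ (b ∙ d) ∎
      where open ≡-Reasoning

    module _ {I : Set} where

      big-↭ : ∀ (f : I → A) {xs ys} → xs ↭ ys → big f xs ≡ big f ys
      big-↭ f P.refl = refl
      big-↭ f (prep x π) = cong (f x ∙_) (big-↭ f π)
      big-↭ f (swap {xs} {ys} x y π) = begin
        f x ∙ (f y ∙ big f xs) ≡⟨ sym (assoc (f x) (f y) (big f xs)) ⟩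
        (f x ∙ f y) ∙ big f xs ≡⟨ cong₂ _∙_ (comm (f x) (f y)) (big-↭ f π) ⟩
        (f y ∙ f x) ∙ big f ys ≡⟨ assoc (f y) (f x) (big f ys) ⟩
        f y ∙ (f x ∙ big f ys) ∎
        where open ≡-Reasoning
      big-↭ f (P.trans π ρ) = trans (big-↭ f π) (big-↭ f ρ)

      big-cong : ∀ {f g : I → A} xs → (∀ {x} → x ∈ xs → f x ≡ g x) → big f xs ≡ big g xs
      big-cong []       h = refl
      big-cong (x ∷ xs) h = cong₂ _∙_ (h (here refl)) (big-cong xs (λ k → h (there k)))

      big-∙ : ∀ (f g : I → A) xs → big (λ x → f x ∙ g x) xs ≡ big f xs ∙ big g xs
      big-∙ f g []       = sym (idˡ ε)
      big-∙ f g (x ∷ xs) = trans (cong ((f x ∙ g x) ∙_) (big-∙ f g xs)) (interchange (f x) (g x) (big f xs) (big g xs))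

      big-map : ∀ {J : Set} (f : J → A) (s : I → J) xs → big f (map s xs) ≡ big (λ x → f (s x)) xs
      big-map f s []       = refl
      big-map f s (x ∷ xs) = cong (f (s x) ∙_) (big-map f s xs)

      big-ε : ∀ (xs : List I) → big (λ _ → ε) xs ≡ ε
      big-ε []       = refl
      big-ε (x ∷ xs) = trans (idˡ _) (big-ε xs)

    big-swap : ∀ {I J : Set} (f : I → J → A) xs ys →
               big (λ x → big (f x) ys) xs ≡ big (λ y → big (λ x → f x y) xs) ys
    big-swap f []       ys = sym (big-ε ys)
    big-swap f (x ∷ xs) ys = trans (cong (big (f x) ys ∙_) (big-swap f xs ys)) (sym (big-∙ (f x) _ ys))

-- Roots of monic polynomials modulo a prime.

module Lagrange where

  open import Data.Integer hiding (suc)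
  open import Data.Integer.Divisibility.Signed
  open import Data.Vec using (Vec; []; _∷_; replicate)
  open import Data.List using ([]; _∷_; length)
  open import Data.List.Relation.Unary.All as All using (All; []; _∷_)
  open import Data.List.Relation.Unary.AllPairs using (AllPairs; []; _∷_)
  open import Data.Sum using ([_,_]′)
  open Congruence

  -- The leading coefficient 1 of these monic polynomials is left implicit.
  evalMonic : ∀ {n} → Vec ℤ n → ℤ → ℤ
  evalMonic []       x = + 1
  evalMonic (c ∷ cs) x = c + x * evalMonic cs x

  -- The second polynomial has degree one less, so the sum stays monic; in the last clause its
  -- implicit leading 1 meets the top stored coefficient.
  addScaled : ∀ {n} → ℤ → Vec ℤ (suc n) → Vec ℤ n → Vec ℤ (suc n)
  addScaled a (c ∷ [])      []       = (c + a) ∷ []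
  addScaled a (c ∷ c′ ∷ cs) (d ∷ ds) = (c + a * d) ∷ addScaled a (c′ ∷ cs) ds

  evalMonic-addScaled : ∀ {n} a (cs : Vec ℤ (suc n)) ds x →
    evalMonic (addScaled a cs ds) x ≡ evalMonic cs x + a * evalMonic ds x
  evalMonic-addScaled a (c ∷ [])      []       x = lem a c x
    where lem : ∀ a c x → c + a + x * + 1 ≡ c + x * + 1 + a * + 1
          lem = solve-∀
  evalMonic-addScaled a (c ∷ c′ ∷ cs) (d ∷ ds) x =
    trans (cong (λ t → c + a * d + x * t) (evalMonic-addScaled a (c′ ∷ cs) ds x))
          (lem a c d x (evalMonic (c′ ∷ cs) x) (evalMonic ds x))
    where lem : ∀ a c d x u v → c + a * d + x * (u + a * v) ≡ c + x * u + a * (d + x * v)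
          lem = solve-∀

  deflate : ∀ {n} → ℤ → Vec ℤ (suc n) → Vec ℤ n
  deflate a (c ∷ [])      = []
  deflate a (c ∷ c′ ∷ cs) = addScaled a (c′ ∷ cs) (deflate a (c′ ∷ cs))

  factor-theorem : ∀ {n} a (cs : Vec ℤ (suc n)) x →
    evalMonic cs x - evalMonic cs a ≡ (x - a) * evalMonic (deflate a cs) x
  factor-theorem a (c ∷ []) x = lem a c x
    where lem : ∀ a c x → c + x * + 1 - (c + a * + 1) ≡ (x - a) * + 1
          lem = solve-∀
  factor-theorem a (c ∷ c′ ∷ cs) x = begin
    c + x * E x - (c + a * E a)                   ≡⟨ lem₁ a c x (E x) (E a) ⟩
    (x - a) * E x + a * (E x - E a)               ≡⟨ cong (λ t → (x - a) * E x + a * t) (factor-theorem a (c′ ∷ cs) x) ⟩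
    (x - a) * E x + a * ((x - a) * Q)             ≡⟨ lem₂ a x (E x) Q ⟩
    (x - a) * (E x + a * Q)                       ≡⟨ cong ((x - a) *_) (sym (evalMonic-addScaled a (c′ ∷ cs) _ x)) ⟩
    (x - a) * evalMonic (deflate a (c ∷ c′ ∷ cs)) x ∎
    where
    open ≡-Reasoning
    E = evalMonic (c′ ∷ cs)
    Q = evalMonic (deflate a (c′ ∷ cs)) x
    lem₁ : ∀ a c x u v → c + x * u - (c + a * v) ≡ (x - a) * u + a * (u - v)
    lem₁ = solve-∀
    lem₂ : ∀ a x u q → (x - a) * u + a * ((x - a) * q) ≡ (x - a) * (u + a * q)
    lem₂ = solve-∀

  module _ {p} (pp : Prime p) where

    -- Dividing by x - a keeps every root incongruent to a, since p is prime; in degree 0 the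
    -- polynomial is the constant 1, which has no root.
    roots-bound : ∀ {n} (cs : Vec ℤ n) xs → length xs ≡ suc n →
      AllPairs (λ x y → ¬ (x ≋ y mod p)) xs → All (λ x → evalMonic cs x ≋ + 0 mod p) xs → ⊥
    roots-bound []       (x ∷ xs) l d (r ∷ rs) = ∤1 pp (≋0⇒∣ r)
    roots-bound (c ∷ cs) (a ∷ xs) l (a≢ ∷ d) (r ∷ rs) =
      roots-bound (deflate a (c ∷ cs)) xs (ℕP.suc-injective l) d (go a≢ rs)
      where
      go : ∀ {xs} → All (λ y → ¬ (a ≋ y mod p)) xs → All (λ x → evalMonic (c ∷ cs) x ≋ + 0 mod p) xs →
           All (λ x → evalMonic (deflate a (c ∷ cs)) x ≋ + 0 mod p) xs
      go [] [] = []
      go {x ∷ _} (n ∷ ns) (s ∷ ss) =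
        [ (λ h → ⊥-elim (n (≋-sym (cong∣ h)))) , ∣⇒≋0 ]′
          (euclid pp (x - a) _ (subst (+ p ∣_) (factor-theorem a (c ∷ cs) x) (∣diff (≋-trans s (≋-sym r)))))
        ∷ go ns ss

  evalMonic-zeros : ∀ n x → evalMonic (replicate n (+ 0)) x ≡ x ^ n
  evalMonic-zeros zero    x = refl
  evalMonic-zeros (suc n) x = trans (ℤP.+-identityˡ _) (cong (x *_) (evalMonic-zeros n x))

-- The quadratic character modulo an odd prime.

module Legendre where

  open import Data.Nat.Primality using (¬prime[1])
  open import Data.Integer hiding (suc)
  open import Data.Integer.DivMod using (_%ℕ_; n%ℕd<d)
  open import Data.Integer.Divisibility.Signed
  open import Data.Sum using ([_,_]′)
  open import Data.Vec using (Vec; []; _∷_; replicate)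
  open import Data.List using (List; []; _∷_; map; length)
  open import Data.List.Properties using (length-map)
  open import Data.List.Membership.Propositional using (_∈_)
  open import Data.List.Membership.Propositional.Properties using (∈-map⁻)
  open import Data.List.Relation.Unary.Any using (here; there)
  open import Data.List.Relation.Unary.All as All using (All; []; _∷_)
  open import Data.List.Relation.Unary.AllPairs as AllPairs using (AllPairs; []; _∷_)
  open import Data.List.Relation.Binary.Permutation.Propositional using (_↭_)
  open Congruence
  open BigOp
  open Lagrange

  ⟦_⟧ : Sign → ℤ
  ⟦ Sign.+ ⟧ = + 1
  ⟦ Sign.- ⟧ = - (+ 1)

  ⟦⟧-* : ∀ s t → ⟦ s Sign.* t ⟧ ≡ ⟦ s ⟧ * ⟦ t ⟧
  ⟦⟧-* Sign.+ Sign.+ = refl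
  ⟦⟧-* Sign.+ Sign.- = refl
  ⟦⟧-* Sign.- Sign.+ = refl
  ⟦⟧-* Sign.- Sign.- = refl

  ⟦⟧-square : ∀ s → ⟦ s ⟧ * ⟦ s ⟧ ≡ + 1
  ⟦⟧-square Sign.+ = refl
  ⟦⟧-square Sign.- = refl

  module Π = Big {ℤ} _*_ (+ 1) ℤP.*-assoc ℤP.*-comm ℤP.*-identityˡ
  module ΠS = Big {Sign} Sign._*_ Sign.+ SignP.*-assoc SignP.*-comm SignP.*-identityˡ

  ⟦⟧-big : ∀ {I : Set} (f : I → Sign) xs → ⟦ ΠS.big f xs ⟧ ≡ Π.big (λ x → ⟦ f x ⟧) xs
  ⟦⟧-big f []       = refl
  ⟦⟧-big f (x ∷ xs) = trans (⟦⟧-* (f x) _) (cong (⟦ f x ⟧ *_) (⟦⟧-big f xs))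

  Πbig-≋ : ∀ {I : Set} {p} {f g : I → ℤ} xs → (∀ {x} → x ∈ xs → f x ≋ g x mod p) →
           Π.big f xs ≋ Π.big g xs mod p
  Πbig-≋ []       h = ≋-refl
  Πbig-≋ (x ∷ xs) h = ≋-* (h (here refl)) (Πbig-≋ xs (λ k → h (there k)))

  Πbig-const : ∀ {I : Set} c (xs : List I) → Π.big (λ _ → c) xs ≡ c ^ length xs
  Πbig-const c []       = refl
  Πbig-const c (x ∷ xs) = cong (c *_) (Πbig-const c xs)

  ^-distrib-* : ∀ x y n → (x * y) ^ n ≡ x ^ n * y ^ n
  ^-distrib-* x y zero    = refl
  ^-distrib-* x y (suc n) = trans (cong ((x * y) *_) (^-distrib-* x y n)) (lem x y (x ^ n) (y ^ n))
    where lem : ∀ x y u v → (x * y) * (u * v) ≡ (x * u) * (y * v)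
          lem = solve-∀

  -- ε and a below are the sign and the size of the representative of x of least absolute value.
  module Half (h : ℕ) where

    p : ℕ
    p = suc (h ℕ.+ h)

    εʳ : ℕ → Sign
    εʳ r with r ℕ.≤? h
    ... | yes _ = Sign.+
    ... | no  _ = Sign.-

    aʳ : ℕ → ℕ
    aʳ r with r ℕ.≤? h
    ... | yes _ = r
    ... | no  _ = p ℕ.∸ r

    ε : ℤ → Sign
    ε x = εʳ (x %ℕ p)

    a : ℤ → ℕ
    a x = aʳ (x %ℕ p)

    -- Gauss's lemma taken as the definition; `euler` connects it with powers. At multiples of p the
    -- value is +, so divisibility by p always has to be excluded separately.
    legendre : ℤ → Sign
    legendre u = ΠS.big (λ k → ε (u * + k)) [1⋯ h ]

    ε-cong : ∀ {x y} → x ≋ y mod p → ε x ≡ ε y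
    ε-cong k = cong εʳ (≋⇒%ℕ≡ p k)

    legendre-cong : ∀ {u v} → u ≋ v mod p → legendre u ≡ legendre v
    legendre-cong k = ΠS.big-cong [1⋯ h ] (λ {x} _ → ε-cong (≋-* k (≋-refl {x = + x})))

    signed : ∀ x → x ≋ ⟦ ε x ⟧ * + a x mod p
    signed x with x %ℕ p ℕ.≤? h
    ... | yes _ = ≋-trans (≋-%ℕ p x) (≋-reflexive (sym (ℤP.*-identityˡ _)))
    ... | no  _ = ≋-trans (≋-%ℕ p x) (cong∣ (divides (+ 1) (trans (cong (λ t → + (x %ℕ p) - - (+ 1) * t) e) (lem (+ (x %ℕ p)) (+ p)))))
      where
      e : + (p ℕ.∸ x %ℕ p) ≡ + p - + (x %ℕ p)
      e = sym (trans (ℤP.m-n≡m⊖n p (x %ℕ p)) (ℤP.⊖-≥ (ℕP.<⇒≤ (n%ℕd<d x p))))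
      lem : ∀ r q → r - - (+ 1) * (q - r) ≡ + 1 * q
      lem = solve-∀

    a≤h : ∀ x → a x ℕ.≤ h
    a≤h x with x %ℕ p ℕ.≤? h
    ... | yes l = l
    ... | no  l = ℕP.≤-trans (ℕP.∸-monoʳ-≤ p (ℕP.≰⇒> l)) (ℕP.≤-reflexive (ℕP.m+n∸n≡m h h))

    h<p : h ℕ.< p
    h<p = ℕ.s≤s (ℕP.m≤m+n h h)

    0<a : ∀ x → ¬ (+ p ∣ x) → 0 ℕ.< a x
    0<a x n with a x | signed x
    ... | zero  | s = ⊥-elim (n (≋0⇒∣ (≋-trans s (≋-reflexive (ℤP.*-zeroʳ ⟦ ε x ⟧)))))
    ... | suc _ | s = ℕ.s≤s ℕ.z≤n

    module _ (pp : Prime p) where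

      0<h : 0 ℕ.< h
      0<h = ℕP.n≢0⇒n>0 (λ e → ¬prime[1] (subst Prime (cong (λ t → suc (t ℕ.+ t)) e) pp))

      2<p : 2 ℕ.< p
      2<p = ℕ.s≤s (ℕP.+-mono-≤ 0<h 0<h)

      ⟦⟧-injective-mod : ∀ s t → ⟦ s ⟧ ≋ ⟦ t ⟧ mod p → s ≡ t
      ⟦⟧-injective-mod Sign.+ Sign.+ k = refl
      ⟦⟧-injective-mod Sign.+ Sign.- (cong∣ k) = ⊥-elim (∤-small (ℕ.s≤s ℕ.z≤n) 2<p k)
      ⟦⟧-injective-mod Sign.- Sign.+ k = ⊥-elim (∤-small (ℕ.s≤s ℕ.z≤n) 2<p (∣diff (≋-sym k)))
      ⟦⟧-injective-mod Sign.- Sign.- k = refl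

      ∈⇒∤ : ∀ {k} → k ∈ [1⋯ h ] → ¬ (+ p ∣ + k)
      ∈⇒∤ k∈ with ∈[1⋯]⁻ k∈
      ... | l , m = ∤-small l (ℕP.≤-<-trans m h<p)

      +-of-∈ : ∀ {k l} → k ∈ [1⋯ h ] → l ∈ [1⋯ h ] → ¬ (+ p ∣ + (k ℕ.+ l))
      +-of-∈ k∈ l∈ with ∈[1⋯]⁻ k∈ | ∈[1⋯]⁻ l∈
      ... | a , b | c , d = ∤-small (ℕP.<-≤-trans a (ℕP.m≤m+n _ _)) (ℕ.s≤s (ℕP.+-mono-≤ b d))

      ∈-≋⇒≡ : ∀ {k l} → k ∈ [1⋯ h ] → l ∈ [1⋯ h ] → ∀ s → + k ≋ ⟦ s ⟧ * + l mod p → k ≡ l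
      ∈-≋⇒≡ k∈ l∈ Sign.+ e =
        <∧≋⇒≡ (ℕP.≤-<-trans (proj₂ (∈[1⋯]⁻ k∈)) h<p) (ℕP.≤-<-trans (proj₂ (∈[1⋯]⁻ l∈)) h<p)
              (≋-trans e (≋-reflexive (ℤP.*-identityˡ _)))
      ∈-≋⇒≡ {k} {l} k∈ l∈ Sign.- (cong∣ e) = ⊥-elim (+-of-∈ k∈ l∈ (subst (+ p ∣_) (lem (+ k) (+ l)) e))
        where lem : ∀ k l → k - - (+ 1) * l ≡ k + l
              lem = solve-∀

      module _ {u} (p∤u : ¬ (+ p ∣ u)) where

        -- If u k and u l have the same absolute least residue, then k ≡ ±l; for k and l between 1
        -- and h the sum k + l is below p, so the minus sign is impossible.
        a-permutes : map (λ k → a (u * + k)) [1⋯ h ] ↭ [1⋯ h ]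
        a-permutes = permutes (λ k → a (u * + k)) ([1⋯]-unique h) into inj
          where
          into : ∀ {k} → k ∈ [1⋯ h ] → a (u * + k) ∈ [1⋯ h ]
          into {k} k∈ = ∈[1⋯]⁺ (0<a _ (∤-* pp p∤u (∈⇒∤ k∈))) (a≤h (u * + k))
          inj : ∀ {k l} → k ∈ [1⋯ h ] → l ∈ [1⋯ h ] → a (u * + k) ≡ a (u * + l) → k ≡ l
          inj {k} {l} k∈ l∈ e = ∈-≋⇒≡ k∈ l∈ (εk Sign.* εl) (≋-cancelˡ pp p∤u
            (≋-trans (signed (u * + k)) (≋-trans (≋-reflexive lem₁)
              (≋-trans (≋-*ˡ (⟦ εk ⟧ * ⟦ εl ⟧) (≋-sym (signed (u * + l)))) (≋-reflexive lem₂)))))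
            where
            εk = ε (u * + k)
            εl = ε (u * + l)
            A = + a (u * + l)
            ring₁ : ∀ e f x → e * f * (f * x) ≡ e * (f * f * x)
            ring₁ = solve-∀
            ring₂ : ∀ e f u l → e * f * (u * l) ≡ u * (e * f * l)
            ring₂ = solve-∀
            lem₁ : ⟦ εk ⟧ * + a (u * + k) ≡ ⟦ εk ⟧ * ⟦ εl ⟧ * (⟦ εl ⟧ * A)
            lem₁ = trans (cong (λ t → ⟦ εk ⟧ * + t) e) (sym (trans (ring₁ ⟦ εk ⟧ ⟦ εl ⟧ A)
                     (cong (⟦ εk ⟧ *_) (trans (cong (_* A) (⟦⟧-square εl)) (ℤP.*-identityˡ A)))))
            lem₂ : ⟦ εk ⟧ * ⟦ εl ⟧ * (u * + l) ≡ u * (⟦ εk Sign.* εl ⟧ * + l)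
            lem₂ = trans (ring₂ ⟦ εk ⟧ ⟦ εl ⟧ u (+ l)) (cong (λ t → u * (t * + l)) (sym (⟦⟧-* εk εl)))

        -- Multiply u k ≡ ± |u k| over k ≤ h: by `a-permutes` both sides contain h!, which is prime
        -- to p and cancels.
        euler : u ^ h ≋ ⟦ legendre u ⟧ mod p
        euler = ≋-cancelˡ pp (∤-fact [1⋯ h ] ∈⇒∤) (≋-trans (≋-reflexive lhs) (≋-trans step (≋-reflexive rhs)))
          where
          fact : List ℕ → ℤ
          fact = Π.big (λ k → + k)
          ∤-fact : ∀ ks → (∀ {k} → k ∈ ks → ¬ (+ p ∣ + k)) → ¬ (+ p ∣ fact ks)
          ∤-fact []       n = ∤1 pp
          ∤-fact (k ∷ ks) n = ∤-* pp (n (here refl)) (∤-fact ks (λ m → n (there m)))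
          step : Π.big (λ k → u * + k) [1⋯ h ] ≋ Π.big (λ k → ⟦ ε (u * + k) ⟧ * + a (u * + k)) [1⋯ h ] mod p
          step = Πbig-≋ [1⋯ h ] (λ {k} _ → signed (u * + k))
          lhs : fact [1⋯ h ] * u ^ h ≡ Π.big (λ k → u * + k) [1⋯ h ]
          lhs = sym (trans (Π.big-∙ (λ _ → u) (λ k → + k) [1⋯ h ])
                  (trans (cong (_* fact [1⋯ h ]) (trans (Πbig-const u [1⋯ h ]) (cong (u ^_) (length-[1⋯] h))))
                         (ℤP.*-comm (u ^ h) _)))
          rhs : Π.big (λ k → ⟦ ε (u * + k) ⟧ * + a (u * + k)) [1⋯ h ] ≡ fact [1⋯ h ] * ⟦ legendre u ⟧
          rhs = trans (Π.big-∙ _ _ [1⋯ h ]) (trans (cong₂ _*_ (sym (⟦⟧-big _ [1⋯ h ]))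
                  (trans (sym (Π.big-map (λ k → + k) (λ k → a (u * + k)) [1⋯ h ])) (Π.big-↭ _ a-permutes)))
                  (ℤP.*-comm _ (fact [1⋯ h ])))

      legendre-* : ∀ {u v} → ¬ (+ p ∣ u) → ¬ (+ p ∣ v) → legendre (u * v) ≡ legendre u Sign.* legendre v
      legendre-* {u} {v} nu nv = ⟦⟧-injective-mod _ _
        (≋-trans (≋-sym (euler (∤-* pp nu nv))) (≋-trans (≋-reflexive (^-distrib-* u v h))
          (≋-trans (≋-* (euler nu) (euler nv)) (≋-reflexive (sym (⟦⟧-* (legendre u) (legendre v)))))))

      legendre-square : ∀ {u} → ¬ (+ p ∣ u) → legendre (u * u) ≡ Sign.+
      legendre-square {u} n = trans (legendre-* n n) (SignP.s*s≡+ (legendre u))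

      -- Otherwise u together with the h squares 1², ..., h² would be h + 1 incongruent roots of x^h
      -- - 1.
      legendre-+⇒square : ∀ {u} → ¬ (+ p ∣ u) → legendre u ≡ Sign.+ → ∃ λ x → x * x ≋ u mod p
      legendre-+⇒square {u} n e = search [1⋯ h ] (λ none → roots-bound pp unity
          (u ∷ map sq [1⋯ h ])
          (cong suc (trans (length-map sq [1⋯ h ]) (trans (length-[1⋯] h) (sym hh))))
          (All.tabulate (λ k c → distinct none k c) ∷ sq-distinct [1⋯ h ] ([1⋯]-unique h) (λ k → k))
          (root n e ∷ All.tabulate sq-roots))
        where
        sq : ℕ → ℤ
        sq k = + k * + k
        search : ∀ ks → ((∀ {k} → k ∈ ks → ¬ (sq k ≋ u mod p)) → ⊥) → ∃ λ x → x * x ≋ u mod p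
        search []       f = ⊥-elim (f (λ ()))
        search (k ∷ ks) f with ∣? {p} (sq k - u)
        ... | yes d = + k , cong∣ d
        ... | no nd = search ks (λ g → f (λ { (here refl) (cong∣ c) → nd c ; (there m) → g m }))
        h′ : ℕ
        h′ = ℕ.pred h
        hh : suc h′ ≡ h
        hh = ℕP.suc-pred h {{ℕ.>-nonZero 0<h}}
        unity : Vec ℤ (suc h′)
        unity = - (+ 1) ∷ replicate h′ (+ 0)
        root : ∀ {v} → ¬ (+ p ∣ v) → legendre v ≡ Sign.+ → evalMonic unity v ≋ + 0 mod p
        root {v} nv ev = ≋-trans (≋-reflexive (cong (λ t → - (+ 1) + t)
            (trans (cong (v *_) (evalMonic-zeros h′ v)) (cong (v ^_) hh))))
          (≋-+ {x = - (+ 1)} ≋-refl (≋-trans (euler nv) (≋-reflexive (cong ⟦_⟧ ev))))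
        sq-roots : ∀ {x} → x ∈ map sq [1⋯ h ] → evalMonic unity x ≋ + 0 mod p
        sq-roots k with ∈-map⁻ sq k
        ... | i , i∈ , refl = root (∤-* pp (∈⇒∤ i∈) (∈⇒∤ i∈)) (legendre-square (∈⇒∤ i∈))
        distinct : (∀ {k} → k ∈ [1⋯ h ] → ¬ (sq k ≋ u mod p)) → ∀ {x} → x ∈ map sq [1⋯ h ] → ¬ (u ≋ x mod p)
        distinct none k c with ∈-map⁻ sq k
        ... | i , i∈ , refl = none i∈ (≋-sym c)
        sq-inj : ∀ {k l} → k ∈ [1⋯ h ] → l ∈ [1⋯ h ] → sq k ≋ sq l mod p → k ≡ l
        sq-inj {k} {l} k∈ l∈ (cong∣ d) =
          [ (λ c → ∈-≋⇒≡ k∈ l∈ Sign.+ (≋-trans (cong∣ c) (≋-reflexive (sym (ℤP.*-identityˡ (+ l))))))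
          , (λ c → ⊥-elim (+-of-∈ k∈ l∈ c)) ]′ (euclid pp (+ k - + l) (+ k + + l) (subst (+ p ∣_) (lem (+ k) (+ l)) d))
          where lem : ∀ k l → k * k - l * l ≡ (k - l) * (k + l)
                lem = solve-∀
        sq-distinct : ∀ ks → AllPairs _≢_ ks → (∀ {k} → k ∈ ks → k ∈ [1⋯ h ]) →
                      AllPairs (λ x y → ¬ (x ≋ y mod p)) (map sq ks)
        sq-distinct [] [] s = []
        sq-distinct (k ∷ ks) (k∉ ∷ d) s = All.tabulate f ∷ sq-distinct ks d (λ m → s (there m))
          where
          f : ∀ {x} → x ∈ map sq ks → ¬ (sq k ≋ x mod p)
          f m c with ∈-map⁻ sq m
          ... | l , l∈ , refl = All.lookup k∉ l∈ (sq-inj (s (here refl)) (s (there l∈)) c)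

-- Quadratic reciprocity by counting lattice points, and the supplements for 2 and -1.

module Reciprocity where

  open import Data.Nat using (_+_; _*_; _∸_; _<_; _≤_; z≤n; s≤s; _/_; _%_)
  open import Data.Nat.Properties
  open import Data.Nat.DivMod using (m≡m%n+[m/n]*n; m%n<n; m<n⇒m%n≡m)
  open import Data.Integer as ℤ using (ℤ; +_)
  open import Data.Integer.DivMod using (_%ℕ_)
  open import Data.Integer.Divisibility.Signed using (divides) renaming (_∣_ to _∣ℤ_)
  open import Data.List using (List; []; _∷_; map; length)
  open import Data.List.Properties using (map-applyUpTo; applyUpTo-∷ʳ)
  open import Data.List.Membership.Propositional using (_∈_)
  open import Data.List.Relation.Binary.Permutation.Propositional.Properties using (∷↭∷ʳ)
  open import Data.List.Relation.Binary.Permutation.Propositional using (↭-reflexive; ↭-trans; ↭-sym)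
  open Congruence
  open BigOp
  open Legendre

  negs : ℕ → Sign
  negs zero    = Sign.+
  negs (suc n) = opposite (negs n)

  opposite-*ˡ : ∀ s t → opposite s Sign.* t ≡ opposite (s Sign.* t)
  opposite-*ˡ Sign.+ t = refl
  opposite-*ˡ Sign.- Sign.+ = refl
  opposite-*ˡ Sign.- Sign.- = refl

  negs-+ : ∀ m n → negs (m + n) ≡ negs m Sign.* negs n
  negs-+ zero    n = refl
  negs-+ (suc m) n = trans (cong opposite (negs-+ m n)) (sym (opposite-*ˡ (negs m) (negs n)))

  negs-double : ∀ m → negs (m + m) ≡ Sign.+
  negs-double m = trans (negs-+ m m) (SignP.s*s≡+ (negs m))

  negs-odd* : ∀ g k → negs (suc (g + g) * k) ≡ negs k
  negs-odd* g k = trans (negs-+ k ((g + g) * k)) (trans (cong (negs k Sign.*_)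
    (trans (cong negs (*-distribʳ-+ k g g)) (negs-double (g * k)))) (SignP.*-identityʳ (negs k)))

  -- An indicator of m < n with values in signs, so that its products count lattice points modulo 2.
  lt : ℕ → ℕ → Sign
  lt _       zero    = Sign.+
  lt zero    (suc n) = Sign.-
  lt (suc m) (suc n) = lt m n

  lt-< : ∀ {m n} → m < n → lt m n ≡ Sign.-
  lt-< {zero}  (s≤s l) = refl
  lt-< {suc m} (s≤s l) = lt-< l

  lt-≥ : ∀ {m n} → n ≤ m → lt m n ≡ Sign.+
  lt-≥ z≤n     = refl
  lt-≥ (s≤s l) = lt-≥ l

  [1⋯suc] : ∀ h → [1⋯ suc h ] ≡ 1 ∷ map suc [1⋯ h ]
  [1⋯suc] h = cong (1 ∷_) (sym (map-applyUpTo suc suc h))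

  count-lt : ∀ f g → f ≤ g → ΠS.big (λ j → lt j (suc f)) [1⋯ g ] ≡ negs f
  count-lt zero    g l = trans (ΠS.big-cong [1⋯ g ] (λ {j} j∈ → lt-≥ {j} {1} (proj₁ (∈[1⋯]⁻ j∈)))) (ΠS.big-ε [1⋯ g ])
  count-lt (suc f) (suc g) (s≤s l) = trans (cong (ΠS.big (λ j → lt j (suc (suc f)))) ([1⋯suc] g))
    (cong opposite (trans (ΠS.big-map _ suc [1⋯ g ]) (count-lt f g l)))

  module Eisenstein (h g : ℕ) (pp : Prime (suc (h + h)))
                    (p∤q : ¬ (+ suc (h + h) ∣ℤ + suc (g + g))) where

    open Half h
    q = suc (g + g)

    r f : ℕ → ℕ
    r k = (q * k) % p
    f k = (q * k) / p

    a′ : ℕ → ℕ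
    a′ k = a (+ q ℤ.* + k)

    residue : ∀ k → (+ q ℤ.* + k) %ℕ p ≡ r k
    residue k = cong (_%ℕ p) (sym (ℤP.pos-* q k))

    -- Beyond h the residue s is replaced by p - s, and p is odd, so the parity changes exactly when
    -- the sign is -.
    ε-parity : ∀ s → s < p → εʳ s ≡ negs s Sign.* negs (aʳ s)
    ε-parity s l with s ℕ.≤? h
    ... | yes _ = sym (SignP.s*s≡+ (negs s))
    ... | no  _ = sym (trans (sym (negs-+ s (p ∸ s))) (trans (cong negs (m+[n∸m]≡n (<⇒≤ l))) (cong opposite (negs-double h))))

    -- Read q k = r + f p modulo 2, with p and q odd.
    negs-r : ∀ k → negs (r k) ≡ negs k Sign.* negs (f k)
    negs-r k = SignP.*-cancelʳ-≡ (negs (f k)) (negs (r k)) _ (begin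
      negs (r k) Sign.* negs (f k)                 ≡⟨ cong (negs (r k) Sign.*_) (sym (trans (cong negs (*-comm (f k) p)) (negs-odd* h (f k)))) ⟩
      negs (r k) Sign.* negs (f k * p)             ≡⟨ sym (negs-+ (r k) (f k * p)) ⟩
      negs (r k + f k * p)                         ≡⟨ cong negs (sym (m≡m%n+[m/n]*n (q * k) p)) ⟩
      negs (q * k)                                 ≡⟨ negs-odd* g k ⟩
      negs k                                       ≡⟨ sym (SignP.*-identityʳ (negs k)) ⟩
      negs k Sign.* Sign.+                         ≡⟨ cong (negs k Sign.*_) (sym (SignP.s*s≡+ (negs (f k)))) ⟩
      negs k Sign.* (negs (f k) Sign.* negs (f k)) ≡⟨ sym (SignP.*-assoc (negs k) (negs (f k)) (negs (f k))) ⟩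
      negs k Sign.* negs (f k) Sign.* negs (f k)   ∎)
      where open ≡-Reasoning

    ε-expand : ∀ k → ε (+ q ℤ.* + k) ≡ negs (f k) Sign.* (negs k Sign.* negs (a′ k))
    ε-expand k = begin
      εʳ ((+ q ℤ.* + k) %ℕ p)                       ≡⟨ cong εʳ (residue k) ⟩
      εʳ (r k)                                      ≡⟨ ε-parity (r k) (m%n<n (q * k) p) ⟩
      negs (r k) Sign.* negs (aʳ (r k))             ≡⟨ cong₂ Sign._*_ (negs-r k) (cong (λ t → negs (aʳ t)) (sym (residue k))) ⟩
      negs k Sign.* negs (f k) Sign.* negs (a′ k)   ≡⟨ cong (Sign._* negs (a′ k)) (SignP.*-comm (negs k) (negs (f k))) ⟩
      negs (f k) Sign.* negs k Sign.* negs (a′ k)   ≡⟨ SignP.*-assoc (negs (f k)) (negs k) (negs (a′ k)) ⟩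
      negs (f k) Sign.* (negs k Sign.* negs (a′ k)) ∎
      where open ≡-Reasoning

    -- In `ε-expand` the parities of k and of |q k| cancel over all k, as one family is a
    -- rearrangement of the other. Only the floors of q k / p are left.
    eisenstein : legendre (+ q) ≡ ΠS.big (λ k → negs (f k)) [1⋯ h ]
    eisenstein = begin
      legendre (+ q)
        ≡⟨ ΠS.big-cong [1⋯ h ] (λ {k} _ → ε-expand k) ⟩
      ΠS.big (λ k → negs (f k) Sign.* (negs k Sign.* negs (a′ k))) [1⋯ h ]
        ≡⟨ ΠS.big-∙ (λ k → negs (f k)) _ [1⋯ h ] ⟩
      F Sign.* ΠS.big (λ k → negs k Sign.* negs (a′ k)) [1⋯ h ]
        ≡⟨ cong (F Sign.*_) (ΠS.big-∙ negs (λ k → negs (a′ k)) [1⋯ h ]) ⟩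
      F Sign.* (ΠS.big negs [1⋯ h ] Sign.* ΠS.big (λ k → negs (a′ k)) [1⋯ h ])
        ≡⟨ cong (λ t → F Sign.* (ΠS.big negs [1⋯ h ] Sign.* t))
             (trans (sym (ΠS.big-map negs a′ [1⋯ h ])) (ΠS.big-↭ negs (a-permutes pp p∤q))) ⟩
      F Sign.* (ΠS.big negs [1⋯ h ] Sign.* ΠS.big negs [1⋯ h ])
        ≡⟨ cong (F Sign.*_) (SignP.s*s≡+ (ΠS.big negs [1⋯ h ])) ⟩
      F Sign.* Sign.+
        ≡⟨ SignP.*-identityʳ F ⟩
      F ∎
      where
      open ≡-Reasoning
      F = ΠS.big (λ k → negs (f k)) [1⋯ h ]

    module _ {k} (k∈ : k ∈ [1⋯ h ]) where

      fp≤qk : f k * p ≤ q * k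
      fp≤qk = subst (f k * p ≤_) (sym (m≡m%n+[m/n]*n (q * k) p)) (m≤n+m (f k * p) (r k))

      qk<p[1+f] : q * k < suc (f k) * p
      qk<p[1+f] = subst (_< suc (f k) * p) (sym (m≡m%n+[m/n]*n (q * k) p)) (+-monoˡ-< (f k * p) (m%n<n (q * k) p))

      pj≢qk : ∀ j → p * j ≢ q * k
      pj≢qk j e with euclid pp (+ q) (+ k) (divides (+ j)
                       (trans (sym (ℤP.pos-* q k)) (trans (cong +_ (trans (sym e) (*-comm p j))) (ℤP.pos-* j p))))
      ... | inj₁ d = p∤q d
      ... | inj₂ d = ∈⇒∤ pp k∈ d

      lt-floor : ∀ j → lt (p * j) (q * k) ≡ lt j (suc (f k))
      lt-floor j with j ℕ.≤? f k
      ... | yes l = trans (lt-< (≤∧≢⇒< (≤-trans (subst (_≤ f k * p) (*-comm j p) (*-monoˡ-≤ p l)) fp≤qk) (pj≢qk j))) (sym (lt-< {j} {suc (f k)} (s≤s l)))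
      ... | no  l = trans (lt-≥ (≤-trans (<⇒≤ qk<p[1+f]) (subst (suc (f k) * p ≤_) (*-comm j p) (*-monoˡ-≤ p (≰⇒> l))))) (sym (lt-≥ (≰⇒> l)))

      -- No lattice point below the diagonal is lost: k ≤ h already forces the floor of q k / p to
      -- be at most g.
      f≤g : f k ≤ g
      f≤g = ≮⇒≥ λ l → <⇒≱ (bound g h) (≤-trans (*-monoˡ-≤ p l) (≤-trans fp≤qk (*-monoʳ-≤ q (proj₂ (∈[1⋯]⁻ k∈)))))
        where
        ring : ∀ g h → suc g * suc (h + h) ≡ suc (g + g) * h + suc (g + h)
        ring = ℕRing.solve-∀
        bound : ∀ g h → suc (g + g) * h < suc g * suc (h + h)
        bound g h = subst (suc (g + g) * h <_) (sym (ring g h)) (m<m+n _ (s≤s z≤n))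

    legendre-count : legendre (+ q) ≡ ΠS.big (λ k → ΠS.big (λ j → lt (p * j) (q * k)) [1⋯ g ]) [1⋯ h ]
    legendre-count = trans eisenstein (ΠS.big-cong [1⋯ h ] (λ {k} k∈ → sym (trans
      (ΠS.big-cong [1⋯ g ] (λ {j} _ → lt-floor k∈ j)) (count-lt (f k) g (f≤g k∈)))))

  ΠS-minus : ∀ {I : Set} (xs : List I) → ΠS.big (λ _ → Sign.-) xs ≡ negs (length xs)
  ΠS-minus []       = refl
  ΠS-minus (x ∷ xs) = cong opposite (ΠS-minus xs)

  ΠS-power : ∀ {I : Set} n (xs : List I) → ΠS.big (λ _ → negs n) xs ≡ negs (length xs * n)
  ΠS-power n []       = refl
  ΠS-power n (x ∷ xs) = trans (cong (negs n Sign.*_) (ΠS-power n xs)) (sym (negs-+ n _))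

  module _ (h g : ℕ) (pp : Prime (suc (h + h))) (qq : Prime (suc (g + g)))
           (p∤q : ¬ (+ suc (h + h) ∣ℤ + suc (g + g))) (q∤p : ¬ (+ suc (g + g) ∣ℤ + suc (h + h))) where

    private
      module A = Eisenstein h g pp p∤q
      module B = Eisenstein g h qq q∤p
      p = suc (h + h)
      q = suc (g + g)

    -- Each of the h g points of the rectangle lies on exactly one side of the diagonal p j = q k,
    -- which passes through none of them.
    quadratic-reciprocity : Half.legendre h (+ q) Sign.* Half.legendre g (+ p) ≡ negs (h * g)
    quadratic-reciprocity = begin
      Half.legendre h (+ q) Sign.* Half.legendre g (+ p)
        ≡⟨ cong₂ Sign._*_ A.legendre-count (trans B.legendre-count (ΠS.big-swap (λ k j → lt (q * j) (p * k)) [1⋯ g ] [1⋯ h ])) ⟩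
      ΠS.big (λ k → ΠS.big (λ j → lt (p * j) (q * k)) [1⋯ g ]) [1⋯ h ] Sign.* ΠS.big (λ k → ΠS.big (λ j → lt (q * k) (p * j)) [1⋯ g ]) [1⋯ h ]
        ≡⟨ sym (ΠS.big-∙ _ _ [1⋯ h ]) ⟩
      ΠS.big (λ k → ΠS.big (λ j → lt (p * j) (q * k)) [1⋯ g ] Sign.* ΠS.big (λ j → lt (q * k) (p * j)) [1⋯ g ]) [1⋯ h ]
        ≡⟨ ΠS.big-cong [1⋯ h ] (λ {k} k∈ → trans (sym (ΠS.big-∙ _ _ [1⋯ g ])) (trans
             (ΠS.big-cong [1⋯ g ] (λ {j} _ → exactly-one (A.pj≢qk k∈ j))) (trans (ΠS-minus [1⋯ g ]) (cong negs (length-[1⋯] g))))) ⟩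
      ΠS.big (λ _ → negs g) [1⋯ h ]
        ≡⟨ trans (ΠS-power g [1⋯ h ]) (cong (λ t → negs (t * g)) (length-[1⋯] h)) ⟩
      negs (h * g) ∎
      where
      open ≡-Reasoning
      exactly-one : ∀ {m n} → m ≢ n → lt m n Sign.* lt n m ≡ Sign.-
      exactly-one {m} {n} ne with <-≤-connex m n
      ... | inj₁ l = cong₂ Sign._*_ (lt-< l) (lt-≥ (<⇒≤ l))
      ... | inj₂ l = cong₂ Sign._*_ (lt-≥ l) (lt-< (≤∧≢⇒< l (λ e → ne (sym e))))

  -- κ ⌊n/2⌋ is the character (2/n) of odd n.
  κ : ℕ → Sign
  κ 0             = Sign.+
  κ 1             = Sign.-
  κ (suc (suc n)) = opposite (κ n)

  -- Gauss's lemma for 2: the doubles 2k lie below p, and those beyond h contribute -. From h to h +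
  -- 2 all terms shift, apart from one new + at k = 1 and one new - at the end.
  κ-count : ∀ h → ΠS.big (λ k → lt h (k + k)) [1⋯ h ] ≡ κ h
  κ-count 0 = refl
  κ-count 1 = refl
  κ-count (suc (suc h)) = begin
    ΠS.big (λ k → lt (2 + h) (k + k)) [1⋯ 2 + h ]
      ≡⟨ cong (ΠS.big (λ k → lt (2 + h) (k + k))) ([1⋯suc] (suc h)) ⟩
    lt (2 + h) 2 Sign.* ΠS.big (λ k → lt (2 + h) (k + k)) (map suc [1⋯ suc h ])
      ≡⟨ ΠS.big-map (λ k → lt (2 + h) (k + k)) suc [1⋯ suc h ] ⟩
    ΠS.big (λ k → lt (1 + h) (k + suc k)) [1⋯ suc h ]
      ≡⟨ ΠS.big-cong [1⋯ suc h ] (λ {k} _ → cong (lt (1 + h)) (+-suc k k)) ⟩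
    ΠS.big (λ k → lt h (k + k)) [1⋯ suc h ]
      ≡⟨ ΠS.big-↭ (λ k → lt h (k + k)) (↭-trans (↭-reflexive (sym (applyUpTo-∷ʳ suc h))) (↭-sym (∷↭∷ʳ (suc h) [1⋯ h ]))) ⟩
    lt h (suc h + suc h) Sign.* ΠS.big (λ k → lt h (k + k)) [1⋯ h ]
      ≡⟨ cong₂ Sign._*_ (lt-< (m≤m+n (suc h) (suc h))) (κ-count h) ⟩
    opposite (κ h) ∎
    where open ≡-Reasoning

  legendre-2 : ∀ h → Half.legendre h (+ 2) ≡ κ h
  legendre-2 h = trans (ΠS.big-cong [1⋯ h ] (λ {k} k∈ → term k (proj₂ (∈[1⋯]⁻ k∈)))) (κ-count h)
    where
    open Half h
    εʳ-lt : ∀ s → εʳ s ≡ lt h s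
    εʳ-lt s with s ℕ.≤? h
    ... | yes l = sym (lt-≥ l)
    ... | no  l = sym (lt-< (≰⇒> l))
    term : ∀ k → k ≤ h → ε (+ 2 ℤ.* + k) ≡ lt h (k + k)
    term k l = trans (cong (λ t → εʳ (t %ℕ p)) (trans (sym (ℤP.pos-* 2 k)) (cong (λ t → + (k + t)) (+-identityʳ k))))
      (trans (cong εʳ (m<n⇒m%n≡m (s≤s (+-mono-≤ l l)))) (εʳ-lt (k + k)))

  legendre-neg1 : ∀ h → Prime (suc (h + h)) → Half.legendre h (ℤ.- (+ 1)) ≡ negs h
  legendre-neg1 h pp = ⟦⟧-injective-mod pp _ _ (≋-trans (≋-sym (euler pp (∤-neg (∤1 pp)))) (≋-reflexive (pow h)))
    where
    open Half h
    pow : ∀ n → (ℤ.- (+ 1)) ℤ.^ n ≡ ⟦ negs n ⟧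
    pow zero = refl
    pow (suc n) = trans (cong ((ℤ.- (+ 1)) ℤ.*_) (pow n)) (opp (negs n))
      where opp : ∀ s → (ℤ.- (+ 1)) ℤ.* ⟦ s ⟧ ≡ ⟦ opposite s ⟧
            opp Sign.+ = refl
            opp Sign.- = refl

-- Finite sums of integers and summation by parts.

module Sums where

  open import Data.Integer hiding (suc)
  open import Data.Integer.Properties

  Σ< : ℕ → (ℕ → ℤ) → ℤ
  Σ< zero    f = + 0
  Σ< (suc n) f = Σ< n f + f n

  Σ-cong : ∀ n {f g} → (∀ i → i ℕ.< n → f i ≡ g i) → Σ< n f ≡ Σ< n g
  Σ-cong zero    h = refl
  Σ-cong (suc n) h = cong₂ _+_ (Σ-cong n (λ i l → h i (ℕP.m<n⇒m<1+n l))) (h n (ℕP.n<1+n n))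

  Σ-cong′ : ∀ n {f g} → (∀ i → f i ≡ g i) → Σ< n f ≡ Σ< n g
  Σ-cong′ n h = Σ-cong n (λ i _ → h i)

  Σ-0 : ∀ n → Σ< n (λ _ → + 0) ≡ + 0
  Σ-0 zero    = refl
  Σ-0 (suc n) = trans (+-identityʳ _) (Σ-0 n)

  Σ-const : ∀ n c → Σ< n (λ _ → c) ≡ + n * c
  Σ-const zero    c = refl
  Σ-const (suc n) c = trans (cong (_+ c) (Σ-const n c)) (lem (+ n) c)
    where lem : ∀ n c → n * c + c ≡ (+ 1 + n) * c
          lem = solve-∀

  Σ-+ : ∀ n f g → Σ< n (λ i → f i + g i) ≡ Σ< n f + Σ< n g
  Σ-+ zero    f g = refl
  Σ-+ (suc n) f g = trans (cong (_+ (f n + g n)) (Σ-+ n f g)) (lem (Σ< n f) (Σ< n g) (f n) (g n))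
    where lem : ∀ a b c d → a + b + (c + d) ≡ a + c + (b + d)
          lem = solve-∀

  Σ-*ˡ : ∀ n c f → Σ< n (λ i → c * f i) ≡ c * Σ< n f
  Σ-*ˡ zero    c f = sym (*-zeroʳ c)
  Σ-*ˡ (suc n) c f = trans (cong (_+ c * f n) (Σ-*ˡ n c f)) (sym (*-distribˡ-+ c (Σ< n f) (f n)))

  Σ-swap : ∀ m n (f : ℕ → ℕ → ℤ) → Σ< m (λ i → Σ< n (f i)) ≡ Σ< n (λ j → Σ< m (λ i → f i j))
  Σ-swap zero    n f = sym (Σ-0 n)
  Σ-swap (suc m) n f = trans (cong (_+ Σ< n (f m)) (Σ-swap m n f)) (sym (Σ-+ n _ (f m)))

  Σ-split : ∀ m n f → Σ< (m ℕ.+ n) f ≡ Σ< m f + Σ< n (λ i → f (m ℕ.+ i))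
  Σ-split m zero    f = trans (cong (λ t → Σ< t f) (ℕP.+-identityʳ m)) (sym (+-identityʳ _))
  Σ-split m (suc n) f = trans (cong (λ t → Σ< t f) (ℕP.+-suc m n))
    (trans (cong (_+ f (m ℕ.+ n)) (Σ-split m n f)) (+-assoc (Σ< m f) _ _))

  Σ-head : ∀ n f → Σ< (suc n) f ≡ f 0 + Σ< n (λ i → f (suc i))
  Σ-head n f = trans (Σ-split 1 n f) (cong (_+ Σ< n (λ i → f (suc i))) (+-identityˡ (f 0)))

  Σ-mono : ∀ n {f g} → (∀ i → i ℕ.< n → f i ≤ g i) → Σ< n f ≤ Σ< n g
  Σ-mono zero    h = ≤-refl
  Σ-mono (suc n) h = +-mono-≤ (Σ-mono n (λ i l → h i (ℕP.m<n⇒m<1+n l))) (h n (ℕP.n<1+n n))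

  Σ-≥0 : ∀ n {f} → (∀ i → i ℕ.< n → + 0 ≤ f i) → + 0 ≤ Σ< n f
  Σ-≥0 n h = ≤-trans (≤-reflexive (sym (Σ-0 n))) (Σ-mono n h)

  Σ-triangle : ∀ n f → + ∣ Σ< n f ∣ ≤ Σ< n (λ i → + ∣ f i ∣)
  Σ-triangle zero    f = ≤-refl
  Σ-triangle (suc n) f = ≤-trans (+≤+ (∣i+j∣≤∣i∣+∣j∣ (Σ< n f) (f n))) (+-monoˡ-≤ (+ ∣ f n ∣) (Σ-triangle n f))

  Σ-monoˡ : ∀ {m n} {f} → (∀ i → + 0 ≤ f i) → m ℕ.≤ n → Σ< m f ≤ Σ< n f
  Σ-monoˡ {m} {n} {f} h l = ≤-trans (≤-reflexive (sym (+-identityʳ _)))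
    (≤-trans (+-monoʳ-≤ (Σ< m f) (Σ-≥0 (n ℕ.∸ m) (λ i _ → h (m ℕ.+ i))))
      (≤-reflexive (trans (sym (Σ-split m (n ℕ.∸ m) f)) (cong (λ t → Σ< t f) (ℕP.m+[n∸m]≡n l)))))

  -- Summation by parts: the oscillating factor enters only through its partial sums, the smooth one
  -- through its differences.
  abel : ∀ n (g F : ℕ → ℤ) →
    Σ< n (λ i → g i * F i) ≡ Σ< n (λ i → Σ< (suc i) g * (F i - F (suc i))) + Σ< n g * F n
  abel zero    g F = refl
  abel (suc n) g F = trans (cong (_+ g n * F n) (abel n g F))
    (lem (Σ< n (λ i → Σ< (suc i) g * (F i - F (suc i)))) (Σ< n g) (g n) (F n) (F (suc n)))
    where lem : ∀ A S g x y → A + S * x + g * x ≡ A + (S + g) * (x - y) + (S + g) * y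
          lem = solve-∀

  telescope : ∀ n (F : ℕ → ℤ) → Σ< n (λ i → F i - F (suc i)) ≡ F 0 - F n
  telescope zero    F = sym (+-inverseʳ (F 0))
  telescope (suc n) F = trans (cong (_+ (F n - F (suc n))) (telescope n F)) (lem (F 0) (F n) (F (suc n)))
    where lem : ∀ a b c → a - b + (b - c) ≡ a - c
          lem = solve-∀

  Σ-subsequence : ∀ (s : ℕ → ℕ) (h : ℕ → ℤ) → (∀ i → s i ℕ.< s (suc i)) → (∀ i → + 0 ≤ h i) →
                  ∀ n → Σ< n (λ i → h (s i)) ≤ Σ< (s n) h
  Σ-subsequence s h inc pos zero    = Σ-≥0 (s 0) (λ i _ → pos i)
  Σ-subsequence s h inc pos (suc n) = ≤-trans (+-monoˡ-≤ (h (s n)) (Σ-subsequence s h inc pos n)) (Σ-monoˡ pos (inc n))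

  δ : ℕ → ℕ → ℤ
  δ x y with x ℕ.≟ y
  ... | yes _ = + 1
  ... | no  _ = + 0

  δ-≡ : ∀ {x y} → x ≡ y → δ x y ≡ + 1
  δ-≡ {x} {y} e with x ℕ.≟ y
  ... | yes _ = refl
  ... | no  n = ⊥-elim (n e)

  δ-≢ : ∀ {x y} → x ≢ y → δ x y ≡ + 0
  δ-≢ {x} {y} n with x ℕ.≟ y
  ... | yes e = ⊥-elim (n e)
  ... | no  _ = refl

  δ-⇔ : ∀ {x y u v} → (x ≡ y → u ≡ v) → (u ≡ v → x ≡ y) → δ x y ≡ δ u v
  δ-⇔ {x} {y} f g with x ℕ.≟ y
  ... | yes e = sym (δ-≡ (f e))
  ... | no  n = sym (δ-≢ (λ e → n (g e)))

  Σ-δ-out : ∀ n y (h : ℕ → ℤ) → n ℕ.≤ y → Σ< n (λ i → δ y i * h i) ≡ + 0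
  Σ-δ-out n y h l = trans (Σ-cong n (λ i k → trans (cong (_* h i) (δ-≢ (λ e → ℕP.<⇒≢ (ℕP.<-≤-trans k l) (sym e)))) (*-zeroˡ (h i)))) (Σ-0 n)

  Σ-δ : ∀ n y (h : ℕ → ℤ) → y ℕ.< n → Σ< n (λ i → δ y i * h i) ≡ h y
  Σ-δ (suc n) y h (ℕ.s≤s l) with y ℕ.≟ n
  ... | yes refl = trans (cong (_+ + 1 * h y) (Σ-δ-out n y h ℕP.≤-refl)) (trans (+-identityˡ _) (*-identityˡ (h y)))
  ... | no  ne   = trans (cong₂ _+_ (Σ-δ n y h (ℕP.≤∧≢⇒< l ne)) (*-zeroˡ (h n))) (+-identityʳ (h y))

-- A smoothed sum under the hyperbola and its bound by the variation of the weight.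

module Hyperbola where

  open import Data.Integer hiding (suc)
  open import Data.Integer.Properties
  open Sums

  -- Convexity of max(0, ·), up to 1. The error arises because (a + 1)(b + 1) exceeds a b by a + b +
  -- 1 and not by a + b.
  ∸-convex : ∀ t a b → (t ℕ.∸ a) ℕ.+ (t ℕ.∸ b) ℕ.≤ suc (t ℕ.+ (t ℕ.∸ suc (a ℕ.+ b)))
  ∸-convex t a b with ℕP.<-≤-connex (a ℕ.+ b) t
  ... | inj₁ l = ℕP.≤-reflexive (begin
      (t ℕ.∸ a) ℕ.+ (t ℕ.∸ b)     ≡⟨ cong₂ ℕ._+_ (cong (ℕ._∸ a) e₁) (cong (ℕ._∸ b) e₂) ⟩
      (a ℕ.+ (b ℕ.+ suc c) ℕ.∸ a) ℕ.+ (b ℕ.+ (a ℕ.+ suc c) ℕ.∸ b) ≡⟨ cong₂ ℕ._+_ (ℕP.m+n∸m≡n a _) (ℕP.m+n∸m≡n b _) ⟩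
      (b ℕ.+ suc c) ℕ.+ (a ℕ.+ suc c) ≡⟨ ring a b c ⟩
      suc (suc (a ℕ.+ b) ℕ.+ c ℕ.+ c) ≡⟨ cong (λ u → suc (u ℕ.+ c)) (ℕP.m+[n∸m]≡n l) ⟩
      suc (t ℕ.+ c) ∎)
    where
    open ≡-Reasoning
    c = t ℕ.∸ suc (a ℕ.+ b)
    ring : ∀ a b c → (b ℕ.+ suc c) ℕ.+ (a ℕ.+ suc c) ≡ suc (suc (a ℕ.+ b) ℕ.+ c ℕ.+ c)
    ring = ℕRing.solve-∀
    ring₁ : ∀ a b c → suc (a ℕ.+ b) ℕ.+ c ≡ a ℕ.+ (b ℕ.+ suc c)
    ring₁ = ℕRing.solve-∀
    ring₂ : ∀ a b c → suc (a ℕ.+ b) ℕ.+ c ≡ b ℕ.+ (a ℕ.+ suc c)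
    ring₂ = ℕRing.solve-∀
    e₁ : t ≡ a ℕ.+ (b ℕ.+ suc c)
    e₁ = trans (sym (ℕP.m+[n∸m]≡n l)) (ring₁ a b c)
    e₂ : t ≡ b ℕ.+ (a ℕ.+ suc c)
    e₂ = trans (sym (ℕP.m+[n∸m]≡n l)) (ring₂ a b c)
  ... | inj₂ l = ℕP.≤-trans main (ℕP.≤-trans (ℕP.m≤m+n t _) (ℕP.n≤1+n _))
    where
    main : (t ℕ.∸ a) ℕ.+ (t ℕ.∸ b) ℕ.≤ t
    main with ℕP.≤-total t b
    ... | inj₁ t≤b = ℕP.≤-trans (ℕP.≤-reflexive (trans (cong ((t ℕ.∸ a) ℕ.+_) (ℕP.m≤n⇒m∸n≡0 t≤b)) (ℕP.+-identityʳ _))) (ℕP.m∸n≤m t a)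
    ... | inj₂ b≤t = ℕP.≤-trans (ℕP.+-monoˡ-≤ (t ℕ.∸ b) (ℕP.m≤n+o⇒m∸n≤o t a l)) (ℕP.≤-reflexive (ℕP.m+[n∸m]≡n b≤t))

  ∣x∣≤x+2 : ∀ {x} → - (+ 1) ≤ x → + ∣ x ∣ ≤ x + + 2
  ∣x∣≤x+2 {+ n}           h = +≤+ (ℕP.m≤m+n n 2)
  ∣x∣≤x+2 { -[1+ zero ]}  h = ≤-refl
  ∣x∣≤x+2 { -[1+ suc n ]} (-≤- ())

  x∸y-spec : ∀ {m n} → n ℕ.≤ m → + (m ℕ.∸ n) ≡ + m - + n
  x∸y-spec {m} {n} l = sym (trans (m-n≡m⊖n m n) (⊖-≥ l))

  module Weight (X : ℕ) where

    -- The weight max(0, X - a b) at a = α + 1 and b = β + 1; the shift lets the sums start at 0.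
    -- Smoothing makes the second difference almost nonnegative, which a sharp cutoff would not.
    W : ℕ → ℕ → ℤ
    W α β = + (X ℕ.∸ suc α ℕ.* suc β)

    ΔΔ : ℕ → ℕ → ℤ
    ΔΔ α β = (W α β - W α (suc β)) - (W (suc α) β - W (suc α) (suc β))

    I : ℕ → ℕ → ℤ
    I α β with suc α ℕ.* suc β ℕ.<? X
    ... | yes _ = + 1
    ... | no  _ = + 0

    I-cases : ∀ α β → (I α β ≡ + 1 × suc α ℕ.* suc β ℕ.< X) ⊎ (I α β ≡ + 0 × X ℕ.≤ suc α ℕ.* suc β)

    I-cases α β with suc α ℕ.* suc β ℕ.<? X
    ... | yes l = inj₁ (refl , l)
    ... | no  l = inj₂ (refl , ℕP.≮⇒≥ l)

    0≤I : ∀ α β → + 0 ≤ I α β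
    0≤I α β with I-cases α β
    ... | inj₁ (e , _) = subst (+ 0 ≤_) (sym e) (+≤+ ℕ.z≤n)
    ... | inj₂ (e , _) = subst (+ 0 ≤_) (sym e) ≤-refl

    I≤1 : ∀ α β → I α β ≤ + 1
    I≤1 α β with I-cases α β
    ... | inj₁ (e , _) = subst (_≤ + 1) (sym e) ≤-refl
    ... | inj₂ (e , _) = subst (_≤ + 1) (sym e) (+≤+ ℕ.z≤n)

    I-sym : ∀ α β → I α β ≡ I β α
    I-sym α β with I-cases α β | I-cases β α
    ... | inj₁ (e , _) | inj₁ (f , _) = trans e (sym f)
    ... | inj₂ (e , _) | inj₂ (f , _) = trans e (sym f)
    ... | inj₁ (_ , l) | inj₂ (_ , m) = ⊥-elim (ℕP.<⇒≱ l (subst (X ℕ.≤_) (ℕP.*-comm (suc β) (suc α)) m))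
    ... | inj₂ (_ , m) | inj₁ (_ , l) = ⊥-elim (ℕP.<⇒≱ l (subst (X ℕ.≤_) (ℕP.*-comm (suc α) (suc β)) m))

    W-αsβ : ∀ α β → X ℕ.∸ suc α ℕ.* suc (suc β) ≡ (X ℕ.∸ suc α ℕ.* suc β) ℕ.∸ suc α
    W-αsβ α β = trans (cong (X ℕ.∸_) (ring α β)) (sym (ℕP.∸-+-assoc X (suc α ℕ.* suc β) (suc α)))
      where ring : ∀ α β → suc α ℕ.* suc (suc β) ≡ suc α ℕ.* suc β ℕ.+ suc α
            ring = ℕRing.solve-∀

    W-sαβ : ∀ α β → X ℕ.∸ suc (suc α) ℕ.* suc β ≡ (X ℕ.∸ suc α ℕ.* suc β) ℕ.∸ suc β
    W-sαβ α β = trans (cong (X ℕ.∸_) (ring α β)) (sym (ℕP.∸-+-assoc X (suc α ℕ.* suc β) (suc β)))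
      where ring : ∀ α β → suc (suc α) ℕ.* suc β ≡ suc α ℕ.* suc β ℕ.+ suc β
            ring = ℕRing.solve-∀

    W-sαsβ : ∀ α β → X ℕ.∸ suc (suc α) ℕ.* suc (suc β) ≡ (X ℕ.∸ suc α ℕ.* suc β) ℕ.∸ suc (suc α ℕ.+ suc β)
    W-sαsβ α β = trans (cong (X ℕ.∸_) (ring α β)) (sym (ℕP.∸-+-assoc X (suc α ℕ.* suc β) (suc (suc α ℕ.+ suc β))))
      where ring : ∀ α β → suc (suc α) ℕ.* suc (suc β) ≡ suc α ℕ.* suc β ℕ.+ suc (suc α ℕ.+ suc β)
            ring = ℕRing.solve-∀

    ΔΔ≥-1 : ∀ α β → - (+ 1) ≤ ΔΔ α β
    ΔΔ≥-1 α β = 0≤i-j⇒j≤i (subst (+ 0 ≤_) (ring (W α β) (W α (suc β)) (W (suc α) β) (W (suc α) (suc β))) (i≤j⇒0≤j-i conv))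
      where
      conv : W α (suc β) + W (suc α) β ≤ + 1 + (W α β + W (suc α) (suc β))
      conv = +≤+ (subst₂ ℕ._≤_ (cong₂ ℕ._+_ (sym (W-αsβ α β)) (sym (W-sαβ α β)))
               (cong (λ u → suc (X ℕ.∸ suc α ℕ.* suc β ℕ.+ u)) (sym (W-sαsβ α β)))
               (∸-convex (X ℕ.∸ suc α ℕ.* suc β) (suc α) (suc β)))
      ring : ∀ a b c d → (+ 1 + (a + d)) - (b + c) ≡ ((a - b) - (c - d)) - - (+ 1)
      ring = solve-∀

    -- The second difference is at least -1 under the hyperbola and 0 beyond it. Hence its absolute
    -- values cost only a telescoping sum and twice a number of lattice points.
    ∣ΔΔ∣≤ : ∀ α β → + ∣ ΔΔ α β ∣ ≤ ΔΔ α β + + 2 * I α β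
    ∣ΔΔ∣≤ α β with I-cases α β
    ... | inj₁ (e , _) = subst (λ u → + ∣ ΔΔ α β ∣ ≤ ΔΔ α β + + 2 * u) (sym e) (∣x∣≤x+2 (ΔΔ≥-1 α β))
    ... | inj₂ (e , l) = subst (λ u → + ∣ u ∣ ≤ u + + 2 * I α β) (sym zero-ΔΔ) (subst (λ u → + 0 ≤ + 0 + + 2 * u) (sym e) ≤-refl)
      where
      t0 : X ℕ.∸ suc α ℕ.* suc β ≡ 0
      t0 = ℕP.m≤n⇒m∸n≡0 l
      zero-ΔΔ : ΔΔ α β ≡ + 0
      zero-ΔΔ rewrite W-αsβ α β | W-sαβ α β | W-sαsβ α β | t0 = refl

    W-edge : ∀ α → W α X ≡ + 0
    W-edge α = cong +_ (ℕP.m≤n⇒m∸n≡0 (ℕP.≤-trans (ℕP.n≤1+n X) (ℕP.m≤m+n (suc X) _)))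

    W-edge′ : ∀ β → W X β ≡ + 0
    W-edge′ β = cong +_ (ℕP.m≤n⇒m∸n≡0 (ℕP.≤-trans (ℕP.n≤1+n X) (ℕP.m≤m*n (suc X) (suc β))))

    D : ℤ
    D = Σ< X (λ α → Σ< X (I α))

    -- Telescoping in both variables leaves the single corner value `W 0 0`.
    ΣΣΔΔ : Σ< X (λ α → Σ< X (ΔΔ α)) ≤ + X
    ΣΣΔΔ = ≤-trans (≤-reflexive eq) (+≤+ (ℕP.m∸n≤m X (1 ℕ.* 1)))
      where
      inner : ∀ α → Σ< X (ΔΔ α) ≡ W α 0 - W (suc α) 0
      inner α = trans (Σ-cong′ X (λ β → ring (W α β) (W α (suc β)) (W (suc α) β) (W (suc α) (suc β))))
        (trans (telescope X (λ β → W α β - W (suc α) β))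
          (trans (cong (λ u → W α 0 - W (suc α) 0 - u) (cong₂ _-_ (W-edge α) (W-edge (suc α)))) (+-identityʳ _)))
        where ring : ∀ a b c d → (a - b) - (c - d) ≡ (a - c) - (b - d)
              ring = solve-∀
      eq : Σ< X (λ α → Σ< X (ΔΔ α)) ≡ W 0 0
      eq = trans (Σ-cong′ X inner) (trans (telescope X (λ α → W α 0)) (trans (cong (λ u → W 0 0 - u) (W-edge′ 0)) (+-identityʳ _)))

    V : ℤ
    V = Σ< X (λ α → Σ< X (λ β → + ∣ ΔΔ α β ∣))

    V≤ : V ≤ + X + + 2 * D
    V≤ = ≤-trans (Σ-mono X (λ α _ → Σ-mono X (λ β _ → ∣ΔΔ∣≤ α β)))
      (≤-trans (≤-reflexive (trans (Σ-cong′ X (λ α → trans (Σ-+ X (ΔΔ α) (λ β → + 2 * I α β)) (cong (_+_ (Σ< X (ΔΔ α))) (Σ-*ˡ X (+ 2) (I α)))))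
        (trans (Σ-+ X _ _) (cong (_+_ (Σ< X (λ α → Σ< X (ΔΔ α)))) (Σ-*ˡ X (+ 2) (λ α → Σ< X (I α)))))))
        (+-monoˡ-≤ (+ 2 * D) ΣΣΔΔ))

    module _ (N : ℕ) (g₁ g₂ : ℕ → ℤ) (b₁ : ∀ n → ∣ Σ< n g₁ ∣ ℕ.≤ N) (b₂ : ∀ n → ∣ Σ< n g₂ ∣ ℕ.≤ N) where

      S : ℤ
      S = Σ< X (λ α → g₁ α * Σ< X (λ β → g₂ β * W α β))

      -- No boundary terms survive, since the weight vanishes along α = X and along β = X.
      S-abel : S ≡ Σ< X (λ α → Σ< X (λ β → Σ< (suc α) g₁ * (Σ< (suc β) g₂ * ΔΔ α β)))
      S-abel = begin
        Σ< X (λ α → g₁ α * F α)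
          ≡⟨ abel X g₁ F ⟩
        Σ< X (λ α → Σ< (suc α) g₁ * (F α - F (suc α))) + Σ< X g₁ * F X
          ≡⟨ cong₂ _+_ (Σ-cong′ X (λ α → trans (cong (Σ< (suc α) g₁ *_) (FF α)) (sym (Σ-*ˡ X (Σ< (suc α) g₁) _))))
                       (trans (cong (Σ< X g₁ *_) FX) (*-zeroʳ (Σ< X g₁))) ⟩
        Σ< X (λ α → Σ< X (λ β → Σ< (suc α) g₁ * (Σ< (suc β) g₂ * ΔΔ α β))) + + 0
          ≡⟨ +-identityʳ _ ⟩
        Σ< X (λ α → Σ< X (λ β → Σ< (suc α) g₁ * (Σ< (suc β) g₂ * ΔΔ α β))) ∎
        where
        open ≡-Reasoning
        F : ℕ → ℤ
        F α = Σ< X (λ β → g₂ β * W α β)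
        FX : F X ≡ + 0
        FX = trans (Σ-cong′ X (λ β → trans (cong (g₂ β *_) (W-edge′ β)) (*-zeroʳ (g₂ β)))) (Σ-0 X)
        F-abel : ∀ α → F α ≡ Σ< X (λ β → Σ< (suc β) g₂ * (W α β - W α (suc β)))
        F-abel α = trans (abel X g₂ (W α)) (trans (cong (_+_ (Σ< X (λ β → Σ< (suc β) g₂ * (W α β - W α (suc β)))))
          (trans (cong (Σ< X g₂ *_) (W-edge α)) (*-zeroʳ (Σ< X g₂)))) (+-identityʳ _))
        FF : ∀ α → F α - F (suc α) ≡ Σ< X (λ β → Σ< (suc β) g₂ * ΔΔ α β)
        FF α = sym (trans (Σ-cong′ X (λ β → ring (Σ< (suc β) g₂) (W α β - W α (suc β)) (W (suc α) β - W (suc α) (suc β))))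
          (trans (Σ-+ X _ _) (cong₂ _+_ (sym (F-abel α)) (trans (Σ-*ˡ X (- (+ 1)) _) (trans (-1*i≡-i _) (cong -_ (sym (F-abel (suc α)))))))))
          where ring : ∀ s x y → s * (x - y) ≡ s * x + - (+ 1) * (s * y)
                ring = solve-∀

      S-bound : S ≤ + N * (+ N * (+ X + + 2 * D))
      S-bound = ≤-trans (i≤∣i∣ S) (≤-trans (≤-reflexive (cong (λ u → + ∣ u ∣) S-abel))
        (≤-trans (Σ-triangle X _) (≤-trans (Σ-mono X (λ α _ → ≤-trans (Σ-triangle X _) (Σ-mono X (λ β _ → term α β))))
        (≤-trans (≤-reflexive (trans (Σ-cong′ X (λ α → trans (Σ-*ˡ X (+ N) _) (cong (+ N *_) (Σ-*ˡ X (+ N) _))))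
                  (trans (Σ-*ˡ X (+ N) _) (cong (+ N *_) (Σ-*ˡ X (+ N) _)))))
        (*-monoˡ-≤-nonNeg (+ N) (*-monoˡ-≤-nonNeg (+ N) V≤))))))
        where
        i≤∣i∣ : ∀ i → i ≤ + ∣ i ∣
        i≤∣i∣ (+ n)    = ≤-refl
        i≤∣i∣ -[1+ n ] = -≤+
        term : ∀ α β → + ∣ Σ< (suc α) g₁ * (Σ< (suc β) g₂ * ΔΔ α β) ∣ ≤ + N * (+ N * + ∣ ΔΔ α β ∣)
        term α β = ≤-trans (≤-reflexive (cong +_ (trans (abs-* (Σ< (suc α) g₁) _) (cong (∣ Σ< (suc α) g₁ ∣ ℕ.*_) (abs-* (Σ< (suc β) g₂) (ΔΔ α β))))))
          (≤-trans (+≤+ (ℕP.*-mono-≤ (b₁ (suc α)) (ℕP.*-monoˡ-≤ ∣ ΔΔ α β ∣ (b₂ (suc β)))))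
            (≤-reflexive (trans (pos-* N _) (cong (+ N *_) (pos-* N _)))))

    row-bound : ∀ α n → + suc α * Σ< n (I α) ≤ + X
    row-bound α zero    = ≤-trans (≤-reflexive (*-zeroʳ (+ suc α))) (+≤+ ℕ.z≤n)
    row-bound α (suc n) with I-cases α n
    ... | inj₁ (e , l) = ≤-trans (*-monoˡ-≤-nonNeg (+ suc α) (≤-trans (Σ-mono (suc n) (λ β _ → I≤1 α β))
            (≤-reflexive (trans (Σ-const (suc n) (+ 1)) (*-identityʳ (+ suc n))))))
            (≤-trans (≤-reflexive (sym (pos-* (suc α) (suc n)))) (+≤+ (ℕP.<⇒≤ l)))
    ... | inj₂ (e , _) = ≤-trans (≤-reflexive (cong (+ suc α *_) (trans (cong (_+_ (Σ< n (I α))) e) (+-identityʳ _)))) (row-bound α n)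

    row : ℕ → ℤ
    row α = Σ< X (I α)

    row≤X : ∀ α → row α ≤ + X
    row≤X α = ≤-trans (Σ-mono X (λ β _ → I≤1 α β)) (≤-reflexive (trans (Σ-const X (+ 1)) (*-identityʳ (+ X))))

    0≤row : ∀ α → + 0 ≤ row α
    0≤row α = Σ-≥0 X (λ β _ → 0≤I α β)

    -- A substitute for the harmonic sum: each of the first K rows has at most X points, each later
    -- one at most X / K. With K free this still gives o(X √X), and no logarithm appears.
    rows-bound : ∀ K L → + K * Σ< (K ℕ.+ L) row ≤ (+ K * + K + + L) * + X
    rows-bound K L = begin
      + K * Σ< (K ℕ.+ L) row                                       ≡⟨ cong (+ K *_) (Σ-split K L row) ⟩
      + K * (Σ< K row + Σ< L (λ i → row (K ℕ.+ i)))                ≡⟨ *-distribˡ-+ (+ K) _ _ ⟩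
      + K * Σ< K row + + K * Σ< L (λ i → row (K ℕ.+ i))            ≡⟨ cong (λ u → + K * Σ< K row + u) (sym (Σ-*ˡ L (+ K) _)) ⟩
      + K * Σ< K row + Σ< L (λ i → + K * row (K ℕ.+ i))            ≤⟨ +-mono-≤ (*-monoˡ-≤-nonNeg (+ K) (≤-trans (Σ-mono K (λ α _ → row≤X α)) (≤-reflexive (Σ-const K (+ X)))))
                                                                               (≤-trans (Σ-mono L (λ i _ → far i)) (≤-reflexive (Σ-const L (+ X)))) ⟩
      + K * (+ K * + X) + + L * + X                                ≡⟨ ring (+ K) (+ L) (+ X) ⟩
      (+ K * + K + + L) * + X                                      ∎
      where
      open ≤-Reasoning
      ring : ∀ k l x → k * (k * x) + l * x ≡ (k * k + l) * x
      ring = solve-∀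
      far : ∀ i → + K * row (K ℕ.+ i) ≤ + X
      far i = ≤-trans (*-monoʳ-≤-nonNeg (row (K ℕ.+ i)) {{nonNegative (0≤row (K ℕ.+ i))}} (+≤+ (ℕP.≤-trans (ℕP.m≤m+n K i) (ℕP.n≤1+n _)))) (row-bound (K ℕ.+ i) X)

    -- A lattice point under the hyperbola αβ = M² has a coordinate below M.
    D≤rows : ∀ M → X ≡ M ℕ.* M → D ≤ + 2 * Σ< M row
    D≤rows zero    refl = ≤-refl
    D≤rows M@(suc _) refl = begin
      Σ< X row                                              ≡⟨ cong (λ t → Σ< t row) (sym X≡) ⟩
      Σ< (M ℕ.+ Y) row                                      ≡⟨ Σ-split M Y row ⟩
      Σ< M row + Σ< Y (λ i → row (M ℕ.+ i))                 ≡⟨ cong (_+_ (Σ< M row)) (Σ-cong′ Y short) ⟩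
      Σ< M row + Σ< Y (λ i → Σ< M (I (M ℕ.+ i)))            ≤⟨ +-monoʳ-≤ (Σ< M row) (≤-trans (≤-reflexive (sym (+-identityˡ _))) (+-monoˡ-≤ _ (Σ-≥0 M (λ α _ → Σ-≥0 M (λ β _ → 0≤I α β))))) ⟩
      Σ< M row + (Σ< M (λ α → Σ< M (I α)) + Σ< Y (λ i → Σ< M (I (M ℕ.+ i)))) ≡⟨ cong (_+_ (Σ< M row)) (sym (Σ-split M Y (λ α → Σ< M (I α)))) ⟩
      Σ< M row + Σ< (M ℕ.+ Y) (λ α → Σ< M (I α))            ≡⟨ cong (λ t → Σ< M row + Σ< t (λ α → Σ< M (I α))) X≡ ⟩
      Σ< M row + Σ< X (λ α → Σ< M (I α))                    ≡⟨ cong (_+_ (Σ< M row)) (trans (Σ-swap X M I) (Σ-cong′ M (λ β → Σ-cong′ X (λ α → I-sym α β)))) ⟩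
      Σ< M row + Σ< M row                                   ≡⟨ ring (Σ< M row) ⟩
      + 2 * Σ< M row ∎
      where
      open ≤-Reasoning
      Y = X ℕ.∸ M
      X≡ : M ℕ.+ Y ≡ X
      X≡ = ℕP.m+[n∸m]≡n (ℕP.m≤m*n M M)
      ring : ∀ x → x + x ≡ + 2 * x
      ring = solve-∀
      short : ∀ i → row (M ℕ.+ i) ≡ Σ< M (I (M ℕ.+ i))
      short i = trans (cong (λ t → Σ< t (I (M ℕ.+ i))) (sym X≡)) (trans (Σ-split M Y _)
        (trans (cong (_+_ (Σ< M (I (M ℕ.+ i)))) (trans (Σ-cong′ Y vanish) (Σ-0 Y))) (+-identityʳ _)))
        where
        vanish : ∀ j → I (M ℕ.+ i) (M ℕ.+ j) ≡ + 0
        vanish j with I-cases (M ℕ.+ i) (M ℕ.+ j)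
        ... | inj₂ (e , _) = e
        ... | inj₁ (_ , l) = ⊥-elim (ℕP.<⇒≱ l (ℕP.*-mono-≤ (ℕP.≤-trans (ℕP.m≤m+n M i) (ℕP.n≤1+n _)) (ℕP.≤-trans (ℕP.m≤m+n M j) (ℕP.n≤1+n _))))

    D-bound : ∀ K L → X ≡ (K ℕ.+ L) ℕ.* (K ℕ.+ L) → + K * D ≤ + 2 * ((+ K * + K + + L) * + X)
    D-bound K L e = ≤-trans (*-monoˡ-≤-nonNeg (+ K) (D≤rows (K ℕ.+ L) e))
      (≤-trans (≤-reflexive (ring (+ K) (Σ< (K ℕ.+ L) row))) (*-monoˡ-≤-nonNeg (+ 2) (rows-bound K L)))
      where ring : ∀ k s → k * (+ 2 * s) ≡ + 2 * (k * s)
            ring = solve-∀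

-- Dirichlet convolution of two completely multiplicative functions.

module Convolution where

  open import Data.Nat.Induction using (<-wellFounded; Acc; acc)
  open import Data.Nat.Primality using (euclidsLemma; prime⇒nonZero)
  open import Data.Integer hiding (suc)
  open import Data.Integer.Properties
  open import Data.Nat.Primality.Factorisation using (factorise)
  open import Data.Nat.ListAction using (product)
  open import Data.List using ([]; _∷_)
  open import Data.List.Relation.Unary.All using (_∷_)
  open Sums

  valuation : ∀ {p} → 1 ℕ.< p → ∀ n → 0 ℕ.< n → ∃ λ e → ∃ λ m → n ≡ p ℕ.^ e ℕ.* m × ¬ (p ℕD.∣ m)
  valuation {p} 1<p n = go n (<-wellFounded n)
    where
    go : ∀ n → Acc ℕ._<_ n → 0 ℕ.< n → ∃ λ e → ∃ λ m → n ≡ p ℕ.^ e ℕ.* m × ¬ (p ℕD.∣ m)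
    go n (acc rec) 0<n with p ℕD.∣? n
    ... | no  h = 0 , n , sym (ℕP.*-identityˡ n) , h
    ... | yes (ℕD.divides zero    refl) = ⊥-elim (ℕP.<-irrefl refl 0<n)
    ... | yes (ℕD.divides (suc q) refl) with go (suc q) (rec (ℕP.m<m*n (suc q) p 1<p)) (ℕ.s≤s ℕ.z≤n)
    ...   | e , m , eq , h = suc e , m , trans (cong (ℕ._* p) eq) (trans (ℕP.*-comm _ p) (sym (ℕP.*-assoc p (p ℕ.^ e) m))) , h

  prime-divisor : ∀ n → 1 ℕ.< n → ∃ λ p → Prime p × p ℕD.∣ n
  prime-divisor n 1<n with factorise n {{ℕ.>-nonZero (ℕP.<-trans (ℕ.s≤s ℕ.z≤n) 1<n)}}
  ... | record { factors = [] ; isFactorisation = e } = ⊥-elim (ℕP.<⇒≢ 1<n (sym e))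
  ... | record { factors = p ∷ ps ; isFactorisation = e ; factorsPrime = pp ∷ _ } =
        p , pp , ℕD.divides (product ps) (trans e (ℕP.*-comm p (product ps)))

  -- The sum xᵉ + xᵉ⁻¹ y + ⋯ + yᵉ: the value of the convolution at pᵉ when the two functions take
  -- the values x and y at p.
  geom : ℤ → ℤ → ℕ → ℤ
  geom x y zero    = + 1
  geom x y (suc e) = x * geom x y e + y ^ suc e

  module Convolve (B : ℕ) (χ₁ χ₂ : ℕ → ℤ)
                  (χ₁-* : ∀ m n → χ₁ (m ℕ.* n) ≡ χ₁ m * χ₁ n) (χ₂-* : ∀ m n → χ₂ (m ℕ.* n) ≡ χ₂ m * χ₂ n) where

    inner : ℕ → ℕ → ℤ
    inner a n = Σ< B (λ b → δ (a ℕ.* b) n * χ₂ b)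

    -- The sum over a b = n written with indicators over all a, b < B. For 0 < n < B every
    -- factorisation is in range, so this is the full convolution.
    conv : ℕ → ℤ
    conv n = Σ< B (λ a → χ₁ a * inner a n)

    conv-1 : 1 ℕ.< B → χ₁ 1 ≡ + 1 → χ₂ 1 ≡ + 1 → conv 1 ≡ + 1
    conv-1 l e₁ e₂ = trans (Σ-cong′ B (λ a → trans (cong (χ₁ a *_) (inner-1 a)) (*-comm (χ₁ a) (δ 1 a))))
                           (trans (Σ-δ B 1 χ₁ l) e₁)
      where
      inner-1 : ∀ a → inner a 1 ≡ δ 1 a
      inner-1 a with 1 ℕ.≟ a
      ... | yes refl = trans (Σ-cong′ B (λ b → cong (_* χ₂ b) (δ-⇔ (λ e → trans (sym e) (ℕP.*-identityˡ b)) (λ e → trans (ℕP.*-identityˡ b) (sym e)))))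
                             (trans (Σ-δ B 1 χ₂ l) e₂)
      ... | no  ne   = trans (Σ-cong′ B (λ b → trans (cong (_* χ₂ b) (δ-≢ (λ e → ne (sym (ℕP.m*n≡1⇒m≡1 a b e))))) (*-zeroˡ (χ₂ b)))) (Σ-0 B)

    module _ {p : ℕ} (pp : Prime p) where

      private
        instance
          p≢0 : ℕ.NonZero p
          p≢0 = prime⇒nonZero pp

      ι : ℕ → ℤ
      ι a with p ℕD.∣? a
      ... | yes _ = + 1
      ... | no  _ = + 0

      -- Here `k` must vanish from B on, because the arguments p a on the right run beyond the range
      -- of the left.
      multiples : ∀ (k : ℕ → ℤ) → (∀ x → B ℕ.≤ x → k x ≡ + 0) →
                  Σ< B (λ a → ι a * k a) ≡ Σ< B (λ a → k (p ℕ.* a))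
      multiples k out = sym (begin
        Σ< B (λ a → k (p ℕ.* a))                                  ≡⟨ Σ-cong′ B expand ⟩
        Σ< B (λ a → Σ< B (λ x → δ (p ℕ.* a) x * k x))             ≡⟨ Σ-swap B B _ ⟩
        Σ< B (λ x → Σ< B (λ a → δ (p ℕ.* a) x * k x))             ≡⟨ Σ-cong B (λ x l → trans (Σ-cong′ B (λ a → *-comm (δ (p ℕ.* a) x) (k x)))
                                                                       (trans (Σ-*ˡ B (k x) _) (trans (*-comm (k x) _) (cong (_* k x) (hits x l))))) ⟩
        Σ< B (λ x → ι x * k x)                                    ∎)
        where
        open ≡-Reasoning
        expand : ∀ a → k (p ℕ.* a) ≡ Σ< B (λ x → δ (p ℕ.* a) x * k x)
        expand a with ℕP.<-≤-connex (p ℕ.* a) B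
        ... | inj₁ l = sym (Σ-δ B (p ℕ.* a) k l)
        ... | inj₂ l = trans (out (p ℕ.* a) l) (sym (Σ-δ-out B (p ℕ.* a) k l))
        hits : ∀ x → x ℕ.< B → Σ< B (λ a → δ (p ℕ.* a) x) ≡ ι x
        hits x l with p ℕD.∣? x
        ... | yes (ℕD.divides y refl) = trans (Σ-cong′ B (λ a → trans (δ-⇔ {u = y} {v = a} (λ e → ℕP.*-cancelʳ-≡ y a p (trans (sym e) (ℕP.*-comm p a))) (λ e → trans (cong (p ℕ.*_) (sym e)) (ℕP.*-comm p y))) (sym (*-identityʳ _))))
                                              (Σ-δ B y (λ _ → + 1) (ℕP.≤-<-trans (ℕP.m≤m*n y p) l))
        ... | no  h = trans (Σ-cong′ B (λ a → δ-≢ (λ e → h (ℕD.divides a (trans (sym e) (ℕP.*-comm p a)))))) (Σ-0 B)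

      -- Sorting factorisations a b by whether p divides a gives a recursion along powers of p:
      -- multiples of p contribute χ₁ p times the previous value (`conv-p*`), while otherwise p
      -- divides b and a factor χ₂ p comes out (`coprime-part-p*`).
      coprime-part : ℕ → ℤ
      coprime-part n = Σ< B (λ a → (+ 1 - ι a) * (χ₁ a * inner a n))

      module _ {n} (0<n : 0 ℕ.< p ℕ.* n) (pn<B : p ℕ.* n ℕ.< B) where

        δ-out : ∀ a b → B ℕ.≤ a → δ (a ℕ.* b) (p ℕ.* n) ≡ + 0
        δ-out a zero    l = δ-≢ (λ e → ℕP.<⇒≢ 0<n (trans (sym (ℕP.*-zeroʳ a)) e))
        δ-out a (suc b) l = δ-≢ (λ e → ℕP.<⇒≢ (ℕP.<-≤-trans pn<B (ℕP.≤-trans l (ℕP.m≤m*n a (suc b)))) (sym e))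

        conv-p* : conv (p ℕ.* n) ≡ χ₁ p * conv n + coprime-part (p ℕ.* n)
        conv-p* = begin
          Σ< B (λ a → χ₁ a * inner a (p ℕ.* n))
            ≡⟨ Σ-cong′ B (λ a → ring (ι a) (χ₁ a * inner a (p ℕ.* n))) ⟩
          Σ< B (λ a → ι a * (χ₁ a * inner a (p ℕ.* n)) + (+ 1 - ι a) * (χ₁ a * inner a (p ℕ.* n)))
            ≡⟨ Σ-+ B _ _ ⟩
          Σ< B (λ a → ι a * (χ₁ a * inner a (p ℕ.* n))) + coprime-part (p ℕ.* n)
            ≡⟨ cong (_+ coprime-part (p ℕ.* n)) (multiples (λ a → χ₁ a * inner a (p ℕ.* n)) out) ⟩
          Σ< B (λ a → χ₁ (p ℕ.* a) * inner (p ℕ.* a) (p ℕ.* n)) + coprime-part (p ℕ.* n)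
            ≡⟨ cong (_+ coprime-part (p ℕ.* n)) (trans (Σ-cong′ B step) (Σ-*ˡ B (χ₁ p) _)) ⟩
          χ₁ p * conv n + coprime-part (p ℕ.* n) ∎
          where
          open ≡-Reasoning
          ring : ∀ i x → x ≡ i * x + (+ 1 - i) * x
          ring = solve-∀
          out : ∀ x → B ℕ.≤ x → χ₁ x * inner x (p ℕ.* n) ≡ + 0
          out x l = trans (cong (χ₁ x *_) (trans (Σ-cong′ B (λ b → trans (cong (_* χ₂ b) (δ-out x b l)) (*-zeroˡ (χ₂ b)))) (Σ-0 B))) (*-zeroʳ (χ₁ x))
          step : ∀ a → χ₁ (p ℕ.* a) * inner (p ℕ.* a) (p ℕ.* n) ≡ χ₁ p * (χ₁ a * inner a n)
          step a = trans (cong₂ _*_ (χ₁-* p a) (Σ-cong′ B (λ b → cong (_* χ₂ b)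
              (δ-⇔ (λ e → ℕP.*-cancelˡ-≡ _ _ p (trans (sym (ℕP.*-assoc p a b)) e)) (λ e → trans (ℕP.*-assoc p a b) (cong (p ℕ.*_) e))))))
            (*-assoc (χ₁ p) (χ₁ a) _)

        coprime-part-p* : coprime-part (p ℕ.* n) ≡ χ₂ p * coprime-part n
        coprime-part-p* = trans (Σ-cong′ B step) (Σ-*ˡ B (χ₂ p) _)
          where
          ring : ∀ x y z w → x * (y * (z * w)) ≡ z * (x * (y * w))
          ring = solve-∀
          inner-p* : ∀ a → ¬ (p ℕD.∣ a) → inner a (p ℕ.* n) ≡ χ₂ p * inner a n
          inner-p* a p∤a = begin
            Σ< B (λ b → δ (a ℕ.* b) (p ℕ.* n) * χ₂ b)
              ≡⟨ Σ-cong′ B only ⟩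
            Σ< B (λ b → ι b * (δ (a ℕ.* b) (p ℕ.* n) * χ₂ b))
              ≡⟨ multiples (λ b → δ (a ℕ.* b) (p ℕ.* n) * χ₂ b) (λ b l → trans (cong (_* χ₂ b) (trans (cong (λ t → δ t (p ℕ.* n)) (ℕP.*-comm a b)) (δ-out b a l))) (*-zeroˡ (χ₂ b))) ⟩
            Σ< B (λ b → δ (a ℕ.* (p ℕ.* b)) (p ℕ.* n) * χ₂ (p ℕ.* b))
              ≡⟨ Σ-cong′ B (λ b → trans (cong₂ _*_ (δ-⇔ (λ e → ℕP.*-cancelˡ-≡ _ _ p (trans (sym (swap a b)) e)) (λ e → trans (swap a b) (cong (p ℕ.*_) e))) (χ₂-* p b)) (ring′ (δ (a ℕ.* b) n) (χ₂ p) (χ₂ b))) ⟩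
            Σ< B (λ b → χ₂ p * (δ (a ℕ.* b) n * χ₂ b))
              ≡⟨ Σ-*ˡ B (χ₂ p) _ ⟩
            χ₂ p * inner a n ∎
            where
            open ≡-Reasoning
            ring′ : ∀ d x y → d * (x * y) ≡ x * (d * y)
            ring′ = solve-∀
            swap : ∀ a b → a ℕ.* (p ℕ.* b) ≡ p ℕ.* (a ℕ.* b)
            swap a b = trans (sym (ℕP.*-assoc a p b)) (trans (cong (ℕ._* b) (ℕP.*-comm a p)) (ℕP.*-assoc p a b))
            only : ∀ b → δ (a ℕ.* b) (p ℕ.* n) * χ₂ b ≡ ι b * (δ (a ℕ.* b) (p ℕ.* n) * χ₂ b)
            only b with p ℕD.∣? b
            ... | yes _ = sym (*-identityˡ _)
            ... | no  h = trans (cong (_* χ₂ b) (δ-≢ ne)) refl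
              where
              ne : a ℕ.* b ≢ p ℕ.* n
              ne e with euclidsLemma a b pp (ℕD.divides n (trans e (ℕP.*-comm p n)))
              ... | inj₁ d = p∤a d
              ... | inj₂ d = h d
          step : ∀ a → (+ 1 - ι a) * (χ₁ a * inner a (p ℕ.* n)) ≡ χ₂ p * ((+ 1 - ι a) * (χ₁ a * inner a n))
          step a with p ℕD.∣? a
          ... | yes _ = sym (*-zeroʳ (χ₂ p))
          ... | no  h = trans (cong (λ t → + 1 * (χ₁ a * t)) (inner-p* a h)) (ring (+ 1) (χ₁ a) (χ₂ p) (inner a n))

      coprime-part-∤ : ∀ {n} → ¬ (p ℕD.∣ n) → coprime-part n ≡ conv n
      coprime-part-∤ {n} p∤n = Σ-cong′ B step
        where
        step : ∀ a → (+ 1 - ι a) * (χ₁ a * inner a n) ≡ χ₁ a * inner a n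
        step a with p ℕD.∣? a
        ... | no  _ = *-identityˡ _
        ... | yes (ℕD.divides y refl) = sym (trans (cong (χ₁ a *_) (trans (Σ-cong′ B (λ b → trans (cong (_* χ₂ b) (δ-≢ (ne b))) (*-zeroˡ (χ₂ b)))) (Σ-0 B))) (*-zeroʳ (χ₁ a)))
          where
          ne : ∀ b → y ℕ.* p ℕ.* b ≢ n
          ne b refl = p∤n (ℕD.∣m⇒∣m*n b (ℕD.n∣m*n y))

      module _ {m} (0<m : 0 ℕ.< m) (p∤m : ¬ (p ℕD.∣ m)) where

        0<p^e*m : ∀ e → 0 ℕ.< p ℕ.^ e ℕ.* m
        0<p^e*m e = ℕP.*-mono-≤ (ℕP.m^n>0 p e) 0<m

        p^-assoc : ∀ e → p ℕ.^ suc e ℕ.* m ≡ p ℕ.* (p ℕ.^ e ℕ.* m)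
        p^-assoc e = ℕP.*-assoc p (p ℕ.^ e) m

        coprime-part-power : ∀ e → p ℕ.^ e ℕ.* m ℕ.< B → coprime-part (p ℕ.^ e ℕ.* m) ≡ χ₂ p ^ e * conv m
        coprime-part-power zero    l = trans (cong coprime-part (ℕP.*-identityˡ m)) (trans (coprime-part-∤ p∤m) (sym (*-identityˡ _)))
        coprime-part-power (suc e) l = trans (cong coprime-part (p^-assoc e))
          (trans (coprime-part-p* {p ℕ.^ e ℕ.* m} (subst (0 ℕ.<_) (p^-assoc e) (0<p^e*m (suc e))) (subst (ℕ._< B) (p^-assoc e) l))
          (trans (cong (χ₂ p *_) (coprime-part-power e (ℕP.≤-<-trans (ℕP.≤-trans (ℕP.m≤n*m _ p) (ℕP.≤-reflexive (sym (p^-assoc e)))) l)))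
            (sym (*-assoc (χ₂ p) (χ₂ p ^ e) (conv m)))))

        conv-power : ∀ e → p ℕ.^ e ℕ.* m ℕ.< B → conv (p ℕ.^ e ℕ.* m) ≡ geom (χ₁ p) (χ₂ p) e * conv m
        conv-power zero    l = trans (cong conv (ℕP.*-identityˡ m)) (sym (*-identityˡ _))
        conv-power (suc e) l = begin
          conv (p ℕ.^ suc e ℕ.* m)
            ≡⟨ cong conv (p^-assoc e) ⟩
          conv (p ℕ.* (p ℕ.^ e ℕ.* m))
            ≡⟨ conv-p* {p ℕ.^ e ℕ.* m} (subst (0 ℕ.<_) (p^-assoc e) (0<p^e*m (suc e))) (subst (ℕ._< B) (p^-assoc e) l) ⟩
          χ₁ p * conv (p ℕ.^ e ℕ.* m) + coprime-part (p ℕ.* (p ℕ.^ e ℕ.* m))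
            ≡⟨ cong₂ (λ u v → χ₁ p * u + v) (conv-power e (ℕP.≤-<-trans (ℕP.≤-trans (ℕP.m≤n*m _ p) (ℕP.≤-reflexive (sym (p^-assoc e)))) l))
                      (trans (cong coprime-part (sym (p^-assoc e))) (coprime-part-power (suc e) l)) ⟩
          χ₁ p * (geom (χ₁ p) (χ₂ p) e * conv m) + χ₂ p ^ suc e * conv m
            ≡⟨ ring (χ₁ p) (geom (χ₁ p) (χ₂ p) e) (χ₂ p ^ suc e) (conv m) ⟩
          geom (χ₁ p) (χ₂ p) (suc e) * conv m ∎
          where
          open ≡-Reasoning
          ring : ∀ x g y c → x * (g * c) + y * c ≡ (x * g + y) * c
          ring = solve-∀

-- Two nontrivial real characters are both -1 at some prime.

module CharacterPair where

  open import Data.Nat.DivMod using (m≡m%n+[m/n]*n; m%n<n)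
  open import Data.Nat.Induction using (<-wellFounded; Acc; acc)
  open import Data.Nat.Primality using (euclidsLemma; prime⇒nonZero; prime⇒nonTrivial)
  open import Data.Integer hiding (suc)
  open import Data.Integer.Properties
  open import Data.Sum using ([_,_]′)
  open Sums
  open Hyperbola
  open Convolution

  record Character (N : ℕ) (χ : ℕ → ℤ) : Set where
    field
      χ-0    : χ 0 ≡ + 0
      χ-1    : χ 1 ≡ + 1
      χ-*    : ∀ m n → χ (m ℕ.* n) ≡ χ m * χ n
      χ-bd   : ∀ n → ∣ χ n ∣ ℕ.≤ 1
      χ-per  : ∀ n → χ (N ℕ.+ n) ≡ χ n
      χ-sum  : Σ< N χ ≡ + 0

  -- The excluded pair of nonzero values is (−1, −1).
  data Compatible : ℤ → ℤ → Set where
    both-+ : Compatible (+ 1) (+ 1)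
    +∧-    : Compatible (+ 1) (- (+ 1))
    -∧+    : Compatible (- (+ 1)) (+ 1)
    both-0 : Compatible (+ 0) (+ 0)

  0^ : ∀ e → (+ 0) ^ suc e ≡ + 0
  0^ e = *-zeroˡ ((+ 0) ^ e)

  1^ : ∀ e → (+ 1) ^ e ≡ + 1
  1^ zero    = refl
  1^ (suc e) = trans (*-identityˡ _) (1^ e)

  geom-both : ∀ e → geom (+ 1) (+ 1) e ≡ + suc e
  geom-both zero    = refl
  geom-both (suc e) = trans (cong₂ (λ u v → + 1 * u + v) (geom-both e) (1^ (suc e))) (lem (+ e))
    where lem : ∀ e → + 1 * (+ 1 + e) + + 1 ≡ + 1 + (+ 1 + e)
          lem = solve-∀

  -- For y = -x and x² = 1 the values are 1, 0, 1, 0, ..., so such a prime contributes exactly at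
  -- even exponents.
  geom-mixed : ∀ x y → x * x ≡ + 1 → x + y ≡ + 0 → ∀ e → geom x y (suc (suc e)) ≡ geom x y e
  geom-mixed x y xx x+y e = trans (ring x y (geom x y e) (y ^ e))
    (trans (cong₂ (λ u v → u * geom x y e + y * y ^ e * v) xx x+y) (ring′ (geom x y e) (y * y ^ e)))
    where
    ring : ∀ x y g z → x * (x * g + y * z) + y * (y * z) ≡ x * x * g + y * z * (x + y)
    ring = solve-∀
    ring′ : ∀ g z → + 1 * g + z * + 0 ≡ g
    ring′ = solve-∀

  geom-mixed-≥0 : ∀ x y → x * x ≡ + 1 → x + y ≡ + 0 → ∀ e → + 0 ≤ geom x y e
  geom-mixed-≥0 x y xx x+y 0 = +≤+ ℕ.z≤n
  geom-mixed-≥0 x y xx x+y 1 = ≤-reflexive (sym (trans (ring x y) x+y))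
    where ring : ∀ x y → x * + 1 + y * + 1 ≡ x + y
          ring = solve-∀
  geom-mixed-≥0 x y xx x+y (suc (suc e)) = subst (+ 0 ≤_) (sym (geom-mixed x y xx x+y e)) (geom-mixed-≥0 x y xx x+y e)

  geom-mixed-even : ∀ x y → x * x ≡ + 1 → x + y ≡ + 0 → ∀ e → geom x y (e ℕ.+ e) ≡ + 1
  geom-mixed-even x y xx x+y zero    = refl
  geom-mixed-even x y xx x+y (suc e) = trans (cong (λ t → geom x y (suc t)) (ℕP.+-suc e e))
    (trans (geom-mixed x y xx x+y (e ℕ.+ e)) (geom-mixed-even x y xx x+y e))

  geom-≥0 : ∀ {x y} → Compatible x y → ∀ e → + 0 ≤ geom x y e
  geom-≥0 both-+ e = subst (+ 0 ≤_) (sym (geom-both e)) (+≤+ ℕ.z≤n)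
  geom-≥0 +∧-    e = geom-mixed-≥0 (+ 1) (- (+ 1)) refl refl e
  geom-≥0 -∧+    e = geom-mixed-≥0 (- (+ 1)) (+ 1) refl refl e
  geom-≥0 both-0 zero    = +≤+ ℕ.z≤n
  geom-≥0 both-0 (suc e) = ≤-reflexive (sym (trans (cong₂ _+_ (*-zeroˡ (geom (+ 0) (+ 0) e)) (0^ e)) refl))

  geom-even : ∀ {x y} → Compatible x y → x ≢ + 0 → ∀ e → + 1 ≤ geom x y (e ℕ.+ e)
  geom-even both-+ _ e = subst (+ 1 ≤_) (sym (geom-both (e ℕ.+ e))) (+≤+ (ℕ.s≤s ℕ.z≤n))
  geom-even +∧-    _ e = ≤-reflexive (sym (geom-mixed-even (+ 1) (- (+ 1)) refl refl e))
  geom-even -∧+    _ e = ≤-reflexive (sym (geom-mixed-even (- (+ 1)) (+ 1) refl refl e))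
  geom-even both-0 n e = ⊥-elim (n refl)

  -- Complete periods sum to 0, and fewer than N terms remain.
  partial-sums : ∀ {N χ} → 0 ℕ.< N → Character N χ → ∀ n → ∣ Σ< n χ ∣ ℕ.≤ N
  partial-sums {N} {χ} 0<N ch n = subst (λ t → ∣ t ∣ ℕ.≤ N) (sym (trans (cong (λ t → Σ< t χ) (trans (m≡m%n+[m/n]*n n N) (ℕP.+-comm (n ℕ.% N) _))) (reduce (n ℕ./ N) (n ℕ.% N))))
      (ℕP.≤-trans (short (n ℕ.% N)) (ℕP.<⇒≤ (m%n<n n N)))
    where
    open Character ch
    instance N≢0 = ℕ.>-nonZero 0<N
    reduce : ∀ k r → Σ< (k ℕ.* N ℕ.+ r) χ ≡ Σ< r χ
    reduce zero    r = refl
    reduce (suc k) r = trans (cong (λ t → Σ< t χ) (ℕP.+-assoc N (k ℕ.* N) r)) (trans (Σ-split N (k ℕ.* N ℕ.+ r) χ)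
      (trans (cong₂ _+_ χ-sum (Σ-cong′ (k ℕ.* N ℕ.+ r) χ-per)) (trans (+-identityˡ _) (reduce k r))))
    short : ∀ n → ∣ Σ< n χ ∣ ℕ.≤ n
    short zero    = ℕ.z≤n
    short (suc n) = ℕP.≤-trans (∣i+j∣≤∣i∣+∣j∣ (Σ< n χ) (χ n)) (ℕP.≤-trans (ℕP.+-mono-≤ (short n) (χ-bd n)) (ℕP.≤-reflexive (ℕP.+-comm n 1)))

  *-≥0 : ∀ {x y} → + 0 ≤ x → + 0 ≤ y → + 0 ≤ x * y
  *-≥0 {x} {y} h k = ≤-trans (≤-reflexive (sym (*-zeroʳ x))) (*-monoˡ-≤-nonNeg x {{nonNegative h}} k)

  *-≥1 : ∀ {x y} → + 1 ≤ x → + 1 ≤ y → + 1 ≤ x * y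
  *-≥1 {x} {y} h k = ≤-trans h (≤-trans (≤-reflexive (sym (*-identityʳ x))) (*-monoˡ-≤-nonNeg x {{nonNegative (≤-trans (+≤+ ℕ.z≤n) h)}} k))

  module Positivity {N} {χ₁ χ₂ : ℕ → ℤ} (c₁ : Character N χ₁) (c₂ : Character N χ₂)
                    (compatible : ∀ {q} → Prime q → Compatible (χ₁ q) (χ₂ q)) (B : ℕ) (1<B : 1 ℕ.< B) where

    open Character
    open Convolve B χ₁ χ₂ (χ-* c₁) (χ-* c₂)

    1<p : ∀ {p} → Prime p → 1 ℕ.< p
    1<p pp = ℕ.nonTrivial⇒n>1 _ {{prime⇒nonTrivial pp}}

    record PrimePower (n : ℕ) : Set where
      field
        {p e m} : ℕ
        pp  : Prime p
        eq  : n ≡ p ℕ.^ suc e ℕ.* m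
        p∤m : ¬ (p ℕD.∣ m)
        0<m : 0 ℕ.< m
        m<n : m ℕ.< n

    prime-power : ∀ n → 1 ℕ.< n → PrimePower n
    prime-power n 1<n with prime-divisor n 1<n
    ... | p , pp , p∣n with valuation (1<p pp) n (ℕP.<-trans (ℕ.s≤s ℕ.z≤n) 1<n)
    ...   | zero  , m , eq , p∤m = ⊥-elim (p∤m (subst (p ℕD.∣_) (trans eq (ℕP.*-identityˡ m)) p∣n))
    ...   | suc e , m , eq , p∤m = record { p = p ; e = e ; m = m ; pp = pp ; eq = eq ; p∤m = p∤m ; 0<m = 0<m ; m<n = m<n }
      where
      0<m : 0 ℕ.< m
      0<m = ℕP.n≢0⇒n>0 (λ { refl → p∤m (p ℕD.∣0) })
      m<n : m ℕ.< n
      m<n = subst (m ℕ.<_) (sym (trans eq (ℕP.*-comm _ m))) (ℕP.m<m*n m (p ℕ.^ suc e) {{ℕ.>-nonZero 0<m}}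
              (ℕP.<-≤-trans (1<p pp) (ℕP.m≤m*n p (p ℕ.^ e) {{ℕ.>-nonZero (ℕP.m^n>0 p {{prime⇒nonZero pp}} e)}})))

    1≤conv-1 : + 1 ≤ conv 1
    1≤conv-1 = ≤-reflexive (sym (conv-1 1<B (χ-1 c₁) (χ-1 c₂)))

    -- One prime power is split off at a time, and its factor `geom` is nonnegative for compatible
    -- values. The excluded pair (-1, -1) would give -2 at exponent 1.
    conv-≥0 : ∀ n → Acc ℕ._<_ n → 0 ℕ.< n → n ℕ.< B → + 0 ≤ conv n
    conv-≥0 1 _ _ _ = ≤-trans (+≤+ ℕ.z≤n) 1≤conv-1
    conv-≥0 n@(suc (suc _)) (acc rec) _ n<B =
      subst (+ 0 ≤_) (sym (trans (cong conv eq) (conv-power pp 0<m p∤m (suc e) (subst (ℕ._< B) eq n<B))))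
        (*-≥0 (geom-≥0 (compatible pp) (suc e)) (conv-≥0 m (rec m<n) 0<m (ℕP.<-trans m<n n<B)))
      where open PrimePower (prime-power n (ℕ.s≤s (ℕ.s≤s ℕ.z≤n)))

    -- In a square all exponents are even, and there `geom` is at least 1 unless both values are 0,
    -- which χ₁ k ≠ 0 rules out.
    conv-square-≥1 : ∀ k → Acc ℕ._<_ k → 0 ℕ.< k → k ℕ.* k ℕ.< B → χ₁ k ≢ + 0 → + 1 ≤ conv (k ℕ.* k)
    conv-square-≥1 1 _ _ _ _ = 1≤conv-1
    conv-square-≥1 k@(suc (suc _)) (acc rec) _ k²<B χk≢0 =
      subst (+ 1 ≤_) (sym (trans (cong conv sq) (conv-power pp (ℕP.*-mono-≤ 0<m 0<m) p∤m² (suc e ℕ.+ suc e) (subst (ℕ._< B) sq k²<B))))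
        (*-≥1 (geom-even (compatible pp) χp≢0 (suc e)) (conv-square-≥1 m (rec m<n) 0<m (ℕP.≤-<-trans (ℕP.*-mono-≤ (ℕP.<⇒≤ m<n) (ℕP.<⇒≤ m<n)) k²<B) χm≢0))
      where
      open PrimePower (prime-power k (ℕ.s≤s (ℕ.s≤s ℕ.z≤n)))
      ring : ∀ x m → x ℕ.* m ℕ.* (x ℕ.* m) ≡ x ℕ.* x ℕ.* (m ℕ.* m)
      ring = ℕRing.solve-∀
      sq : k ℕ.* k ≡ p ℕ.^ (suc e ℕ.+ suc e) ℕ.* (m ℕ.* m)
      sq = trans (cong₂ ℕ._*_ eq eq) (trans (ring (p ℕ.^ suc e) m) (cong (ℕ._* (m ℕ.* m)) (sym (ℕP.^-distribˡ-+-* p (suc e) (suc e)))))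
      p∤m² : ¬ (p ℕD.∣ m ℕ.* m)
      p∤m² d = [ p∤m , p∤m ]′ (euclidsLemma m m pp d)
      χm≢0 : χ₁ m ≢ + 0
      χm≢0 z = χk≢0 (trans (cong χ₁ eq) (trans (χ-* c₁ (p ℕ.^ suc e) m) (trans (cong (χ₁ (p ℕ.^ suc e) *_) z) (*-zeroʳ (χ₁ (p ℕ.^ suc e))))))
      χp≢0 : χ₁ p ≢ + 0
      χp≢0 z = χk≢0 (trans (cong χ₁ (trans eq (ℕP.*-assoc p (p ℕ.^ e) m))) (trans (χ-* c₁ p (p ℕ.^ e ℕ.* m)) (trans (cong (_* χ₁ (p ℕ.^ e ℕ.* m)) z) (*-zeroˡ (χ₁ (p ℕ.^ e ℕ.* m))))))

    conv-0 : conv 0 ≡ + 0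
    conv-0 = trans (Σ-cong′ B row-0) (Σ-0 B)
      where
      row-0 : ∀ a → χ₁ a * inner a 0 ≡ + 0
      row-0 zero      = trans (cong (_* inner 0 0) (χ-0 c₁)) (*-zeroˡ (inner 0 0))
      row-0 a@(suc _) = trans (cong (χ₁ a *_) (trans (Σ-cong′ B term) (Σ-0 B))) (*-zeroʳ (χ₁ a))
        where
        term : ∀ b → δ (a ℕ.* b) 0 * χ₂ b ≡ + 0
        term zero    = trans (cong (δ (a ℕ.* 0) 0 *_) (χ-0 c₂)) (*-zeroʳ (δ (a ℕ.* 0) 0))
        term (suc b) = refl

  module _ (n : ℕ) {χ₁ χ₂ : ℕ → ℤ} (c₁ : Character (suc n) χ₁) (c₂ : Character (suc n) χ₂)
           (compatible : ∀ {q} → Prime q → Compatible (χ₁ q) (χ₂ q)) where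

    open Character

    private
      N : ℕ
      N = suc n

    module Estimate (K T M X : ℕ) (M≡ : M ≡ 2 ℕ.* suc (N ℕ.* T)) (X≡ : X ≡ M ℕ.* M) (K≤M : K ℕ.≤ M) where

      L B : ℕ
      L = M ℕ.∸ K
      B = suc X

      -- Squares of numbers ≡ 1 mod N, where χ₁ does not vanish. For j < T they are at most X / 4 =
      -- s T, so that their weight is at least X / 2.
      s : ℕ → ℕ
      s j = suc (N ℕ.* j) ℕ.* suc (N ℕ.* j)

      g₁ g₂ : ℕ → ℤ
      g₁ α = χ₁ (suc α)
      g₂ α = χ₂ (suc α)

      X≡4s : X ≡ 4 ℕ.* s T
      X≡4s = trans X≡ (trans (cong (λ t → t ℕ.* t) M≡) (ring (suc (N ℕ.* T))))
        where ring : ∀ r → 2 ℕ.* r ℕ.* (2 ℕ.* r) ≡ 4 ℕ.* (r ℕ.* r)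
              ring = ℕRing.solve-∀

      0<X : 0 ℕ.< X
      0<X = subst (0 ℕ.<_) (sym X≡4s) (ℕ.s≤s ℕ.z≤n)

      shifted : ∀ {χ} → Character N χ → ∀ k → ∣ Σ< k (λ α → χ (suc α)) ∣ ℕ.≤ N
      shifted {χ} c k = subst (λ t → ∣ t ∣ ℕ.≤ N) (trans (Σ-head k χ) (trans (cong (_+ Σ< k (λ α → χ (suc α))) (χ-0 c)) (+-identityˡ (Σ< k (λ α → χ (suc α))))))
        (partial-sums (ℕ.s≤s ℕ.z≤n) c (suc k))

      open Weight X
      open Convolve B χ₁ χ₂ (χ-* c₁) (χ-* c₂)
      open Positivity c₁ c₂ compatible B (ℕ.s≤s 0<X)

      w : ℕ → ℤ
      w k = + (X ℕ.∸ k)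

      S₀ : ℤ
      S₀ = S N g₁ g₂ (shifted c₁) (shifted c₂)

      -- Each product of α + 1 and β + 1 is recorded by an indicator δ; the products from X on have
      -- weight 0, so restricting to k < X changes nothing.
      regroup : S₀ ≡ Σ< X (λ k → w k * conv k)
      regroup = begin
        Σ< X (λ α → g₁ α * Σ< X (λ β → g₂ β * W α β))
          ≡⟨ Σ-cong′ X (λ α → trans (cong (g₁ α *_) (Σ-cong′ X (λ β → trans (cong (g₂ β *_) (expand (suc α ℕ.* suc β))) (sym (Σ-*ˡ X (g₂ β) _))))) (sym (Σ-*ˡ X (g₁ α) _))) ⟩
        Σ< X (λ α → Σ< X (λ β → g₁ α * Σ< X (λ k → g₂ β * (δ (suc α ℕ.* suc β) k * w k))))
          ≡⟨ Σ-cong′ X (λ α → Σ-cong′ X (λ β → sym (Σ-*ˡ X (g₁ α) _))) ⟩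
        Σ< X (λ α → Σ< X (λ β → Σ< X (λ k → g₁ α * (g₂ β * (δ (suc α ℕ.* suc β) k * w k)))))
          ≡⟨ Σ-cong′ X (λ α → Σ-swap X X (λ β k → g₁ α * (g₂ β * (δ (suc α ℕ.* suc β) k * w k)))) ⟩
        Σ< X (λ α → Σ< X (λ k → Σ< X (λ β → g₁ α * (g₂ β * (δ (suc α ℕ.* suc β) k * w k)))))
          ≡⟨ Σ-swap X X (λ α k → Σ< X (λ β → g₁ α * (g₂ β * (δ (suc α ℕ.* suc β) k * w k)))) ⟩
        Σ< X (λ k → Σ< X (λ α → Σ< X (λ β → g₁ α * (g₂ β * (δ (suc α ℕ.* suc β) k * w k)))))
          ≡⟨ Σ-cong′ X (λ k → trans (Σ-cong′ X (λ α → trans (Σ-cong′ X (λ β → ring (g₁ α) (g₂ β) (δ (suc α ℕ.* suc β) k) (w k)))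
                (trans (Σ-*ˡ X (w k) _) (cong (w k *_) (Σ-*ˡ X (g₁ α) _))))) (trans (Σ-*ˡ X (w k) _) (cong (w k *_) (sym (unshift k))))) ⟩
        Σ< X (λ k → w k * conv k) ∎
        where
        open ≡-Reasoning
        ring : ∀ g h d w → g * (h * (d * w)) ≡ w * (g * (d * h))
        ring = solve-∀
        expand : ∀ y → + (X ℕ.∸ y) ≡ Σ< X (λ k → δ y k * w k)
        expand y with ℕP.<-≤-connex y X
        ... | inj₁ l = sym (Σ-δ X y w l)
        ... | inj₂ l = trans (cong +_ (ℕP.m≤n⇒m∸n≡0 l)) (sym (Σ-δ-out X y w l))
        unshift : ∀ k → conv k ≡ Σ< X (λ α → g₁ α * Σ< X (λ β → δ (suc α ℕ.* suc β) k * g₂ β))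
        unshift k = trans (Σ-head X (λ a → χ₁ a * inner a k)) (trans (cong₂ _+_ (trans (cong (_* inner 0 k) (χ-0 c₁)) (*-zeroˡ (inner 0 k)))
          (Σ-cong′ X (λ α → cong (g₁ α *_) (trans (Σ-head X (λ b → δ (suc α ℕ.* b) k * χ₂ b))
            (trans (cong (_+ Σ< X (λ β → δ (suc α ℕ.* suc β) k * g₂ β)) (trans (cong (δ (suc α ℕ.* 0) k *_) (χ-0 c₂)) (*-zeroʳ (δ (suc α ℕ.* 0) k)))) (+-identityˡ _)))))) (+-identityˡ _))

      h : ℕ → ℤ
      h k = w k * conv k

      h≥0 : ∀ k → + 0 ≤ h k
      h≥0 zero = ≤-reflexive (sym (trans (cong (w 0 *_) conv-0) (*-zeroʳ (w 0))))
      h≥0 k@(suc _) with ℕP.<-≤-connex k X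
      ... | inj₁ l = *-≥0 {w k} {conv k} (+≤+ ℕ.z≤n) (conv-≥0 k (<-wellFounded k) (ℕ.s≤s ℕ.z≤n) (ℕP.m<n⇒m<1+n l))
      ... | inj₂ l = ≤-reflexive (sym (trans (cong (λ t → + t * conv k) (ℕP.m≤n⇒m∸n≡0 l)) (*-zeroˡ (conv k))))

      s-mono : ∀ {i j} → i ℕ.≤ j → s i ℕ.≤ s j
      s-mono l = ℕP.*-mono-≤ (ℕ.s≤s (ℕP.*-monoʳ-≤ N l)) (ℕ.s≤s (ℕP.*-monoʳ-≤ N l))

      s-inc : ∀ j → s j ℕ.< s (suc j)
      s-inc j = ℕP.*-mono-< l l
        where l : suc (N ℕ.* j) ℕ.< suc (N ℕ.* suc j)
              l = ℕ.s≤s (ℕP.*-monoʳ-< N (ℕP.n<1+n j))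

      term : ∀ j → j ℕ.< T → + X ≤ + 2 * h (s j)
      term j j<T = ≤-trans (≤-trans half (≤-reflexive (sym (*-identityʳ _))))
        (≤-trans (*-monoˡ-≤-nonNeg (+ 2 * w (s j)) {{nonNegative (*-≥0 {+ 2} {w (s j)} (+≤+ ℕ.z≤n) (+≤+ ℕ.z≤n))}}
           (conv-square-≥1 k (<-wellFounded k) (ℕ.s≤s ℕ.z≤n) (ℕ.s≤s s≤X) χk≢0))
          (≤-reflexive (*-assoc (+ 2) (w (s j)) (conv (s j)))))
        where
        k = suc (N ℕ.* j)
        s≤ : 4 ℕ.* s j ℕ.≤ X
        s≤ = ℕP.≤-trans (ℕP.*-monoʳ-≤ 4 (s-mono (ℕP.<⇒≤ j<T))) (ℕP.≤-reflexive (sym X≡4s))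
        s≤X : s j ℕ.≤ X
        s≤X = ℕP.≤-trans (ℕP.m≤n*m (s j) 4) s≤
        periods : ∀ i m → χ₁ (i ℕ.* N ℕ.+ m) ≡ χ₁ m
        periods zero    m = refl
        periods (suc i) m = trans (cong χ₁ (ℕP.+-assoc N (i ℕ.* N) m)) (trans (χ-per c₁ _) (periods i m))
        χk≢0 : χ₁ k ≢ + 0
        χk≢0 z = 1≢0 (trans (sym (χ-1 c₁)) (trans (sym (periods j 1)) (trans (cong χ₁ (trans (ℕP.+-comm (j ℕ.* N) 1) (cong suc (ℕP.*-comm j N)))) z)))
          where 1≢0 : + 1 ≢ + 0
                1≢0 ()
        half : + X ≤ + 2 * w (s j)
        half = subst (+ X ≤_) (sym (trans (cong (+ 2 *_) (x∸y-spec s≤X)) (ring (+ X) (+ s j))))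
          (0≤i-j⇒j≤i (subst (+ 0 ≤_) (ring′ (+ X) (+ s j)) (i≤j⇒0≤j-i (+≤+ (ℕP.≤-trans (ℕP.*-monoˡ-≤ (s j) {2} {4} (ℕ.s≤s (ℕ.s≤s ℕ.z≤n))) s≤)))))
          where
          ring : ∀ x y → + 2 * (x - y) ≡ x + (x - (y + (y + + 0)))
          ring = solve-∀
          ring′ : ∀ x y → x - (y + (y + + 0)) ≡ x + (x - (y + (y + + 0))) - x
          ring′ = solve-∀

      lower : + T * + X ≤ + 2 * S₀
      lower = begin
        + T * + X                          ≡⟨ sym (Σ-const T (+ X)) ⟩
        Σ< T (λ _ → + X)                   ≤⟨ Σ-mono T term ⟩
        Σ< T (λ j → + 2 * h (s j))         ≡⟨ Σ-*ˡ T (+ 2) _ ⟩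
        + 2 * Σ< T (λ j → h (s j))         ≤⟨ *-monoˡ-≤-nonNeg (+ 2) (≤-trans (Σ-subsequence s h s-inc h≥0 T) (Σ-monoˡ h≥0 (ℕP.≤-trans (ℕP.m≤n*m (s T) 4) (ℕP.≤-reflexive (sym X≡4s))))) ⟩
        + 2 * Σ< X h                       ≡⟨ cong (+ 2 *_) (sym regroup) ⟩
        + 2 * S₀ ∎
        where open ≤-Reasoning

      final : + K * + T * + X ≤ + 2 * (+ N * + N) * (+ K + + 4 * (+ K * + K + + L)) * + X
      final = begin
        + K * + T * + X                                            ≡⟨ *-assoc (+ K) (+ T) (+ X) ⟩
        + K * (+ T * + X)                                          ≤⟨ *-monoˡ-≤-nonNeg (+ K) (≤-trans lower (*-monoˡ-≤-nonNeg (+ 2) (S-bound N g₁ g₂ (shifted c₁) (shifted c₂)))) ⟩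
        + K * (+ 2 * (+ N * (+ N * (+ X + + 2 * D))))              ≡⟨ ring₁ (+ K) (+ N) (+ X) D ⟩
        + 2 * (+ N * + N) * (+ K * + X + + 2 * (+ K * D))          ≤⟨ *-monoˡ-≤-nonNeg (+ 2 * (+ N * + N)) {{nonNegative (*-≥0 {+ 2} {+ N * + N} (+≤+ ℕ.z≤n) (*-≥0 {+ N} {+ N} (+≤+ ℕ.z≤n) (+≤+ ℕ.z≤n)))}}
                                                                        (+-monoʳ-≤ (+ K * + X) (*-monoˡ-≤-nonNeg (+ 2) (D-bound K L (trans X≡ (sym (cong (λ t → t ℕ.* t) (ℕP.m+[n∸m]≡n K≤M))))))) ⟩
        + 2 * (+ N * + N) * (+ K * + X + + 2 * (+ 2 * ((+ K * + K + + L) * + X))) ≡⟨ ring₂ (+ K) (+ N) (+ X) (+ L) ⟩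
        + 2 * (+ N * + N) * (+ K + + 4 * (+ K * + K + + L)) * + X  ∎
        where
        open ≤-Reasoning
        ring₁ : ∀ k n x d → k * (+ 2 * (n * (n * (x + + 2 * d)))) ≡ + 2 * (n * n) * (k * x + + 2 * (k * d))
        ring₁ = solve-∀
        ring₂ : ∀ k n x l → + 2 * (n * n) * (k * x + + 2 * (+ 2 * ((k * k + l) * x))) ≡ + 2 * (n * n) * (k + + 4 * (k * k + l)) * x
        ring₂ = solve-∀

      estimate : K ℕ.* T ℕ.≤ 2 ℕ.* (N ℕ.* N) ℕ.* (K ℕ.+ 4 ℕ.* (K ℕ.* K ℕ.+ M))
      estimate = ℕP.≤-trans (drop‿+≤+ (subst₂ _≤_ (sym (pos-* K T)) rhs (*-cancelʳ-≤-pos _ _ (+ X) {{positive (+<+ 0<X)}} final)))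
        (ℕP.*-monoʳ-≤ (2 ℕ.* (N ℕ.* N)) (ℕP.+-monoʳ-≤ K (ℕP.*-monoʳ-≤ 4 (ℕP.+-monoʳ-≤ (K ℕ.* K) (ℕP.m∸n≤m M K)))))
        where
        rhs : + 2 * (+ N * + N) * (+ K + + 4 * (+ K * + K + + L)) ≡ + (2 ℕ.* (N ℕ.* N) ℕ.* (K ℕ.+ 4 ℕ.* (K ℕ.* K ℕ.+ L)))
        rhs = sym (trans (pos-* (2 ℕ.* (N ℕ.* N)) _) (cong₂ _*_ (trans (pos-* 2 (N ℕ.* N)) (cong (+ 2 *_) (pos-* N N)))
                (cong (_+_ (+ K)) (trans (pos-* 4 (K ℕ.* K ℕ.+ L)) (cong (λ t → + 4 * (t + + L)) (pos-* K K))))))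

    -- Grouped by the product αβ the smoothed sum S is at least of order X √X (squares alone contribute that much),
    -- whereas cancellation in both variables bounds it by X √X / K + K X for every K.
    no-compatible-pair : ⊥
    -- As M is about 2 N T, the term 2 N² · 4 M of `estimate` grows like 16 N³ T, so K must exceed
    -- 16 N³. K is passed with its equation to remain a variable for the ring solver.
    no-compatible-pair = contradict (17 ℕ.* (N ℕ.* N ℕ.* N)) refl
      where
      contradict : ∀ K → K ≡ 17 ℕ.* (N ℕ.* N ℕ.* N) → ⊥
      contradict K K≡ = ℕP.<⇒≱ numeric (Estimate.estimate K T _ _ refl refl K≤M)
        where
        -- The bound of `estimate` is 2 N² Z + 16 N³ T, so what has to be beaten is 2 N² Z, with N³
        -- T to spare; T = 1 + 2 Z does it.
        Z T : ℕ
        Z = K ℕ.+ 4 ℕ.* (K ℕ.* K) ℕ.+ 8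
        T = suc (2 ℕ.* Z)
        K≤M : K ℕ.≤ 2 ℕ.* suc (N ℕ.* T)
        K≤M = ℕP.≤-trans (ℕP.≤-trans (ℕP.m≤m+n K _) (ℕP.m≤m+n (K ℕ.+ 4 ℕ.* (K ℕ.* K)) 8))
          (ℕP.≤-trans (ℕP.m≤n*m Z 2) (ℕP.≤-trans (ℕP.n≤1+n _) (ℕP.≤-trans (ℕP.m≤n*m T N) (ℕP.≤-trans (ℕP.n≤1+n _) (ℕP.m≤n*m (suc (N ℕ.* T)) 2)))))
        ring₁ : ∀ n t k → 2 ℕ.* (n ℕ.* n) ℕ.* (k ℕ.+ 4 ℕ.* (k ℕ.* k ℕ.+ 2 ℕ.* suc (n ℕ.* t))) ≡
                2 ℕ.* (n ℕ.* n) ℕ.* (k ℕ.+ 4 ℕ.* (k ℕ.* k) ℕ.+ 8) ℕ.+ 16 ℕ.* (n ℕ.* n ℕ.* n) ℕ.* t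
        ring₁ = ℕRing.solve-∀
        ring₂ : ∀ n z → 17 ℕ.* (suc n ℕ.* suc n ℕ.* suc n) ℕ.* suc (2 ℕ.* z) ≡
                2 ℕ.* (suc n ℕ.* suc n) ℕ.* z ℕ.+ suc n ℕ.* suc n ℕ.* (suc n ℕ.+ 2 ℕ.* z ℕ.* n) ℕ.+ 16 ℕ.* (suc n ℕ.* suc n ℕ.* suc n) ℕ.* suc (2 ℕ.* z)
        ring₂ = ℕRing.solve-∀
        numeric : 2 ℕ.* (N ℕ.* N) ℕ.* (K ℕ.+ 4 ℕ.* (K ℕ.* K ℕ.+ 2 ℕ.* suc (N ℕ.* T))) ℕ.< K ℕ.* T
        numeric = subst₂ ℕ._<_ (sym (ring₁ N T K)) (sym (trans (cong (ℕ._* T) K≡) (ring₂ n Z)))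
          (ℕP.+-monoˡ-< (16 ℕ.* (N ℕ.* N ℕ.* N) ℕ.* T) (ℕP.m<m+n (2 ℕ.* (N ℕ.* N) ℕ.* Z) (ℕ.s≤s ℕ.z≤n)))

-- Diagonal forms over ℚ up to Witt equivalence, and isotropic subspaces.

module Witt where

  open import Data.Integer hiding (suc)
  open import Data.Integer.Properties
  open import Data.Vec using (Vec; []; _∷_; zipWith; map; replicate)
  open import Data.List as List using (List; []; _∷_; length; _++_)
  open import Data.List.Relation.Binary.Permutation.Propositional using (_↭_; prep; swap; ↭-refl; ↭-sym; ↭-trans)
  import Data.List.Relation.Binary.Permutation.Propositional as P
  open import Data.List.Relation.Binary.Permutation.Propositional.Properties using (map⁺; ↭-length)
  open import Relation.Nullary.Decidable using (¬¬-excluded-middle)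

  *-≢0 : ∀ {x y} → x ≢ + 0 → y ≢ + 0 → x * y ≢ + 0
  *-≢0 {x} h k e with i*j≡0⇒i≡0∨j≡0 x e
  ... | inj₁ z = h z
  ... | inj₂ z = k z

  neg-≢0 : ∀ {x} → x ≢ + 0 → - x ≢ + 0
  neg-≢0 {x} h e = h (trans (sym (neg-involutive x)) (cong -_ e))

  infix 3 _~_

  -- A list stands for the diagonal form over ℚ with these coefficients, and ~ is equality in the Witt group.
  data _~_ : List ℤ → List ℤ → Set where
    perm   : ∀ {ℓ m} → ℓ ↭ m → ℓ ~ m
    sq     : ∀ {a s} ℓ → a ≢ + 0 → s ≢ + 0 → a * (s * s) ∷ ℓ ~ a ∷ ℓ
    add    : ∀ {a b} ℓ → a ≢ + 0 → b ≢ + 0 → a + b ≢ + 0 → a ∷ b ∷ ℓ ~ a + b ∷ a * b * (a + b) ∷ ℓ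
    hyp    : ∀ {a} ℓ → a ≢ + 0 → a ∷ - a ∷ ℓ ~ ℓ
    ~sym   : ∀ {ℓ m} → ℓ ~ m → m ~ ℓ
    ~trans : ∀ {ℓ m n} → ℓ ~ m → m ~ n → ℓ ~ n

  ~refl : ∀ {ℓ} → ℓ ~ ℓ
  ~refl = perm ↭-refl

  ~reflexive : ∀ {ℓ m} → ℓ ≡ m → ℓ ~ m
  ~reflexive refl = ~refl

  ~swap : ∀ {a b ℓ} → a ∷ b ∷ ℓ ~ b ∷ a ∷ ℓ
  ~swap {a} {b} = perm (swap a b ↭-refl)

  ~cons : ∀ x {ℓ m} → ℓ ~ m → x ∷ ℓ ~ x ∷ m
  ~cons x (perm π)      = perm (prep x π)
  ~cons x (sq ℓ h k)    = ~trans ~swap (~trans (sq (x ∷ ℓ) h k) ~swap)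
  ~cons x (add ℓ h k l) = ~trans (perm (rot x _ _ ℓ)) (~trans (add (x ∷ ℓ) h k l) (~sym (perm (rot x _ _ ℓ))))
    where rot : ∀ x a b (ℓ : List ℤ) → x ∷ a ∷ b ∷ ℓ ↭ a ∷ b ∷ x ∷ ℓ
          rot x a b ℓ = ↭-trans (swap x a ↭-refl) (prep a (swap x b ↭-refl))
  ~cons x (hyp {a} ℓ h)     = ~trans (perm (↭-trans (swap x a ↭-refl) (prep a (swap x (- a) ↭-refl)))) (hyp (x ∷ ℓ) h)
  ~cons x (~sym e)      = ~sym (~cons x e)
  ~cons x (~trans e f)  = ~trans (~cons x e) (~cons x f)

  ~++ : ∀ k {ℓ m} → ℓ ~ m → k ++ ℓ ~ k ++ m
  ~++ []      e = e
  ~++ (x ∷ k) e = ~cons x (~++ k e)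

  ~scale : ∀ {c} → c ≢ + 0 → ∀ {ℓ m} → ℓ ~ m → List.map (c *_) ℓ ~ List.map (c *_) m
  ~scale {c} hc (perm π)   = perm (map⁺ (c *_) π)
  ~scale {c} hc (sq {a} {s} ℓ h k) = ~trans (~reflexive (cong (_∷ List.map (c *_) ℓ) (sym (*-assoc c a (s * s))))) (sq (List.map (c *_) ℓ) (*-≢0 hc h) k)
  ~scale {c} hc (add {a} {b} ℓ h k l) = ~trans (add cℓ (*-≢0 hc h) (*-≢0 hc k) (λ e → *-≢0 hc l (trans (*-distribˡ-+ c a b) e)))
      (~trans (~reflexive (cong₂ (λ u v → u ∷ v ∷ cℓ) (sym (*-distribˡ-+ c a b)) (ring a b c)))
      (~trans ~swap (~trans (sq (c * (a + b) ∷ cℓ) (*-≢0 hc (*-≢0 (*-≢0 h k) l)) hc) ~swap)))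
    where
    cℓ = List.map (c *_) ℓ
    ring : ∀ a b c → c * a * (c * b) * (c * a + c * b) ≡ c * (a * b * (a + b)) * (c * c)
    ring = solve-∀
  ~scale {c} hc (hyp {a} ℓ h) = ~trans (~reflexive (cong (λ t → c * a ∷ t ∷ List.map (c *_) ℓ) (sym (neg-distribʳ-* c a)))) (hyp _ (*-≢0 hc h))
  ~scale hc (~sym e)     = ~sym (~scale hc e)
  ~scale hc (~trans e f) = ~trans (~scale hc e) (~scale hc f)

  infixl 6 _⊕_
  infixl 7 _⊙_

  _⊕_ : ∀ {n} → Vec ℤ n → Vec ℤ n → Vec ℤ n
  _⊕_ = zipWith _+_

  _⊙_ : ∀ {n} → ℤ → Vec ℤ n → Vec ℤ n
  c ⊙ v = map (c *_) v

  0⃗ : ∀ {n} → Vec ℤ n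
  0⃗ = replicate _ (+ 0)

  ∷-inj : ∀ {n} {x y : ℤ} {u v : Vec ℤ n} → x ∷ u ≡ y ∷ v → x ≡ y × u ≡ v
  ∷-inj refl = refl , refl

  ⊙-⊕ : ∀ {n} c (u v : Vec ℤ n) → c ⊙ (u ⊕ v) ≡ c ⊙ u ⊕ c ⊙ v
  ⊙-⊕ c [] [] = refl
  ⊙-⊕ c (x ∷ u) (y ∷ v) = cong₂ _∷_ (*-distribˡ-+ c x y) (⊙-⊕ c u v)

  ⊙-⊙ : ∀ {n} c d (u : Vec ℤ n) → c ⊙ (d ⊙ u) ≡ d ⊙ (c ⊙ u)
  ⊙-⊙ c d [] = refl
  ⊙-⊙ c d (x ∷ u) = cong₂ _∷_ (ring c d x) (⊙-⊙ c d u)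
    where ring : ∀ c d x → c * (d * x) ≡ d * (c * x)
          ring = solve-∀

  ⊙-≡0 : ∀ {n} {c} {u : Vec ℤ n} → c ≢ + 0 → c ⊙ u ≡ 0⃗ → u ≡ 0⃗
  ⊙-≡0 {u = []} h e = refl
  ⊙-≡0 {c = c} {u = x ∷ u} h e with ∷-inj e
  ... | e₁ , e₂ with i*j≡0⇒i≡0∨j≡0 c e₁
  ...   | inj₁ z = ⊥-elim (h z)
  ...   | inj₂ z = cong₂ _∷_ z (⊙-≡0 h e₂)

  record Embedding (m n : ℕ) : Set where
    field
      fun   : Vec ℤ m → Vec ℤ n
      fun-⊕ : ∀ u v → fun (u ⊕ v) ≡ fun u ⊕ fun v
      fun-⊙ : ∀ c u → fun (c ⊙ u) ≡ c ⊙ fun u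
      inj   : ∀ {u} → fun u ≡ 0⃗ → u ≡ 0⃗
  open Embedding

  _∘ₑ_ : ∀ {l m n} → Embedding m n → Embedding l m → Embedding l n
  f ∘ₑ g = record
    { fun = λ v → fun f (fun g v)
    ; fun-⊕ = λ u v → trans (cong (fun f) (fun-⊕ g u v)) (fun-⊕ f _ _)
    ; fun-⊙ = λ c u → trans (cong (fun f) (fun-⊙ g c u)) (fun-⊙ f c _)
    ; inj = λ e → inj g (inj f e) }

  idₑ : ∀ {n} → Embedding n n
  idₑ = record { fun = λ v → v ; fun-⊕ = λ _ _ → refl ; fun-⊙ = λ _ _ → refl ; inj = λ e → e }

  Q : (ℓ : List ℤ) → Vec ℤ (length ℓ) → ℤ
  Q []      []      = + 0
  Q (a ∷ ℓ) (x ∷ v) = a * (x * x) + Q ℓ v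

  Q-⊙ : ∀ ℓ c v → Q ℓ (c ⊙ v) ≡ c * c * Q ℓ v
  Q-⊙ []      c []      = sym (*-zeroʳ (c * c))
  Q-⊙ (a ∷ ℓ) c (x ∷ v) = trans (cong (_+_ (a * (c * x * (c * x)))) (Q-⊙ ℓ c v)) (ring a c x (Q ℓ v))
    where ring : ∀ a c x q → a * (c * x * (c * x)) + c * c * q ≡ c * c * (a * (x * x) + q)
          ring = solve-∀

  -- An isometry over ℚ with cleared denominators: the scaling of vectors multiplies the form by a
  -- square. Zeros of the form are preserved, which is all that `transport` needs.
  record Similar (ℓ m : List ℤ) : Set where
    field
      emb     : Embedding (length ℓ) (length m)
      factor  : ℤ
      nonzero : factor ≢ + 0
      similar : ∀ v → Q m (fun emb v) ≡ factor * factor * Q ℓ v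
  open Similar

  *-cancel0 : ∀ {c x} → c ≢ + 0 → c * x ≡ + 0 → x ≡ + 0
  *-cancel0 {c} h e with i*j≡0⇒i≡0∨j≡0 c e
  ... | inj₁ z = ⊥-elim (h z)
  ... | inj₂ z = z

  1≢0 : + 1 ≢ + 0
  1≢0 ()

  similar-↭ : ∀ {ℓ m} → ℓ ↭ m → Similar ℓ m
  similar-↭ P.refl = record { emb = idₑ ; factor = + 1 ; nonzero = 1≢0 ; similar = λ v → sym (*-identityˡ _) }
  similar-↭ (prep {ℓ} {m} x π) = record
    { emb = record
      { fun   = λ { (y ∷ v) → s * y ∷ fun f v }
      ; fun-⊕ = λ { (y ∷ u) (z ∷ v) → cong₂ _∷_ (*-distribˡ-+ s y z) (fun-⊕ f u v) }
      ; fun-⊙ = λ { c (y ∷ u) → cong₂ _∷_ (ring c s y) (fun-⊙ f c u) }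
      ; inj   = λ { {y ∷ u} e → cong₂ _∷_ (*-cancel0 (nonzero S) (proj₁ (∷-inj e))) (inj f (proj₂ (∷-inj e))) } }
    ; factor = s ; nonzero = nonzero S
    ; similar = λ { (y ∷ v) → trans (cong (_+_ (x * (s * y * (s * y)))) (similar S v)) (ring′ x s y (Q ℓ v)) } }
    where
    S = similar-↭ π
    f = emb S
    s = factor S
    ring : ∀ c s y → s * (c * y) ≡ c * (s * y)
    ring = solve-∀
    ring′ : ∀ x s y q → x * (s * y * (s * y)) + s * s * q ≡ s * s * (x * (y * y) + q)
    ring′ = solve-∀
  similar-↭ (swap {ℓ} {m} x x′ π) = record
    { emb = record
      { fun   = λ { (y ∷ y′ ∷ v) → s * y′ ∷ s * y ∷ fun f v }
      ; fun-⊕ = λ { (y ∷ y′ ∷ u) (z ∷ z′ ∷ v) → cong₂ _∷_ (*-distribˡ-+ s y′ z′) (cong₂ _∷_ (*-distribˡ-+ s y z) (fun-⊕ f u v)) }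
      ; fun-⊙ = λ { c (y ∷ y′ ∷ u) → cong₂ _∷_ (ring c s y′) (cong₂ _∷_ (ring c s y) (fun-⊙ f c u)) }
      ; inj   = λ { {y ∷ y′ ∷ u} e → cong₂ _∷_ (*-cancel0 (nonzero S) (proj₁ (∷-inj (proj₂ (∷-inj e)))))
                  (cong₂ _∷_ (*-cancel0 (nonzero S) (proj₁ (∷-inj e))) (inj f (proj₂ (∷-inj (proj₂ (∷-inj e)))))) } }
    ; factor = s ; nonzero = nonzero S
    ; similar = λ { (y ∷ y′ ∷ v) → trans (cong (λ t → x′ * (s * y′ * (s * y′)) + (x * (s * y * (s * y)) + t)) (similar S v)) (ring′ x x′ s y y′ (Q ℓ v)) } }
    where
    S = similar-↭ π
    f = emb S
    s = factor S
    ring : ∀ c s y → s * (c * y) ≡ c * (s * y)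
    ring = solve-∀
    ring′ : ∀ x x′ s y y′ q → x′ * (s * y′ * (s * y′)) + (x * (s * y * (s * y)) + s * s * q) ≡ s * s * (x * (y * y) + (x′ * (y′ * y′) + q))
    ring′ = solve-∀
  similar-↭ (P.trans {ℓ} {m} {n} π ρ) = record
    { emb = emb (similar-↭ ρ) ∘ₑ emb (similar-↭ π)
    ; factor = factor (similar-↭ ρ) * factor (similar-↭ π)
    ; nonzero = *-≢0 (nonzero (similar-↭ ρ)) (nonzero (similar-↭ π))
    ; similar = λ v → trans (similar (similar-↭ ρ) _) (trans (cong (factor (similar-↭ ρ) * factor (similar-↭ ρ) *_) (similar (similar-↭ π) v))
        (ring (factor (similar-↭ ρ)) (factor (similar-↭ π)) (Q ℓ v))) }
    where ring : ∀ s t q → s * s * (t * t * q) ≡ s * t * (s * t) * q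
          ring = solve-∀

  similar-sq : ∀ {a s} ℓ → s ≢ + 0 → Similar (a * (s * s) ∷ ℓ) (a ∷ ℓ)
  similar-sq {a} {s} ℓ h = record
    { emb = record
      { fun   = λ { (y ∷ v) → s * y ∷ v }
      ; fun-⊕ = λ { (y ∷ u) (z ∷ v) → cong (_∷ u ⊕ v) (*-distribˡ-+ s y z) }
      ; fun-⊙ = λ { c (y ∷ u) → cong (_∷ c ⊙ u) (ring c s y) }
      ; inj   = λ { {y ∷ u} e → cong₂ _∷_ (*-cancel0 h (proj₁ (∷-inj e))) (proj₂ (∷-inj e)) } }
    ; factor = + 1 ; nonzero = 1≢0
    ; similar = λ { (y ∷ v) → ring′ a s y (Q ℓ v) } }
    where
    ring : ∀ c s y → s * (c * y) ≡ c * (s * y)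
    ring = solve-∀
    ring′ : ∀ a s y q → a * (s * y * (s * y)) + q ≡ + 1 * (a * (s * s) * (y * y) + q)
    ring′ = solve-∀

  similar-sq⁻ : ∀ {a s} ℓ → s ≢ + 0 → Similar (a ∷ ℓ) (a * (s * s) ∷ ℓ)
  similar-sq⁻ {a} {s} ℓ h = record
    { emb = record
      { fun   = λ { (y ∷ v) → y ∷ s ⊙ v }
      ; fun-⊕ = λ { (y ∷ u) (z ∷ v) → cong (y + z ∷_) (⊙-⊕ s u v) }
      ; fun-⊙ = λ { c (y ∷ u) → cong (c * y ∷_) (⊙-⊙ s c u) }
      ; inj   = λ { {y ∷ u} e → cong₂ _∷_ (proj₁ (∷-inj e)) (⊙-≡0 h (proj₂ (∷-inj e))) } }
    ; factor = s ; nonzero = h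
    ; similar = λ { (y ∷ v) → trans (cong (_+_ (a * (s * s) * (y * y))) (Q-⊙ ℓ s v)) (ring a s y (Q ℓ v)) } }
    where
    ring : ∀ a s y q → a * (s * s) * (y * y) + s * s * q ≡ s * s * (a * (y * y) + q)
    ring = solve-∀

  -- The vectors e₁ + e₂ and b e₁ - a e₂ are orthogonal, of norms a + b and a b (a + b). Coordinates
  -- with respect to them have denominator a + b, whence the factor.
  similar-add : ∀ {a b} ℓ → a + b ≢ + 0 → Similar (a ∷ b ∷ ℓ) (a + b ∷ a * b * (a + b) ∷ ℓ)
  similar-add {a} {b} ℓ h = record
    { emb = record
      { fun   = λ { (x ∷ y ∷ v) → a * x + b * y ∷ x - y ∷ (a + b) ⊙ v }
      ; fun-⊕ = λ { (x ∷ y ∷ u) (x′ ∷ y′ ∷ v) → cong₂ _∷_ (r₁ a b x y x′ y′) (cong₂ _∷_ (r₂ x y x′ y′) (⊙-⊕ (a + b) u v)) }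
      ; fun-⊙ = λ { c (x ∷ y ∷ u) → cong₂ _∷_ (r₃ a b c x y) (cong₂ _∷_ (r₄ c x y) (⊙-⊙ (a + b) c u)) }
      ; inj   = λ { {x ∷ y ∷ u} e → injective (proj₁ (∷-inj e)) (proj₁ (∷-inj (proj₂ (∷-inj e)))) (proj₂ (∷-inj (proj₂ (∷-inj e)))) } }
    ; factor = a + b ; nonzero = h
    ; similar = λ { (x ∷ y ∷ v) → trans (cong (λ t → (a + b) * ((a * x + b * y) * (a * x + b * y)) + (a * b * (a + b) * ((x - y) * (x - y)) + t)) (Q-⊙ ℓ (a + b) v)) (r₅ a b x y (Q ℓ v)) } }
    where
    r₁ : ∀ a b x y x′ y′ → a * (x + x′) + b * (y + y′) ≡ a * x + b * y + (a * x′ + b * y′)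
    r₁ = solve-∀
    r₂ : ∀ x y x′ y′ → x + x′ - (y + y′) ≡ x - y + (x′ - y′)
    r₂ = solve-∀
    r₃ : ∀ a b c x y → a * (c * x) + b * (c * y) ≡ c * (a * x + b * y)
    r₃ = solve-∀
    r₄ : ∀ c x y → c * x - c * y ≡ c * (x - y)
    r₄ = solve-∀
    r₅ : ∀ a b x y q → (a + b) * ((a * x + b * y) * (a * x + b * y)) + (a * b * (a + b) * ((x - y) * (x - y)) + (a + b) * (a + b) * q) ≡ (a + b) * (a + b) * (a * (x * x) + (b * (y * y) + q))
    r₅ = solve-∀
    injective : ∀ {x y u} → a * x + b * y ≡ + 0 → x - y ≡ + 0 → (a + b) ⊙ u ≡ 0⃗ → x ∷ y ∷ u ≡ 0⃗
    injective {x} {y} e₁ e₂ e₃ with i-j≡0⇒i≡j x y e₂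
    ... | refl = cong₂ _∷_ x0 (cong₂ _∷_ x0 (⊙-≡0 h e₃))
      where x0 = *-cancel0 h (trans (*-distribʳ-+ x a b) e₁)

  similar-add⁻ : ∀ {a b} ℓ → a + b ≢ + 0 → Similar (a + b ∷ a * b * (a + b) ∷ ℓ) (a ∷ b ∷ ℓ)
  similar-add⁻ {a} {b} ℓ h = record
    { emb = record
      { fun   = λ { (x ∷ y ∷ v) → x + b * y ∷ x - a * y ∷ v }
      ; fun-⊕ = λ { (x ∷ y ∷ u) (x′ ∷ y′ ∷ v) → cong₂ _∷_ (r₁ b x y x′ y′) (cong (_∷ u ⊕ v) (r₂ a x y x′ y′)) }
      ; fun-⊙ = λ { c (x ∷ y ∷ u) → cong₂ _∷_ (r₃ b c x y) (cong (_∷ c ⊙ u) (r₄ a c x y)) }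
      ; inj   = λ { {x ∷ y ∷ u} e → injective (proj₁ (∷-inj e)) (proj₁ (∷-inj (proj₂ (∷-inj e)))) (proj₂ (∷-inj (proj₂ (∷-inj e)))) } }
    ; factor = + 1 ; nonzero = 1≢0
    ; similar = λ { (x ∷ y ∷ v) → r₅ a b x y (Q ℓ v) } }
    where
    r₁ : ∀ b x y x′ y′ → x + x′ + b * (y + y′) ≡ x + b * y + (x′ + b * y′)
    r₁ = solve-∀
    r₂ : ∀ a x y x′ y′ → x + x′ - a * (y + y′) ≡ x - a * y + (x′ - a * y′)
    r₂ = solve-∀
    r₃ : ∀ b c x y → c * x + b * (c * y) ≡ c * (x + b * y)
    r₃ = solve-∀
    r₄ : ∀ a c x y → c * x - a * (c * y) ≡ c * (x - a * y)
    r₄ = solve-∀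
    r₅ : ∀ a b x y q → a * ((x + b * y) * (x + b * y)) + (b * ((x - a * y) * (x - a * y)) + q) ≡ + 1 * ((a + b) * (x * x) + (a * b * (a + b) * (y * y) + q))
    r₅ = solve-∀
    r₆ : ∀ a b x y → (a + b) * y ≡ x + b * y - (x - a * y)
    r₆ = solve-∀
    injective : ∀ {x y} {u : Vec ℤ (length ℓ)} → x + b * y ≡ + 0 → x - a * y ≡ + 0 → u ≡ 0⃗ → x ∷ y ∷ u ≡ 0⃗
    injective {x} {y} e₁ e₂ e₃ = cong₂ _∷_ (trans (sym (trans (cong (λ t → x + b * t) y0) (trans (cong (_+_ (x)) (*-zeroʳ b)) (+-identityʳ x)))) e₁) (cong₂ _∷_ y0 e₃)
      where y0 = *-cancel0 h (trans (r₆ a b x y) (cong₂ _-_ e₁ e₂))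

  -- The form vanishes on the whole image, hence so does its polarisation: the image is totally
  -- isotropic, of rank j by injectivity.
  record Isotropic (j : ℕ) (ℓ : List ℤ) : Set where
    constructor isotropic
    field
      sub      : Embedding j (length ℓ)
      vanishes : ∀ c → Q ℓ (fun sub c) ≡ + 0
  open Isotropic

  transport : ∀ {j ℓ m} → Similar ℓ m → Isotropic j ℓ → Isotropic j m
  transport S I = isotropic (emb S ∘ₑ sub I) (λ c → trans (similar S _)
    (trans (cong (factor S * factor S *_) (vanishes I c)) (*-zeroʳ (factor S * factor S))))

  isotropic-hyp⁻ : ∀ {a j} ℓ → Isotropic j ℓ → Isotropic (suc j) (a ∷ - a ∷ ℓ)
  isotropic-hyp⁻ {a} ℓ I = isotropic
    (record
      { fun   = λ { (x ∷ c) → x ∷ x ∷ fun (sub I) c }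
      ; fun-⊕ = λ { (x ∷ u) (y ∷ v) → cong (λ t → x + y ∷ x + y ∷ t) (fun-⊕ (sub I) u v) }
      ; fun-⊙ = λ { c (x ∷ u) → cong (λ t → c * x ∷ c * x ∷ t) (fun-⊙ (sub I) c u) }
      ; inj   = λ { {x ∷ u} e → cong₂ _∷_ (proj₁ (∷-inj e)) (inj (sub I) (proj₂ (∷-inj (proj₂ (∷-inj e))))) } })
    (λ { (x ∷ c) → trans (cong (λ t → a * (x * x) + (- a * (x * x) + t)) (vanishes I c)) (ring a x) })
    where ring : ∀ a x → a * (x * x) + (- a * (x * x) + + 0) ≡ + 0
          ring = solve-∀

  record Functional (n : ℕ) : Set where
    field
      val   : Vec ℤ n → ℤ
      val-⊕ : ∀ u v → val (u ⊕ v) ≡ val u + val v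
      val-⊙ : ∀ c u → val (c ⊙ u) ≡ c * val u
  open Functional

  ⊕-0 : ∀ {n} (u : Vec ℤ n) → 0⃗ ⊕ u ≡ u
  ⊕-0 []      = refl
  ⊕-0 (x ∷ u) = cong₂ _∷_ (+-identityˡ x) (⊕-0 u)

  ⊙-0 : ∀ {n} c → c ⊙ 0⃗ {n} ≡ 0⃗
  ⊙-0 {zero}  c = refl
  ⊙-0 {suc n} c = cong₂ _∷_ (*-zeroʳ c) (⊙-0 c)

  tail-functional : ∀ {n} → Functional (suc n) → Functional n
  tail-functional f = record
    { val   = λ v → val f (+ 0 ∷ v)
    ; val-⊕ = λ u v → val-⊕ f (+ 0 ∷ u) (+ 0 ∷ v)
    ; val-⊙ = λ c u → trans (cong (λ t → val f (t ∷ c ⊙ u)) (sym (*-zeroʳ c))) (val-⊙ f c (+ 0 ∷ u)) }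

  val-∷ : ∀ {n} (f : Functional (suc n)) x v → val f (x ∷ v) ≡ x * val f (+ 1 ∷ 0⃗) + val f (+ 0 ∷ v)
  val-∷ f x v = trans (cong (val f) (cong₂ _∷_ (ring x) (sym (trans (cong (_⊕ v) (⊙-0 x)) (⊕-0 v)))))
    (trans (val-⊕ f (x ⊙ (+ 1 ∷ 0⃗)) (+ 0 ∷ v)) (cong (_+ val f (+ 0 ∷ v)) (val-⊙ f x _)))
    where ring : ∀ x → x ≡ x * + 1 + + 0
          ring = solve-∀

  -- If the first basis vector has value l ≠ 0, the vectors (-g c, l c) lie in the kernel, g being
  -- the restriction to the other coordinates. Otherwise the first coordinate is free and the rest
  -- is handled recursively.
  kernel : ∀ {j} (f : Functional (suc j)) → Σ (Embedding j (suc j)) λ K → ∀ c → val f (fun K c) ≡ + 0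
  kernel {j} f with val f (+ 1 ∷ 0⃗) ≟ + 0
  ... | no h = record
      { fun   = λ c → - val g c ∷ l ⊙ c
      ; fun-⊕ = λ u v → cong₂ _∷_ (trans (cong -_ (val-⊕ g u v)) (neg-distrib-+ (val g u) (val g v))) (⊙-⊕ l u v)
      ; fun-⊙ = λ c u → cong₂ _∷_ (trans (cong -_ (val-⊙ g c u)) (neg-distribʳ-* c (val g u))) (⊙-⊙ l c u)
      ; inj   = λ e → ⊙-≡0 h (proj₂ (∷-inj e)) }
    , λ c → trans (val-∷ f (- val g c) (l ⊙ c)) (trans (cong (_+_ (- val g c * l)) (val-⊙ g l c)) (ring (val g c) l))
    where
    g = tail-functional f
    l = val f (+ 1 ∷ 0⃗)
    ring : ∀ x l → - x * l + l * x ≡ + 0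
    ring = solve-∀
  kernel {zero}  f | yes z = record { fun = λ _ → + 0 ∷ [] ; fun-⊕ = λ _ _ → refl ; fun-⊙ = λ c _ → cong (_∷ []) (sym (*-zeroʳ c)) ; inj = λ { {[]} _ → refl } }
    , λ _ → trans (val-⊙ f (+ 0) (+ 0 ∷ [])) (*-zeroˡ (val f (+ 0 ∷ [])))
  kernel {suc j} f | yes z with kernel (tail-functional f)
  ... | K , h = record
      { fun   = λ { (x ∷ c) → x ∷ fun K c }
      ; fun-⊕ = λ { (x ∷ u) (y ∷ v) → cong (x + y ∷_) (fun-⊕ K u v) }
      ; fun-⊙ = λ { c (x ∷ u) → cong (c * x ∷_) (fun-⊙ K c u) }
      ; inj   = λ { {x ∷ u} e → cong₂ _∷_ (proj₁ (∷-inj e)) (inj K (proj₂ (∷-inj e))) } }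
    , λ { (x ∷ c) → trans (val-∷ f x (fun K c)) (trans (cong₂ (λ u v → x * u + v) z (h c)) (trans (+-identityʳ _) (*-zeroʳ x))) }

  pull : ∀ {m n} → Functional n → Embedding m n → Functional m
  pull f e = record
    { val   = λ v → val f (fun e v)
    ; val-⊕ = λ u v → trans (cong (val f) (fun-⊕ e u v)) (val-⊕ f _ _)
    ; val-⊙ = λ c u → trans (cong (val f) (fun-⊙ e c u)) (val-⊙ f c _) }

  -- Restricting to the line x = y or to the line x = −y and projecting to ℓ: one of the two is injective,
  -- as the vectors (1,1,0) and (1,−1,0) cannot both lie in a totally isotropic subspace.
  module _ {a : ℤ} (a≢0 : a ≢ + 0) (ℓ : List ℤ) {j : ℕ} (I : Isotropic (suc j) (a ∷ - a ∷ ℓ)) where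

    private
      L = sub I
      V = Vec ℤ (suc (suc (length ℓ)))

      line : ℤ → Functional (suc (suc (length ℓ)))
      line ε = record
        { val   = λ { (x ∷ y ∷ _) → x - ε * y }
        ; val-⊕ = λ { (x ∷ y ∷ _) (x′ ∷ y′ ∷ _) → r₁ ε x y x′ y′ }
        ; val-⊙ = λ { c (x ∷ y ∷ _) → r₂ ε c x y } }
        where
        r₁ : ∀ ε x y x′ y′ → x + x′ - ε * (y + y′) ≡ x - ε * y + (x′ - ε * y′)
        r₁ = solve-∀
        r₂ : ∀ ε c x y → c * x - ε * (c * y) ≡ c * (x - ε * y)
        r₂ = solve-∀

      drop2 : V → Vec ℤ (length ℓ)
      drop2 (_ ∷ _ ∷ v) = v

      drop2-⊕ : ∀ u v → drop2 (u ⊕ v) ≡ drop2 u ⊕ drop2 v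
      drop2-⊕ (_ ∷ _ ∷ _) (_ ∷ _ ∷ _) = refl

      drop2-⊙ : ∀ c u → drop2 (c ⊙ u) ≡ c ⊙ drop2 u
      drop2-⊙ c (_ ∷ _ ∷ _) = refl

      Bad : ℤ → Set
      Bad ε = ∃ λ c → ∃ λ y → y ≢ + 0 × fun L c ≡ ε * y ∷ y ∷ 0⃗

      restrict : ∀ ε → ε * ε ≡ + 1 → ¬ Bad ε → Isotropic j ℓ
      restrict ε εε good with kernel (pull (line ε) L)
      ... | K , k = isotropic
          (record
            { fun   = λ c → drop2 (fun LK c)
            ; fun-⊕ = λ u v → trans (cong drop2 (fun-⊕ LK u v)) (drop2-⊕ (fun LK u) (fun LK v))
            ; fun-⊙ = λ c u → trans (cong drop2 (fun-⊙ LK c u)) (drop2-⊙ c (fun LK u))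
            ; inj   = λ {u} e → inj K (inj L (zero-vec (fun LK u) refl (k u) e)) })
          (λ c → vanish (fun LK c) (k c) (vanishes I (fun K c)))
        where
        LK = L ∘ₑ K
        zero-vec : ∀ {c} (v : V) → fun L c ≡ v → val (line ε) v ≡ + 0 → drop2 v ≡ 0⃗ → fun L c ≡ 0⃗
        zero-vec {c} (x ∷ y ∷ v) e e₁ refl with y ≟ + 0 | i-j≡0⇒i≡j x (ε * y) e₁
        ... | yes refl | refl = trans e (cong (λ t → t ∷ + 0 ∷ v) (*-zeroʳ ε))
        ... | no  ne   | refl = ⊥-elim (good (c , y , ne , e))
        vanish : ∀ (v : V) → val (line ε) v ≡ + 0 → Q (a ∷ - a ∷ ℓ) v ≡ + 0 → Q ℓ (drop2 v) ≡ + 0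
        vanish (x ∷ y ∷ v) e q with i-j≡0⇒i≡j x (ε * y) e
        ... | refl = trans (sym (trans (ring a ε y (Q ℓ v)) (trans (cong (λ t → a * (t * (y * y)) + (- a * (y * y) + Q ℓ v)) εε) (ring′ a y (Q ℓ v))))) q
          where
          ring : ∀ a ε y q → a * (ε * y * (ε * y)) + (- a * (y * y) + q) ≡ a * (ε * ε * (y * y)) + (- a * (y * y) + q)
          ring = solve-∀
          ring′ : ∀ a y q → a * (+ 1 * (y * y)) + (- a * (y * y) + q) ≡ q
          ring′ = solve-∀

      not-both : Bad (+ 1) → ¬ Bad (- (+ 1))
      not-both (c , y , y≢0 , e) (c′ , y′ , y′≢0 , e′) =
        *-≢0 a≢0 (*-≢0 2yy≢0 2yy≢0) (trans (sym (Q-axis t)) (trans (sym (cong (Q (a ∷ - a ∷ ℓ)) combo)) (vanishes I (y′ ⊙ c ⊕ (- y) ⊙ c′))))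
        where
        t = + 2 * (y * y′)
        2yy≢0 : t ≢ + 0
        2yy≢0 = *-≢0 {+ 2} (λ ()) (*-≢0 y≢0 y′≢0)
        r₁ : ∀ y y′ → y′ * (+ 1 * y) + - y * (- (+ 1) * y′) ≡ + 2 * (y * y′)
        r₁ = solve-∀
        r₂ : ∀ y y′ → y′ * y + - y * y′ ≡ + 0
        r₂ = solve-∀
        combo : fun L (y′ ⊙ c ⊕ (- y) ⊙ c′) ≡ t ∷ + 0 ∷ 0⃗
        combo = trans (fun-⊕ L _ _) (trans (cong₂ _⊕_ (trans (fun-⊙ L y′ c) (cong (y′ ⊙_) e)) (trans (fun-⊙ L (- y) c′) (cong ((- y) ⊙_) e′)))
          (cong₂ _∷_ (r₁ y y′) (cong₂ _∷_ (r₂ y y′) (trans (cong₂ _⊕_ (⊙-0 y′) (⊙-0 (- y))) (⊕-0 0⃗)))))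
        Q-0 : ∀ ℓ → Q ℓ 0⃗ ≡ + 0
        Q-0 []      = refl
        Q-0 (b ∷ ℓ) = trans (cong₂ _+_ (*-zeroʳ b) (Q-0 ℓ)) refl
        Q-axis : ∀ x → Q (a ∷ - a ∷ ℓ) (x ∷ + 0 ∷ 0⃗) ≡ a * (x * x)
        Q-axis x = trans (cong (λ u → a * (x * x) + u) (trans (cong₂ _+_ (*-zeroʳ (- a)) (Q-0 ℓ)) refl)) (+-identityʳ _)

    -- Removing a hyperbolic plane costs one dimension. Whether `Bad` holds is a question about all
    -- vectors of a subspace, so the case distinction is made under a double negation.
    isotropic-hyp : ¬ ¬ Isotropic j ℓ
    isotropic-hyp k = ¬¬-excluded-middle λ
      { (yes bad) → k (restrict (- (+ 1)) refl (not-both bad))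
      ; (no good) → k (restrict (+ 1) refl good) }

  -- A totally isotropic subspace of half the dimension: the geometric content of Witt triviality,
  -- and preserved in both directions by every generator of `~`, including the addition of a
  -- hyperbolic plane.
  Metabolic : List ℤ → Set
  Metabolic ℓ = ∃ λ j → length ℓ ≡ j ℕ.+ j × ¬ ¬ Isotropic j ℓ

  metabolic-similar : ∀ {ℓ m} → length ℓ ≡ length m → Similar ℓ m → Metabolic ℓ → Metabolic m
  metabolic-similar l S (j , e , h) = j , trans (sym l) e , λ k → h (λ I → k (transport S I))

  ~⇒metabolic : ∀ {ℓ m} → ℓ ~ m → (Metabolic ℓ → Metabolic m) × (Metabolic m → Metabolic ℓ)
  ~⇒metabolic (perm π) = metabolic-similar (↭-length π) (similar-↭ π) , metabolic-similar (sym (↭-length π)) (similar-↭ (↭-sym π))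
  ~⇒metabolic (sq ℓ h k) = metabolic-similar refl (similar-sq ℓ k) , metabolic-similar refl (similar-sq⁻ ℓ k)
  ~⇒metabolic (add ℓ h k l) = metabolic-similar refl (similar-add ℓ l) , metabolic-similar refl (similar-add⁻ ℓ l)
  ~⇒metabolic (hyp {a} ℓ h) = down , up
    where
    down : Metabolic (a ∷ - a ∷ ℓ) → Metabolic ℓ
    down (suc j , e , n) = j , ℕP.suc-injective (ℕP.suc-injective (trans e (cong suc (ℕP.+-suc j j)))) , λ k → n (λ I → isotropic-hyp h ℓ I k)
    up : Metabolic ℓ → Metabolic (a ∷ - a ∷ ℓ)
    up (j , e , n) = suc j , cong suc (trans (cong suc e) (sym (ℕP.+-suc j j))) , λ k → n (λ I → k (isotropic-hyp⁻ ℓ I))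
  ~⇒metabolic (~sym e) = proj₂ (~⇒metabolic e) , proj₁ (~⇒metabolic e)
  ~⇒metabolic (~trans e f) = (λ x → proj₁ (~⇒metabolic f) (proj₁ (~⇒metabolic e) x)) , (λ x → proj₂ (~⇒metabolic e) (proj₂ (~⇒metabolic f) x))

  ~[]⇒metabolic : ∀ {ℓ} → ℓ ~ [] → Metabolic ℓ
  ~[]⇒metabolic e = proj₂ (~⇒metabolic e) (0 , refl , λ k → k (isotropic idₑ (λ { [] → refl })))

  -- Inside a totally isotropic subspace of dimension 3 the two linear conditions x₅ = x₆ = 0 leave
  -- a nonzero vector.
  albert : ∀ {a b c d e f} → a ∷ b ∷ c ∷ d ∷ e ∷ f ∷ [] ~ [] →
    ¬ ¬ (∃ λ x → ∃ λ y → ∃ λ z → ∃ λ w → a * (x * x) + (b * (y * y) + (c * (z * z) + d * (w * w))) ≡ + 0 ×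
         ¬ (x ≡ + 0 × y ≡ + 0 × z ≡ + 0 × w ≡ + 0))
  albert {a} {b} {c} {d} {e} {f} h k with ~[]⇒metabolic h
  ... | 3 , refl , n = n extract
    where
    coord : Vec ℤ 6 → ℤ × ℤ
    coord (_ ∷ _ ∷ _ ∷ _ ∷ x ∷ y ∷ []) = x , y
    fifth sixth : Functional 6
    fifth = record { val = λ v → proj₁ (coord v)
      ; val-⊕ = λ { (_ ∷ _ ∷ _ ∷ _ ∷ x ∷ y ∷ []) (_ ∷ _ ∷ _ ∷ _ ∷ x′ ∷ y′ ∷ []) → refl } ; val-⊙ = λ { c (_ ∷ _ ∷ _ ∷ _ ∷ x ∷ y ∷ []) → refl } }
    sixth = record { val = λ v → proj₂ (coord v)
      ; val-⊕ = λ { (_ ∷ _ ∷ _ ∷ _ ∷ x ∷ y ∷ []) (_ ∷ _ ∷ _ ∷ _ ∷ x′ ∷ y′ ∷ []) → refl } ; val-⊙ = λ { c (_ ∷ _ ∷ _ ∷ _ ∷ x ∷ y ∷ []) → refl } }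
    extract : Isotropic 3 (a ∷ b ∷ c ∷ d ∷ e ∷ f ∷ []) → ⊥
    extract I with kernel (pull fifth (sub I))
    ... | K₁ , k₁ with kernel (pull sixth (sub I ∘ₑ K₁))
    ...   | K₂ , k₂ = conclude (fun E (+ 1 ∷ [])) (λ z → 1≢0 (proj₁ (∷-inj (inj E z)))) (k₁ (fun K₂ (+ 1 ∷ []))) (k₂ (+ 1 ∷ [])) (vanishes I (fun K₁ (fun K₂ (+ 1 ∷ []))))
      where
      E = (sub I ∘ₑ K₁) ∘ₑ K₂
      ring : ∀ A B C D e f → A + (B + (C + (D + (e * (+ 0 * + 0) + (f * (+ 0 * + 0) + + 0))))) ≡ A + (B + (C + D))
      ring = solve-∀
      conclude : ∀ (v : Vec ℤ 6) → v ≢ 0⃗ → proj₁ (coord v) ≡ + 0 → proj₂ (coord v) ≡ + 0 → Q (a ∷ b ∷ c ∷ d ∷ e ∷ f ∷ []) v ≡ + 0 → ⊥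
      conclude (x ∷ y ∷ z ∷ w ∷ _ ∷ _ ∷ []) ne refl refl q =
        k (x , y , z , w , trans (sym (ring (a * (x * x)) (b * (y * y)) (c * (z * z)) (d * (w * w)) e f)) q , λ { (refl , refl , refl , refl) → ne refl })
  ... | suc (suc (suc (suc j))) , 6≡ , n = ⊥-elim (ℕP.<⇒≢ (ℕP.<-≤-trans (ℕP.m≤m+n 7 1) (ℕP.+-mono-≤ (ℕP.m≤m+n 4 j) (ℕP.m≤m+n 4 j))) 6≡)

-- Residue maps to the Witt groups of the prime fields.

module Residue where

  open import Data.Nat.Primality using (prime⇒nonZero; prime⇒nonTrivial)
  open import Data.Integer hiding (suc)
  open import Data.Integer.Properties
  open import Data.Integer.Divisibility.Signed
  open import Data.Bool using (not; _xor_)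
  open import Data.Bool.Properties using (xor-assoc; xor-comm; xor-same; xor-identityʳ)
  open import Data.List using (List; []; _∷_)
  open import Relation.Binary.Definitions using (tri<; tri≈; tri>)
  open Congruence
  open BigOp
  open Convolution using (valuation)
  open Witt

  true≢false : true ≢ false
  true≢false ()

  odd : ℕ → Bool
  odd zero    = false
  odd (suc n) = not (odd n)

  odd-+ : ∀ m n → odd (m ℕ.+ n) ≡ odd m xor odd n
  odd-+ zero    n = refl
  odd-+ (suc m) n = trans (cong not (odd-+ m n)) (not-xor (odd m) (odd n))
    where not-xor : ∀ x y → not (x xor y) ≡ not x xor y
          not-xor true  true  = refl
          not-xor true  false = refl
          not-xor false y     = refl

  odd-double : ∀ m → odd (m ℕ.+ m) ≡ false
  odd-double m = trans (odd-+ m m) (xor-same (odd m))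

  halve : ∀ n → ∃ λ f → n ≡ f ℕ.+ f ⊎ n ≡ suc (f ℕ.+ f)
  halve zero = 0 , inj₁ refl
  halve (suc e) with halve e
  ... | f , inj₁ refl = f , inj₂ refl
  ... | f , inj₂ refl = suc f , inj₁ (cong suc (sym (ℕP.+-suc f f)))

  pos-^ : ∀ p e → + (p ℕ.^ e) ≡ (+ p) ^ e
  pos-^ p zero    = refl
  pos-^ p (suc e) = trans (pos-* p (p ℕ.^ e)) (cong (+ p *_) (pos-^ p e))

  abstract
    -- Abstract, so that the well-founded recursion behind it is never unfolded; by `unique` nothing
    -- depends on which decomposition it returns.
    valuationℤ : ∀ {p} → Prime p → ∀ n → n ≢ + 0 → ∃ λ e → ∃ λ u → n ≡ (+ p) ^ e * u × ¬ (+ p ∣ u)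
    valuationℤ {p} pp n n≢0 with valuation (ℕ.nonTrivial⇒n>1 _ {{prime⇒nonTrivial pp}}) ∣ n ∣ (ℕP.n≢0⇒n>0 (λ e → n≢0 (∣i∣≡0⇒i≡0 e)))
    ... | e , m , eq , p∤m = e , σ * + m , lem , ∤σm
      where
      σ : ℤ
      σ = sign n ◃ 1
      ring : ∀ s P m → s * (P * m) ≡ P * (s * m)
      ring = solve-∀
      sign*abs : ∀ n → n ≡ (sign n ◃ 1) * + ∣ n ∣
      sign*abs (+ k)    = sym (*-identityˡ (+ k))
      sign*abs -[1+ k ] = sym (-1*i≡-i (+ suc k))
      lem : n ≡ (+ p) ^ e * (σ * + m)
      lem = trans (sign*abs n) (trans (cong (λ t → σ * + t) eq) (trans (cong (σ *_) (trans (pos-* (p ℕ.^ e) m) (cong (_* + m) (pos-^ p e)))) (ring σ ((+ p) ^ e) (+ m))))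
      ∤σm : ¬ (+ p ∣ σ * + m)
      ∤σm d = p∤m (subst (p ℕD.∣_) (trans (abs-* σ (+ m)) (trans (cong (ℕ._* m) (∣σ∣ (sign n))) (ℕP.*-identityˡ m))) (∣⇒∣ᵤ d))
        where ∣σ∣ : ∀ s → ∣ s ◃ 1 ∣ ≡ 1
              ∣σ∣ Sign.+ = refl
              ∣σ∣ Sign.- = refl

  G : Set
  G = Bool × Sign

  -- For η = (−1/p) this is the Witt group of 𝔽ₚ: dimension mod 2 and signed discriminant.
  module WittFp (η : Sign) where

    w : Bool → Bool → Sign
    w true true = η
    w _    _    = Sign.+

    infixl 6 _∙_
    _∙_ : G → G → G
    (x , s) ∙ (y , t) = x xor y , w x y Sign.* (s Sign.* t)

    0G : G
    0G = false , Sign.+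

    ∙-comm : ∀ g k → g ∙ k ≡ k ∙ g
    ∙-comm (x , s) (y , t) = cong₂ _,_ (xor-comm x y) (cong₂ Sign._*_ (w-comm x y) (SignP.*-comm s t))
      where w-comm : ∀ x y → w x y ≡ w y x
            w-comm true  true  = refl
            w-comm true  false = refl
            w-comm false true  = refl
            w-comm false false = refl

    ∙-idˡ : ∀ g → 0G ∙ g ≡ g
    ∙-idˡ (true  , s) = refl
    ∙-idˡ (false , s) = refl

    ∙-assoc : ∀ g k l → (g ∙ k) ∙ l ≡ g ∙ (k ∙ l)
    ∙-assoc (x , s) (y , t) (z , u) = cong₂ _,_ (xor-assoc x y z) (begin
      w (x xor y) z Sign.* (w x y Sign.* (s Sign.* t) Sign.* u)     ≡⟨ cong (w (x xor y) z Sign.*_) (SignP.*-assoc (w x y) (s Sign.* t) u) ⟩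
      w (x xor y) z Sign.* (w x y Sign.* (s Sign.* t Sign.* u))     ≡⟨ sym (SignP.*-assoc (w (x xor y) z) (w x y) _) ⟩
      w (x xor y) z Sign.* w x y Sign.* (s Sign.* t Sign.* u)       ≡⟨ cong₂ Sign._*_ (cocycle x y z) (SignP.*-assoc s t u) ⟩
      w x (y xor z) Sign.* w y z Sign.* (s Sign.* (t Sign.* u))     ≡⟨ SignP.*-assoc (w x (y xor z)) (w y z) _ ⟩
      w x (y xor z) Sign.* (w y z Sign.* (s Sign.* (t Sign.* u)))   ≡⟨ cong (w x (y xor z) Sign.*_) (swap (w y z) s (t Sign.* u)) ⟩
      w x (y xor z) Sign.* (s Sign.* (w y z Sign.* (t Sign.* u)))   ∎)
      where
      open ≡-Reasoning
      swap : ∀ a b c → a Sign.* (b Sign.* c) ≡ b Sign.* (a Sign.* c)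
      swap a b c = trans (sym (SignP.*-assoc a b c)) (trans (cong (Sign._* c) (SignP.*-comm a b)) (SignP.*-assoc b a c))
      cocycle : ∀ x y z → w (x xor y) z Sign.* w x y ≡ w x (y xor z) Sign.* w y z
      cocycle true  true  true  = refl
      cocycle true  true  false = sym (SignP.*-identityʳ η)
      cocycle true  false true  = refl
      cocycle true  false false = refl
      cocycle false true  true  = SignP.*-identityʳ η
      cocycle false true  false = refl
      cocycle false false true  = refl
      cocycle false false false = refl

    open Big _∙_ 0G ∙-assoc ∙-comm ∙-idˡ public

  -- The Hilbert symbol of pᵉ u and pᶠ v at an odd prime, which depends only on the parities of e
  -- and f and on the residues of the units u and v.
  tameSymbol : (ℤ → Sign) → Bool → ℤ → Bool → ℤ → Sign
  tameSymbol leg false u false v = Sign.+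
  tameSymbol leg true  u false v = leg v
  tameSymbol leg false u true  v = leg u
  tameSymbol leg true  u true  v = leg (- (u * v))

  -- The character `leg` is a parameter, so that the constant character + makes the same proofs
  -- cover p = 2.
  module Residues {p : ℕ} (pp : Prime p) (leg : ℤ → Sign)
                  (leg-* : ∀ {u v} → ¬ (+ p ∣ u) → ¬ (+ p ∣ v) → leg (u * v) ≡ leg u Sign.* leg v)
                  (leg-cong : ∀ {u v} → u ≋ v mod p → leg u ≡ leg v) where

    η : Sign
    η = leg (- (+ 1))

    open WittFp η public

    private
      P = + p

      instance
        P≢0 : NonZero P
        P≢0 = prime⇒nonZero pp

    classᵇ : Bool → ℤ → G
    classᵇ true  u = true , leg u
    classᵇ false u = 0G

    class : ℕ → ℤ → G
    class e = classᵇ (odd e)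

    class-cong : ∀ {e f u v} → odd e ≡ odd f → leg u ≡ leg v → class e u ≡ class f v
    class-cong {e} {f} h k with odd e | odd f
    class-cong refl k | true  | .true  = cong (true ,_) k
    class-cong refl k | false | .false = refl

    unique : ∀ e f {u v} → P ^ e * u ≡ P ^ f * v → ¬ (P ∣ u) → ¬ (P ∣ v) → e ≡ f × u ≡ v
    unique zero    zero    {u} {v} eq nu nv = refl , trans (sym (*-identityˡ u)) (trans eq (*-identityˡ v))
    unique zero    (suc f) {u} {v} eq nu nv = ⊥-elim (nu (divides (P ^ f * v) (trans (sym (*-identityˡ u)) (trans eq (ring P (P ^ f) v)))))
      where ring : ∀ P Q v → P * Q * v ≡ Q * v * P
            ring = solve-∀
    unique (suc e) zero    {u} {v} eq nu nv = ⊥-elim (nv (divides (P ^ e * u) (trans (sym (*-identityˡ v)) (trans (sym eq) (ring P (P ^ e) u)))))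
      where ring : ∀ P Q v → P * Q * v ≡ Q * v * P
            ring = solve-∀
    unique (suc e) (suc f) {u} {v} eq nu nv with unique e f (*-cancelˡ-≡ P _ _ (trans (sym (*-assoc P (P ^ e) u)) (trans eq (*-assoc P (P ^ f) v)))) nu nv
    ... | refl , h = refl , h

    Valuation : ℤ → Set
    Valuation n = ∃ λ e → ∃ λ u → n ≡ P ^ e * u × ¬ (P ∣ u)

    classOf : ∀ {n} → Valuation n → G
    classOf (e , u , _) = class e u

    classOf-unique : ∀ {n} (v : Valuation n) e u → n ≡ P ^ e * u → ¬ (P ∣ u) → classOf v ≡ class e u
    classOf-unique (e′ , u′ , eq′ , nu′) e u eq nu with unique e′ e (trans (sym eq′) eq) nu′ nu
    ... | refl , refl = refl

    -- The second residue of ⟨n⟩: units and even powers of p contribute nothing. The value at 0 is a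
    -- mere convention.
    ∂ : ℤ → G
    ∂ n with n ≟ + 0
    ... | yes _ = 0G
    ... | no  h = classOf (valuationℤ pp n h)

    P^≢0 : ∀ e → P ^ e ≢ + 0
    P^≢0 zero    = λ ()
    P^≢0 (suc e) = *-≢0 {P} (λ z → ℕ.≢-nonZero⁻¹ p {{prime⇒nonZero pp}} (+-injective z)) (P^≢0 e)

    ∂-class : ∀ {n} e u → n ≡ P ^ e * u → ¬ (P ∣ u) → ∂ n ≡ class e u
    ∂-class {n} e u eq nu with n ≟ + 0
    ... | yes z = ⊥-elim (*-≢0 (P^≢0 e) (∤⇒≢0 nu) (trans (sym eq) z))
    ... | no  h = classOf-unique (valuationℤ pp n h) e u eq nu

    leg-square : ∀ {u} → ¬ (P ∣ u) → leg (u * u) ≡ Sign.+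
    leg-square {u} n = trans (leg-* n n) (SignP.s*s≡+ (leg u))

    leg-neg : ∀ {u} → ¬ (P ∣ u) → leg (- u) ≡ η Sign.* leg u
    leg-neg {u} n = trans (cong leg (sym (-1*i≡-i u))) (leg-* (∤-neg (∤1 pp)) n)

    leg-*-square : ∀ {u v} → ¬ (P ∣ u) → ¬ (P ∣ v) → leg (u * (v * v)) ≡ leg u
    leg-*-square {u} nu nv = trans (leg-* nu (∤-* pp nv nv)) (trans (cong (leg u Sign.*_) (leg-square nv)) (SignP.*-identityʳ (leg u)))

    ∂-sq : ∀ {a s} → a ≢ + 0 → s ≢ + 0 → ∂ (a * (s * s)) ≡ ∂ a
    ∂-sq {a} {s} ha hs with valuationℤ pp a ha | valuationℤ pp s hs
    ... | e , u , eu , nu | f , v , ev , nv =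
      trans (∂-class (e ℕ.+ (f ℕ.+ f)) (u * (v * v)) eq (∤-* pp nu (∤-* pp nv nv)))
        (trans (class-cong {e ℕ.+ (f ℕ.+ f)} {e} (trans (odd-+ e (f ℕ.+ f)) (trans (cong (odd e xor_) (odd-double f)) (xor-identityʳ (odd e)))) (leg-*-square nu nv))
          (sym (∂-class e u eu nu)))
      where
      ring : ∀ E F u v → E * u * (F * v * (F * v)) ≡ E * (F * F) * (u * (v * v))
      ring = solve-∀
      eq : a * (s * s) ≡ P ^ (e ℕ.+ (f ℕ.+ f)) * (u * (v * v))
      eq = trans (cong₂ (λ x y → x * (y * y)) eu ev) (trans (ring (P ^ e) (P ^ f) u v)
        (cong (_* (u * (v * v))) (sym (trans (^-distribˡ-+-* P e (f ℕ.+ f)) (cong (P ^ e *_) (^-distribˡ-+-* P f f))))))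

    -- The character of -u v, that is, the signed discriminant of ⟨u, v⟩. For odd p and units u, v
    -- it is + exactly when this form is hyperbolic over the residue field.
    τ : ℤ → ℤ → Sign
    τ u v = η Sign.* (leg u Sign.* leg v)

    class-pair : ∀ e u v → (odd e ≡ true × class e u ∙ class e v ≡ (false , τ u v)) ⊎ (odd e ≡ false × class e u ∙ class e v ≡ 0G)
    class-pair e u v with odd e
    ... | true  = inj₁ (refl , refl)
    ... | false = inj₂ (refl , refl)

    τ-neg : ∀ {u v} → ¬ (P ∣ u) → v ≋ - u mod p → τ u v ≡ Sign.+
    τ-neg {u} {v} nu h = trans (cong (λ t → η Sign.* (leg u Sign.* t)) (trans (leg-cong h) (leg-neg nu))) (cancel η (leg u))
      where cancel : ∀ a b → a Sign.* (b Sign.* (a Sign.* b)) ≡ Sign.+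
            cancel Sign.+ Sign.+ = refl
            cancel Sign.+ Sign.- = refl
            cancel Sign.- Sign.+ = refl
            cancel Sign.- Sign.- = refl

    ∂-hyp : ∀ {a} → a ≢ + 0 → ∂ a ∙ ∂ (- a) ≡ 0G
    ∂-hyp {a} ha with valuationℤ pp a ha
    ... | e , u , eu , nu = trans (cong₂ _∙_ (∂-class e u eu nu) (∂-class e (- u) (trans (cong -_ eu) (neg-distribʳ-* (P ^ e) u)) (∤-neg nu))) go
      where
      go : class e u ∙ class e (- u) ≡ 0G
      go with class-pair e u (- u)
      ... | inj₁ (_ , h) = trans h (cong (false ,_) (τ-neg nu ≋-refl))
      ... | inj₂ (_ , h) = h

    -- The term of smaller valuation dominates: a + b has the class of a, and a b (a + b) that of b
    -- times a square.
    ∂-add-< : ∀ {a b} e k {u v} → a ≡ P ^ e * u → b ≡ P ^ (e ℕ.+ suc k) * v → ¬ (P ∣ u) → ¬ (P ∣ v) →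
              ∂ (a + b) ∙ ∂ (a * b * (a + b)) ≡ ∂ a ∙ ∂ b
    ∂-add-< {a} {b} e k {u} {v} ea eb nu nv = cong₂ _∙_ (trans (∂-class e c ec nc) (trans (class-cong {e} {e} refl (leg-cong c≋u)) (sym (∂-class e u ea nu))))
        (trans (∂-class (e ℕ.+ f ℕ.+ e) (u * v * c) eabc (∤-* pp (∤-* pp nu nv) nc))
          (trans (class-cong {e ℕ.+ f ℕ.+ e} {f} parity legs) (sym (∂-class f v eb nv))))
      where
      f = e ℕ.+ suc k
      c = u + P ^ suc k * v
      c≋u : c ≋ u mod p
      c≋u = ≋-trans (≋-+ {x = u} ≋-refl (∣⇒≋0 (divides (P ^ k * v) (ring₀ P (P ^ k) v)))) (≋-reflexive (+-identityʳ u))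
        where ring₀ : ∀ P Q v → P * Q * v ≡ Q * v * P
              ring₀ = solve-∀
      nc : ¬ (P ∣ c)
      nc = ∤-≋ (≋-sym c≋u) nu
      ec : a + b ≡ P ^ e * c
      ec = trans (cong₂ _+_ ea (trans eb (cong (_* v) (^-distribˡ-+-* P e (suc k))))) (ring (P ^ e) (P ^ suc k) u v)
        where ring : ∀ E K u v → E * u + E * K * v ≡ E * (u + K * v)
              ring = solve-∀
      eabc : a * b * (a + b) ≡ P ^ (e ℕ.+ f ℕ.+ e) * (u * v * c)
      eabc = trans (cong₂ _*_ (cong₂ _*_ ea eb) ec) (trans (ring (P ^ e) (P ^ f) u v c)
          (cong (_* (u * v * c)) (sym (trans (^-distribˡ-+-* P (e ℕ.+ f) e) (cong (_* P ^ e) (^-distribˡ-+-* P e f))))))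
        where ring : ∀ E F u v c → E * u * (F * v) * (E * c) ≡ E * F * E * (u * v * c)
              ring = solve-∀
      parity : odd (e ℕ.+ f ℕ.+ e) ≡ odd f
      parity = trans (cong odd (trans (ℕP.+-comm (e ℕ.+ f) e) (sym (ℕP.+-assoc e e f)))) (trans (odd-+ (e ℕ.+ e) f) (cong (_xor odd f) (odd-double e)))
      legs : leg (u * v * c) ≡ leg v
      legs = trans (leg-cong (≋-trans (≋-*ˡ (u * v) c≋u) (≋-reflexive (ring u v)))) (leg-*-square nv nu)
        where ring : ∀ u v → u * v * u ≡ v * (u * u)
              ring = solve-∀

    -- If u + v is a unit, both sides have the same rank and discriminant. If not, v ≡ -u and both
    -- sides are hyperbolic, so they vanish whatever the valuation of the sum is.
    ∂-add-≡ : ∀ {a b} e {u v} → a ≡ P ^ e * u → b ≡ P ^ e * v → ¬ (P ∣ u) → ¬ (P ∣ v) → a + b ≢ + 0 →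
              ∂ (a + b) ∙ ∂ (a * b * (a + b)) ≡ ∂ a ∙ ∂ b
    ∂-add-≡ {a} {b} e {u} {v} ea eb nu nv ne with valuationℤ pp (u + v) (λ z → ne (trans (cong₂ _+_ ea eb) (trans (sym (*-distribˡ-+ (P ^ e) u v)) (trans (cong (P ^ e *_) z) (*-zeroʳ (P ^ e))))))
    ... | k , c , eq , nc = begin
        ∂ (a + b) ∙ ∂ (a * b * (a + b))                          ≡⟨ cong₂ _∙_ (∂-class (e ℕ.+ k) c ec nc) (∂-class (e ℕ.+ e ℕ.+ (e ℕ.+ k)) (u * v * c) eabc (∤-* pp (∤-* pp nu nv) nc)) ⟩
        class (e ℕ.+ k) c ∙ class (e ℕ.+ e ℕ.+ (e ℕ.+ k)) (u * v * c) ≡⟨ cong (class (e ℕ.+ k) c ∙_) (class-cong {e ℕ.+ e ℕ.+ (e ℕ.+ k)} {e ℕ.+ k} parity refl) ⟩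
        class (e ℕ.+ k) c ∙ class (e ℕ.+ k) (u * v * c)          ≡⟨ right ⟩
        class e u ∙ class e v                                    ≡⟨ sym (cong₂ _∙_ (∂-class e u ea nu) (∂-class e v eb nv)) ⟩
        ∂ a ∙ ∂ b ∎
      where
      open ≡-Reasoning
      ec : a + b ≡ P ^ (e ℕ.+ k) * c
      ec = trans (cong₂ _+_ ea eb) (trans (sym (*-distribˡ-+ (P ^ e) u v)) (trans (cong (P ^ e *_) eq)
            (trans (sym (*-assoc (P ^ e) (P ^ k) c)) (cong (_* c) (sym (^-distribˡ-+-* P e k))))))
      eabc : a * b * (a + b) ≡ P ^ (e ℕ.+ e ℕ.+ (e ℕ.+ k)) * (u * v * c)
      eabc = trans (cong₂ _*_ (cong₂ _*_ ea eb) ec) (trans (ring (P ^ e) (P ^ (e ℕ.+ k)) u v c)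
          (cong (_* (u * v * c)) (sym (trans (^-distribˡ-+-* P (e ℕ.+ e) (e ℕ.+ k)) (cong (_* P ^ (e ℕ.+ k)) (^-distribˡ-+-* P e e))))))
        where ring : ∀ E K u v c → E * u * (E * v) * (K * c) ≡ E * E * K * (u * v * c)
              ring = solve-∀
      parity : odd (e ℕ.+ e ℕ.+ (e ℕ.+ k)) ≡ odd (e ℕ.+ k)
      parity = trans (odd-+ (e ℕ.+ e) (e ℕ.+ k)) (cong (_xor odd (e ℕ.+ k)) (odd-double e))
      τc : τ c (u * v * c) ≡ τ u v
      τc = cong (η Sign.*_) (trans (cong (leg c Sign.*_) (trans (leg-* (∤-* pp nu nv) nc) (cong (Sign._* leg c) (leg-* nu nv)))) (cancel (leg c) (leg u Sign.* leg v)))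
        where cancel : ∀ x y → x Sign.* (y Sign.* x) ≡ y
              cancel Sign.+ y = SignP.*-identityʳ y
              cancel Sign.- Sign.+ = refl
              cancel Sign.- Sign.- = refl
      u+v≋0 : ∀ k′ → k ≡ suc k′ → v ≋ - u mod p
      u+v≋0 k′ k≡ = cong∣ (subst (P ∣_) (ring u v) (divides (P ^ k′ * c) (trans eq (trans (cong (λ t → P ^ t * c) k≡) (ring′ P (P ^ k′) c)))))
        where ring : ∀ u v → u + v ≡ v - - u
              ring = solve-∀
              ring′ : ∀ P Q v → P * Q * v ≡ Q * v * P
              ring′ = solve-∀
      trivial : ∀ m x y → τ x y ≡ Sign.+ → class m x ∙ class m y ≡ 0G
      trivial m x y t with class-pair m x y
      ... | inj₁ (_ , h) = trans h (cong (false ,_) t)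
      ... | inj₂ (_ , h) = h
      same : ∀ e → class e c ∙ class e (u * v * c) ≡ class e u ∙ class e v
      same e with class-pair e c (u * v * c) | class-pair e u v
      ... | inj₁ (_ , h) | inj₁ (_ , h′) = trans h (trans (cong (false ,_) τc) (sym h′))
      ... | inj₂ (_ , h) | inj₂ (_ , h′) = trans h (sym h′)
      ... | inj₁ (o , _) | inj₂ (o′ , _) = ⊥-elim (true≢false (trans (sym o) o′))
      ... | inj₂ (o , _) | inj₁ (o′ , _) = ⊥-elim (true≢false (trans (sym o′) o))
      cases : ∀ k → k ≡ 0 ⊎ ∃ λ k′ → k ≡ suc k′
      cases zero    = inj₁ refl
      cases (suc k) = inj₂ (k , refl)
      right : class (e ℕ.+ k) c ∙ class (e ℕ.+ k) (u * v * c) ≡ class e u ∙ class e v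
      right with cases k
      ... | inj₁ k≡0 = trans (cong (λ t → class t c ∙ class t (u * v * c)) (trans (cong (e ℕ.+_) k≡0) (ℕP.+-identityʳ e))) (same e)
      ... | inj₂ (k′ , k≡) = trans (trivial (e ℕ.+ k) c (u * v * c) (trans τc (τ-neg nu (u+v≋0 k′ k≡)))) (sym (trivial e u v (τ-neg nu (u+v≋0 k′ k≡))))

    ∂-add : ∀ {a b} → a ≢ + 0 → b ≢ + 0 → a + b ≢ + 0 → ∂ (a + b) ∙ ∂ (a * b * (a + b)) ≡ ∂ a ∙ ∂ b
    ∂-add {a} {b} ha hb hc with valuationℤ pp a ha | valuationℤ pp b hb
    ... | e , u , ea , nu | f , v , eb , nv with ℕP.<-cmp e f
    ...   | tri≈ _ refl _ = ∂-add-≡ e ea eb nu nv hc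
    ...   | tri< l _ _ = ∂-add-< e (f ℕ.∸ suc e) ea (trans eb (cong (λ t → P ^ t * v) (sym (trans (ℕP.+-suc e _) (ℕP.m+[n∸m]≡n l))))) nu nv
    ...   | tri> _ _ l = trans (cong₂ (λ x y → ∂ x ∙ ∂ y) (+-comm a b) (cong₂ _*_ (*-comm a b) (+-comm a b)))
              (trans (∂-add-< f (e ℕ.∸ suc f) eb (trans ea (cong (λ t → P ^ t * u) (sym (trans (ℕP.+-suc f _) (ℕP.m+[n∸m]≡n l))))) nv nu) (∙-comm (∂ b) (∂ a)))

    ∂* : List ℤ → G
    ∂* = big ∂

    ∂*-~ : ∀ {ℓ m} → ℓ ~ m → ∂* ℓ ≡ ∂* m
    ∂*-~ (perm π)      = big-↭ ∂ π
    ∂*-~ (sq ℓ h k)    = cong (_∙ ∂* ℓ) (∂-sq h k)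
    ∂*-~ (add {a} {b} ℓ h k l) = trans (sym (∙-assoc (∂ a) (∂ b) (∂* ℓ))) (trans (cong (_∙ ∂* ℓ) (sym (∂-add h k l))) (∙-assoc (∂ (a + b)) _ (∂* ℓ)))
    ∂*-~ (hyp {a} ℓ h) = trans (sym (∙-assoc (∂ a) (∂ (- a)) (∂* ℓ))) (trans (cong (_∙ ∂* ℓ) (∂-hyp h)) (∙-idˡ (∂* ℓ)))
    ∂*-~ (~sym e)      = sym (∂*-~ e)
    ∂*-~ (~trans e f)  = trans (∂*-~ e) (∂*-~ f)

    module _ {a b u v : ℤ} (e f : ℕ) (ea : a ≡ P ^ e * u) (eb : b ≡ P ^ f * v) (nu : ¬ (P ∣ u)) (nv : ¬ (P ∣ v)) where

      private
        lu lv : Sign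
        lu = leg u
        lv = leg v

        leg-uv : leg (u * v) ≡ lu Sign.* lv
        leg-uv = leg-* nu nv

        leg-neg-uv : leg (- (u * v)) ≡ η Sign.* (lu Sign.* lv)
        leg-neg-uv = trans (leg-neg (∤-* pp nu nv)) (cong (η Sign.*_) leg-uv)

        c₁ : ∀ n x y → n Sign.* (x Sign.* (n Sign.* (x Sign.* y))) ≡ y
        c₁ Sign.+ Sign.+ y = refl
        c₁ Sign.+ Sign.- y = SignP.opposite-involutive y
        c₁ Sign.- Sign.+ y = SignP.opposite-involutive y
        c₁ Sign.- Sign.- Sign.+ = refl
        c₁ Sign.- Sign.- Sign.- = refl

        c₂ : ∀ n x y → n Sign.* (n Sign.* x Sign.* (x Sign.* y)) ≡ y
        c₂ Sign.+ Sign.+ y = refl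
        c₂ Sign.+ Sign.- y = SignP.opposite-involutive y
        c₂ Sign.- Sign.+ y = SignP.opposite-involutive y
        c₂ Sign.- Sign.- Sign.+ = refl
        c₂ Sign.- Sign.- Sign.- = refl

        c₃ : ∀ n x y → n Sign.* (n Sign.* x Sign.* (n Sign.* y Sign.* Sign.+)) ≡ n Sign.* (x Sign.* y)
        c₃ Sign.+ x y = cong (x Sign.*_) (SignP.*-identityʳ y)
        c₃ Sign.- Sign.+ Sign.+ = refl
        c₃ Sign.- Sign.+ Sign.- = refl
        c₃ Sign.- Sign.- Sign.+ = refl
        c₃ Sign.- Sign.- Sign.- = refl

        triple-cases : ∀ x y → classᵇ x u ∙ (classᵇ y v ∙ classᵇ (x xor y) (- (u * v))) ≡ (false , tameSymbol leg x u y v)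
        triple-cases false false = refl
        triple-cases true  false = cong (false ,_) (trans (cong (λ t → η Sign.* (lu Sign.* t)) leg-neg-uv) (c₁ η lu lv))
        triple-cases false true  = cong (false ,_) (trans (cong (λ t → η Sign.* (lv Sign.* t)) (trans leg-neg-uv (cong (η Sign.*_) (SignP.*-comm lu lv)))) (c₁ η lv lu))
        triple-cases true  true  = cong (false ,_) (trans (cong (λ t → η Sign.* (lu Sign.* t)) (SignP.*-identityʳ lv)) (sym leg-neg-uv))

        triple-neg-cases : ∀ x y → classᵇ x (- u) ∙ (classᵇ y (- v) ∙ classᵇ (x xor y) (u * v)) ≡ (false , tameSymbol leg x u y v)
        triple-neg-cases false false = refl
        triple-neg-cases true  false = cong (false ,_) (trans (cong₂ (λ s t → η Sign.* (s Sign.* t)) (leg-neg nu) leg-uv) (c₂ η lu lv))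
        triple-neg-cases false true  = cong (false ,_) (trans (cong₂ (λ s t → η Sign.* (s Sign.* t)) (leg-neg nv) (trans leg-uv (SignP.*-comm lu lv))) (c₂ η lv lu))
        triple-neg-cases true  true  = cong (false ,_) (trans (cong₂ (λ s t → η Sign.* (s Sign.* (t Sign.* Sign.+))) (leg-neg nu) (leg-neg nv)) (trans (c₃ η lu lv) (sym leg-neg-uv)))

        ab : a * b ≡ P ^ (e ℕ.+ f) * (u * v)
        ab = trans (cong₂ _*_ ea eb) (trans (ring (P ^ e) (P ^ f) u v) (cong (_* (u * v)) (sym (^-distribˡ-+-* P e f))))
          where ring : ∀ E F u v → E * u * (F * v) ≡ E * F * (u * v)
                ring = solve-∀

        negate-power : ∀ {n} k w → n ≡ P ^ k * w → - n ≡ P ^ k * - w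
        negate-power k w e = trans (cong -_ e) (neg-distribʳ-* (P ^ k) w)

      -- Among e, f and e + f an even number are odd, so the rank component of the pure quaternion
      -- form vanishes and the discriminant that remains is the symbol (a, b). This carries
      -- ramification into the Witt group.
      triple : ∂ a ∙ (∂ b ∙ ∂ (- (a * b))) ≡ (false , tameSymbol leg (odd e) u (odd f) v)
      triple = trans (cong₂ _∙_ (∂-class e u ea nu) (cong₂ _∙_ (∂-class f v eb nv)
          (trans (∂-class (e ℕ.+ f) (- (u * v)) (negate-power (e ℕ.+ f) (u * v) ab) (∤-neg (∤-* pp nu nv))) (cong (λ t → classᵇ t (- (u * v))) (odd-+ e f)))))
        (triple-cases (odd e) (odd f))

      triple-neg : ∂ (- a) ∙ (∂ (- b) ∙ ∂ (a * b)) ≡ (false , tameSymbol leg (odd e) u (odd f) v)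
      triple-neg = trans (cong₂ _∙_ (∂-class e (- u) (negate-power e u ea) (∤-neg nu)) (cong₂ _∙_ (∂-class f (- v) (negate-power f v eb) (∤-neg nv))
          (trans (∂-class (e ℕ.+ f) (u * v) ab (∤-* pp nu nv)) (cong (λ t → classᵇ t (u * v)) (odd-+ e f)))))
        (triple-neg-cases (odd e) (odd f))

    ∂*-albert : ∀ {a b d c s t} → ∂ a ∙ (∂ b ∙ ∂ (- (a * b))) ≡ (false , s) → ∂ (- d) ∙ (∂ (- c) ∙ ∂ (d * c)) ≡ (false , t) → s ≡ t →
                ∂* (a ∷ b ∷ - (a * b) ∷ - d ∷ - c ∷ d * c ∷ []) ≡ 0G
    ∂*-albert {a} {b} {d} {c} {s} h k refl = trans (regroup (∂ a) (∂ b) (∂ (- (a * b))) (∂ (- d)) (∂ (- c)) (∂ (d * c)))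
      (trans (cong₂ _∙_ h k) (cong (false ,_) (SignP.s*s≡+ s)))
      where
      regroup : ∀ g₁ g₂ g₃ g₄ g₅ g₆ → g₁ ∙ (g₂ ∙ (g₃ ∙ (g₄ ∙ (g₅ ∙ (g₆ ∙ 0G))))) ≡ (g₁ ∙ (g₂ ∙ g₃)) ∙ (g₄ ∙ (g₅ ∙ g₆))
      regroup g₁ g₂ g₃ g₄ g₅ g₆ = begin
        g₁ ∙ (g₂ ∙ (g₃ ∙ (g₄ ∙ (g₅ ∙ (g₆ ∙ 0G))))) ≡⟨ cong (λ t → g₁ ∙ (g₂ ∙ (g₃ ∙ (g₄ ∙ (g₅ ∙ t))))) (trans (∙-comm g₆ 0G) (∙-idˡ g₆)) ⟩
        g₁ ∙ (g₂ ∙ (g₃ ∙ (g₄ ∙ (g₅ ∙ g₆))))        ≡⟨ cong (g₁ ∙_) (sym (∙-assoc g₂ g₃ _)) ⟩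
        g₁ ∙ ((g₂ ∙ g₃) ∙ (g₄ ∙ (g₅ ∙ g₆)))        ≡⟨ sym (∙-assoc g₁ (g₂ ∙ g₃) _) ⟩
        (g₁ ∙ (g₂ ∙ g₃)) ∙ (g₄ ∙ (g₅ ∙ g₆))        ∎
        where open ≡-Reasoning

-- Elimination of the largest prime from a form with vanishing residue.

module Elimination where

  open import Data.Nat.Induction using (<-wellFounded; Acc; acc)
  open import Data.Nat.Primality using (prime⇒nonTrivial)
  open import Data.Integer hiding (suc)
  open import Data.Integer.Properties
  open import Data.Integer.DivMod using (_%ℕ_; _/ℕ_; n%ℕd<d; a≡a%ℕn+[a/ℕn]*n)
  open import Data.Integer.Divisibility.Signed
  open import Data.Fin as Fin using (Fin; toℕ; fromℕ<; splitAt; join)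
  import Data.Fin.Properties as FinP
  open import Data.List using (List; []; _∷_; _++_; map; length)
  open import Data.List.Properties using (++-assoc; ++-identityʳ)
  open import Data.List.Relation.Unary.All using (All; []; _∷_)
  import Data.List.Relation.Unary.All.Properties as AllP
  open import Data.List.Relation.Binary.Permutation.Propositional using (↭-sym; prep)
  open import Data.List.Relation.Binary.Permutation.Propositional.Properties using (shift; ++-comm)
  open import Data.Sum using ([_,_]′)
  open Congruence
  open Legendre using (module Half)
  open Convolution using (prime-divisor)
  open Witt
  open Residue

  prime>1 : ∀ {p} → Prime p → 1 ℕ.< p
  prime>1 pp = ℕ.nonTrivial⇒n>1 _ {{prime⇒nonTrivial pp}}

  record Small (B : ℕ) (n : ℤ) : Set where
    constructor small
    field
      nz     : n ≢ + 0
      smooth : ∀ {q} → Prime q → + q ∣ n → q ℕ.≤ B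
  open Small

  small-* : ∀ {B x y} → Small B x → Small B y → Small B (x * y)
  small-* {B} {x} {y} sx sy = small (*-≢0 (nz sx) (nz sy)) f
    where
    f : ∀ {q} → Prime q → + q ∣ x * y → q ℕ.≤ B
    f qq d with euclid qq x y d
    ... | inj₁ h = smooth sx qq h
    ... | inj₂ h = smooth sy qq h

  small-neg : ∀ {B x} → Small B x → Small B (- x)
  small-neg {x = x} s = small (neg-≢0 (nz s)) (λ {q} qq d → smooth s qq (subst (+ q ∣_) (neg-involutive x) (∣m⇒∣-m d)))

  small-≤ : ∀ {B n} → n ≢ + 0 → ∣ n ∣ ℕ.≤ B → Small B n
  small-≤ {B} {n} h l = small h (λ qq d → ℕP.≤-trans (ℕD.∣⇒≤ {{ℕ.≢-nonZero (λ e → h (∣i∣≡0⇒i≡0 e))}} (∣⇒∣ᵤ d)) l)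

  small-weaken : ∀ {B C n} → B ℕ.≤ C → Small B n → Small C n
  small-weaken l s = small (nz s) (λ qq d → ℕP.≤-trans (smooth s qq d) l)

  small-divisor : ∀ {B x y} → x * y ≢ + 0 → Small B (x * y) → Small B y
  small-divisor {x = x} {y} ne s = small (λ e → ne (trans (cong (x *_) e) (*-zeroʳ x))) (λ qq d → smooth s qq (∣n⇒∣m*n x d))

  negate : List ℤ → List ℤ
  negate = map (-_)

  ~++ʳ : ∀ k {ℓ m} → ℓ ~ m → ℓ ++ k ~ m ++ k
  ~++ʳ k {ℓ} {m} e = ~trans (perm (++-comm ℓ k)) (~trans (~++ k e) (perm (++-comm k m)))

  cancel-negate : ∀ m → All (_≢ + 0) m → m ++ negate m ~ []
  cancel-negate []      []       = ~refl
  cancel-negate (x ∷ m) (h ∷ hs) = ~trans (perm (prep x (shift (- x) m (negate m)))) (~trans (hyp _ h) (cancel-negate m hs))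

  move : ∀ {ℓ n} m → All (_≢ + 0) m → ℓ ++ m ~ n → ℓ ~ n ++ negate m
  move {ℓ} {n} m h e = ~trans (~sym (~trans (~++ ℓ (cancel-negate m h)) (~reflexive (++-identityʳ ℓ))))
    (~trans (~reflexive (sym (++-assoc ℓ m (negate m)))) (~++ʳ (negate m) e))

  All-nz : ∀ {B m} → All (Small B) m → All (_≢ + 0) m
  All-nz []       = []
  All-nz (s ∷ ss) = nz s ∷ All-nz ss

  All-negate : ∀ {B m} → All (Small B) m → All (Small B) (negate m)
  All-negate []       = []
  All-negate (s ∷ ss) = small-neg s ∷ All-negate ss

  All-scale : ∀ {B c m} → Small B c → All (Small B) m → All (Small B) (map (c *_) m)
  All-scale sc []       = []
  All-scale sc (s ∷ ss) = small-* sc s ∷ All-scale sc ss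

  -- Here p = P + 1. A product of two factors at most P has a quotient by p that is again at most P,
  -- hence free of the prime p: this keeps the corrections in `basic` smooth.
  abs-≤-quotient : ∀ {P s k n} → s ℕ.< suc P → n ≡ + s + k * + suc P → ∣ n ∣ ℕ.≤ P ℕ.* P → ∣ k ∣ ℕ.≤ P
  abs-≤-quotient {P} {s} {+ k} {n} s<P eq l = ℕP.≮⇒≥ λ P<k → ℕP.<⇒≱ (ℕP.<-≤-trans (bound P<k) (ℕP.m≤n+m (k ℕ.* suc P) s))
      (subst (ℕ._≤ P ℕ.* P) (trans (cong ∣_∣ (trans eq (cong (_+_ (+ s)) (sym (pos-* k (suc P)))))) refl) l)
    where
    bound : P ℕ.< k → P ℕ.* P ℕ.< k ℕ.* suc P
    bound P<k = ℕP.*-mono-< P<k (ℕP.n<1+n P)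
  abs-≤-quotient {P} {s} { -[1+ k ]} {n} (ℕ.s≤s s≤P) eq l = ℕP.≮⇒≥ λ P<k → ℕP.<⇒≱ (bound P<k) (subst (ℕ._≤ P ℕ.* P ℕ.+ P) ∣k∣ (ℕP.≤-trans (∣i-j∣≤∣i∣+∣j∣ n (+ s)) (ℕP.+-mono-≤ l s≤P)))
    where
    ∣k∣ : ∣ n - + s ∣ ≡ suc k ℕ.* suc P
    ∣k∣ = trans (cong ∣_∣ (trans (cong (_- + s) eq) (ring (+ s) (-[1+ k ] * + suc P)))) (abs-* -[1+ k ] (+ suc P))
      where ring : ∀ s t → s + t - s ≡ t
            ring = solve-∀
    bound : P ℕ.< suc k → P ℕ.* P ℕ.+ P ℕ.< suc k ℕ.* suc P
    bound P<k = ℕP.<-≤-trans (ℕP.≤-<-trans (ℕP.≤-reflexive (trans (ℕP.+-comm (P ℕ.* P) P) (sym (ℕP.*-suc P P)))) (ℕP.*-monoˡ-< (suc P) (ℕP.n<1+n P))) (ℕP.*-monoˡ-≤ (suc P) P<k)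

  assemble : ∀ {x₁ x₂ x₃ a b c d} m₁ m₂ m₃ → x₁ ∷ [] ~ a ∷ m₁ → x₂ ∷ [] ~ b ∷ m₂ →
             (∀ ℓ → a ∷ b ∷ ℓ ~ c ∷ d ∷ ℓ) → x₃ ∷ c ∷ [] ~ m₃ → x₁ ∷ x₂ ∷ x₃ ∷ [] ~ d ∷ m₃ ++ (m₁ ++ m₂)
  assemble {x₁} {x₂} {x₃} {a} {b} {c} {d} m₁ m₂ m₃ e₁ e₂ e e₃ =
    ~trans (~++ʳ (x₂ ∷ x₃ ∷ []) e₁)
    (~trans (perm (prep a (++-comm m₁ (x₂ ∷ x₃ ∷ []))))
    (~trans (~swap {a} {x₂})
    (~trans (~++ʳ (a ∷ x₃ ∷ m₁) e₂)
    (~trans (perm (prep b (++-comm m₂ (a ∷ x₃ ∷ m₁))))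
    (~trans (~swap {b} {a})
    (~trans (e (x₃ ∷ m₁ ++ m₂))
    (~trans (~cons c (~swap {d} {x₃}))
    (~trans (~swap {c} {x₃})
    (~trans (~++ʳ (d ∷ m₁ ++ m₂) e₃)
    (perm (shift d m₃ (m₁ ++ m₂))))))))))))

  module Reduce {B : ℕ} (pp : Prime (suc B)) where

    p : ℕ
    p = suc B

    P : ℤ
    P = + p

    P≢0 : P ≢ + 0
    P≢0 ()

    sm∤ : ∀ {n} → Small B n → ¬ (P ∣ n)
    sm∤ s d = ℕP.<-irrefl refl (smooth s pp d)

    small-ℕ : ∀ {s} → 0 ℕ.< s → s ℕ.< p → Small B (+ s)
    small-ℕ {suc s} _ (ℕ.s≤s l) = small-≤ (λ ()) l

    0<% : ∀ {n} → ¬ (P ∣ n) → 0 ℕ.< n %ℕ p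
    0<% {n} h = ℕP.n≢0⇒n>0 (λ e → h (≋0⇒∣ (≋-trans (≋-%ℕ p n) (≋-reflexive (cong +_ e)))))

    small-% : ∀ {n} → ¬ (P ∣ n) → Small B (+ (n %ℕ p))
    small-% {n} h = small-ℕ (0<% h) (n%ℕd<d n p)

    -- Equality of ⟨p y⟩ and ⟨p y′⟩ modulo forms whose coefficients have all their prime factors
    -- below p, with the correction kept explicit.
    record Reduced (y y′ : ℤ) : Set where
      constructor reduced
      field
        rest  : List ℤ
        rest-small : All (Small B) rest
        equiv : P * y ∷ [] ~ P * y′ ∷ rest

    -- With n = s + k p, apply `add` to ⟨p s, k p²⟩: the sum is p n, the second coefficient is k up
    -- to a square, and the last one is s k n up to a square. Only p s and p n still involve p.
    basic : ∀ {n} → Small B n → ∣ n ∣ ℕ.≤ B ℕ.* B → Reduced n (+ (n %ℕ p))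
    basic {n} sn l with n /ℕ p ≟ + 0
    ... | yes z = reduced [] [] (~reflexive (cong (λ t → P * t ∷ []) (trans (a≡a%ℕn+[a/ℕn]*n n p) (trans (cong (λ t → + (n %ℕ p) + t * P) z) (+-identityʳ _)))))
    ... | no  z = reduced (k ∷ - (s * k * n) ∷ []) (sk ∷ small-neg (small-* (small-* ss sk) sn) ∷ []) (move (s * k * n ∷ []) (nz (small-* (small-* ss sk) sn) ∷ []) (~sym e₂))
      where
      s = + (n %ℕ p)
      k = n /ℕ p
      eq : n ≡ s + k * P
      eq = a≡a%ℕn+[a/ℕn]*n n p
      ss : Small B s
      ss = small-% (sm∤ sn)
      sk : Small B k
      sk = small-≤ z (abs-≤-quotient {B} {n %ℕ p} {k} {n} (n%ℕd<d n p) eq l)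
      sum : P * s + k * (P * P) ≡ P * n
      sum = trans (ring P s k) (cong (P *_) (sym eq))
        where ring : ∀ P s k → P * s + k * (P * P) ≡ P * (s + k * P)
              ring = solve-∀
      PP≢0 : P * P ≢ + 0
      PP≢0 = *-≢0 P≢0 P≢0
      e₁ : P * s ∷ k * (P * P) ∷ [] ~ P * n ∷ s * k * n * (P * P * (P * P)) ∷ []
      e₁ = ~trans (add [] (*-≢0 P≢0 (nz ss)) (*-≢0 (nz sk) PP≢0) (λ e → *-≢0 P≢0 (nz sn) (trans (sym sum) e)))
        (~reflexive (cong₂ (λ u v → u ∷ v ∷ []) sum (trans (cong (P * s * (k * (P * P)) *_) sum) (ring P s k n))))
        where ring : ∀ P s k n → P * s * (k * (P * P)) * (P * n) ≡ s * k * n * (P * P * (P * P))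
              ring = solve-∀
      e₂ : P * s ∷ k ∷ [] ~ P * n ∷ s * k * n ∷ []
      e₂ = ~trans (~cons (P * s) (~sym (sq [] (nz sk) P≢0))) (~trans e₁ (~cons (P * n) (sq [] (nz (small-* (small-* ss sk) sn)) PP≢0)))

    reduced-trans : ∀ {x y z} → Reduced x y → Reduced y z → Reduced x z
    reduced-trans (reduced m sm e) (reduced m′ sm′ e′) = reduced (m′ ++ m) (AllP.++⁺ sm′ sm) (~trans e (~++ʳ m e′))

    reduced-sym : ∀ {x y} → Reduced x y → Reduced y x
    reduced-sym (reduced m sm e) = reduced (negate m) (All-negate sm) (move m (All-nz sm) (~sym e))

    reduced-scale : ∀ {c x y} → Small B c → Reduced x y → Reduced (c * x) (c * y)
    reduced-scale {c} {x} {y} sc (reduced m sm e) = reduced (map (c *_) m) (All-scale sc sm)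
      (~trans (~reflexive (cong (_∷ []) (ring c P x))) (~trans (~scale (nz sc) e) (~reflexive (cong (_∷ map (c *_) m) (sym (ring c P y))))))
      where ring : ∀ c P x → P * (c * x) ≡ c * (P * x)
            ring = solve-∀

    -- One prime factor q ≤ B of y is split off; the cofactor is replaced by its residue s′
    -- recursively, and then q s′ ≤ B² is in the range of `basic`.
    to-residue : ∀ {y} → Acc ℕ._<_ ∣ y ∣ → Small B y → Reduced y (+ (y %ℕ p))
    to-residue {y} (acc rec) sy with ∣ y ∣ ℕ.≤? B
    ... | yes l = basic sy (ℕP.≤-trans l (ℕP.m≤m*n B B {{ℕ.>-nonZero (ℕP.≤-pred (prime>1 pp))}}))
    ... | no  l with prime-divisor ∣ y ∣ (ℕP.≤-<-trans (ℕP.≤-pred (prime>1 pp)) (ℕP.≰⇒> l))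
    ...   | q , qq , d with ∣ᵤ⇒∣ {+ q} {y} d
    ...     | divides y′ refl = subst (Reduced (y′ * + q)) (cong +_ (≋⇒%ℕ≡ p final))
                (subst (λ t → Reduced t (+ (n %ℕ p))) (*-comm (+ q) y′) (reduced-trans (reduced-scale sq′ (to-residue (rec smaller) sy′)) (basic (small-* sq′ ss′) size)))
      where
      q≤B : q ℕ.≤ B
      q≤B = smooth sy qq (divides y′ refl)
      0<q : 0 ℕ.< q
      0<q = ℕP.<-trans (ℕ.s≤s ℕ.z≤n) (prime>1 qq)
      sq′ : Small B (+ q)
      sq′ = small-ℕ 0<q (ℕ.s≤s q≤B)
      sy′ : Small B y′
      sy′ = small-divisor {x = + q} (λ e → nz sy (trans (*-comm y′ (+ q)) e)) (subst (Small B) (*-comm y′ (+ q)) sy)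
      smaller : ∣ y′ ∣ ℕ.< ∣ y′ * + q ∣
      smaller = subst (∣ y′ ∣ ℕ.<_) (sym (abs-* y′ (+ q))) (ℕP.m<m*n ∣ y′ ∣ q {{ℕ.≢-nonZero (λ e → nz sy′ (∣i∣≡0⇒i≡0 e))}} (prime>1 qq))
      s′ = y′ %ℕ p
      ss′ : Small B (+ s′)
      ss′ = small-% (sm∤ sy′)
      n = + q * + s′
      size : ∣ n ∣ ℕ.≤ B ℕ.* B
      size = subst (ℕ._≤ B ℕ.* B) (sym (abs-* (+ q) (+ s′))) (ℕP.*-mono-≤ q≤B (ℕP.≤-pred (n%ℕd<d y′ p)))
      final : n ≋ y′ * + q mod p
      final = ≋-trans (≋-*ˡ (+ q) (≋-sym (≋-%ℕ p y′))) (≋-reflexive (*-comm (+ q) y′))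

    ≋⇒reduced : ∀ {y y′} → Small B y → Small B y′ → y ≋ y′ mod p → Reduced y y′
    ≋⇒reduced {y} {y′} s s′ h = reduced-trans (to-residue (<-wellFounded ∣ y ∣) s)
      (subst (λ t → Reduced (+ t) y′) (sym (≋⇒%ℕ≡ p h)) (reduced-sym (to-residue (<-wellFounded ∣ y′ ∣) s′)))

    record Leftover (ℓ : List ℤ) : Set where
      constructor leftover
      field
        kept       : List ℤ
        kept-small : All (Small B) kept
        equiv      : ℓ ~ kept

    cancel : ∀ {s s′} → Small B s → Small B s′ → ∀ t → ¬ (P ∣ t) → s′ ≋ - (s * (t * t)) mod p →
             ∃ λ m → All (Small B) m × P * s ∷ P * s′ ∷ [] ~ m
    cancel {s} {s′} ss ss′ t nt h = finish (≋⇒reduced ss′ (small-neg (small-* ss (small-* st st))) h′)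
      where
      T : ℤ
      T = + (t %ℕ p)
      st : Small B T
      st = small-% nt
      h′ : s′ ≋ - (s * (T * T)) mod p
      h′ = ≋-trans h (≋-neg {x = s * (t * t)} {y = s * (T * T)} (≋-*ˡ s {t * t} {T * T} (≋-* (≋-%ℕ p t) (≋-%ℕ p t))))
      ring : ∀ P s t → P * - (s * (t * t)) ≡ - (P * s) * (t * t)
      ring = solve-∀
      finish : Reduced s′ (- (s * (T * T))) → ∃ λ m → All (Small B) m × P * s ∷ P * s′ ∷ [] ~ m
      finish (reduced m sm e) = m , sm , ~trans (~cons (P * s) (~trans e (~trans (~reflexive (cong (_∷ m) (ring P s T)))
            (sq m (neg-≢0 (*-≢0 P≢0 (nz ss))) (nz st))))) (hyp m (*-≢0 P≢0 (nz ss)))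

    square-class : ∀ {s} → Small B s → ∀ t → ¬ (P ∣ t) → ∀ {y} → Small B y → s * (t * t) ≋ y mod p → Reduced s y
    square-class {s} ss t nt {y} sy h = finish (≋⇒reduced (small-* ss (small-* st st)) sy h′)
      where
      T : ℤ
      T = + (t %ℕ p)
      st : Small B T
      st = small-% nt
      h′ : s * (T * T) ≋ y mod p
      h′ = ≋-trans (≋-sym (≋-*ˡ s {t * t} {T * T} (≋-* (≋-%ℕ p t) (≋-%ℕ p t)))) h
      ring : ∀ P s t → P * s * (t * t) ≡ P * (s * (t * t))
      ring = solve-∀
      finish : Reduced (s * (T * T)) y → Reduced s y
      finish (reduced m sm e) = reduced m sm (~trans (~sym (sq [] (*-≢0 P≢0 (nz ss)) (nz st))) (~trans (~reflexive (cong (_∷ []) (ring P s T))) e))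

    module Residual {s₁ s₂ s₃} (ss₁ : Small B s₁) (ss₂ : Small B s₂) (ss₃ : Small B s₃) (x y : ℤ)
             (nx : ¬ (P ∣ x)) (ny : ¬ (P ∣ y)) (h : s₁ * (x * x) + s₂ * (y * y) ≋ - s₃ mod p)
             (α ρ : ℕ) (0<α : 0 ℕ.< α) (α<p : α ℕ.< p) (0<ρ : 0 ℕ.< ρ) (ρ<p : ρ ℕ.< p)
             (α≋ : s₁ * (x * x) ≋ + α mod p) (ρ≋ : s₂ * (y * y) ≋ + ρ mod p) where

      -- b < 0 < a keeps |a + b| < p, so that a + b is again Small
      a b c : ℤ
      a = + α
      b = + ρ - P
      c = a + b

      b≋ : s₂ * (y * y) ≋ b mod p
      b≋ = ≋-trans ρ≋ (cong∣ (divides (+ 1) (ring (+ ρ) P)))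
        where ring : ∀ r P → r - (r - P) ≡ + 1 * P
              ring = solve-∀

      ∣b∣ : ∣ b ∣ ≡ p ℕ.∸ ρ
      ∣b∣ = trans (cong ∣_∣ (m-n≡m⊖n ρ p)) (trans (∣m⊖n∣≡∣n⊖m∣ ρ p) (cong ∣_∣ (⊖-≥ (ℕP.<⇒≤ ρ<p))))

      sa : Small B a
      sa = small-ℕ 0<α α<p

      sb : Small B b
      sb = small-≤ (∤⇒≢0 {p} {b} (∤-≋ b≋ (∤-* pp (sm∤ ss₂) (∤-* pp ny ny)))) (subst (ℕ._≤ B) (sym ∣b∣) (ℕP.∸-monoʳ-≤ p 0<ρ))

      c≋ : c ≋ - s₃ mod p
      c≋ = ≋-trans {y = s₁ * (x * x) + s₂ * (y * y)} (≋-sym (≋-+ {x = s₁ * (x * x)} {a} {s₂ * (y * y)} {b} α≋ b≋)) h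

      ∣c∣ : ∣ c ∣ ℕ.≤ B
      ∣c∣ = ℕP.≤-pred (subst (λ t → ∣ t ∣ ℕ.< p) eq (∣m⊖n∣< {α} {p ℕ.∸ ρ} α<p (ℕP.∸-monoʳ-< {p} {ρ} {0} 0<ρ (ℕP.<⇒≤ ρ<p))))
        where
        ring : ∀ a r P → a - (P - r) ≡ a + (r - P)
        ring = solve-∀
        eq : + α - + (p ℕ.∸ ρ) ≡ c
        eq = trans (cong (λ t → + α - t) (sym (trans (m-n≡m⊖n p ρ) (⊖-≥ (ℕP.<⇒≤ ρ<p))))) (ring a (+ ρ) P)

      sc : Small B c
      sc = small-≤ (∤⇒≢0 {p} {c} (∤-≋ (≋-sym c≋) (∤-neg (sm∤ ss₃)))) ∣c∣

      add-residues : ∀ ℓ → P * a ∷ P * b ∷ ℓ ~ P * c ∷ P * (a * b * c) ∷ ℓ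
      add-residues ℓ = ~trans (add {P * a} {P * b} ℓ (*-≢0 P≢0 (nz sa)) (*-≢0 P≢0 (nz sb)) (λ e → *-≢0 P≢0 (nz sc) (trans (*-distribˡ-+ P a b) e)))
        (~trans (~reflexive (cong₂ (λ u v → u ∷ v ∷ ℓ) (sym (*-distribˡ-+ P a b)) (ring P a b)))
        (~cons (P * c) (sq ℓ (*-≢0 P≢0 (nz (small-* (small-* sa sb) sc))) P≢0)))
        where ring : ∀ P a b → P * a * (P * b) * (P * a + P * b) ≡ P * (a * b * (a + b)) * (P * P)
              ring = solve-∀

      c≋′ : c ≋ - (s₃ * (+ 1 * + 1)) mod p
      c≋′ = subst (λ t → c ≋ - t mod p) (sym (*-identityʳ s₃)) c≋

      Goal : Set
      Goal = ∃ λ s → ∃ λ m → Small B s × All (Small B) m × P * s₁ ∷ P * s₂ ∷ P * s₃ ∷ [] ~ P * s ∷ m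

      finish : Reduced s₁ a → Reduced s₂ b → (∃ λ m → All (Small B) m × P * s₃ ∷ P * c ∷ [] ~ m) → Goal
      finish (reduced m₁ sm₁ e₁) (reduced m₂ sm₂ e₂) (m₃ , sm₃ , e₃) =
        a * b * c , m₃ ++ (m₁ ++ m₂) , small-* (small-* sa sb) sc , AllP.++⁺ sm₃ (AllP.++⁺ sm₁ sm₂) ,
        assemble {P * s₁} {P * s₂} {P * s₃} {P * a} {P * b} {P * c} {P * (a * b * c)} m₁ m₂ m₃ e₁ e₂ add-residues e₃

      goal : Goal
      goal = finish (square-class ss₁ x nx sa α≋) (square-class ss₂ y ny sb b≋) (cancel ss₃ sc (+ 1) (∤1 pp) c≋′)

    -- As ⟨s₁, s₂⟩ represents -s₃ mod p, it can be traded for ⟨-s₃⟩ and one further term. The former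
    -- cancels against ⟨s₃⟩, so three multiples of p shrink to one.
    ternary : ∀ {s₁ s₂ s₃} → Small B s₁ → Small B s₂ → Small B s₃ → ∀ x y → ¬ (P ∣ x) → ¬ (P ∣ y) →
              s₁ * (x * x) + s₂ * (y * y) ≋ - s₃ mod p →
              ∃ λ s → ∃ λ m → Small B s × All (Small B) m × P * s₁ ∷ P * s₂ ∷ P * s₃ ∷ [] ~ P * s ∷ m
    ternary {s₁} {s₂} ss₁ ss₂ ss₃ x y nx ny h = Residual.goal ss₁ ss₂ ss₃ x y nx ny h
      ((s₁ * (x * x)) %ℕ p) ((s₂ * (y * y)) %ℕ p)
      (0<% (∤-* pp (sm∤ ss₁) (∤-* pp nx nx))) (n%ℕd<d (s₁ * (x * x)) p)
      (0<% (∤-* pp (sm∤ ss₂) (∤-* pp ny ny))) (n%ℕd<d (s₂ * (y * y)) p) (≋-%ℕ p (s₁ * (x * x))) (≋-%ℕ p (s₂ * (y * y)))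

    record Separated (ℓ : List ℤ) : Set where
      constructor separated
      field
        multiples       : List ℤ
        units           : List ℤ
        multiples-small : All (Small B) multiples
        units-small     : All (Small B) units
        equiv           : ℓ ~ map (P *_) multiples ++ units

    P^≢0 : ∀ f → P ^ f ≢ + 0
    P^≢0 zero    = λ ()
    P^≢0 (suc f) = *-≢0 P≢0 (P^≢0 f)

    -- Even powers of p are squares, so each coefficient reduces to u or p u with u prime to p.
    separate : ∀ ℓ → All (Small p) ℓ → Separated ℓ
    separate []      []       = separated [] [] [] [] ~refl
    separate (x ∷ ℓ) (sx ∷ h) with separate ℓ h | valuationℤ pp x (nz sx)
    ... | separated ss m hs hm e | k , u , eq , nu with halve k
    ...   | f , inj₁ refl = separated ss (u ∷ m) hs (su ∷ hm)
            (~trans (~reflexive (cong (_∷ ℓ) (trans eq (trans (cong (_* u) (^-distribˡ-+-* P f f)) (*-comm (P ^ f * P ^ f) u)))))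
            (~trans (sq ℓ (nz su) (P^≢0 f)) (~trans (~cons u e) (perm (↭-sym (shift u (map (P *_) ss) m))))))
      where
      su : Small B u
      su = small (∤⇒≢0 nu) λ {q} qq d → ℕP.≤-pred (ℕP.≤∧≢⇒< (smooth sx qq (subst (+ q ∣_) (sym eq) (∣n⇒∣m*n (P ^ k) d))) (λ { refl → nu d }))
    ...   | f , inj₂ refl = separated (u ∷ ss) m (su ∷ hs) hm
            (~trans (~reflexive (cong (_∷ ℓ) (trans eq (trans (cong (λ t → P * t * u) (^-distribˡ-+-* P f f)) (ring P (P ^ f) u)))))
            (~trans (sq ℓ (*-≢0 P≢0 (nz su)) (P^≢0 f)) (~cons (P * u) e)))
      where
      ring : ∀ P F u → P * (F * F) * u ≡ P * u * (F * F)
      ring = solve-∀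
      su : Small B u
      su = small (∤⇒≢0 nu) λ {q} qq d → ℕP.≤-pred (ℕP.≤∧≢⇒< (smooth sx qq (subst (+ q ∣_) (sym eq) (∣n⇒∣m*n (P ^ k) d))) (λ { refl → nu d }))

  module Pigeonhole (h : ℕ) (pp : Prime (suc (h ℕ.+ h))) where

    p : ℕ
    p = suc (h ℕ.+ h)

    squares-distinct : ∀ {m n} → m ℕ.≤ h → n ℕ.≤ h → + m * + m ≋ + n * + n mod p → m ≡ n
    squares-distinct {m} {n} l k (cong∣ d) =
      [ (λ e → <∧≋⇒≡ (ℕP.≤-<-trans l (Half.h<p h)) (ℕP.≤-<-trans k (Half.h<p h)) (cong∣ e))
      , (λ e → trans (ℕP.m+n≡0⇒m≡0 m (zero-sum e)) (sym (ℕP.m+n≡0⇒n≡0 m (zero-sum e)))) ]′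
      (euclid pp (+ m - + n) (+ m + + n) (subst (+ p ∣_) (ring (+ m) (+ n)) d))
      where
      ring : ∀ m n → m * m - n * n ≡ (m - n) * (m + n)
      ring = solve-∀
      zero-sum : + p ∣ + m + + n → m ℕ.+ n ≡ 0
      zero-sum e = +-injective (∣∣<⇒0 e (ℕ.s≤s (ℕP.+-mono-≤ l k)))

    -- For 0 ≤ x, y ≤ h the h + 1 values s₁ x² and the h + 1 values t - s₂ y² cannot all be
    -- different among 2 h + 1 residues.
    represent : ∀ {s₁ s₂} → ¬ (+ p ∣ s₁) → ¬ (+ p ∣ s₂) → ∀ t → ∃ λ x → ∃ λ y → s₁ * (x * x) + s₂ * (y * y) ≋ t mod p
    represent {s₁} {s₂} n₁ n₂ t = conclude (FinP.pigeonhole (ℕ.s≤s (ℕP.≤-reflexive (sym (ℕP.+-suc h h)))) value)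
      where
      left right : Fin (suc h) → ℤ
      left  x = s₁ * (+ toℕ x * + toℕ x)
      right y = t - s₂ * (+ toℕ y * + toℕ y)
      residue : ℤ → Fin p
      residue z = fromℕ< (n%ℕd<d z p)
      residue-≋ : ∀ {u v} → residue u ≡ residue v → u ≋ v mod p
      residue-≋ {u} {v} e = ≋-trans (≋-%ℕ p u) (≋-trans (≋-reflexive (cong +_ (trans (sym (FinP.toℕ-fromℕ< _)) (trans (cong toℕ e) (FinP.toℕ-fromℕ< _))))) (≋-sym (≋-%ℕ p v)))
      value : Fin (suc h ℕ.+ suc h) → Fin p
      value i = residue ([ left , right ]′ (splitAt (suc h) i))
      bound : ∀ (x : Fin (suc h)) → toℕ x ℕ.≤ h
      bound x = ℕP.≤-pred (FinP.toℕ<n x)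
      meet : ∀ x y → left x ≋ right y mod p → ∃ λ x → ∃ λ y → s₁ * (x * x) + s₂ * (y * y) ≋ t mod p
      meet x y e = + toℕ x , + toℕ y , ≋-trans (≋-+ e ≋-refl) (≋-reflexive (ring t (s₂ * (+ toℕ y * + toℕ y))))
        where ring : ∀ t z → t - z + z ≡ t
              ring = solve-∀
      right-≋ : ∀ y y′ → right y ≋ right y′ mod p → s₂ * (+ toℕ y * + toℕ y) ≋ s₂ * (+ toℕ y′ * + toℕ y′) mod p
      right-≋ y y′ e = cong∣ (subst (+ p ∣_) (ring t (s₂ * (+ toℕ y * + toℕ y)) (s₂ * (+ toℕ y′ * + toℕ y′))) (∣diff (≋-sym e)))
        where ring : ∀ t u v → t - v - (t - u) ≡ u - v
              ring = solve-∀
      same : ∀ i j → splitAt (suc h) i ≡ splitAt (suc h) j → i ≡ j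
      same i j e = trans (sym (FinP.join-splitAt (suc h) (suc h) i)) (trans (cong (join (suc h) (suc h)) e) (FinP.join-splitAt (suc h) (suc h) j))
      conclude : (∃ λ i → ∃ λ j → i Fin.< j × value i ≡ value j) → ∃ λ x → ∃ λ y → s₁ * (x * x) + s₂ * (y * y) ≋ t mod p
      conclude (i , j , i<j , e) with splitAt (suc h) i in ei | splitAt (suc h) j in ej
      ... | inj₁ x | inj₂ y = meet x y (residue-≋ e)
      ... | inj₂ y | inj₁ x = meet x y (≋-sym (residue-≋ e))
      ... | inj₁ x | inj₁ x′ = ⊥-elim (FinP.<⇒≢ i<j (same i j (trans ei (trans (cong inj₁ (FinP.toℕ-injective (squares-distinct (bound x) (bound x′) (≋-cancelˡ pp n₁ (residue-≋ e))))) (sym ej)))))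
      ... | inj₂ y | inj₂ y′ = ⊥-elim (FinP.<⇒≢ i<j (same i j (trans ei (trans (cong inj₂ (FinP.toℕ-injective (squares-distinct (bound y) (bound y′) (≋-cancelˡ pp n₂ (right-≋ y y′ (residue-≋ e)))))) (sym ej)))))

  module OddPrime (h : ℕ) (pp : Prime (suc (h ℕ.+ h))) where

    open Half h using (legendre)
    open Residues pp legendre (Half.legendre-* h pp) (Half.legendre-cong h) public

    open Reduce {h ℕ.+ h} pp
    open Pigeonhole h pp using (represent)

    ∂-unit : ∀ {u} → ¬ (+ suc (h ℕ.+ h) ∣ u) → ∂ u ≡ 0G
    ∂-unit {u} n = ∂-class 0 u (sym (*-identityˡ u)) n

    ∂-P* : ∀ {u} → ¬ (+ suc (h ℕ.+ h) ∣ u) → ∂ (P * u) ≡ (true , legendre u)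
    ∂-P* {u} n = ∂-class 1 u (cong (_* u) (sym (*-identityʳ P))) n

    ∂*-small : ∀ {m} → All (Small (h ℕ.+ h)) m → ∂* m ≡ 0G
    ∂*-small []       = refl
    ∂*-small (s ∷ hs) = trans (cong₂ _∙_ (∂-unit (sm∤ s)) (∂*-small hs)) refl

    pair-legendre : ∀ {s s′ m} → Small (h ℕ.+ h) s → Small (h ℕ.+ h) s′ → All (Small (h ℕ.+ h)) m →
                    ∂* (P * s ∷ P * s′ ∷ m) ≡ 0G → legendre (- (s * s′)) ≡ Sign.+
    pair-legendre {s} {s′} {m} hs hs′ hm e = begin
      legendre (- (s * s′))                             ≡⟨ leg-neg (∤-* pp (sm∤ hs) (sm∤ hs′)) ⟩
      η Sign.* legendre (s * s′)                        ≡⟨ cong (η Sign.*_) (Half.legendre-* h pp (sm∤ hs) (sm∤ hs′)) ⟩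
      η Sign.* (legendre s Sign.* legendre s′)          ≡⟨ cong (λ z → η Sign.* (legendre s Sign.* z)) (sym (SignP.*-identityʳ (legendre s′))) ⟩
      proj₂ ((true , legendre s) ∙ ((true , legendre s′) ∙ 0G)) ≡⟨ cong proj₂ (sym (cong₂ _∙_ (∂-P* (sm∤ hs)) (cong₂ _∙_ (∂-P* (sm∤ hs′)) (∂*-small hm)))) ⟩
      proj₂ (∂* (P * s ∷ P * s′ ∷ m))                   ≡⟨ cong proj₂ e ⟩
      Sign.+ ∎
      where open ≡-Reasoning

    -- Vanishing of the residue makes -s s′ a square x² mod p. Replacing s′ by s′ s² gives s′ s² ≡
    -- -s x² with no division, and `cancel` applies.
    cancel-pair : ∀ {s s′ m} → Small (h ℕ.+ h) s → Small (h ℕ.+ h) s′ → All (Small (h ℕ.+ h)) m →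
                  ∂* (P * s ∷ P * s′ ∷ m) ≡ 0G → Leftover (P * s ∷ P * s′ ∷ m)
    cancel-pair {s} {s′} {m} hs hs′ hm e =
      root (Half.legendre-+⇒square h pp (∤-neg (∤-* pp (sm∤ hs) (sm∤ hs′))) (pair-legendre hs hs′ hm e))
      where
      ring : ∀ s s′ → s′ * (s * s) ≡ - (s * - (s * s′))
      ring = solve-∀
      to-square : P * s ∷ P * s′ ∷ m ~ P * s ∷ P * (s′ * (s * s)) ∷ m
      to-square = ~cons (P * s) (~trans (~sym (sq m (*-≢0 P≢0 (nz hs′)) (nz hs))) (~reflexive (cong (_∷ m) (*-assoc P s′ (s * s)))))
      finish : (∃ λ m′ → All (Small (h ℕ.+ h)) m′ × P * s ∷ P * (s′ * (s * s)) ∷ [] ~ m′) → Leftover (P * s ∷ P * s′ ∷ m)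
      finish (m′ , hm′ , e′) = leftover (m′ ++ m) (AllP.++⁺ hm′ hm) (~trans to-square (~++ʳ m e′))
      root : (∃ λ x → x * x ≋ - (s * s′) mod suc (h ℕ.+ h)) → Leftover (P * s ∷ P * s′ ∷ m)
      root (x , x²≋) = finish (cancel hs (small-* hs′ (small-* hs hs)) x nx class≋)
        where
        nx : ¬ (P ∣ x)
        nx d = ∤-neg (∤-* pp (sm∤ hs) (sm∤ hs′)) (≋-∣ (≋-sym x²≋) (∣n⇒∣m*n x d))
        class≋ : s′ * (s * s) ≋ - (s * (x * x)) mod suc (h ℕ.+ h)
        class≋ = ≋-trans (≋-reflexive (ring s s′)) (≋-neg {x = s * - (s * s′)} {s * (x * x)} (≋-*ˡ s { - (s * s′)} {x * x} (≋-sym x²≋)))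

    -- Ternary forms over 𝔽ₚ are isotropic.
    module Shorten {s₁ s₂ s₃} (h₁ : Small (h ℕ.+ h) s₁) (h₂ : Small (h ℕ.+ h) s₂) (h₃ : Small (h ℕ.+ h) s₃) where

      Goal : Set
      Goal = ∃ λ s → ∃ λ m → Small (h ℕ.+ h) s × All (Small (h ℕ.+ h)) m × P * s₁ ∷ P * s₂ ∷ P * s₃ ∷ [] ~ P * s ∷ m

      s₃≋ : ∀ {z} → z ≋ - s₃ mod suc (h ℕ.+ h) → s₃ ≋ - z mod suc (h ℕ.+ h)
      s₃≋ {z} e = ≋-trans (≋-reflexive (sym (neg-involutive s₃))) (≋-neg {x = - s₃} {z} (≋-sym e))

      module _ (x y : ℤ) (eq : s₁ * (x * x) + s₂ * (y * y) ≋ - s₃ mod suc (h ℕ.+ h)) where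

        drop₁ : P ∣ x → s₂ * (y * y) ≋ - s₃ mod suc (h ℕ.+ h)
        drop₁ dx = ≋-trans (≋-sym (≋-trans (≋-+ {u = s₂ * (y * y)} (∣⇒≋0 (∣n⇒∣m*n s₁ (∣n⇒∣m*n x dx))) ≋-refl) (≋-reflexive (+-identityˡ (s₂ * (y * y)))))) eq

        drop₂ : P ∣ y → s₁ * (x * x) ≋ - s₃ mod suc (h ℕ.+ h)
        drop₂ dy = ≋-trans (≋-sym (≋-trans (≋-+ {x = s₁ * (x * x)} ≋-refl (∣⇒≋0 (∣n⇒∣m*n s₂ (∣n⇒∣m*n y dy)))) (≋-reflexive (+-identityʳ (s₁ * (x * x)))))) eq

        cases : Dec (P ∣ x) → Dec (P ∣ y) → Goal
        cases (no nx) (no ny) = ternary h₁ h₂ h₃ x y nx ny eq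
        cases (yes dx) _ = keep (cancel h₂ h₃ y ny (s₃≋ (drop₁ dx)))
          where
          ny : ¬ (P ∣ y)
          ny d = ∤-neg (sm∤ h₃) (≋-∣ (≋-sym (drop₁ dx)) (∣n⇒∣m*n s₂ (∣n⇒∣m*n y d)))
          keep : (∃ λ m → All (Small (h ℕ.+ h)) m × P * s₂ ∷ P * s₃ ∷ [] ~ m) → Goal
          keep (m , hm , e) = s₁ , m , h₁ , hm , ~cons (P * s₁) e
        cases (no nx) (yes dy) = keep (cancel h₁ h₃ x nx (s₃≋ (drop₂ dy)))
          where
          keep : (∃ λ m → All (Small (h ℕ.+ h)) m × P * s₁ ∷ P * s₃ ∷ [] ~ m) → Goal
          keep (m , hm , e) = s₂ , m , h₂ , hm , ~trans (~swap {P * s₁} {P * s₂}) (~cons (P * s₂) e)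

      shorten : Goal
      shorten = go (represent (sm∤ h₁) (sm∤ h₂) (- s₃))
        where
        go : (∃ λ x → ∃ λ y → s₁ * (x * x) + s₂ * (y * y) ≋ - s₃ mod suc (h ℕ.+ h)) → Goal
        go (x , y , eq) = cases x y eq (∣? x) (∣? y)

    -- Three multiples of p shrink to one, two cancel because of their discriminant, and a single
    -- one would have a residue of odd rank. The number n is fuel.
    clear : ∀ n ss m → length ss ℕ.≤ n → All (Small (h ℕ.+ h)) ss → All (Small (h ℕ.+ h)) m →
            ∂* (map (P *_) ss ++ m) ≡ 0G → Leftover (map (P *_) ss ++ m)
    clear n [] m l hs hm e = leftover m hm ~refl
    clear n (s ∷ []) m l (hs ∷ []) hm e = ⊥-elim (true≢false (cong proj₁ (trans (sym (cong₂ _∙_ (∂-P* (sm∤ hs)) (∂*-small hm))) e)))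
    clear n (s ∷ s′ ∷ []) m l (hs ∷ hs′ ∷ []) hm e = cancel-pair hs hs′ hm e
    clear (suc n) (s₁ ∷ s₂ ∷ s₃ ∷ ss) m (ℕ.s≤s l) (h₁ ∷ h₂ ∷ h₃ ∷ hs) hm e = go (Shorten.shorten h₁ h₂ h₃)
      where
      go : Shorten.Goal h₁ h₂ h₃ → Leftover (P * s₁ ∷ P * s₂ ∷ P * s₃ ∷ map (P *_) ss ++ m)
      go (s , m′ , h′ , hm′ , eq) = result (clear n (s ∷ ss) (m′ ++ m) (ℕP.≤-trans (ℕP.n≤1+n _) l) (h′ ∷ hs) (AllP.++⁺ hm′ hm) (trans (sym (∂*-~ step)) e))
        where
        step : P * s₁ ∷ P * s₂ ∷ P * s₃ ∷ map (P *_) ss ++ m ~ P * s ∷ map (P *_) ss ++ (m′ ++ m)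
        step = ~trans (~++ʳ (map (P *_) ss ++ m) eq) (~cons (P * s) (~trans (~reflexive (sym (++-assoc m′ (map (P *_) ss) m)))
          (~trans (~++ʳ m (perm (++-comm m′ (map (P *_) ss)))) (~reflexive (++-assoc (map (P *_) ss) m′ m)))))
        result : Leftover (P * s ∷ map (P *_) ss ++ (m′ ++ m)) → Leftover (P * s₁ ∷ P * s₂ ∷ P * s₃ ∷ map (P *_) ss ++ m)
        result (leftover k hk ek) = leftover k hk (~trans step ek)

    eliminate : ∀ ℓ → All (Small (suc (h ℕ.+ h))) ℓ → ∂* ℓ ≡ 0G → Leftover ℓ
    eliminate ℓ hℓ e = go (separate ℓ hℓ)
      where
      go : Separated ℓ → Leftover ℓ
      go (separated ss m hs hm eq) = result (clear (length ss) ss m ℕP.≤-refl hs hm (trans (sym (∂*-~ eq)) e))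
        where
        result : Leftover (map (P *_) ss ++ m) → Leftover ℓ
        result (leftover k hk ek) = leftover k hk (~trans eq ek)

-- Residues and signature determine the Witt class.

module WeakHasse where

  open import Data.Nat.Primality using (prime?; prime[2]; prime⇒irreducible)
  open import Data.Integer hiding (suc)
  open import Data.Integer.Properties
  open import Data.Integer.Divisibility.Signed
  open import Data.Bool using (_xor_)
  open import Data.List using (List; []; _∷_; _++_; map; replicate)
  open import Data.List.Relation.Unary.All as All using (All; []; _∷_)
  import Data.List.Relation.Unary.All.Properties as AllP
  import Data.List.Relation.Binary.Permutation.Propositional as P
  open Congruence
  open BigOp
  open Convolution using (prime-divisor)
  open Witt
  open Residue
  open Elimination

  module Σℤ = Big {ℤ} _+_ (+ 0) +-assoc +-comm +-identityˡ

  sg : ℤ → ℤ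
  sg (+ zero)  = + 0
  sg (+ suc _) = + 1
  sg -[1+ _ ]  = - (+ 1)

  sg-* : ∀ x y → sg (x * y) ≡ sg x * sg y
  sg-* (+ zero)  y          = refl
  sg-* (+ suc m) (+ zero)   = cong sg (*-zeroʳ (+ suc m))
  sg-* (+ suc m) (+ suc n)  = refl
  sg-* (+ suc m) -[1+ n ]   = refl
  sg-* -[1+ m ] (+ zero)    = cong sg (*-zeroʳ -[1+ m ])
  sg-* -[1+ m ] (+ suc n)   = refl
  sg-* -[1+ m ] -[1+ n ]    = refl

  sg-square : ∀ {s} → s ≢ + 0 → sg (s * s) ≡ + 1
  sg-square {+ zero}  h = ⊥-elim (h refl)
  sg-square {+ suc n} h = refl
  sg-square { -[1+ n ]} h = refl

  sg-neg : ∀ x → sg (- x) ≡ - sg x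
  sg-neg (+ zero)  = refl
  sg-neg (+ suc n) = refl
  sg-neg -[1+ n ]  = refl

  sg-add : ∀ {a b} → a ≢ + 0 → b ≢ + 0 → sg a + sg b ≡ sg (a + b) + sg (a * b * (a + b))
  sg-add {a} {b} ha hb = trans (lem a b ha hb (sg (a + b)) refl) (cong (_+_ (sg (a + b))) (sym (trans (sg-* (a * b) (a + b)) (cong (_* sg (a + b)) (sg-* a b)))))
    where
    cancel : ∀ c → + 0 ≡ c + - (+ 1) * c
    cancel = solve-∀
    lem : ∀ a b → a ≢ + 0 → b ≢ + 0 → ∀ c → sg (a + b) ≡ c → sg a + sg b ≡ c + sg a * sg b * c
    lem (+ zero)  b          ha hb c e = ⊥-elim (ha refl)
    lem a         (+ zero)   ha hb c e = ⊥-elim (hb refl)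
    lem (+ suc m) (+ suc n)  ha hb c refl = refl
    lem -[1+ m ]  -[1+ n ]   ha hb c refl = refl
    lem (+ suc m) -[1+ n ]   ha hb c e = cancel c
    lem -[1+ m ]  (+ suc n)  ha hb c e = cancel c

  signature : List ℤ → ℤ
  signature = Σℤ.big sg

  signature-~ : ∀ {ℓ m} → ℓ ~ m → signature ℓ ≡ signature m
  signature-~ (perm π)      = Σℤ.big-↭ sg π
  signature-~ (sq {a} {s} ℓ h k) = cong (_+ signature ℓ) (trans (sg-* a (s * s)) (trans (cong (sg a *_) (sg-square k)) (*-identityʳ (sg a))))
  signature-~ (add {a} {b} ℓ h k l) = trans (sym (+-assoc (sg a) (sg b) (signature ℓ))) (trans (cong (_+ signature ℓ) (sg-add h k)) (+-assoc (sg (a + b)) _ (signature ℓ)))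
  signature-~ (hyp {a} ℓ h) = trans (sym (+-assoc (sg a) (sg (- a)) (signature ℓ))) (trans (cong (_+ signature ℓ) (trans (cong (_+_ (sg a)) (sg-neg a)) (+-inverseʳ (sg a)))) (+-identityˡ _))
  signature-~ (~sym e)      = sym (signature-~ e)
  signature-~ (~trans e f)  = trans (signature-~ e) (signature-~ f)

  data Unit : ℤ → Set where
    plus  : Unit (+ 1)
    minus : Unit (- (+ 1))

  canonical : ∀ ℓ → All Unit ℓ → ∃ λ k → (ℓ ~ replicate k (+ 1)) ⊎ (ℓ ~ replicate k (- (+ 1)))
  canonical [] [] = 0 , inj₁ ~refl
  canonical (x ∷ ℓ) (u ∷ us) with u | canonical ℓ us
  ... | plus  | k , inj₁ e = suc k , inj₁ (~cons (+ 1) e)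
  ... | minus | k , inj₂ e = suc k , inj₂ (~cons (- (+ 1)) e)
  ... | plus  | zero , inj₂ e = 1 , inj₁ (~cons (+ 1) e)
  ... | minus | zero , inj₁ e = 1 , inj₂ (~cons (- (+ 1)) e)
  ... | plus  | suc k , inj₂ e = k , inj₂ (~trans (~cons (+ 1) e) (hyp _ (λ ())))
  ... | minus | suc k , inj₁ e = k , inj₁ (~trans (~cons (- (+ 1)) e) (hyp _ (λ ())))

  signature-units : ∀ ℓ → All Unit ℓ → signature ℓ ≡ + 0 → ℓ ~ []
  signature-units ℓ us s with canonical ℓ us
  ... | zero , inj₁ e = e
  ... | zero , inj₂ e = e
  ... | suc k , inj₁ e = ⊥-elim (absurd (trans (sym (count (suc k))) (trans (sym (signature-~ e)) s)))
    where
    count : ∀ k → signature (replicate k (+ 1)) ≡ + k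
    count zero    = refl
    count (suc k) = cong (_+_ (+ 1)) (count k)
    absurd : + suc k ≢ + 0
    absurd ()
  ... | suc k , inj₂ e = ⊥-elim (absurd (trans (sym (count (suc k))) (trans (sym (signature-~ e)) s)))
    where
    count : ∀ k → signature (replicate k (- (+ 1))) ≡ - (+ k)
    count zero    = refl
    count (suc k) = trans (cong (_+_ (- (+ 1))) (count k)) (ring (+ k))
      where ring : ∀ k → - (+ 1) + - k ≡ - (+ 1 + k)
            ring = solve-∀
    absurd : - (+ suc k) ≢ + 0
    absurd ()

  small1⇒unit : ∀ {n} → Small 1 n → Unit n
  small1⇒unit {n} s = from n (ℕP.≤-antisym (ℕP.≮⇒≥ big) (ℕP.n≢0⇒n>0 (λ e → Small.nz s (∣i∣≡0⇒i≡0 e))))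
    where
    big : ¬ (1 ℕ.< ∣ n ∣)
    big l with prime-divisor ∣ n ∣ l
    ... | q , qq , d = ℕP.<⇒≱ (prime>1 qq) (Small.smooth s qq (∣ᵤ⇒∣ d))
    from : ∀ n → ∣ n ∣ ≡ 1 → Unit n
    from (+ 1)    refl = plus
    from -[1+ 0 ] refl = minus

  module Two = Residues prime[2] (λ _ → Sign.+) (λ _ _ → refl) (λ _ → refl)

  module EliminateTwo where

    open Reduce {1} prime[2]
    open Two using (∂*; ∂*-~; ∂; ∂-class; _∙_; 0G)

    ∂-2* : ∀ {s} → Small 1 s → ∂ (P * s) ≡ (true , Sign.+)
    ∂-2* {s} hs = ∂-class 1 s (cong (_* s) (sym (*-identityʳ P))) (sm∤ hs)

    ∂*-units : ∀ {m} → All (Small 1) m → ∂* m ≡ 0G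
    ∂*-units []           = refl
    ∂*-units {x ∷ m} (s ∷ hs) = trans (cong₂ _∙_ (∂-class 0 x (sym (*-identityˡ x)) (sm∤ s)) (∂*-units hs)) refl

    -- ⟨2, 2⟩ ~ ⟨4, 16⟩ ~ ⟨1, 1⟩, and likewise with minus signs, while ⟨2, -2⟩ is hyperbolic. So the
    -- parity of the number of 2s is the only obstruction at 2.
    pair : ∀ {s s′} → Unit s → Unit s′ → ∀ ℓ → ∃ λ m → All Unit m × P * s ∷ P * s′ ∷ ℓ ~ m ++ ℓ
    pair plus  minus ℓ = [] , [] , hyp ℓ (λ ())
    pair minus plus  ℓ = [] , [] , hyp ℓ (λ ())
    pair plus  plus  ℓ = + 1 ∷ + 1 ∷ [] , plus ∷ plus ∷ [] , ~trans (add ℓ (λ ()) (λ ()) (λ ()))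
      (~trans (sq {+ 1} {+ 2} _ (λ ()) (λ ())) (~cons (+ 1) (sq {+ 1} {+ 4} ℓ (λ ()) (λ ()))))
    pair minus minus ℓ = - (+ 1) ∷ - (+ 1) ∷ [] , minus ∷ minus ∷ [] , ~trans (add ℓ (λ ()) (λ ()) (λ ()))
      (~trans (sq { - (+ 1)} {+ 2} _ (λ ()) (λ ())) (~cons (- (+ 1)) (sq { - (+ 1)} {+ 4} ℓ (λ ()) (λ ()))))

    clear : ∀ ss m → All (Small 1) ss → All Unit m → proj₁ (∂* (map (P *_) ss)) ≡ false →
            ∃ λ k → All Unit k × map (P *_) ss ++ m ~ k
    clear [] m hs hm e = m , hm , ~refl
    clear (s ∷ []) m (hs ∷ []) hm e = ⊥-elim (true≢false (trans (sym (cong (λ t → proj₁ (t ∙ 0G)) (∂-2* hs))) e))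
    clear (s ∷ s′ ∷ ss) m (hs ∷ hs′ ∷ hss) hm e = combine (pair (small1⇒unit hs) (small1⇒unit hs′) rest) (clear ss m hss hm even)
      where
      rest = map (P *_) ss ++ m
      shape : ∀ g → proj₁ ((true , Sign.+) ∙ ((true , Sign.+) ∙ g)) ≡ proj₁ g
      shape (true  , _) = refl
      shape (false , _) = refl
      even : proj₁ (∂* (map (P *_) ss)) ≡ false
      even = trans (sym (shape (∂* (map (P *_) ss)))) (trans (sym (cong proj₁ (cong₂ (λ x y → x ∙ (y ∙ ∂* (map (P *_) ss))) (∂-2* hs) (∂-2* hs′)))) e)
      combine : (∃ λ m₁ → All Unit m₁ × P * s ∷ P * s′ ∷ rest ~ m₁ ++ rest) → (∃ λ k → All Unit k × rest ~ k) →
                ∃ λ k → All Unit k × P * s ∷ P * s′ ∷ rest ~ k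
      combine (m₁ , hm₁ , e₁) (m₂ , hm₂ , e₂) = m₁ ++ m₂ , AllP.++⁺ hm₁ hm₂ , ~trans e₁ (~++ m₁ e₂)

    ∂*-++ : ∀ ℓ m → ∂* m ≡ 0G → proj₁ (∂* (ℓ ++ m)) ≡ proj₁ (∂* ℓ)
    ∂*-++ []      m e = cong proj₁ e
    ∂*-++ (x ∷ ℓ) m e = cong (proj₁ (∂ x) xor_) (∂*-++ ℓ m e)

    eliminate : ∀ ℓ → All (Small 2) ℓ → ∂* ℓ ≡ 0G → ∃ λ k → All Unit k × ℓ ~ k
    eliminate ℓ hℓ e = go (separate ℓ hℓ)
      where
      go : Separated ℓ → ∃ λ k → All Unit k × ℓ ~ k
      go (separated ss m hs hm eq) = result (clear ss m hs (All.map small1⇒unit hm)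
          (trans (sym (∂*-++ (map (P *_) ss) m (∂*-units hm))) (cong proj₁ (trans (sym (∂*-~ eq)) e))))
        where
        result : (∃ λ k → All Unit k × map (P *_) ss ++ m ~ k) → ∃ λ k → All Unit k × ℓ ~ k
        result (k , hk , ek) = k , hk , ~trans eq ek

  OddTrivial TwoTrivial Trivial : List ℤ → Set
  OddTrivial ℓ = ∀ h (pp : Prime (suc (h ℕ.+ h))) → OddPrime.∂* h pp ℓ ≡ (false , Sign.+)
  TwoTrivial ℓ = Two.∂* ℓ ≡ (false , Sign.+)
  Trivial ℓ    = OddTrivial ℓ × TwoTrivial ℓ × signature ℓ ≡ + 0

  trivial-~ : ∀ {ℓ m} → ℓ ~ m → Trivial ℓ → Trivial m
  trivial-~ e (o , t , s) = (λ h pp → trans (sym (OddPrime.∂*-~ h pp e)) (o h pp)) , trans (sym (Two.∂*-~ e)) t , trans (sym (signature-~ e)) s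

  odd-prime : ∀ {p} → Prime p → 2 ℕ.< p → ∃ λ h → p ≡ suc (h ℕ.+ h)
  odd-prime {p} pp l with halve p
  ... | h , inj₂ e = h , e
  ... | h , inj₁ e with prime⇒irreducible pp (ℕD.divides h (trans e (trans (cong (h ℕ.+_) (sym (ℕP.+-identityʳ h))) (ℕP.*-comm 2 h))))
  ...   | inj₁ ()
  ...   | inj₂ refl = ⊥-elim (ℕP.<-irrefl refl l)

  -- B bounds the primes that occur. A prime B is eliminated and a composite B can simply be
  -- lowered; from 2 on only ±1 and ±2 are left up to squares, and the signature decides.
  descend : ∀ B ℓ → All (Small B) ℓ → Trivial ℓ → ℓ ~ []
  descend-prime : ∀ B ℓ → All (Small (suc B)) ℓ → Trivial ℓ → Dec (Prime (suc B)) → 2 ℕ.< suc B → ℓ ~ []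

  descend-base : ∀ ℓ → All (Small 2) ℓ → Trivial ℓ → ℓ ~ []
  descend-base ℓ hℓ t = go (EliminateTwo.eliminate ℓ hℓ (proj₁ (proj₂ t)))
    where
    go : (∃ λ k → All Unit k × ℓ ~ k) → ℓ ~ []
    go (k , hk , e) = ~trans e (signature-units k hk (trans (sym (signature-~ e)) (proj₂ (proj₂ t))))

  descend 0 ℓ hℓ t = descend-base ℓ (All.map (small-weaken ℕ.z≤n) hℓ) t
  descend 1 ℓ hℓ t = descend-base ℓ (All.map (small-weaken (ℕ.s≤s ℕ.z≤n)) hℓ) t
  descend 2 ℓ hℓ t = descend-base ℓ hℓ t
  descend (suc B@(suc (suc _))) ℓ hℓ t = descend-prime B ℓ hℓ t (prime? (suc B)) (ℕ.s≤s (ℕ.s≤s (ℕ.s≤s ℕ.z≤n)))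

  descend-prime B ℓ hℓ t (no np) l = descend B ℓ (All.map (λ s → small (Small.nz s) (λ {q} qq d → ℕP.≤-pred (ℕP.≤∧≢⇒< (Small.smooth s qq d) (λ { refl → np qq })))) hℓ) t
  descend-prime B ℓ hℓ t (yes pp) l = go (odd-prime pp l)
    where
    kept : Reduce.Leftover pp ℓ → ℓ ~ []
    kept (Reduce.leftover k hk e) = ~trans e (descend B k hk (trivial-~ e t))
    eliminated : ∀ h → B ≡ h ℕ.+ h → Reduce.Leftover pp ℓ
    eliminated h refl = OddPrime.eliminate h pp ℓ hℓ (proj₁ t h pp)
    go : (∃ λ h → suc B ≡ suc (h ℕ.+ h)) → ℓ ~ []
    go (h , e) = kept (eliminated h (ℕP.suc-injective e))

  -- The injectivity half of Milnor's description of W(ℚ) by ℤ and the groups W(𝔽ₚ). The sum of the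
  -- absolute values is a crude bound for all primes that occur.
  weak-hasse : ∀ ℓ → All (_≢ + 0) ℓ → Trivial ℓ → ℓ ~ []
  weak-hasse ℓ hℓ t = descend (bound ℓ) ℓ (all-small ℓ hℓ) t
    where
    bound : List ℤ → ℕ
    bound []      = 0
    bound (x ∷ ℓ) = ∣ x ∣ ℕ.+ bound ℓ
    all-small : ∀ ℓ → All (_≢ + 0) ℓ → All (Small (bound ℓ)) ℓ
    all-small []      []       = []
    all-small (x ∷ ℓ) (h ∷ hs) = small-≤ h (ℕP.m≤m+n ∣ x ∣ (bound ℓ)) ∷ All.map (small-weaken (ℕP.m≤n+m (bound ℓ) ∣ x ∣)) (all-small ℓ hs)

-- Local splitting at odd primes in terms of the tame symbol.

module LocalSymbol where

  open import Data.Integer hiding (suc)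
  open import Data.Integer.Properties
  open import Data.Integer.Divisibility.Signed
  open import Data.Bool using (not)
  open Congruence
  open Legendre using (module Half; ⟦_⟧; ⟦⟧-square)
  open Witt using (*-≢0)
  open Residue
  open Elimination using (module Pigeonhole)

  form : ℤ → ℤ → ℤ → ℤ → ℤ → ℤ
  form a b x y z = a * (x * x) + b * (y * y) - z * z

  module Local (h : ℕ) (pp : Prime (suc (h ℕ.+ h))) where

    open Half h using (legendre; p)
    open Pigeonhole h pp using (represent)

    P : ℤ
    P = + p

    AllDiv : ℤ → ℤ → ℤ → ℤ → Set
    AllDiv m x y z = (m ∣ x) × (m ∣ y) × (m ∣ z)

    record Solution (a b : ℤ) (k : ℕ) : Set where
      constructor sol
      field
        x y z     : ℤ
        coprime   : ¬ AllDiv P x y z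
        divisible : P ^ k ∣ form a b x y z

    allDiv? : ∀ x y z → Dec (AllDiv P x y z)
    allDiv? x y z with ∣? {p} x | ∣? {p} y | ∣? {p} z
    ... | yes d | yes e | yes f = yes (d , e , f)
    ... | no n  | _     | _     = no (λ t → n (proj₁ t))
    ... | yes _ | no n  | _     = no (λ t → n (proj₁ (proj₂ t)))
    ... | yes _ | yes _ | no n  = no (λ t → n (proj₂ (proj₂ t)))

    ^-∣ : ∀ k l → P ^ k ∣ P ^ (k ℕ.+ l)
    ^-∣ k l = divides (P ^ l) (trans (^-distribˡ-+-* P k l) (*-comm (P ^ k) (P ^ l)))

    ∣-P* : ∀ {m x} → m ∣ x → m * P ∣ x * P
    ∣-P* {m} (divides q refl) = divides q (*-assoc q m P)

    ∣-cancel : ∀ c {m x} → c ≢ + 0 → m * c ∣ x * c → m ∣ x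
    ∣-cancel c {m} {x} h (divides q e) = divides q (*-cancelʳ-≡ x (q * m) c {{≢-nonZero h}} (trans e (sym (*-assoc q m c))))

    P≢0 : P ≢ + 0
    P≢0 ()

    -- Common factors p are divided out, at most n times; each division lowers the exponent of the
    -- modulus by 2, which the surplus 2n pays for.
    primitivize : ∀ {a b} n k x y z → ¬ AllDiv (P ^ suc n) x y z → P ^ (k ℕ.+ (n ℕ.+ n)) ∣ form a b x y z → Solution a b k
    primitivize {a} {b} zero k x y z prim d =
      sol x y z (λ t → prim (subst (λ m → AllDiv m x y z) (sym (*-identityʳ P)) t)) (subst (λ t → P ^ t ∣ form a b x y z) (ℕP.+-identityʳ k) d)
    primitivize {a} {b} (suc n) k x y z prim d = cases (allDiv? x y z)
      where
      cases : Dec (AllDiv P x y z) → Solution a b k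
      cases (no np) = sol x y z np (∣-trans (^-∣ k (suc n ℕ.+ suc n)) d)
      cases (yes (divides x′ ex , divides y′ ey , divides z′ ez)) = primitivize {a} {b} n k x′ y′ z′
        (λ (dx , dy , dz) → prim (lift ex dx , lift ey dy , lift ez dz))
        (∣-cancel (P * P) {P ^ (k ℕ.+ (n ℕ.+ n))} {form a b x′ y′ z′} (*-≢0 P≢0 P≢0) (subst₂ _∣_ pow (trans (cong₃ ex ey ez) (ring a b x′ y′ z′ P)) d))
        where
        lift : ∀ {u u′} → u ≡ u′ * P → P ^ suc n ∣ u′ → P ^ suc (suc n) ∣ u
        lift {u′ = u′} e t = subst₂ _∣_ (*-comm (P ^ suc n) P) (sym e) (∣-P* t)
        cong₃ : ∀ {x x″ y y″ z z″} → x ≡ x″ → y ≡ y″ → z ≡ z″ → form a b x y z ≡ form a b x″ y″ z″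
        cong₃ refl refl refl = refl
        ring : ∀ a b x y z P → a * (x * P * (x * P)) + b * (y * P * (y * P)) - z * P * (z * P) ≡ (a * (x * x) + b * (y * y) - z * z) * (P * P)
        ring = solve-∀
        ring′ : ∀ P Q → P * (P * Q) ≡ Q * (P * P)
        ring′ = solve-∀
        pow : P ^ (k ℕ.+ (suc n ℕ.+ suc n)) ≡ P ^ (k ℕ.+ (n ℕ.+ n)) * (P * P)
        pow = trans (cong (P ^_) (trans (cong (k ℕ.+_) (cong suc (ℕP.+-suc n n))) (trans (ℕP.+-suc k _) (cong suc (ℕP.+-suc k (n ℕ.+ n)))))) (ring′ P (P ^ (k ℕ.+ (n ℕ.+ n))))

    ∣-unscale : ∀ i j {x} → P ^ (i ℕ.+ suc j) ∣ P ^ i * x → P ∣ x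
    ∣-unscale i j {x} d = ∣-trans (divides (P ^ j) (*-comm P (P ^ j)))
      (∣-cancel (P ^ i) (P^≢0 i) (subst₂ _∣_ (trans (^-distribˡ-+-* P i (suc j)) (*-comm (P ^ i) _)) (*-comm (P ^ i) x) d))
      where
      P^≢0 : ∀ e → P ^ e ≢ + 0
      P^≢0 zero    = λ ()
      P^≢0 (suc e) = *-≢0 P≢0 (P^≢0 e)

    module _ (a b : ℤ) (i j : ℕ) where

      private
        s = P ^ i
        t = P ^ j
        n = i ℕ.+ j

        +-suc′ : suc n ≡ j ℕ.+ suc i
        +-suc′ = trans (cong suc (ℕP.+-comm i j)) (sym (ℕP.+-suc j i))

      -- The substitution (s x, t y, z) absorbs the square factors. Primitivity may suffer by up to
      -- i + j powers of p, and the additional precision lets `primitivize` repair it.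
      to-core : ∀ k → Solution (a * (s * s)) (b * (t * t)) (k ℕ.+ (n ℕ.+ n)) → Solution a b k
      to-core k (sol x y z prim d) = primitivize {a} {b} n k (s * x) (t * y) z
        (λ (dx , dy , dz) → prim ( ∣-unscale i j (subst (λ m → P ^ m ∣ s * x) (sym (ℕP.+-suc i j)) dx)
                                 , ∣-unscale j i (subst (λ m → P ^ m ∣ t * y) +-suc′ dy)
                                 , ∣-trans (divides (P ^ n) (*-comm P (P ^ n))) dz))
        (subst (P ^ (k ℕ.+ (n ℕ.+ n)) ∣_) (ring a b s t x y z) d)
        where ring : ∀ a b s t x y z → a * (s * s) * (x * x) + b * (t * t) * (y * y) - z * z ≡ a * (s * x * (s * x)) + b * (t * y * (t * y)) - z * z
              ring = solve-∀

      from-core : ∀ k → Solution a b (k ℕ.+ (n ℕ.+ n)) → Solution (a * (s * s)) (b * (t * t)) k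
      from-core k (sol x y z prim d) = primitivize {a * (s * s)} {b * (t * t)} n k (t * x) (s * y) (P ^ n * z)
        (λ (dx , dy , dz) → prim ( ∣-unscale j i (subst (λ m → P ^ m ∣ t * x) +-suc′ dx)
                                 , ∣-unscale i j (subst (λ m → P ^ m ∣ s * y) (sym (ℕP.+-suc i j)) dy)
                                 , ∣-unscale n 0 (subst (λ m → P ^ m ∣ P ^ n * z) (ℕP.+-comm 1 n) dz)))
        (subst (P ^ (k ℕ.+ (n ℕ.+ n)) ∣_) (trans (ring a b s t x y z) (cong (λ u → a * (s * s) * (t * x * (t * x)) + b * (t * t) * (s * y * (s * y)) - u * z * (u * z)) (sym (^-distribˡ-+-* P i j)))) (∣n⇒∣m*n (s * s * (t * t)) d))
        where ring : ∀ a b s t x y z → s * s * (t * t) * (a * (x * x) + b * (y * y) - z * z) ≡ a * (s * s) * (t * x * (t * x)) + b * (t * t) * (s * y * (s * y)) - s * t * z * (s * t * z)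
              ring = solve-∀

    -- Euler's criterion gives w^h ≡ ±1, so w^(h-1) times that sign inverts w.
    inverse : ∀ {w} → ¬ (P ∣ w) → ∃ λ v → w * v ≋ + 1 mod p
    inverse {w} nw = w ^ ℕ.pred h * L , ≋-trans (≋-reflexive (trans (sym (*-assoc w (w ^ ℕ.pred h) L)) (cong (λ t → w ^ t * L) (ℕP.suc-pred h {{ℕ.>-nonZero (Half.0<h h pp)}}))))
      (≋-trans (≋-* {u = L} (Half.euler h pp nw) ≋-refl) (≋-reflexive (⟦⟧-square (legendre w))))
      where L = ⟦ legendre w ⟧

    hensel : ∀ {u} → ¬ (P ∣ u) → legendre u ≡ Sign.+ → ∀ k → ∃ λ z → ¬ (P ∣ z) × P ^ suc k ∣ z * z - u
    hensel {u} nu e zero = base (Half.legendre-+⇒square h pp nu e)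
      where
      base : (∃ λ x → x * x ≋ u mod p) → ∃ λ z → ¬ (P ∣ z) × P ^ 1 ∣ z * z - u
      base (x , c) = x , (λ d → nu (≋-∣ (≋-sym c) (∣n⇒∣m*n x d))) , subst (_∣ x * x - u) (sym (*-identityʳ P)) (∣diff c)
    hensel {u} nu e (suc k) = step (hensel nu e k)
      where
      step : (∃ λ z → ¬ (P ∣ z) × P ^ suc k ∣ z * z - u) → ∃ λ z → ¬ (P ∣ z) × P ^ suc (suc k) ∣ z * z - u
      step (z , nz , divides m eq) = lift (inverse (∤-* pp (∤-small (ℕ.s≤s ℕ.z≤n) (Half.2<p h pp)) nz))
        where
        Q = P ^ k
        lift : (∃ λ v → + 2 * z * v ≋ + 1 mod p) → ∃ λ z → ¬ (P ∣ z) × P ^ suc (suc k) ∣ z * z - u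
        -- Newton's step: z² - u is m p^(k+1) and v inverts 2 z mod p, so moving z by -m v p^(k+1)
        -- kills the error modulo p^(k+2).
        lift (v , cong∣ (divides w ev)) = z + t * (P * Q) , nz′ , divides (m * - w + Q * (m * v * (m * v))) final
          where
          t = - (m * v)
          nz′ : ¬ (P ∣ z + t * (P * Q))
          nz′ = ∤-≋ (≋-trans (≋-reflexive (sym (+-identityʳ z))) (≋-+ {x = z} ≋-refl (≋-sym (∣⇒≋0 (divides (t * Q) (ring₀ t P Q)))))) nz
            where ring₀ : ∀ t P Q → t * (P * Q) ≡ t * Q * P
                  ring₀ = solve-∀
          ring₁ : ∀ z m v P Q u → (z + - (m * v) * (P * Q)) * (z + - (m * v) * (P * Q)) - u ≡ (z * z - u) - m * (P * Q) + m * (P * Q) * - (+ 2 * z * v - + 1) + (P * Q) * (P * Q) * (m * v * (m * v))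
          ring₁ = solve-∀
          ring₂ : ∀ m w v P Q → m * (P * Q) - m * (P * Q) + m * (P * Q) * - (w * P) + (P * Q) * (P * Q) * (m * v * (m * v)) ≡ (m * - w + Q * (m * v * (m * v))) * (P * (P * Q))
          ring₂ = solve-∀
          final : (z + t * (P * Q)) * (z + t * (P * Q)) - u ≡ (m * - w + Q * (m * v * (m * v))) * (P * (P * Q))
          final = trans (ring₁ z m v P Q u) (trans (cong₂ (λ A B → A - m * (P * Q) + m * (P * Q) * - B + (P * Q) * (P * Q) * (m * v * (m * v))) eq ev) (ring₂ m w v P Q))

    tame : Bool → ℤ → Bool → ℤ → Sign
    tame = tameSymbol legendre

    core : Bool → ℤ → ℤ
    core false u = u
    core true  u = P * u

    module _ {u v : ℤ} (nu : ¬ (P ∣ u)) (nv : ¬ (P ∣ v)) where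

      leg-+ : ∀ {w x y} → ¬ (P ∣ w) → ¬ (P ∣ x) → w * (x * x) ≋ y * y mod p → legendre w ≡ Sign.+
      leg-+ {w} {x} {y} nw nx e = trans (sym (trans (Half.legendre-* h pp nw (∤-* pp nx nx)) (trans (cong (legendre w Sign.*_) (Half.legendre-square h pp nx)) (SignP.*-identityʳ _))))
        (trans (Half.legendre-cong h e) (Half.legendre-square h pp ny))
        where ny : ¬ (P ∣ y)
              ny d = ∤-* pp nw (∤-* pp nx nx) (≋-∣ e (∣n⇒∣m*n y d))

      P²∣⇒P∣ : ∀ {x} → P ^ 2 ∣ x → P ∣ x
      P²∣⇒P∣ = ∣-trans (divides P (cong (P *_) (*-identityʳ P)))

      square-∣ : ∀ {x} → P ∣ x * x → P ∣ x
      square-∣ {x} d with euclid pp x x d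
      ... | inj₁ e = e
      ... | inj₂ e = e

      unit-∣ : ∀ {w x} → ¬ (P ∣ w) → P ∣ w * x → P ∣ x
      unit-∣ {w} {x} nw d with euclid pp w x d
      ... | inj₁ e = ⊥-elim (nw e)
      ... | inj₂ e = e

      -- Precision p² suffices. If p divided y it would divide z, then p² would divide p u x² and p
      -- would divide x, against primitivity. So y is a unit and v is the square of z / y.
      mixed : ∀ u v → ¬ (P ∣ u) → ¬ (P ∣ v) → ∀ x y z → P ^ 2 ∣ P * u * (x * x) + v * (y * y) - z * z → ¬ AllDiv P x y z → legendre v ≡ Sign.+
      mixed u v nu nv x y z d prim = leg-+ {v} {y} {z} nv ny vy²≋z²
        where
        ring : ∀ P u x A B → A - B ≡ (P * u * (x * x) + A - B) - u * (x * x) * P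
        ring = solve-∀
        vy²≋z² : v * (y * y) ≋ z * z mod p
        vy²≋z² = cong∣ (subst (P ∣_) (sym (ring P u x (v * (y * y)) (z * z))) (∣m∣n⇒∣m-n (P²∣⇒P∣ d) (divides (u * (x * x)) refl)))
        ny : ¬ (P ∣ y)
        ny dy = prim (square-∣ (unit-∣ nu (∣-cancel P P≢0 (subst₂ _∣_ (cong (P *_) (*-identityʳ P)) (ring₁ P u x) P²∣Pux²))) , dy , dz)
          where
          dz : P ∣ z
          dz = square-∣ (≋-∣ (≋-sym vy²≋z²) (∣n⇒∣m*n v (∣n⇒∣m*n y dy)))
          sq-div : ∀ {t} → P ∣ t → P ^ 2 ∣ t * t
          sq-div (divides q refl) = divides (q * q) (ring₂ q P)
            where ring₂ : ∀ q P → q * P * (q * P) ≡ q * q * (P * (P * + 1))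
                  ring₂ = solve-∀
          ring₁ : ∀ P u x → P * u * (x * x) ≡ u * (x * x) * P
          ring₁ = solve-∀
          ring₃ : ∀ A B C → (A + B - C) - B + C ≡ A
          ring₃ = solve-∀
          P²∣Pux² : P ^ 2 ∣ P * u * (x * x)
          P²∣Pux² = subst (P ^ 2 ∣_) (ring₃ (P * u * (x * x)) (v * (y * y)) (z * z)) (∣m∣n⇒∣m+n (∣m∣n⇒∣m-n d (∣n⇒∣m*n v (sq-div dy))) (sq-div dz))

      -- First p divides z; then p² divides p (u x² + v y²), so that -u v y² ≡ (u x)² mod p, with y
      -- a unit by primitivity.
      both : ∀ x y z → P ^ 2 ∣ P * u * (x * x) + P * v * (y * y) - z * z → ¬ AllDiv P x y z → legendre (- (u * v)) ≡ Sign.+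
      both x y z d prim = leg-+ { - (u * v)} {y} {u * x} (∤-neg (∤-* pp nu nv)) ny square
        where
        ring : ∀ P u v x y z → (P * u * (x * x) + P * v * (y * y) - z * z) - (u * (x * x) + v * (y * y)) * P ≡ - (z * z)
        ring = solve-∀
        dz : P ∣ z
        dz = square-∣ (subst (P ∣_) (neg-involutive (z * z)) (∣m⇒∣-m (subst (P ∣_) (ring P u v x y z) (∣m∣n⇒∣m-n (P²∣⇒P∣ d) (divides (u * (x * x) + v * (y * y)) refl)))))
        sq-div : ∀ {t} → P ∣ t → P ^ 2 ∣ t * t
        sq-div (divides q refl) = divides (q * q) (ring₂ q P)
          where ring₂ : ∀ q P → q * P * (q * P) ≡ q * q * (P * (P * + 1))
                ring₂ = solve-∀
        ring₁ : ∀ P u v x y z → (P * u * (x * x) + P * v * (y * y) - z * z) + z * z ≡ (u * (x * x) + v * (y * y)) * P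
        ring₁ = solve-∀
        sum : P ∣ u * (x * x) + v * (y * y)
        sum = ∣-cancel P P≢0 (subst₂ _∣_ (cong (P *_) (*-identityʳ P)) (ring₁ P u v x y z) (∣m∣n⇒∣m+n d (sq-div dz)))
        ny : ¬ (P ∣ y)
        ny dy = prim (square-∣ (unit-∣ nu (∣m+n∣n⇒∣m sum (∣n⇒∣m*n v (∣n⇒∣m*n y dy)))) , dy , dz)
        ring₃ : ∀ u v x y → - (u * v) * (y * y) - u * x * (u * x) ≡ - u * (u * (x * x) + v * (y * y))
        ring₃ = solve-∀
        square : - (u * v) * (y * y) ≋ u * x * (u * x) mod p
        square = cong∣ (subst (P ∣_) (sym (ring₃ u v x y)) (∣n⇒∣m*n (- u) sum))

      core-solution⇒tame : ∀ ε φ → Solution (core ε u) (core φ v) 2 → tame ε u φ v ≡ Sign.+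
      core-solution⇒tame false false _ = refl
      core-solution⇒tame true  false (sol x y z prim d) = mixed u v nu nv x y z d prim
      core-solution⇒tame false true  (sol x y z prim d) = mixed v u nv nu y x z (subst (P ^ 2 ∣_) (ring (u * (x * x)) (P * v * (y * y)) (z * z)) d) (λ (dy , dx , dz) → prim (dx , dy , dz))
        where ring : ∀ A B C → A + B - C ≡ B + A - C
              ring = solve-∀
      core-solution⇒tame true  true  (sol x y z prim d) = both x y z d prim

      weaken : ∀ {k x} → P ^ suc k ∣ x → P ^ k ∣ x
      weaken = ∣-trans (divides P refl)

      ∣-flip : ∀ {m x y} → m ∣ x - y → m ∣ y - x
      ∣-flip {m} {x} {y} d = subst (m ∣_) (ring x y) (∣m⇒∣-m d)
        where ring : ∀ x y → - (x - y) ≡ y - x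
              ring = solve-∀

      -- The zeros are (0, 1, √v), (1, 0, √u) and (v, √(-uv), 0), with roots from `hensel`. For two
      -- units, pigeonhole gives u x² + v y² ≡ 1, and the root of the left side is lifted.
      tame⇒core-solution : ∀ ε φ → tame ε u φ v ≡ Sign.+ → ∀ k → Solution (core ε u) (core φ v) k
      tame⇒core-solution false false _ k = start (represent nu nv (+ 1))
        where
        start : (∃ λ x → ∃ λ y → u * (x * x) + v * (y * y) ≋ + 1 mod p) → Solution u v k
        start (x , y , e) = finish (hensel nw (trans (Half.legendre-cong h e) (Half.legendre-square h pp (∤1 pp))) k)
          where
          w = u * (x * x) + v * (y * y)
          nw : ¬ (P ∣ w)
          nw = ∤-≋ (≋-sym e) (∤1 pp)
          finish : (∃ λ z → ¬ (P ∣ z) × P ^ suc k ∣ z * z - w) → Solution u v k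
          finish (z , nz , d) = sol x y z (λ (_ , _ , dz) → nz dz) (∣-flip {x = z * z} {w} (weaken {k} d))
      tame⇒core-solution true false e k = finish (hensel nv e k)
        where
        ring : ∀ P u v z → v - z * z ≡ P * u * (+ 0 * + 0) + v * (+ 1 * + 1) - z * z
        ring = solve-∀
        finish : (∃ λ z → ¬ (P ∣ z) × P ^ suc k ∣ z * z - v) → Solution (P * u) v k
        finish (z , nz , d) = sol (+ 0) (+ 1) z (λ (_ , dy , _) → ∤1 pp dy) (subst (P ^ k ∣_) (ring P u v z) (∣-flip {x = z * z} {v} (weaken {k} d)))
      tame⇒core-solution false true e k = finish (hensel nu e k)
        where
        ring : ∀ P u v z → u - z * z ≡ u * (+ 1 * + 1) + P * v * (+ 0 * + 0) - z * z
        ring = solve-∀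
        finish : (∃ λ z → ¬ (P ∣ z) × P ^ suc k ∣ z * z - u) → Solution u (P * v) k
        finish (z , nz , d) = sol (+ 1) (+ 0) z (λ (dx , _ , _) → ∤1 pp dx) (subst (P ^ k ∣_) (ring P u v z) (∣-flip {x = z * z} {u} (weaken {k} d)))
      tame⇒core-solution true true e k = finish (hensel (∤-neg (∤-* pp nu nv)) e k)
        where
        ring : ∀ P u v z → P * v * (z * z - - (u * v)) ≡ P * u * (v * v) + P * v * (z * z) - + 0 * + 0
        ring = solve-∀
        finish : (∃ λ z → ¬ (P ∣ z) × P ^ suc k ∣ z * z - - (u * v)) → Solution (P * u) (P * v) k
        finish (z , nz , d) = sol v z (+ 0) (λ (dv , _ , _) → nv dv) (subst (P ^ k ∣_) (ring P u v z) (∣n⇒∣m*n (P * v) (weaken {k} d)))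

    square-part : ∀ e → ∃ λ i → ∀ u → P ^ e * u ≡ core (odd e) u * (P ^ i * P ^ i)
    square-part e with halve e
    ... | i , inj₁ refl = i , λ u → trans (trans (cong (_* u) (^-distribˡ-+-* P i i)) (*-comm (P ^ i * P ^ i) u)) (cong (λ t → core t u * (P ^ i * P ^ i)) (sym (odd-double i)))
    ... | i , inj₂ refl = i , λ u → trans (trans (cong (λ t → P * t * u) (^-distribˡ-+-* P i i)) (ring P (P ^ i) u)) (cong (λ t → core (not t) u * (P ^ i * P ^ i)) (sym (odd-double i)))
      where
      ring : ∀ P F u → P * (F * F) * u ≡ P * u * (F * F)
      ring = solve-∀

    splits⇒solution : ∀ {a b} → SplitsAtPrime a b p → ∀ k → Solution a b k
    splits⇒solution {a} {b} s k = let (x , y , z , prim , d) = s k in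
      sol x y z (λ (dx , dy , dz) → prim (∣⇒∣ᵤ dx , ∣⇒∣ᵤ dy , ∣⇒∣ᵤ dz)) (subst (_∣ form a b x y z) (pos-^ p k) (∣ᵤ⇒∣ d))

    solution⇒splits : ∀ {a b} → (∀ k → Solution a b k) → SplitsAtPrime a b p
    solution⇒splits {a} {b} s k = let sol x y z prim d = s k in
      x , y , z , (λ (dx , dy , dz) → prim (∣ᵤ⇒∣ dx , ∣ᵤ⇒∣ dy , ∣ᵤ⇒∣ dz)) , ∣⇒∣ᵤ (subst (_∣ form a b x y z) (sym (pos-^ p k)) d)

    module _ {a b u v : ℤ} (e f : ℕ) (ea : a ≡ P ^ e * u) (eb : b ≡ P ^ f * v) (nu : ¬ (P ∣ u)) (nv : ¬ (P ∣ v)) where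

      private
        i = proj₁ (square-part e)
        j = proj₁ (square-part f)
        a≡ : a ≡ core (odd e) u * (P ^ i * P ^ i)
        a≡ = trans ea (proj₂ (square-part e) u)
        b≡ : b ≡ core (odd f) v * (P ^ j * P ^ j)
        b≡ = trans eb (proj₂ (square-part f) v)

      splits⇒tame : SplitsAtPrime a b p → tame (odd e) u (odd f) v ≡ Sign.+
      splits⇒tame s = core-solution⇒tame nu nv (odd e) (odd f) (to-core (core (odd e) u) (core (odd f) v) i j 2
        (subst₂ (λ x y → Solution x y (2 ℕ.+ (i ℕ.+ j ℕ.+ (i ℕ.+ j)))) a≡ b≡ (splits⇒solution s _)))

      tame⇒splits : tame (odd e) u (odd f) v ≡ Sign.+ → SplitsAtPrime a b p
      tame⇒splits t = solution⇒splits λ k → subst₂ (λ x y → Solution x y k) (sym a≡) (sym b≡)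
        (from-core (core (odd e) u) (core (odd f) v) i j k (tame⇒core-solution nu nv (odd e) (odd f) t _))

-- Real characters modulo N and duality over 𝔽₂.

module Characters where

  open import Data.Nat using (_%_; _/_)
  open import Data.Nat.DivMod using (m≡m%n+[m/n]*n; m%n<n)
  open import Data.Nat.Coprimality as Coprimality using (Coprime; coprime?; coprime-divisor)
  open import Data.Integer as ℤ using (ℤ; +_; _+_; _*_; -_; ∣_∣)
  open import Data.List using ([]; _∷_; map; upTo; applyUpTo)
  open import Data.List.Membership.Propositional using (_∈_)
  open import Data.List.Membership.Propositional.Properties using (∈-upTo⁺; ∈-upTo⁻)
  open import Data.List.Relation.Unary.Unique.Propositional.Properties using (applyUpTo⁺₁)
  open import Data.List.Relation.Binary.Permutation.Propositional using (_↭_)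
  open import Data.Vec as Vec using (Vec; []; _∷_)
  open import Relation.Nullary.Decidable using (¬¬-excluded-middle)
  open BigOp
  open Sums
  open Legendre using (⟦_⟧; ⟦⟧-*)
  open CharacterPair using (Character)
  open Witt using (*-cancel0)
  open WeakHasse using (module Σℤ)

  coprime-* : ∀ {m n N} → Coprime m N → Coprime n N → Coprime (m ℕ.* n) N
  coprime-* {m} {n} {N} cm cn {d} (d∣mn , d∣N) = cn (coprime-divisor {d} {m} (λ (e∣d , e∣m) → cm (e∣m , ℕD.∣-trans e∣d d∣N)) d∣mn , d∣N)

  coprime-*ˡ : ∀ {m n N} → Coprime (m ℕ.* n) N → Coprime m N
  coprime-*ˡ {m} {n} c (d∣m , d∣N) = c (ℕD.∣m⇒∣m*n n d∣m , d∣N)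

  coprime-*ʳ : ∀ {m n N} → Coprime (m ℕ.* n) N → Coprime n N
  coprime-*ʳ {m} {n} c (d∣n , d∣N) = c (ℕD.∣n⇒∣m*n m d∣n , d∣N)

  coprime-+⁻ : ∀ {n N} → Coprime (N ℕ.+ n) N → Coprime n N
  coprime-+⁻ c (d∣n , d∣N) = c (ℕD.∣m∣n⇒∣m+n d∣N d∣n , d∣N)

  -- Signs have no zero, so the values at arguments not coprime to N are left unconstrained; `lift`
  -- replaces them by 0.
  record SignCharacter (N : ℕ) (σ : ℕ → Sign) : Set where
    field
      σ-*   : ∀ {m n} → Coprime m N → Coprime n N → σ (m ℕ.* n) ≡ σ m Sign.* σ n
      σ-per : ∀ {n} → Coprime n N → σ (N ℕ.+ n) ≡ σ n

    σ-1 : σ 1 ≡ Sign.+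
    σ-1 = SignP.*-cancelˡ-≡ (σ 1) (σ 1) Sign.+ (trans (sym (σ-* {1} {1} (Coprimality.1-coprimeTo N) (Coprimality.1-coprimeTo N))) (sym (SignP.*-identityʳ (σ 1))))

  sign-interchange : ∀ a b c d → (a Sign.* b) Sign.* (c Sign.* d) ≡ (a Sign.* c) Sign.* (b Sign.* d)
  sign-interchange a b c d = trans (SignP.*-assoc a b _) (trans (cong (a Sign.*_) (trans (sym (SignP.*-assoc b c d)) (trans (cong (Sign._* d) (SignP.*-comm b c)) (SignP.*-assoc c b d)))) (sym (SignP.*-assoc a c _)))

  trivial-character : ∀ {N} → SignCharacter N (λ _ → Sign.+)
  trivial-character = record { σ-* = λ _ _ → refl ; σ-per = λ _ → refl }

  product-character : ∀ {N σ τ} → SignCharacter N σ → SignCharacter N τ → SignCharacter N (λ n → σ n Sign.* τ n)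
  product-character {N} {σ} {τ} s t = record
    { σ-*   = λ {m} {n} cm cn → trans (cong₂ Sign._*_ (SignCharacter.σ-* s cm cn) (SignCharacter.σ-* t cm cn)) (sign-interchange (σ m) (σ n) (τ m) (τ n))
    ; σ-per = λ c → cong₂ Sign._*_ (SignCharacter.σ-per s c) (SignCharacter.σ-per t c) }

  lift : ℕ → (ℕ → Sign) → ℕ → ℤ
  lift N σ n with coprime? n N
  ... | yes _ = ⟦ σ n ⟧
  ... | no  _ = + 0

  lift-yes : ∀ {N σ n} → Coprime n N → lift N σ n ≡ ⟦ σ n ⟧
  lift-yes {N} {σ} {n} c with coprime? n N
  ... | yes _ = refl
  ... | no  h = ⊥-elim (h c)

  lift-no : ∀ {N σ n} → ¬ Coprime n N → lift N σ n ≡ + 0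
  lift-no {N} {σ} {n} h with coprime? n N
  ... | yes c = ⊥-elim (h c)
  ... | no  _ = refl

  Σℤ-Σ< : ∀ (f : ℕ → ℤ) g n → Σℤ.big f (applyUpTo g n) ≡ Σ< n (λ i → f (g i))
  Σℤ-Σ< f g zero    = refl
  Σℤ-Σ< f g (suc n) = trans (cong (_+_ (f (g 0))) (Σℤ-Σ< f (λ i → g (suc i)) n)) (sym (Σ-head n (λ i → f (g i))))

  module _ {N : ℕ} {σ : ℕ → Sign} (1<N : 1 ℕ.< N) (s : SignCharacter N σ) {u : ℕ} (cu : Coprime u N) (σu : σ u ≡ Sign.-) where

    open SignCharacter s

    private
      instance N≢0 = ℕ.>-nonZero (ℕP.<-trans (ℕ.s≤s ℕ.z≤n) 1<N)

      χ : ℕ → ℤ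
      χ = lift N σ

      mult : ∀ m n → χ (m ℕ.* n) ≡ χ m * χ n
      mult m n = cases (coprime? m N) (coprime? n N)
        where
        cases : Dec (Coprime m N) → Dec (Coprime n N) → χ (m ℕ.* n) ≡ χ m * χ n
        cases (yes cm) (yes cn) = trans (lift-yes (coprime-* cm cn)) (trans (trans (cong ⟦_⟧ (σ-* cm cn)) (⟦⟧-* (σ m) (σ n))) (sym (cong₂ _*_ (lift-yes {σ = σ} cm) (lift-yes {σ = σ} cn))))
        cases (no h) _  = trans (lift-no {n = m ℕ.* n} (λ c → h (coprime-*ˡ {m} {n} c))) (sym (trans (cong (_* χ n) (lift-no {σ = σ} h)) (ℤP.*-zeroˡ (χ n))))
        cases (yes _) (no h) = trans (lift-no {n = m ℕ.* n} (λ c → h (coprime-*ʳ {m} {n} c))) (sym (trans (cong (χ m *_) (lift-no {σ = σ} h)) (ℤP.*-zeroʳ (χ m))))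

      period : ∀ n → χ (N ℕ.+ n) ≡ χ n
      period n = cases (coprime? n N)
        where
        cases : Dec (Coprime n N) → χ (N ℕ.+ n) ≡ χ n
        cases (yes c) = trans (lift-yes (Coprimality.coprime-+ c)) (trans (cong ⟦_⟧ (σ-per c)) (sym (lift-yes {σ = σ} c)))
        cases (no h)  = trans (lift-no {n = N ℕ.+ n} (λ c → h (coprime-+⁻ c))) (sym (lift-no {σ = σ} h))

      bounded : ∀ n → ∣ χ n ∣ ℕ.≤ 1
      bounded n with coprime? n N
      ... | no _ = ℕ.z≤n
      ... | yes _ = lem (σ n)
        where lem : ∀ s → ∣ ⟦ s ⟧ ∣ ℕ.≤ 1
              lem Sign.+ = ℕP.≤-refl
              lem Sign.- = ℕP.≤-refl

      χ-% : ∀ m → χ (m % N) ≡ χ m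
      χ-% m = trans (sym (periods (m / N) (m % N))) (cong χ (trans (ℕP.+-comm _ (m % N)) (sym (m≡m%n+[m/n]*n m N))))
        where
        periods : ∀ i m → χ (i ℕ.* N ℕ.+ m) ≡ χ m
        periods zero    m = refl
        periods (suc i) m = trans (cong χ (ℕP.+-assoc N (i ℕ.* N) m)) (trans (period _) (periods i m))

      f : ℕ → ℕ
      f n = (u ℕ.* n) % N

      cancel-u : ∀ {x y} → x ℕ.≤ y → y ℕ.< N → f x ≡ f y → x ≡ y
      cancel-u {x} {y} x≤y y<N e = ℕP.≤-antisym x≤y (ℕP.m∸n≡0⇒m≤n (small (y ℕ.∸ x) (ℕP.≤-<-trans (ℕP.m∸n≤m y x) y<N) (coprime-divisor (Coprimality.sym cu) N∣u[y∸x])))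
        where
        small : ∀ d → d ℕ.< N → N ℕD.∣ d → d ≡ 0
        small zero    l h = refl
        small (suc d) l h = ⊥-elim (ℕP.<⇒≱ l (ℕD.∣⇒≤ h))
        N∣u[y∸x] : N ℕD.∣ u ℕ.* (y ℕ.∸ x)
        N∣u[y∸x] = subst (N ℕD.∣_) (sym (ℕP.*-distribˡ-∸ u y x)) (subst₂ (λ A B → N ℕD.∣ A ℕ.∸ B) (sym (m≡m%n+[m/n]*n (u ℕ.* y) N)) (sym (trans (m≡m%n+[m/n]*n (u ℕ.* x) N) (cong (ℕ._+ (u ℕ.* x) / N ℕ.* N) e)))
          (ℕD.divides ((u ℕ.* y) / N ℕ.∸ (u ℕ.* x) / N) (trans (ℕP.[m+n]∸[m+o]≡n∸o (f y) _ _) (sym (ℕP.*-distribʳ-∸ N ((u ℕ.* y) / N) ((u ℕ.* x) / N))))))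

      injective : ∀ {x y} → x ∈ upTo N → y ∈ upTo N → f x ≡ f y → x ≡ y
      injective {x} {y} x∈ y∈ e with ℕP.≤-total x y
      ... | inj₁ l = cancel-u l (∈-upTo⁻ y∈) e
      ... | inj₂ l = sym (cancel-u l (∈-upTo⁻ x∈) (sym e))

      f-permutes : map f (upTo N) ↭ upTo N
      f-permutes = permutes f (applyUpTo⁺₁ (λ i → i) N (λ i<j _ → ℕP.<⇒≢ i<j)) (λ {x} _ → ∈-upTo⁺ (m%n<n (u ℕ.* x) N)) injective

      -- Multiplication by u permutes the residues mod N and changes the sign of every value, so the
      -- sum is its own negative.
      sum-zero : Σ< N χ ≡ + 0
      sum-zero = *-cancel0 {+ 2} (λ ()) (trans (ring (Σ< N χ)) (trans (cong (λ t → Σ< N χ + t) invariant) (ℤP.+-inverseʳ (Σ< N χ))))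
        where
        ring : ∀ s → + 2 * s ≡ s + s
        ring = solve-∀
        invariant : Σ< N χ ≡ - Σ< N χ
        invariant = begin
          Σ< N χ                          ≡⟨ sym (Σℤ-Σ< χ (λ i → i) N) ⟩
          Σℤ.big χ (upTo N)               ≡⟨ sym (Σℤ.big-↭ χ f-permutes) ⟩
          Σℤ.big χ (map f (upTo N))       ≡⟨ Σℤ.big-map χ f (upTo N) ⟩
          Σℤ.big (λ n → χ (f n)) (upTo N) ≡⟨ Σℤ-Σ< (λ n → χ (f n)) (λ i → i) N ⟩
          Σ< N (λ n → χ (f n))            ≡⟨ Σ-cong′ N (λ n → trans (χ-% (u ℕ.* n)) (trans (mult u n) (cong (_* χ n) (trans (lift-yes {σ = σ} cu) (cong ⟦_⟧ σu))))) ⟩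
          Σ< N (λ n → - (+ 1) * χ n)      ≡⟨ Σ-*ˡ N (- (+ 1)) χ ⟩
          - (+ 1) * Σ< N χ                ≡⟨ ℤP.-1*i≡-i (Σ< N χ) ⟩
          - Σ< N χ                        ∎
          where open ≡-Reasoning

    lift-character : Character N (lift N σ)
    lift-character = record
      { χ-0   = lift-no {n = 0} (λ c → ℕP.<⇒≢ 1<N (sym (c (N ℕD.∣0 , ℕD.∣-refl))))
      ; χ-1   = trans (lift-yes (Coprimality.1-coprimeTo N)) (cong ⟦_⟧ σ-1)
      ; χ-*   = mult
      ; χ-bd  = bounded
      ; χ-per = period
      ; χ-sum = sum-zero }

  dot : ∀ {n} → Vec Bool n → Vec Sign n → Sign
  dot []          []      = Sign.+
  dot (true ∷ T)  (s ∷ v) = s Sign.* dot T v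
  dot (false ∷ T) (s ∷ v) = dot T v

  _⊛_ : ∀ {n} → Vec Sign n → Vec Sign n → Vec Sign n
  _⊛_ = Vec.zipWith Sign._*_

  dot-⊛ : ∀ {n} (T : Vec Bool n) u v → dot T (u ⊛ v) ≡ dot T u Sign.* dot T v
  dot-⊛ []          []      []      = refl
  dot-⊛ (true ∷ T)  (s ∷ u) (t ∷ v) = trans (cong ((s Sign.* t) Sign.*_) (dot-⊛ T u v)) (sign-interchange s t (dot T u) (dot T v))
  dot-⊛ (false ∷ T) (s ∷ u) (t ∷ v) = dot-⊛ T u v

  ⊛-self : ∀ {n} (u v : Vec Sign n) → u ⊛ (u ⊛ v) ≡ v
  ⊛-self []      []      = refl
  ⊛-self (s ∷ u) (t ∷ v) = cong₂ _∷_ (trans (sym (SignP.*-assoc s s t)) (cong (Sign._* t) (SignP.s*s≡+ s))) (⊛-self u v)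

  Separates : ∀ {n} → (Vec Sign n → Set) → Vec Sign n → Vec Bool n → Set
  Separates G τ T = (∀ g → G g → dot T g ≡ Sign.+) × dot T τ ≡ Sign.-

  -- Linear duality over 𝔽₂, written multiplicatively.
  separation : ∀ {n} (G : Vec Sign n → Set) → G (Vec.replicate n Sign.+) → (∀ {u v} → G u → G v → G (u ⊛ v)) →
               ∀ τ → ¬ ¬ (G τ ⊎ ∃ (Separates G τ))
  separation {zero} G g1 g* [] k = k (inj₁ g1)
  separation {suc n} G g1 g* (t ∷ τ) k = ¬¬-excluded-middle {A = ∃ λ w → G (Sign.- ∷ w)} λ
    { (yes (w , gw)) → have w gw t k
    ; (no none)      → without none t k }
    where
    G₀ : Vec Sign n → Set
    G₀ v = G (Sign.+ ∷ v)
    recurse : ∀ τ → ¬ ¬ (G₀ τ ⊎ ∃ (Separates G₀ τ))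
    recurse = separation G₀ g1 g*
    -- A functional T on the vectors with first entry + extends in exactly one way to a functional
    -- that also kills (-, w): its first coefficient compensates `dot T w`.
    bit : Sign → Bool
    bit Sign.+ = false
    bit Sign.- = true
    kills : ∀ w → G (Sign.- ∷ w) → (T : Vec Bool n) → (∀ g → G₀ g → dot T g ≡ Sign.+) → ∀ g → G g → dot (bit (dot T w) ∷ T) g ≡ Sign.+
    kills w gw T h (Sign.+ ∷ v) gv with dot T w
    ... | Sign.+ = h v gv
    ... | Sign.- = h v gv
    kills w gw T h (Sign.- ∷ v) gv with dot T w in e
    ... | Sign.+ = trans (sym (trans (dot-⊛ T w v) (cong (Sign._* dot T v) e))) (h (w ⊛ v) (g* gw gv))
    ... | Sign.- = trans (sym (trans (dot-⊛ T w v) (cong (Sign._* dot T v) e))) (h (w ⊛ v) (g* gw gv))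
    have : ∀ w → G (Sign.- ∷ w) → ∀ t → ¬ ¬ (G (t ∷ τ) ⊎ ∃ (Separates G (t ∷ τ)))
    have w gw Sign.+ k = recurse τ λ
      { (inj₁ g) → k (inj₁ g)
      ; (inj₂ (T , h , e)) → k (inj₂ (bit (dot T w) ∷ T , kills w gw T h , plus-case T e)) }
      where
      plus-case : ∀ T → dot T τ ≡ Sign.- → dot (bit (dot T w) ∷ T) (Sign.+ ∷ τ) ≡ Sign.-
      plus-case T e with dot T w
      ... | Sign.+ = e
      ... | Sign.- = e
    have w gw Sign.- k = recurse (w ⊛ τ) λ
      { (inj₁ g) → k (inj₁ (subst (λ v → G (Sign.- ∷ v)) (⊛-self w τ) (g* gw g)))
      ; (inj₂ (T , h , e)) → k (inj₂ (bit (dot T w) ∷ T , kills w gw T h , minus-case T e)) }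
      where
      minus-case : ∀ T → dot T (w ⊛ τ) ≡ Sign.- → dot (bit (dot T w) ∷ T) (Sign.- ∷ τ) ≡ Sign.-
      minus-case T e with dot T w in ew
      ... | Sign.+ = trans (sym (trans (dot-⊛ T w τ) (cong (Sign._* dot T τ) ew))) e
      ... | Sign.- = trans (sym (trans (dot-⊛ T w τ) (cong (Sign._* dot T τ) ew))) e
    without : ¬ (∃ λ w → G (Sign.- ∷ w)) → ∀ t → ¬ ¬ (G (t ∷ τ) ⊎ ∃ (Separates G (t ∷ τ)))
    without none Sign.- k = k (inj₂ (true ∷ Vec.replicate n false , none-kills , cong (Sign.- Sign.*_) (dot-none τ)))
      where
      dot-none : ∀ {n} (v : Vec Sign n) → dot (Vec.replicate n false) v ≡ Sign.+
      dot-none []      = refl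
      dot-none (s ∷ v) = dot-none v
      none-kills : ∀ g → G g → dot (true ∷ Vec.replicate n false) g ≡ Sign.+
      none-kills (Sign.+ ∷ v) g = dot-none v
      none-kills (Sign.- ∷ v) g = ⊥-elim (none (v , g))
    without none Sign.+ k = recurse τ λ
      { (inj₁ g) → k (inj₁ g)
      ; (inj₂ (T , h , e)) → k (inj₂ (false ∷ T , kills₀ T h , e)) }
      where
      kills₀ : ∀ T → (∀ g → G₀ g → dot T g ≡ Sign.+) → ∀ g → G g → dot (false ∷ T) g ≡ Sign.+
      kills₀ T h (Sign.+ ∷ v) g = h v g
      kills₀ T h (Sign.- ∷ v) g = ⊥-elim (none (v , g))

-- The character (d/·) and a product of split primes with prescribed residues.

module Auxiliary where

  open import Data.Nat using (⌊_/2⌋)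
  open import Data.Nat.Primality using (prime[2]; euclidsLemma; prime⇒irreducible)
  open import Data.Nat.Coprimality as Coprimality using (Coprime; coprime?)
  open import Data.Integer as ℤ using (ℤ; +_; _+_; _*_; _-_; -_; _^_)
  open import Data.Integer.Divisibility.Signed using (_∣_; divides; ∣⇒∣ᵤ; ∣ᵤ⇒∣; ∣-trans)
  open import Data.Vec as Vec using (Vec; []; _∷_)
  open import Data.Vec.Relation.Unary.All as All using (All; []; _∷_)
  open Congruence
  open Legendre using (module Half; ⟦_⟧)
  open Reciprocity
  open CharacterPair using (Character; Compatible; both-+; +∧-; -∧+; both-0; no-compatible-pair)
  open Residue using (halve)
  open Characters
  open Half using (legendre)

  oddℕ : ℕ → ℕ
  oddℕ h = suc (h ℕ.+ h)

  oddℕ-injective : ∀ {h g} → oddℕ h ≡ oddℕ g → h ≡ g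
  oddℕ-injective {h} {g} e = trans (sym (half h)) (trans (cong ⌊_/2⌋ (ℕP.suc-injective e)) (half g))
    where
    half : ∀ a → ⌊ a ℕ.+ a /2⌋ ≡ a
    half a = sym (ℕP.n≡⌊n+n/2⌋ a)

  ⌊oddℕ/2⌋ : ∀ a → ⌊ oddℕ a /2⌋ ≡ a
  ⌊oddℕ/2⌋ zero    = refl
  ⌊oddℕ/2⌋ (suc a) = cong suc (trans (cong ⌊_/2⌋ (ℕP.+-suc a a)) (⌊oddℕ/2⌋ a))

  pow : Sign → ℕ → Sign
  pow s zero    = Sign.+
  pow s (suc n) = s Sign.* pow s n

  pow-+ : ∀ n → pow Sign.+ n ≡ Sign.+
  pow-+ zero    = refl
  pow-+ (suc n) = pow-+ n

  pow-- : ∀ n → pow Sign.- n ≡ negs n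
  pow-- zero    = refl
  pow-- (suc n) = cong opposite (pow-- n)

  pow-negs : ∀ g h → pow (negs g) h ≡ negs (h ℕ.* g)
  pow-negs g zero    = refl
  pow-negs g (suc h) = trans (cong (negs g Sign.*_) (pow-negs g h)) (sym (negs-+ g (h ℕ.* g)))

  pow-character : ∀ {N σ} → SignCharacter N σ → ∀ k → SignCharacter N (λ n → pow (σ n) k)
  pow-character s zero    = trivial-character
  pow-character s (suc k) = product-character s (pow-character s k)

  κ-+4 : ∀ n m → κ (4 ℕ.* m ℕ.+ n) ≡ κ n
  κ-+4 n zero    = refl
  κ-+4 n (suc m) = trans (cong κ (ring m n)) (trans (SignP.opposite-involutive _) (κ-+4 n m))
    where ring : ∀ m n → 4 ℕ.* suc m ℕ.+ n ≡ 4 ℕ.+ (4 ℕ.* m ℕ.+ n)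
          ring = ℕRing.solve-∀

  -- Multiplicativity of (2/n), read off on halves: (2a + 1)(2b + 1) = 2(2ab + a + b) + 1.
  κ-* : ∀ a b → κ (a ℕ.* b ℕ.+ a ℕ.* b ℕ.+ a ℕ.+ b) ≡ κ a Sign.* κ b
  κ-* 0 b = refl
  κ-* 1 b = trans (cong κ (ring b)) (step b)
    where
    ring : ∀ b → 1 ℕ.* b ℕ.+ 1 ℕ.* b ℕ.+ 1 ℕ.+ b ≡ suc (3 ℕ.* b)
    ring = ℕRing.solve-∀
    step : ∀ b → κ (suc (3 ℕ.* b)) ≡ opposite (κ b)
    step 0 = refl
    step 1 = refl
    step (suc (suc b)) = trans (cong (λ t → κ (suc t)) (ring′ b)) (trans (SignP.opposite-involutive _) (cong opposite (step b)))
      where ring′ : ∀ b → 3 ℕ.* suc (suc b) ≡ suc (suc (suc (suc (suc (suc (3 ℕ.* b))))))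
            ring′ = ℕRing.solve-∀
  κ-* (suc (suc a)) b = trans (cong κ (ring a b)) (trans (κ-+4 _ b) (trans (cong opposite (κ-* a b)) (sym (opposite-*ˡ (κ a) (κ b)))))
    where ring : ∀ a b → suc (suc a) ℕ.* b ℕ.+ suc (suc a) ℕ.* b ℕ.+ suc (suc a) ℕ.+ b ≡ 4 ℕ.* b ℕ.+ suc (suc (a ℕ.* b ℕ.+ a ℕ.* b ℕ.+ a ℕ.+ b))
          ring = ℕRing.solve-∀

  oddℕ-* : ∀ a b → oddℕ a ℕ.* oddℕ b ≡ oddℕ (a ℕ.* b ℕ.+ a ℕ.* b ℕ.+ a ℕ.+ b)
  oddℕ-* = ring
    where ring : ∀ a b → suc (a ℕ.+ a) ℕ.* suc (b ℕ.+ b) ≡ suc (a ℕ.* b ℕ.+ a ℕ.* b ℕ.+ a ℕ.+ b ℕ.+ (a ℕ.* b ℕ.+ a ℕ.* b ℕ.+ a ℕ.+ b))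
          ring = ℕRing.solve-∀

  coprime-odd : ∀ {N n} → 2 ℕD.∣ N → Coprime n N → ∃ λ a → n ≡ oddℕ a
  coprime-odd {N} {n} d c with halve n
  ... | a , inj₂ e = a , e
  ... | a , inj₁ refl with c (ℕD.divides a (trans (cong (a ℕ.+_) (sym (ℕP.+-identityʳ a))) (ℕP.*-comm 2 a)) , d)
  ...   | ()

  -- Covers (-1/n) and (2/n) at once. Numbers coprime to 8 M are odd, and a shift by 8 M moves the
  -- half by 4 M.
  half-character : ∀ (ω : ℕ → Sign) (M : ℕ) → (∀ a b → ω (a ℕ.* b ℕ.+ a ℕ.* b ℕ.+ a ℕ.+ b) ≡ ω a Sign.* ω b) →
                   (∀ n m → ω (4 ℕ.* m ℕ.+ n) ≡ ω n) → SignCharacter (8 ℕ.* M) (λ n → ω ⌊ n /2⌋)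
  half-character ω M ω-* ω-4 = record { σ-* = mult ; σ-per = per }
    where
    even : 2 ℕD.∣ 8 ℕ.* M
    even = ℕD.divides (4 ℕ.* M) (ring M)
      where ring : ∀ m → 8 ℕ.* m ≡ 4 ℕ.* m ℕ.* 2
            ring = ℕRing.solve-∀
    mult : ∀ {m n} → Coprime m (8 ℕ.* M) → Coprime n (8 ℕ.* M) → ω ⌊ m ℕ.* n /2⌋ ≡ ω ⌊ m /2⌋ Sign.* ω ⌊ n /2⌋
    mult cm cn with coprime-odd even cm | coprime-odd even cn
    ... | a , refl | b , refl = trans (cong ω (trans (cong ⌊_/2⌋ (oddℕ-* a b)) (⌊oddℕ/2⌋ _)))
          (trans (ω-* a b) (sym (cong₂ (λ x y → ω x Sign.* ω y) (⌊oddℕ/2⌋ a) (⌊oddℕ/2⌋ b))))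
    per : ∀ {n} → Coprime n (8 ℕ.* M) → ω ⌊ 8 ℕ.* M ℕ.+ n /2⌋ ≡ ω ⌊ n /2⌋
    per cn with coprime-odd even cn
    ... | a , refl = trans (cong ω (trans (cong ⌊_/2⌋ (ring M a)) (⌊oddℕ/2⌋ (4 ℕ.* M ℕ.+ a)))) (trans (ω-4 a M) (cong ω (sym (⌊oddℕ/2⌋ a))))
      where ring : ∀ m a → 8 ℕ.* m ℕ.+ suc (a ℕ.+ a) ≡ suc (4 ℕ.* m ℕ.+ a ℕ.+ (4 ℕ.* m ℕ.+ a))
            ring = ℕRing.solve-∀

  negs-+4 : ∀ n m → negs (4 ℕ.* m ℕ.+ n) ≡ negs n
  negs-+4 n m = trans (negs-+ (4 ℕ.* m) n) (cong (Sign._* negs n) (trans (cong negs (ring m)) (negs-double (m ℕ.+ m))))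
    where ring : ∀ m → 4 ℕ.* m ≡ m ℕ.+ m ℕ.+ (m ℕ.+ m)
          ring = ℕRing.solve-∀

  negs-odd-* : ∀ a b → negs (a ℕ.* b ℕ.+ a ℕ.* b ℕ.+ a ℕ.+ b) ≡ negs a Sign.* negs b
  negs-odd-* a b = trans (negs-+ (a ℕ.* b ℕ.+ a ℕ.* b ℕ.+ a) b) (cong (Sign._* negs b) (trans (negs-+ (a ℕ.* b ℕ.+ a ℕ.* b) a) (cong (Sign._* negs a) (negs-double (a ℕ.* b)))))

  prod : ∀ {n} → Vec ℕ n → ℕ
  prod []       = 1
  prod (h ∷ hs) = oddℕ h ℕ.* prod hs

  coprime⇒∤ : ∀ {p N n} → Prime p → p ℕD.∣ N → Coprime n N → ¬ (+ p ∣ + n)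
  coprime⇒∤ pp d c e = ∤1 pp (∣ᵤ⇒∣ (ℕD.∣-reflexive (c (∣⇒∣ᵤ e , d))))

  legendre-character : ∀ {N} h → Prime (oddℕ h) → oddℕ h ℕD.∣ N → SignCharacter N (λ n → legendre h (+ n))
  legendre-character {N} h pp d = record
    { σ-*   = λ {m} {n} cm cn → trans (cong (legendre h) (ℤP.pos-* m n)) (Half.legendre-* h pp {+ m} {+ n} (coprime⇒∤ pp d cm) (coprime⇒∤ pp d cn))
    ; σ-per = λ {n} _ → Half.legendre-cong h {+ (N ℕ.+ n)} {+ n} (cong∣ (subst (+ oddℕ h ∣_) (sym (ring (+ N) (+ n))) (∣ᵤ⇒∣ d))) }
    where ring : ∀ N n → N + n - n ≡ N
          ring = solve-∀

  vals : ∀ {n} → Vec ℕ n → ℤ → Vec Sign n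
  vals hs x = Vec.map (λ h → legendre h x) hs

  PrimesDividing : ∀ {n} → ℕ → Vec ℕ n → Set
  PrimesDividing N = All (λ h → Prime (oddℕ h) × oddℕ h ℕD.∣ N)

  dot-character : ∀ {N n} (T : Vec Bool n) {hs : Vec ℕ n} → PrimesDividing N hs → SignCharacter N (λ m → dot T (vals hs (+ m)))
  dot-character []          []               = trivial-character
  dot-character (true ∷ T)  {h ∷ _} ((pp , d) ∷ all) = product-character (legendre-character h pp d) (dot-character T all)
  dot-character (false ∷ T) (_ ∷ all)        = dot-character T all

  vals-cong : ∀ {N n} {hs : Vec ℕ n} → PrimesDividing N hs → ∀ {x y} → x ≋ y mod N → vals hs x ≡ vals hs y
  vals-cong []              e = refl
  vals-cong {hs = h ∷ _} ((_ , d) ∷ all) e = cong₂ _∷_ (Half.legendre-cong h (≋-small d e)) (vals-cong all e)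

  vals-* : ∀ {N n} {hs : Vec ℕ n} → PrimesDividing N hs → ∀ {x y} → (∀ {p} → Prime p → p ℕD.∣ N → ¬ (+ p ∣ x)) → (∀ {p} → Prime p → p ℕD.∣ N → ¬ (+ p ∣ y)) →
           vals hs (x * y) ≡ vals hs x ⊛ vals hs y
  vals-* []               nx ny = refl
  vals-* {hs = h ∷ _} ((pp , d) ∷ all) nx ny = cong₂ _∷_ (Half.legendre-* h pp (nx pp d) (ny pp d)) (vals-* all nx ny)

  -- The primes in `hs` may repeat: d need not be squarefree, and N = 8 ∏ p is a period of (d/·) in
  -- any case.
  module Kronecker {n} (k : ℕ) (hs : Vec ℕ n) (all-prime : All (λ h → Prime (oddℕ h)) hs) (M : ℕ) (prod≡ : prod hs ≡ suc M) where

    N N-1 : ℕ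
    N   = 8 ℕ.* suc M
    N-1 = 7 ℕ.+ 8 ℕ.* M

    N≡ : N ≡ suc N-1
    N≡ = ring M
      where ring : ∀ m → 8 ℕ.* suc m ≡ suc (7 ℕ.+ 8 ℕ.* m)
            ring = ℕRing.solve-∀

    1<N : 1 ℕ.< N
    1<N = subst (1 ℕ.<_) (sym N≡) (ℕ.s≤s (ℕ.s≤s ℕ.z≤n))

    d : ℤ
    d = - (+ 1) * ((+ 2) ^ k * + prod hs)

    2∣N : 2 ℕD.∣ N
    2∣N = ℕD.divides (4 ℕ.* suc M) (ring M)
      where ring : ∀ m → 8 ℕ.* suc m ≡ 4 ℕ.* suc m ℕ.* 2
            ring = ℕRing.solve-∀

    prod∣N : prod hs ℕD.∣ N
    prod∣N = ℕD.divides 8 (cong (8 ℕ.*_) (sym prod≡))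

    divide-prod : ∀ {m} {gs : Vec ℕ m} → All (λ h → Prime (oddℕ h)) gs → prod gs ℕD.∣ N → PrimesDividing N gs
    divide-prod [] _ = []
    divide-prod {gs = g ∷ gs} (pp ∷ all) d = (pp , ℕD.∣-trans (ℕD.m∣m*n (prod gs)) d) ∷ divide-prod all (ℕD.∣-trans (ℕD.n∣m*n (oddℕ g)) d)

    primes : PrimesDividing N hs
    primes = divide-prod all-prime prod∣N

    α β : ℕ → Sign
    α m = negs ⌊ m /2⌋
    β m = κ ⌊ m /2⌋

    α-character : SignCharacter N α
    α-character = half-character negs (suc M) negs-odd-* negs-+4

    β-character : SignCharacter N β
    β-character = half-character κ (suc M) κ-* κ-+4

    ψs : ∀ {m} → Vec ℕ m → ℕ → Sign
    ψs []       n = Sign.+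
    ψs (h ∷ gs) n = (legendre h (+ n) Sign.* pow (α n) h) Sign.* ψs gs n

    -- (d/n) after reciprocity: each (p/n) is turned into (n/p) times a power of (-1/n). In this
    -- form periodicity in n is visible, and `ψ-prime` recovers the original meaning at primes.
    ψ : ℕ → Sign
    ψ n = α n Sign.* (pow (β n) k Sign.* ψs hs n)

    ψs-character : ∀ {m} {gs : Vec ℕ m} → PrimesDividing N gs → SignCharacter N (ψs gs)
    ψs-character [] = trivial-character
    ψs-character {gs = h ∷ gs} ((pp , d) ∷ all) = product-character (product-character (legendre-character h pp d) (pow-character α-character h)) (ψs-character all)

    ψ-character : SignCharacter N ψ
    ψ-character = product-character α-character (product-character (pow-character β-character k) (ψs-character primes))

    module _ {g : ℕ} (qq : Prime (oddℕ g)) (cq : Coprime (oddℕ g) N) where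

      prime-∤ : ∀ {p} → Prime p → p ℕD.∣ N → ¬ (+ oddℕ g ∣ + p)
      prime-∤ {p} pp d e with prime⇒irreducible pp (∣⇒∣ᵤ e)
      ... | inj₁ e₁ = ∤1 qq (∣ᵤ⇒∣ (ℕD.∣-reflexive e₁))
      ... | inj₂ e₂ = ∤1 qq (∣ᵤ⇒∣ (ℕD.∣-reflexive (cq (ℕD.∣-refl , subst (ℕD._∣ N) (sym e₂) d))))

      ∤2 : ¬ (+ oddℕ g ∣ + 2)
      ∤2 = prime-∤ prime[2] 2∣N

      ∤2^ : ∀ k → ¬ (+ oddℕ g ∣ (+ 2) ^ k)
      ∤2^ zero    = ∤1 qq
      ∤2^ (suc k) = ∤-* qq ∤2 (∤2^ k)

      ∤prod : ∀ {m} {gs : Vec ℕ m} → PrimesDividing N gs → ¬ (+ oddℕ g ∣ + prod gs)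
      ∤prod [] = ∤1 qq
      ∤prod {gs = h ∷ gs} ((pp , d) ∷ all) e = ∤-* qq (prime-∤ pp d) (∤prod all) (subst (+ oddℕ g ∣_) (ℤP.pos-* (oddℕ h) (prod gs)) e)

      legendre-2^ : ∀ k → legendre g ((+ 2) ^ k) ≡ pow (κ g) k
      legendre-2^ zero    = Half.legendre-square g qq {+ 1} (∤1 qq)
      legendre-2^ (suc k) = trans (Half.legendre-* g qq {+ 2} {(+ 2) ^ k} ∤2 (∤2^ k)) (cong₂ Sign._*_ (legendre-2 g) (legendre-2^ k))

      flip : ∀ {h} → Prime (oddℕ h) → oddℕ h ℕD.∣ N → legendre g (+ oddℕ h) ≡ legendre h (+ oddℕ g) Sign.* negs (h ℕ.* g)
      flip {h} pp d = trans (sym (cancel (legendre h (+ oddℕ g)) (legendre g (+ oddℕ h)))) (cong (legendre h (+ oddℕ g) Sign.*_)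
          (quadratic-reciprocity h g pp qq (coprime⇒∤ pp d cq) (prime-∤ pp d)))
        where cancel : ∀ x y → x Sign.* (x Sign.* y) ≡ y
              cancel x y = trans (sym (SignP.*-assoc x x y)) (cong (Sign._* y) (SignP.s*s≡+ x))

      legendre-prod : ∀ {m} {gs : Vec ℕ m} → PrimesDividing N gs → legendre g (+ prod gs) ≡ ψs gs (oddℕ g)
      legendre-prod [] = Half.legendre-square g qq {+ 1} (∤1 qq)
      legendre-prod {gs = h ∷ gs} ((pp , d) ∷ all) = trans (cong (legendre g) (ℤP.pos-* (oddℕ h) (prod gs)))
        (trans (Half.legendre-* g qq {+ oddℕ h} {+ prod gs} (prime-∤ pp d) (∤prod all)) (cong₂ Sign._*_
          (trans (flip {h} pp d) (cong (legendre h (+ oddℕ g) Sign.*_) (trans (sym (pow-negs g h)) (cong (λ t → pow (negs t) h) (sym (⌊oddℕ/2⌋ g)))))) (legendre-prod all)))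

      ψ-prime : ψ (oddℕ g) ≡ legendre g d
      ψ-prime = sym (trans (Half.legendre-* g qq { - (+ 1)} {(+ 2) ^ k * + prod hs} (∤-neg (∤1 qq)) (∤-* qq (∤2^ k) (∤prod primes)))
        (cong₂ Sign._*_ (trans (legendre-neg1 g qq) (cong negs (sym (⌊oddℕ/2⌋ g))))
          (trans (Half.legendre-* g qq {(+ 2) ^ k} {+ prod hs} (∤2^ k) (∤prod primes)) (cong₂ Sign._*_ (trans (legendre-2^ k) (cong (λ t → pow (κ t) k) (sym (⌊oddℕ/2⌋ g)))) (legendre-prod primes)))))

    ⌊N-1/2⌋ : ⌊ N-1 /2⌋ ≡ 4 ℕ.* M ℕ.+ 3
    ⌊N-1/2⌋ = trans (cong ⌊_/2⌋ (ring M)) (⌊oddℕ/2⌋ (4 ℕ.* M ℕ.+ 3))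
      where ring : ∀ m → 7 ℕ.+ 8 ℕ.* m ≡ suc (4 ℕ.* m ℕ.+ 3 ℕ.+ (4 ℕ.* m ℕ.+ 3))
            ring = ℕRing.solve-∀

    N-1≋-1 : + N-1 ≋ - (+ 1) mod N
    N-1≋-1 = cong∣ (divides (+ 1) (trans (ring (+ N-1)) (trans (cong +_ (sym N≡)) (sym (ℤP.*-identityˡ (+ N))))))
      where ring : ∀ x → x - - (+ 1) ≡ + 1 + x
            ring = solve-∀

    α-N-1 : α N-1 ≡ Sign.-
    α-N-1 = trans (cong negs ⌊N-1/2⌋) (negs-+4 3 M)

    β-N-1 : β N-1 ≡ Sign.+
    β-N-1 = trans (cong κ ⌊N-1/2⌋) (κ-+4 3 M)

    ψs-N-1 : ∀ {m} {gs : Vec ℕ m} → PrimesDividing N gs → ψs gs N-1 ≡ Sign.+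
    ψs-N-1 [] = refl
    ψs-N-1 {gs = h ∷ gs} ((pp , d) ∷ all) = cong₂ Sign._*_
      (trans (cong₂ Sign._*_ (trans (Half.legendre-cong h {+ N-1} { - (+ 1)} (≋-small d N-1≋-1)) (legendre-neg1 h pp)) (trans (cong (λ t → pow t h) α-N-1) (pow-- h))) (SignP.s*s≡+ (negs h)))
      (ψs-N-1 all)

    -- N - 1 stands for -1. All factors are + there except the one from the sign of d, so the
    -- character is odd because d < 0.
    ψ-N-1 : ψ N-1 ≡ Sign.-
    ψ-N-1 = cong₂ Sign._*_ α-N-1 (cong₂ Sign._*_ (trans (cong (λ t → pow t k) β-N-1) (pow-+ k)) (ψs-N-1 primes))

    -- The primes prime to N that split in ℚ(√d).
    GoodPrime : ℕ → Set
    GoodPrime g = Prime (oddℕ g) × Coprime (oddℕ g) N × legendre g d ≡ Sign.+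

    data GoodProduct : ℕ → Set where
      one   : GoodProduct 1
      times : ∀ {g m} → GoodPrime g → GoodProduct m → GoodProduct (oddℕ g ℕ.* m)

    good-coprime : ∀ {m} → GoodProduct m → Coprime m N
    good-coprime one = Coprimality.1-coprimeTo N
    good-coprime (times (_ , c , _) gm) = coprime-* c (good-coprime gm)

    good-* : ∀ {m m′} → GoodProduct m → GoodProduct m′ → GoodProduct (m ℕ.* m′)
    good-* {m′ = m′} one g = subst GoodProduct (sym (ℕP.*-identityˡ m′)) g
    good-* {m′ = m′} (times {g} {m} h gm) g′ = subst GoodProduct (sym (ℕP.*-assoc (oddℕ g) m m′)) (times {g} h (good-* gm g′))

    good-factor : ∀ {m p} → GoodProduct m → Prime p → p ℕD.∣ m → ∃ λ g → GoodPrime g × p ≡ oddℕ g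
    good-factor one pp e = ⊥-elim (∤1 pp (∣ᵤ⇒∣ e))
    good-factor {p = p} (times {g} {m} h gm) pp e with euclidsLemma (oddℕ g) m pp e
    ... | inj₂ e′ = good-factor gm pp e′
    ... | inj₁ e′ with prime⇒irreducible (proj₁ h) e′
    ...   | inj₁ refl = ⊥-elim (∤1 pp (∣ᵤ⇒∣ ℕD.∣-refl))
    ...   | inj₂ refl = g , h , refl

    good-positive : ∀ {m} → GoodProduct m → 0 ℕ.< m
    good-positive one = ℕ.s≤s ℕ.z≤n
    good-positive (times {g} h gm) = ℕP.*-mono-≤ (ℕ.s≤s (ℕ.z≤n {g ℕ.+ g})) (good-positive gm)

    -- The sign vectors realised by products of split primes. They contain the trivial vector and
    -- are closed under `⊛`, so `separation` applies.
    G : Vec Sign n → Set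
    G v = ∃ λ m → GoodProduct m × v ≡ vals hs (+ m)

    good-vals-* : ∀ {m m′} → GoodProduct m → GoodProduct m′ → vals hs (+ (m ℕ.* m′)) ≡ vals hs (+ m) ⊛ vals hs (+ m′)
    good-vals-* {m} {m′} gm gm′ = trans (cong (vals hs) (ℤP.pos-* m m′)) (vals-* primes (λ pp d → coprime⇒∤ pp d (good-coprime gm)) (λ pp d → coprime⇒∤ pp d (good-coprime gm′)))

    vals-1 : ∀ {m} {gs : Vec ℕ m} → PrimesDividing N gs → vals gs (+ 1) ≡ Vec.replicate m Sign.+
    vals-1 [] = refl
    vals-1 {gs = h ∷ _} ((pp , _) ∷ all) = cong₂ _∷_ (Half.legendre-square h pp {+ 1} (∤1 pp)) (vals-1 all)

    module _ (ρ : ℕ) (rr : Prime (oddℕ ρ)) (cr : Coprime (oddℕ ρ) N) (inert : legendre ρ d ≡ Sign.-) where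

      private
        r = oddℕ ρ
        τ = vals hs (- (+ r))

      module _ (T : Vec Bool n) (kills : ∀ g → G g → dot T g ≡ Sign.+) (Tτ : dot T τ ≡ Sign.-) where

        private
          σ₁ σ₂ : ℕ → Sign
          σ₁ m = dot T (vals hs (+ m))
          σ₂ m = ψ m Sign.* σ₁ m

          -- A natural number congruent to -r, as the characters are defined on ℕ only.
          u : ℕ
          u = N-1 ℕ.* r

          cN-1 : Coprime N-1 N
          cN-1 {e} (e∣ , e∣N) = ℕD.∣1⇒≡1 (ℕD.∣m+n∣m⇒∣n (subst (e ℕD.∣_) (trans N≡ (ℕP.+-comm 1 N-1)) e∣N) e∣)

          cu : Coprime u N
          cu = coprime-* cN-1 cr

          u≋-r : + u ≋ - (+ r) mod N
          u≋-r = ≋-trans (≋-reflexive (ℤP.pos-* N-1 r)) (≋-trans (≋-* N-1≋-1 (≋-refl {x = + r})) (≋-reflexive (ℤP.-1*i≡-i (+ r))))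

          s₁ : SignCharacter N σ₁
          s₁ = dot-character T primes

          σ₁u : σ₁ u ≡ Sign.-
          σ₁u = trans (cong (dot T) (vals-cong primes u≋-r)) Tτ

          σ₂u : σ₂ u ≡ Sign.-
          σ₂u = cong₂ Sign._*_ (trans (SignCharacter.σ-* ψ-character cN-1 cr) (cong₂ Sign._*_ ψ-N-1 (trans (ψ-prime {ρ} rr cr) inert))) σ₁u

          -- If σ₁ is - at a prime, the prime is not split, as T kills the vectors of split primes.
          -- Then ψ is - there, so σ₂ = ψ σ₁ is +.
          compatible : ∀ {q} → Prime q → Compatible (lift N σ₁ q) (lift N σ₂ q)
          compatible {q} qq = cases (coprime? q N)
            where
            values : ∀ g → q ≡ oddℕ g → Coprime q N → Compatible ⟦ σ₁ q ⟧ ⟦ σ₂ q ⟧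
            values g refl cq = by-ψ (ψ (oddℕ g)) refl (σ₁ (oddℕ g)) refl
              where
              by-ψ : ∀ s → ψ (oddℕ g) ≡ s → ∀ t → σ₁ (oddℕ g) ≡ t → Compatible ⟦ t ⟧ ⟦ s Sign.* t ⟧
              by-ψ Sign.- _ Sign.+ _ = +∧-
              by-ψ Sign.- _ Sign.- _ = -∧+
              by-ψ Sign.+ _ Sign.+ _ = both-+
              by-ψ Sign.+ e Sign.- f = ⊥-elim (absurd (trans (sym f) (trans (cong (λ m → dot T (vals hs (+ m))) (sym (ℕP.*-identityʳ (oddℕ g))))
                  (kills _ (oddℕ g ℕ.* 1 , times {g} (qq , cq , trans (sym (ψ-prime {g} qq cq)) e) one , refl)))))
                where absurd : Sign.- ≢ Sign.+
                      absurd ()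
            cases : Dec (Coprime q N) → Compatible (lift N σ₁ q) (lift N σ₂ q)
            cases (no h) = subst₂ Compatible (sym (lift-no {σ = σ₁} h)) (sym (lift-no {σ = σ₂} h)) both-0
            cases (yes c) = subst₂ Compatible (sym (lift-yes {σ = σ₁} c)) (sym (lift-yes {σ = σ₂} c)) (values (proj₁ (coprime-odd 2∣N c)) (proj₂ (coprime-odd 2∣N c)) c)

        inseparable : ⊥
        inseparable = contradict N-1 N≡
          where
          contradict : ∀ m → N ≡ suc m → ⊥
          contradict m e = no-compatible-pair m {lift N σ₁} {lift N σ₂}
            (subst (λ t → Character t (lift N σ₁)) e (lift-character 1<N s₁ cu σ₁u))
            (subst (λ t → Character t (lift N σ₂)) e (lift-character 1<N (product-character ψ-character s₁) cu σ₂u))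
            compatible

      -- Such an m agrees with -r up to squares at every odd prime dividing d, so -r m is a square
      -- modulo each of them.
      exists-norm : ¬ ¬ (∃ λ m → GoodProduct m × τ ≡ vals hs (+ m))
      exists-norm k = separation G (1 , one , sym (vals-1 primes))
        (λ { (m , gm , e) (m′ , gm′ , e′) → m ℕ.* m′ , good-* gm gm′ , trans (cong₂ _⊛_ e e′) (sym (good-vals-* gm gm′)) }) τ
        λ { (inj₁ g) → k g ; (inj₂ (T , kills , e)) → inseparable T kills e }

-- From a rational representation of d to an integral quaternion.

module Quaternion where

  open import Data.Integer as ℤ using (ℤ; +_; -[1+_]; ∣_∣)
  open import Data.Rational as ℚ using (ℚ; _+_; _*_; _-_; -_; 0ℚ; 1ℚ; ½)
  open import Data.Rational.Properties as ℚP using (toℚᵘ-injective; toℚᵘ-homo-+; toℚᵘ-homo-*; toℚᵘ-homo‿-; toℚᵘ-fromℚᵘ)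
  open import Data.Rational.Unnormalised as ℚᵘ using (mkℚᵘ; *≡*)
  import Data.Rational.Unnormalised.Properties as ℚᵘP
  open import Data.Rational.Solver using (module +-*-Solver)
  open import Data.List.Relation.Unary.All using ([]; _∷_)
  open Witt using (*-≢0)

  ℤ→ℚ-+ : ∀ x y → ℤ→ℚ (x ℤ.+ y) ≡ ℤ→ℚ x + ℤ→ℚ y
  ℤ→ℚ-+ x y = toℚᵘ-injective (ℚᵘP.≃-trans (toℚᵘ-fromℚᵘ (mkℚᵘ (x ℤ.+ y) 0)) (ℚᵘP.≃-sym (ℚᵘP.≃-trans (toℚᵘ-homo-+ (ℤ→ℚ x) (ℤ→ℚ y))
    (ℚᵘP.≃-trans (ℚᵘP.+-cong (toℚᵘ-fromℚᵘ (mkℚᵘ x 0)) (toℚᵘ-fromℚᵘ (mkℚᵘ y 0))) (*≡* (ring x y))))))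
    where ring : ∀ x y → (x ℤ.* + 1 ℤ.+ y ℤ.* + 1) ℤ.* + 1 ≡ (x ℤ.+ y) ℤ.* + 1
          ring = solve-∀

  ℤ→ℚ-* : ∀ x y → ℤ→ℚ (x ℤ.* y) ≡ ℤ→ℚ x * ℤ→ℚ y
  ℤ→ℚ-* x y = toℚᵘ-injective (ℚᵘP.≃-trans (toℚᵘ-fromℚᵘ (mkℚᵘ (x ℤ.* y) 0)) (ℚᵘP.≃-sym (ℚᵘP.≃-trans (toℚᵘ-homo-* (ℤ→ℚ x) (ℤ→ℚ y))
    (ℚᵘP.≃-trans (ℚᵘP.*-cong (toℚᵘ-fromℚᵘ (mkℚᵘ x 0)) (toℚᵘ-fromℚᵘ (mkℚᵘ y 0))) (*≡* refl)))))

  ℤ→ℚ-neg : ∀ x → ℤ→ℚ (ℤ.- x) ≡ - ℤ→ℚ x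
  ℤ→ℚ-neg x = toℚᵘ-injective (ℚᵘP.≃-trans (toℚᵘ-fromℚᵘ (mkℚᵘ (ℤ.- x) 0)) (ℚᵘP.≃-sym (ℚᵘP.≃-trans (toℚᵘ-homo‿- (ℤ→ℚ x))
    (ℚᵘP.≃-trans (ℚᵘP.-‿cong (toℚᵘ-fromℚᵘ (mkℚᵘ x 0))) (*≡* refl)))))

  ℤ→ℚ-- : ∀ x y → ℤ→ℚ (x ℤ.- y) ≡ ℤ→ℚ x - ℤ→ℚ y
  ℤ→ℚ-- x y = trans (ℤ→ℚ-+ x (ℤ.- y)) (cong (λ t → ℤ→ℚ x + t) (ℤ→ℚ-neg y))

  ℤ→ℚ-injective : ∀ {x y} → ℤ→ℚ x ≡ ℤ→ℚ y → x ≡ y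
  ℤ→ℚ-injective {x} {y} e = drop (ℚᵘP.≃-trans (ℚᵘP.≃-sym (toℚᵘ-fromℚᵘ (mkℚᵘ x 0))) (ℚᵘP.≃-trans (ℚᵘP.≃-reflexive (cong ℚ.toℚᵘ e)) (toℚᵘ-fromℚᵘ (mkℚᵘ y 0))))
    where drop : mkℚᵘ x 0 ℚᵘ.≃ mkℚᵘ y 0 → x ≡ y
          drop (*≡* h) = trans (sym (ℤP.*-identityʳ x)) (trans h (ℤP.*-identityʳ y))

  reciprocal : ∀ k → Σ ℚ λ v → v * ℤ→ℚ (+ suc k) ≡ 1ℚ
  reciprocal k = ℚ.fromℚᵘ (mkℚᵘ (+ 1) k) , toℚᵘ-injective (ℚᵘP.≃-trans (toℚᵘ-homo-* (ℚ.fromℚᵘ (mkℚᵘ (+ 1) k)) (ℤ→ℚ (+ suc k)))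
    (ℚᵘP.≃-trans (ℚᵘP.*-cong (toℚᵘ-fromℚᵘ (mkℚᵘ (+ 1) k)) (toℚᵘ-fromℚᵘ (mkℚᵘ (+ suc k) 0))) (*≡* (ring (+ suc k) (cong +_ (ℕP.*-identityʳ (suc k)))))))
    where
    ring : ∀ n {m} → m ≡ n → + 1 ℤ.* n ℤ.* + 1 ≡ + 1 ℤ.* m
    ring n refl = ℤP.*-identityʳ (+ 1 ℤ.* n)

  isInteger : ∀ {a b} q → ¬ IsScalar q → IsRationalInteger (nrd a b q) → IsRationalInteger (- trd q) → IsInteger a b q
  isInteger q ns hn ht with isScalar? q
  ... | yes s = ⊥-elim (ns s)
  ... | no  _ = hn ∷ ht ∷ []

  -- The witness is the quaternion t/2 + (x i + y j + z k)/(2w).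
  module _ (a b d : ℤ) (t m : ℕ) (x y z w : ℤ) (d≡ : d ≡ + t ℤ.* + t ℤ.- + 4 ℤ.* + m) (d≢0 : d ≢ + 0) (w≢0 : w ≢ + 0)
           (eq : a ℤ.* (x ℤ.* x) ℤ.+ b ℤ.* (y ℤ.* y) ℤ.- a ℤ.* b ℤ.* (z ℤ.* z) ≡ d ℤ.* (w ℤ.* w)) where

    private
      ι = ℤ→ℚ

      -- The absolute value of w serves because only w² enters, and a positive denominator has the
      -- form required by `reciprocal`.
      u : ℤ
      u = + (2 ℕ.* ∣ w ∣)

      inverse : Σ ℚ λ v → v * ι u ≡ 1ℚ
      inverse with 2 ℕ.* ∣ w ∣ in e
      ... | zero  = ⊥-elim (w≢0 (ℤP.∣i∣≡0⇒i≡0 (ℕP.m+n≡0⇒m≡0 ∣ w ∣ e)))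
      ... | suc k = reciprocal k

      v : ℚ
      v = proj₁ inverse

      vu : v * ι u ≡ 1ℚ
      vu = proj₂ inverse

      uu : u ℤ.* u ≡ + 4 ℤ.* (w ℤ.* w)
      uu = trans (cong₂ ℤ._*_ (ℤP.pos-* 2 ∣ w ∣) (ℤP.pos-* 2 ∣ w ∣)) (trans (ring (+ ∣ w ∣)) (cong (+ 4 ℤ.*_) (abs-square w)))
        where
        ring : ∀ n → + 2 ℤ.* n ℤ.* (+ 2 ℤ.* n) ≡ + 4 ℤ.* (n ℤ.* n)
        ring = solve-∀
        abs-square : ∀ w → + ∣ w ∣ ℤ.* + ∣ w ∣ ≡ w ℤ.* w
        abs-square (+ n)    = refl
        abs-square -[1+ n ] = refl

      q : Quat
      q = quat (ι (+ t) * ½) (ι x * v) (ι y * v) (ι z * v)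

      vv4ww : v * v * ι (+ 4 ℤ.* (w ℤ.* w)) ≡ 1ℚ
      vv4ww = trans (cong (λ s → v * v * s) (trans (cong ι (sym uu)) (ℤ→ℚ-* u u))) (trans (regroup v (ι u)) (cong₂ _*_ vu vu))
        where
        open +-*-Solver
        regroup : ∀ v u → v * v * (u * u) ≡ v * u * (v * u)
        regroup = solve 2 (λ v u → v :* v :* (u :* u) := v :* u :* (v :* u)) refl

      quarter : v * v * ι (w ℤ.* w) ≡ ½ * ½
      quarter = begin
        v * v * ι (w ℤ.* w)                               ≡⟨ sym (ℚP.*-identityˡ _) ⟩
        1ℚ * (v * v * ι (w ℤ.* w))                        ≡⟨⟩
        (½ * ½ * ι (+ 4)) * (v * v * ι (w ℤ.* w))         ≡⟨ regroup (½ * ½) (ι (+ 4)) (v * v) (ι (w ℤ.* w)) ⟩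
        ½ * ½ * (v * v * (ι (+ 4) * ι (w ℤ.* w)))         ≡⟨ cong (λ s → ½ * ½ * (v * v * s)) (sym (ℤ→ℚ-* (+ 4) (w ℤ.* w))) ⟩
        ½ * ½ * (v * v * ι (+ 4 ℤ.* (w ℤ.* w)))           ≡⟨ cong (½ * ½ *_) vv4ww ⟩
        ½ * ½ * 1ℚ                                        ≡⟨⟩
        ½ * ½                                             ∎
        where
        open ≡-Reasoning
        open +-*-Solver
        regroup : ∀ h f s t → h * f * (s * t) ≡ h * (s * (f * t))
        regroup = solve 4 (λ h f s t → h :* f :* (s :* t) := h :* (s :* (f :* t))) refl

      expand : nrd a b q ≡ ½ * ½ * (ι (+ t) * ι (+ t)) - v * v * (ι a * (ι x * ι x) + ι b * (ι y * ι y) - ι (a ℤ.* b) * (ι z * ι z))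
      expand = lem (ι (+ t)) ½ (ι a) (ι b) (ι (a ℤ.* b)) (ι x) (ι y) (ι z) v
        where
        open +-*-Solver
        lem : ∀ T h A B C X Y Z v → T * h * (T * h) - A * (X * v * (X * v)) - B * (Y * v * (Y * v)) + C * (Z * v * (Z * v)) ≡
              h * h * (T * T) - v * v * (A * (X * X) + B * (Y * Y) - C * (Z * Z))
        lem = solve 9 (λ T h A B C X Y Z v → T :* h :* (T :* h) :- A :* (X :* v :* (X :* v)) :- B :* (Y :* v :* (Y :* v)) :+ C :* (Z :* v :* (Z :* v)) :=
              h :* h :* (T :* T) :- v :* v :* (A :* (X :* X) :+ B :* (Y :* Y) :- C :* (Z :* Z))) refl

      form-ι : ι a * (ι x * ι x) + ι b * (ι y * ι y) - ι (a ℤ.* b) * (ι z * ι z) ≡ ι (d ℤ.* (w ℤ.* w))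
      form-ι = trans (sym (trans (ℤ→ℚ-- (a ℤ.* (x ℤ.* x) ℤ.+ b ℤ.* (y ℤ.* y)) (a ℤ.* b ℤ.* (z ℤ.* z)))
          (cong₂ _-_ (trans (ℤ→ℚ-+ (a ℤ.* (x ℤ.* x)) (b ℤ.* (y ℤ.* y))) (cong₂ _+_ (mono a x) (mono b y))) (mono (a ℤ.* b) z)))) (cong ι eq)
        where
        mono : ∀ c s → ι (c ℤ.* (s ℤ.* s)) ≡ ι c * (ι s * ι s)
        mono c s = trans (ℤ→ℚ-* c (s ℤ.* s)) (cong (ι c *_) (ℤ→ℚ-* s s))

      norm : nrd a b q ≡ ι (+ m)
      norm = begin
        nrd a b q                                                   ≡⟨ expand ⟩
        ½ * ½ * (ι (+ t) * ι (+ t)) - v * v * (ι a * (ι x * ι x) + ι b * (ι y * ι y) - ι (a ℤ.* b) * (ι z * ι z))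
                                                                    ≡⟨ cong₂ _-_ (cong₂ _*_ (sym quarter) (sym (ℤ→ℚ-* (+ t) (+ t)))) (cong (v * v *_) (trans form-ι (ℤ→ℚ-* d (w ℤ.* w)))) ⟩
        v * v * ι (w ℤ.* w) * ι (+ t ℤ.* + t) - v * v * (ι d * ι (w ℤ.* w))
                                                                    ≡⟨ lem (v * v) (ι (w ℤ.* w)) (ι (+ t ℤ.* + t)) (ι d) ⟩
        v * v * (ι (w ℤ.* w) * (ι (+ t ℤ.* + t) - ι d))             ≡⟨ cong (λ s → v * v * (ι (w ℤ.* w) * s)) (trans (sym (ℤ→ℚ-- (+ t ℤ.* + t) d)) (cong ι four)) ⟩
        v * v * (ι (w ℤ.* w) * ι (+ 4 ℤ.* + m))                     ≡⟨ cong (v * v *_) (trans (sym (ℤ→ℚ-* (w ℤ.* w) (+ 4 ℤ.* + m))) (trans (cong ι (ring (w ℤ.* w) (+ m))) (ℤ→ℚ-* (+ 4 ℤ.* (w ℤ.* w)) (+ m)))) ⟩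
        v * v * (ι (+ 4 ℤ.* (w ℤ.* w)) * ι (+ m))                   ≡⟨ sym (ℚP.*-assoc (v * v) _ _) ⟩
        v * v * ι (+ 4 ℤ.* (w ℤ.* w)) * ι (+ m)                     ≡⟨ cong (_* ι (+ m)) vv4ww ⟩
        1ℚ * ι (+ m)                                                ≡⟨ ℚP.*-identityˡ _ ⟩
        ι (+ m)                                                     ∎
        where
        open ≡-Reasoning
        open +-*-Solver
        lem : ∀ s W T D → s * W * T - s * (D * W) ≡ s * (W * (T - D))
        lem = solve 4 (λ s W T D → s :* W :* T :- s :* (D :* W) := s :* (W :* (T :- D))) refl
        ring : ∀ W m → W ℤ.* (+ 4 ℤ.* m) ≡ + 4 ℤ.* W ℤ.* m
        ring = solve-∀
        four : + t ℤ.* + t ℤ.- d ≡ + 4 ℤ.* + m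
        four = trans (cong (λ s → + t ℤ.* + t ℤ.- s) d≡) (ring′ (+ t ℤ.* + t) (+ 4 ℤ.* + m))
          where ring′ : ∀ A B → A ℤ.- (A ℤ.- B) ≡ B
                ring′ = solve-∀

      trace : - trd q ≡ ι (ℤ.- + t)
      trace = trans (cong -_ (trans (lem (ι (+ 2)) ½ (ι (+ t))) (ℚP.*-identityˡ (ι (+ t))))) (sym (ℤ→ℚ-neg (+ t)))
        where
        open +-*-Solver
        lem : ∀ s h T → s * (T * h) ≡ s * h * T
        lem = solve 3 (λ s h T → s :* (T :* h) := s :* h :* T) refl

      numerator-zero : ∀ s → ι s * v ≡ 0ℚ → s ≡ + 0
      numerator-zero s e = ℤ→ℚ-injective (trans (sym (ℚP.*-identityʳ (ι s))) (trans (cong (ι s *_) (sym vu)) (trans (sym (ℚP.*-assoc (ι s) v (ι u))) (trans (cong (_* ι u) e) (ℚP.*-zeroˡ (ι u))))))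

      vanishing : x ≡ + 0 → y ≡ + 0 → z ≡ + 0 → d ℤ.* (w ℤ.* w) ≡ + 0
      vanishing refl refl refl = trans (sym eq) (ring a b)
        where ring : ∀ a b → a ℤ.* (+ 0 ℤ.* + 0) ℤ.+ b ℤ.* (+ 0 ℤ.* + 0) ℤ.- a ℤ.* b ℤ.* (+ 0 ℤ.* + 0) ≡ + 0
              ring = solve-∀

      not-scalar : ¬ IsScalar q
      not-scalar (e₁ , e₂ , e₃) = *-≢0 d≢0 (*-≢0 w≢0 w≢0) (vanishing (numerator-zero x e₁) (numerator-zero y e₂) (numerator-zero z e₃))

    integer-of-norm : Σ Quat λ q → IsInteger a b q × nrd a b q ≡ ℤ→ℚ (+ m)
    integer-of-norm = q , isInteger {a} {b} q not-scalar (+ m , norm) (ℤ.- + t , trace) , norm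

-- Ramification data, the choice of the trace, and the conclusion.

module Outliers where

  open import Data.Nat.Primality using (prime[2]; prime⇒irreducible; euclidsLemma)
  open import Data.Nat.Primality.Factorisation using (factorise; PrimeFactorisation)
  open import Data.Nat.ListAction using (product)
  open import Data.Nat.Coprimality using (Coprime)
  open import Data.Integer as ℤ using (ℤ; +_; -[1+_]; _+_; _*_; _-_; -_; _^_; ∣_∣; +<+; -<+)
  open import Data.Integer.DivMod using (_%ℕ_)
  open import Data.Integer.Divisibility.Signed using (_∣_; divides; ∣⇒∣ᵤ; ∣ᵤ⇒∣; ∣n⇒∣m*n; ∣-trans)
  open import Data.List using (List; []; _∷_)
  import Data.List.Relation.Unary.All as ListAll
  open import Data.Vec.Properties using (∷-injective)
  open import Data.Vec as Vec using (Vec; []; _∷_)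
  open import Data.Vec.Relation.Unary.All as All using (All; []; _∷_)
  open import Relation.Binary.Definitions using (tri<; tri≈; tri>)
  open Congruence
  open Legendre using (module Half; ⟦_⟧; ⟦⟧-square)
  open Witt
  open Residue
  open Elimination using (module OddPrime; prime>1)
  open WeakHasse
  open LocalSymbol
  open Auxiliary
  open Quaternion
  open Half using (legendre)

  record OddPart (n : ℕ) : Set where
    constructor oddPart
    field
      k    : ℕ
      {l}  : ℕ
      hs   : Vec ℕ l
      odds : All (λ h → Prime (oddℕ h)) hs
      eq   : n ≡ 2 ℕ.^ k ℕ.* prod hs

  odd-part : ∀ ps → ListAll.All Prime ps → OddPart (product ps)
  odd-part [] _ = oddPart 0 [] [] refl
  odd-part (p ∷ ps) (pp ListAll.∷ all) with odd-part ps all | ℕP.<-cmp 2 p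
  ... | oddPart k hs odds eq | tri≈ _ refl _ = oddPart (suc k) hs odds (trans (cong (2 ℕ.*_) eq) (sym (ℕP.*-assoc 2 (2 ℕ.^ k) (prod hs))))
  ... | oddPart k hs odds eq | tri> _ _ l = ⊥-elim (ℕP.<⇒≱ l (prime>1 pp))
  ... | oddPart k hs odds eq | tri< l _ _ with odd-prime pp l
  ...   | h , refl = oddPart k (h ∷ hs) (pp ∷ odds) (trans (cong (p ℕ.*_) eq) (swap p (2 ℕ.^ k) (prod hs)))
    where swap : ∀ a b c → a ℕ.* (b ℕ.* c) ≡ b ℕ.* (a ℕ.* c)
          swap a b c = trans (sym (ℕP.*-assoc a b c)) (trans (cong (ℕ._* c) (ℕP.*-comm a b)) (ℕP.*-assoc b a c))

  lookup-factor : ∀ {n h} {Q : ℕ → Set} {hs : Vec ℕ n} → Prime (oddℕ h) → All (λ g → Prime (oddℕ g)) hs → oddℕ h ℕD.∣ prod hs → All Q hs → Q h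
  lookup-factor pp [] d [] = ⊥-elim (∤1 pp (∣ᵤ⇒∣ d))
  lookup-factor {h = h} {Q} {g ∷ hs} pp (gg ∷ all) d (q ∷ qs) with euclidsLemma (oddℕ g) (prod hs) pp d
  ... | inj₂ e = lookup-factor {h = h} pp all e qs
  ... | inj₁ e with prime⇒irreducible gg e
  ...   | inj₁ e′ = ⊥-elim (∤1 pp (∣ᵤ⇒∣ (ℕD.∣-reflexive e′)))
  ...   | inj₂ e′ = subst Q (sym (oddℕ-injective {h} {g} e′)) q

  vals-pointwise : ∀ {n} (hs : Vec ℕ n) x y → vals hs x ≡ vals hs y → All (λ h → legendre h x ≡ legendre h y) hs
  vals-pointwise []       x y e = []
  vals-pointwise (h ∷ hs) x y e = proj₁ (∷-injective e) ∷ vals-pointwise hs x y (proj₂ (∷-injective e))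

  -- The properties of m make (d, −rm) ramified exactly at r = 2ρ + 1 and ∞.
  record Norm (d : ℤ) (ρ : ℕ) : Set where
    field
      m        : ℕ
      positive : 0 ℕ.< m
      split    : ∀ g → Prime (oddℕ g) → + oddℕ g ∣ + m → legendre g d ≡ Sign.+ × ¬ (+ oddℕ g ∣ d)
      residue  : ∀ h → Prime (oddℕ h) → + oddℕ h ∣ d → legendre h (- (+ oddℕ ρ) * + m) ≡ Sign.+

  module _ {n} (k : ℕ) (hs : Vec ℕ n) (odds : All (λ h → Prime (oddℕ h)) hs) (M : ℕ) (prod≡ : prod hs ≡ suc M)
           (ρ : ℕ) (rr : Prime (oddℕ ρ)) where

    open Kronecker k hs odds M prod≡

    private r = oddℕ ρ

    prod∣d : ∀ {p} → p ℕD.∣ prod hs → + p ∣ d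
    prod∣d e = ∣n⇒∣m*n (- (+ 1)) (∣n⇒∣m*n ((+ 2) ^ k) (∣ᵤ⇒∣ e))

    coprime-r : ¬ (+ r ∣ d) → Coprime r N
    coprime-r r∤d {e} (e∣r , e∣N) with prime⇒irreducible rr e∣r
    ... | inj₁ e≡1 = e≡1
    ... | inj₂ refl with euclidsLemma 8 (suc M) rr e∣N
    ...   | inj₂ h = ⊥-elim (r∤d (prod∣d (subst (r ℕD.∣_) (sym prod≡) h)))
    ...   | inj₁ h with euclidsLemma 2 4 rr h
    ...     | inj₁ h₂ = ⊥-elim (ℕP.<⇒≱ (Half.2<p ρ rr) (ℕD.∣⇒≤ h₂))
    ...     | inj₂ h₄ with euclidsLemma 2 2 rr h₄
    ...       | inj₁ h₂ = ⊥-elim (ℕP.<⇒≱ (Half.2<p ρ rr) (ℕD.∣⇒≤ h₂))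
    ...       | inj₂ h₂ = ⊥-elim (ℕP.<⇒≱ (Half.2<p ρ rr) (ℕD.∣⇒≤ h₂))

    odd∣2^ : ∀ h → Prime (oddℕ h) → ∀ k → ¬ (+ oddℕ h ∣ (+ 2) ^ k)
    odd∣2^ h pp zero    = ∤1 pp
    odd∣2^ h pp (suc k) = ∤-* pp (∤-small (ℕ.s≤s ℕ.z≤n) (Half.2<p h pp)) (odd∣2^ h pp k)

    d∣prod : ∀ h → Prime (oddℕ h) → + oddℕ h ∣ d → oddℕ h ℕD.∣ prod hs
    d∣prod h pp e with euclid pp (- (+ 1)) ((+ 2) ^ k * + prod hs) e
    ... | inj₁ e₁ = ⊥-elim (∤-neg (∤1 pp) e₁)
    ... | inj₂ e₁ with euclid pp ((+ 2) ^ k) (+ prod hs) e₁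
    ...   | inj₁ e₂ = ⊥-elim (odd∣2^ h pp k e₂)
    ...   | inj₂ e₂ = ∣⇒∣ᵤ e₂

    norm′ : ¬ (+ r ∣ d) → legendre ρ d ≡ Sign.- → ¬ ¬ Norm d ρ
    norm′ r∤d inert K = exists-norm ρ rr (coprime-r r∤d) inert (λ (m , gm , e) → K (record
      { m = m ; positive = good-positive gm ; split = split m gm ; residue = residue m gm (vals-pointwise hs (- (+ r)) (+ m) e) }))
      where
      split : ∀ m → GoodProduct m → ∀ g → Prime (oddℕ g) → + oddℕ g ∣ + m → legendre g d ≡ Sign.+ × ¬ (+ oddℕ g ∣ d)
      split m gm g qq e = good (good-factor gm qq (∣⇒∣ᵤ e))
        where
        good : (∃ λ g′ → GoodPrime g′ × oddℕ g ≡ oddℕ g′) → legendre g d ≡ Sign.+ × ¬ (+ oddℕ g ∣ d)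
        good (g′ , (_ , c , l) , e′) = subst (λ t → legendre t d ≡ Sign.+) {g′} {g} (sym (oddℕ-injective {g} {g′} e′)) l ,
          λ q∣d → coprime⇒∤ qq (ℕD.∣-trans (d∣prod g qq q∣d) prod∣N) (subst (λ t → Coprime t N) {oddℕ g′} {oddℕ g} (sym e′) c) (∣ᵤ⇒∣ ℕD.∣-refl)
      residue : ∀ m → GoodProduct m → All (λ h → legendre h (- (+ r)) ≡ legendre h (+ m)) hs → ∀ h → Prime (oddℕ h) → + oddℕ h ∣ d → legendre h (- (+ r) * + m) ≡ Sign.+
      residue m gm same h pp h∣d = trans (Half.legendre-* h pp { - (+ r)} {+ m} (∤-neg h∤r) (coprime⇒∤ pp (ℕD.∣-trans h∣prod prod∣N) (good-coprime gm)))
        (trans (cong (Sign._* legendre h (+ m)) (lookup-factor {h = h} {Q = λ h → legendre h (- (+ r)) ≡ legendre h (+ m)} pp odds h∣prod same)) (SignP.s*s≡+ (legendre h (+ m))))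
        where
        h∣prod : oddℕ h ℕD.∣ prod hs
        h∣prod = d∣prod h pp h∣d
        h∤r : ¬ (+ oddℕ h ∣ + r)
        h∤r e with prime⇒irreducible rr (∣⇒∣ᵤ e)
        ... | inj₁ e′ = ∤1 pp (∣ᵤ⇒∣ (ℕD.∣-reflexive e′))
        ... | inj₂ e′ = r∤d (subst (λ t → + t ∣ d) e′ h∣d)

  norm-exists : ∀ {d ρ} → d ℤ.< + 0 → Prime (oddℕ ρ) → ¬ (+ oddℕ ρ ∣ d) → legendre ρ d ≡ Sign.- → ¬ ¬ Norm d ρ
  norm-exists {+ _} (+<+ ())
  norm-exists { -[1+ δ ]} {ρ} _ rr r∤d inert = go (odd-part (factors f) (factorsPrime f))
    where
    open PrimeFactorisation
    f : PrimeFactorisation (suc δ)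
    f = factorise (suc δ)
    go : OddPart (product (factors f)) → ¬ ¬ Norm -[1+ δ ] ρ
    go (oddPart k hs odds eq) = positive (prod hs) refl
      where
      d≡ : -[1+ δ ] ≡ - (+ 1) * ((+ 2) ^ k * + prod hs)
      d≡ = trans (cong (λ t → - (+ t)) (trans (isFactorisation f) eq)) (trans (sym (ℤP.-1*i≡-i _)) (cong (- (+ 1) *_) (trans (ℤP.pos-* (2 ℕ.^ k) (prod hs)) (cong (_* + prod hs) (pos-^ 2 k)))))
      positive : ∀ P → prod hs ≡ P → ¬ ¬ Norm -[1+ δ ] ρ
      positive zero e = ⊥-elim (ℕP.1+n≢0 (trans (isFactorisation f) (trans eq (trans (cong (2 ℕ.^ k ℕ.*_) e) (ℕP.*-zeroʳ (2 ℕ.^ k))))))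
      positive (suc M) e = subst (λ t → ¬ ¬ Norm t ρ) (sym d≡)
        (norm′ k hs odds M e ρ rr (subst (λ t → ¬ (+ oddℕ ρ ∣ t)) d≡ r∤d) (subst (λ t → legendre ρ t ≡ Sign.-) d≡ inert))

  not-plus : ∀ {s} → s ≢ Sign.+ → s ≡ Sign.-
  not-plus {Sign.+} h = ⊥-elim (h refl)
  not-plus {Sign.-} h = refl

  not-minus : ∀ {s} → s ≢ Sign.- → s ≡ Sign.+
  not-minus {Sign.+} h = refl
  not-minus {Sign.-} h = ⊥-elim (h refl)

  target : ∀ {h ρ : ℕ} → Dec (h ≡ ρ) → Sign
  target (yes _) = Sign.-
  target (no _)  = Sign.+

  -≢+ : Sign.- ≢ Sign.+
  -≢+ ()

  module Ramified {a b : ℤ} {ρ : ℕ} (ram : RamifiedExactlyAt a b (oddℕ ρ)) where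

    -- `RamifiedAtPrime` is only a negation, and off r only the impossibility of ramification is
    -- known. Signs are decidable, so both still fix the value of the symbol.
    tame-target : ∀ h (pp : Prime (oddℕ h)) (h≟ρ : Dec (h ≡ ρ)) {u v} e f → a ≡ (+ oddℕ h) ^ e * u → b ≡ (+ oddℕ h) ^ f * v → ¬ (+ oddℕ h ∣ u) → ¬ (+ oddℕ h ∣ v) →
                  tameSymbol (legendre h) (odd e) u (odd f) v ≡ target h≟ρ
    tame-target h pp (yes refl) e f ea eb nu nv = not-plus λ t → proj₂ (proj₂ ram (oddℕ h) pp) refl (Local.tame⇒splits h pp e f ea eb nu nv t)
    tame-target h pp (no ne) e f ea eb nu nv = not-minus λ t → ne (oddℕ-injective {h} {ρ} (proj₁ (proj₂ ram (oddℕ h) pp) (λ s → -≢+ (trans (sym t) (Local.splits⇒tame h pp e f ea eb nu nv s)))))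

    a≢0 : a ≢ + 0
    a≢0 e = ℤP.<-irrefl e (proj₁ (proj₁ ram))

    b≢0 : b ≢ + 0
    b≢0 e = ℤP.<-irrefl e (proj₂ (proj₁ ram))

    module _ (rr : Prime (oddℕ ρ)) {d : ℤ} (d<0 : d ℤ.< + 0) (r∤d : ¬ (+ oddℕ ρ ∣ d)) (inert : legendre ρ d ≡ Sign.-) (N : Norm d ρ) where

      open Norm N

      private
        r : ℤ
        r = + oddℕ ρ
        c : ℤ
        c = - r * + m

      c<0 : c ℤ.< + 0
      c<0 = subst (ℤ._< + 0) (ℤP.neg-distribˡ-* r (+ m)) (ℤP.neg-mono-< (subst (+ 0 ℤ.<_) (ℤP.pos-* (oddℕ ρ) m) (+<+ (ℕP.*-mono-≤ (ℕ.s≤s (ℕ.z≤n {ρ ℕ.+ ρ})) positive))))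

      d≢0 : d ≢ + 0
      d≢0 e = ℤP.<-irrefl e d<0

      r∤m : ¬ (r ∣ + m)
      r∤m e = -≢+ (trans (sym inert) (proj₁ (split ρ rr e)))

      record TameData (h : ℕ) (s : Sign) : Set where
        constructor tameData
        field
          e f  : ℕ
          u v  : ℤ
          ed   : d ≡ (+ oddℕ h) ^ e * u
          ec   : c ≡ (+ oddℕ h) ^ f * v
          nu   : ¬ (+ oddℕ h ∣ u)
          nv   : ¬ (+ oddℕ h ∣ v)
          tame : tameSymbol (legendre h) (odd e) u (odd f) v ≡ s

      -- At r, d is a nonresidue and c has valuation 1, as the prime divisors of m split and r does
      -- not. At primes dividing m, d is a unit and a square. Elsewhere c is a unit, and it is a
      -- square wherever d is divisible by the prime.
      tame-dc : ∀ h (pp : Prime (oddℕ h)) (h≟ρ : Dec (h ≡ ρ)) → TameData h (target h≟ρ)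
      tame-dc h pp (yes refl) = tameData 0 1 d (- (+ m)) (sym (ℤP.*-identityˡ d)) (ring r (+ m)) r∤d (∤-neg r∤m) inert
        where ring : ∀ r m → - r * m ≡ r * + 1 * - m
              ring = solve-∀
      tame-dc h pp (no h≢ρ) = by-m (∣? {oddℕ h} (+ m))
        where
        by-m : Dec (+ oddℕ h ∣ + m) → TameData h Sign.+
        by-m (yes h∣m) = from (valuationℤ pp c (λ e → ℤP.<-irrefl e c<0))
          where
          symbol : ∀ f v → tameSymbol (legendre h) false d f v ≡ Sign.+
          symbol false v = refl
          symbol true  v = proj₁ (split h pp h∣m)
          from : (∃ λ f → ∃ λ v → c ≡ (+ oddℕ h) ^ f * v × ¬ (+ oddℕ h ∣ v)) → TameData h Sign.+
          from (f , v , ec , nv) = tameData 0 f d v (sym (ℤP.*-identityˡ d)) ec (proj₂ (split h pp h∣m)) nv (symbol (odd f) v)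
        by-m (no h∤m) = from (valuationℤ pp d d≢0)
          where
          h∤r : ¬ (+ oddℕ h ∣ r)
          h∤r e with prime⇒irreducible rr (∣⇒∣ᵤ e)
          ... | inj₁ e₁ = ∤1 pp (∣ᵤ⇒∣ (ℕD.∣-reflexive e₁))
          ... | inj₂ e₂ = h≢ρ (oddℕ-injective {h} {ρ} e₂)
          from : (∃ λ e → ∃ λ u → d ≡ (+ oddℕ h) ^ e * u × ¬ (+ oddℕ h ∣ u)) → TameData h Sign.+
          from (e , u , ed , nu) = tameData e 0 u c ed (sym (ℤP.*-identityˡ c)) nu (∤-* pp (∤-neg h∤r) h∤m) (symbol e ed)
            where
            symbol : ∀ e → d ≡ (+ oddℕ h) ^ e * u → tameSymbol (legendre h) (odd e) u false c ≡ Sign.+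
            symbol zero    ed = refl
            symbol (suc e) ed = by-parity (odd (suc e))
              where
              by-parity : ∀ x → tameSymbol (legendre h) x u false c ≡ Sign.+
              by-parity false = refl
              by-parity true  = residue h pp (divides ((+ oddℕ h) ^ e * u) (trans ed (ring (+ oddℕ h) ((+ oddℕ h) ^ e) u)))
                where ring : ∀ P E u → P * E * u ≡ E * u * P
                      ring = solve-∀

      -- The pure part ⟨a, b, -ab⟩ of one algebra minus the pure part ⟨d, c, -dc⟩ of the other;
      -- equal ramification makes the residues cancel.
      φ : List ℤ
      φ = a ∷ b ∷ - (a * b) ∷ - d ∷ - c ∷ d * c ∷ []

      odd-trivial : OddTrivial φ
      odd-trivial h pp = go (valuationℤ pp a a≢0) (valuationℤ pp b b≢0) (tame-dc h pp (h ℕ.≟ ρ))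
        where
        go : (∃ λ e → ∃ λ u → a ≡ (+ oddℕ h) ^ e * u × ¬ (+ oddℕ h ∣ u)) → (∃ λ f → ∃ λ v → b ≡ (+ oddℕ h) ^ f * v × ¬ (+ oddℕ h ∣ v)) →
             TameData h (target (h ℕ.≟ ρ)) → OddPrime.∂* h pp φ ≡ (false , Sign.+)
        go (e , u , ea , nu) (f , v , eb , nv) (tameData e′ f′ u′ v′ ed ec nu′ nv′ t) =
          OddPrime.∂*-albert h pp {a} {b} {d} {c} (OddPrime.triple h pp e f ea eb nu nv) (OddPrime.triple-neg h pp e′ f′ ed ec nu′ nv′)
            (trans (tame-target h pp (h ℕ.≟ ρ) e f ea eb nu nv) (sym t))

      two-trivial : TwoTrivial φ
      two-trivial = go (valuationℤ prime[2] a a≢0) (valuationℤ prime[2] b b≢0) (valuationℤ prime[2] d d≢0) (valuationℤ prime[2] c (λ e → ℤP.<-irrefl e c<0))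
        where
        all-plus : ∀ x u y v → tameSymbol (λ _ → Sign.+) x u y v ≡ Sign.+
        all-plus false u false v = refl
        all-plus false u true  v = refl
        all-plus true  u false v = refl
        all-plus true  u true  v = refl
        go : Two.Valuation a → Two.Valuation b → Two.Valuation d → Two.Valuation c → TwoTrivial φ
        go (e , u , ea , nu) (f , v , eb , nv) (e′ , u′ , ed , nu′) (f′ , v′ , ec , nv′) =
          Two.∂*-albert {a} {b} {d} {c} (Two.triple e f ea eb nu nv) (Two.triple-neg e′ f′ ed ec nu′ nv′) (trans (all-plus (odd e) u (odd f) v) (sym (all-plus (odd e′) u′ (odd f′) v′)))

      signature-trivial : signature φ ≡ + 0
      signature-trivial = lem a b d c (proj₁ (proj₁ ram)) (proj₂ (proj₁ ram)) d<0 c<0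
        where
        lem : ∀ a b d c → a ℤ.< + 0 → b ℤ.< + 0 → d ℤ.< + 0 → c ℤ.< + 0 → signature (a ∷ b ∷ - (a * b) ∷ - d ∷ - c ∷ d * c ∷ []) ≡ + 0
        lem -[1+ _ ] -[1+ _ ] -[1+ _ ] -[1+ _ ] _ _ _ _ = refl
        lem (+ _) _ _ _ (+<+ ()) _ _ _
        lem -[1+ _ ] (+ _) _ _ _ (+<+ ()) _ _
        lem -[1+ _ ] -[1+ _ ] (+ _) _ _ _ (+<+ ()) _
        lem -[1+ _ ] -[1+ _ ] -[1+ _ ] (+ _) _ _ _ (+<+ ())

      c≢0 : c ≢ + 0
      c≢0 e = ℤP.<-irrefl e c<0

      φ~[] : φ ~ []
      φ~[] = weak-hasse φ (a≢0 ListAll.∷ b≢0 ListAll.∷ neg-≢0 (*-≢0 a≢0 b≢0) ListAll.∷ neg-≢0 d≢0 ListAll.∷ neg-≢0 c≢0 ListAll.∷ *-≢0 d≢0 c≢0 ListAll.∷ ListAll.[])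
               (odd-trivial , two-trivial , signature-trivial)

    Represents : ℤ → Set
    Represents d = ∃ λ x → ∃ λ y → ∃ λ z → ∃ λ w → w ≢ + 0 × a * (x * x) + b * (y * y) - a * b * (z * z) ≡ d * (w * w)

    -- The pure part is negative definite because a, b < 0. So an isotropic vector of the quaternary
    -- form has w ≠ 0, and d becomes a represented value.
    anisotropic : ∀ x y z → a * (x * x) + (b * (y * y) + - (a * b) * (z * z)) ≡ + 0 → x ≡ + 0 × y ≡ + 0 × z ≡ + 0
    anisotropic x y z e = root a<0 x (proj₁ zeros) , root b<0 y (proj₁ zeros′) , root -ab<0 z (proj₂ zeros′)
      where
      a<0 = proj₁ (proj₁ ram)
      b<0 = proj₂ (proj₁ ram)
      -ab<0 : - (a * b) ℤ.< + 0
      -ab<0 = lem a b a<0 b<0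
        where
        lem : ∀ a b → a ℤ.< + 0 → b ℤ.< + 0 → - (a * b) ℤ.< + 0
        lem -[1+ _ ] -[1+ _ ] _ _ = -<+
        lem (+ _) _ (+<+ ()) _
        lem -[1+ _ ] (+ _) _ (+<+ ())
      term≤0 : ∀ {s} → s ℤ.< + 0 → ∀ x → s * (x * x) ℤ.≤ + 0
      term≤0 {s} s<0 x = ℤP.≤-trans (ℤP.*-monoˡ-≤-nonPos s {{ℤ.nonPositive (ℤP.<⇒≤ s<0)}} (square≥0 x)) (ℤP.≤-reflexive (ℤP.*-zeroʳ s))
        where
        square≥0 : ∀ x → + 0 ℤ.≤ x * x
        square≥0 (+ n)    = subst (+ 0 ℤ.≤_) (ℤP.pos-* n n) (ℤ.+≤+ ℕ.z≤n)
        square≥0 -[1+ n ] = ℤ.+≤+ ℕ.z≤n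
      both-zero : ∀ {s t} → s ℤ.≤ + 0 → t ℤ.≤ + 0 → s + t ≡ + 0 → s ≡ + 0 × t ≡ + 0
      both-zero {s} {t} hs ht e = s≡0 , trans (sym (trans (cong (_+ t) s≡0) (ℤP.+-identityˡ t))) e
        where s≡0 = ℤP.≤-antisym hs (subst₂ ℤ._≤_ e (ℤP.+-identityʳ s) (ℤP.+-monoʳ-≤ s ht))
      zeros = both-zero (term≤0 a<0 x) (ℤP.+-mono-≤ (term≤0 b<0 y) (term≤0 -ab<0 z)) e
      zeros′ = both-zero (term≤0 b<0 y) (term≤0 -ab<0 z) (proj₂ zeros)
      root : ∀ {s} → s ℤ.< + 0 → ∀ x → s * (x * x) ≡ + 0 → x ≡ + 0
      root {s} s<0 x e with ℤP.i*j≡0⇒i≡0∨j≡0 s e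
      ... | inj₁ z = ⊥-elim (ℤP.<-irrefl z s<0)
      ... | inj₂ z with ℤP.i*j≡0⇒i≡0∨j≡0 x z
      ...   | inj₁ e′ = e′
      ...   | inj₂ e′ = e′

    represents : Prime (oddℕ ρ) → ∀ {d} → d ℤ.< + 0 → ¬ (+ oddℕ ρ ∣ d) → legendre ρ d ≡ Sign.- → ¬ ¬ Represents d
    represents rr {d} d<0 r∤d inert K = norm-exists d<0 rr r∤d inert λ N → albert (φ~[] rr d<0 r∤d inert N) solution
      where
      solution : ¬ (∃ λ x → ∃ λ y → ∃ λ z → ∃ λ w → a * (x * x) + (b * (y * y) + (- (a * b) * (z * z) + - d * (w * w))) ≡ + 0 × ¬ (x ≡ + 0 × y ≡ + 0 × z ≡ + 0 × w ≡ + 0))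
      solution (x , y , z , w , e , ne) = K (x , y , z , w , w≢0 , moved)
        where
        ring : ∀ A B C D → A + B - C ≡ (A + (B + (- C + - D))) + D
        ring = solve-∀
        moved : a * (x * x) + b * (y * y) - a * b * (z * z) ≡ d * (w * w)
        moved = trans (ring (a * (x * x)) (b * (y * y)) (a * b * (z * z)) (d * (w * w)))
          (trans (cong (_+ d * (w * w)) (trans (cong₂ (λ s t → a * (x * x) + (b * (y * y) + (s + t))) (ℤP.neg-distribˡ-* (a * b) (z * z)) (ℤP.neg-distribˡ-* d (w * w))) e)) (ℤP.+-identityˡ _))
        ring′ : ∀ A B C d → A + (B + C) ≡ A + (B + (C + - d * (+ 0 * + 0)))
        ring′ = solve-∀
        w≢0 : w ≢ + 0
        w≢0 refl = let (x0 , y0 , z0) = anisotropic x y z (trans (ring′ (a * (x * x)) (b * (y * y)) (- (a * b) * (z * z)) d) e) in ne (x0 , y0 , z0 , refl)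

    -- The ramification at r supplies it: the symbol (a, b) at r is -, and in each case that symbol
    -- is the character of an explicit unit.
    nonresidue : Prime (oddℕ ρ) → ∃ λ w → ¬ (+ oddℕ ρ ∣ w) × legendre ρ w ≡ Sign.-
    nonresidue rr = go (valuationℤ rr a a≢0) (valuationℤ rr b b≢0)
      where
      go : (∃ λ e → ∃ λ u → a ≡ (+ oddℕ ρ) ^ e * u × ¬ (+ oddℕ ρ ∣ u)) → (∃ λ f → ∃ λ v → b ≡ (+ oddℕ ρ) ^ f * v × ¬ (+ oddℕ ρ ∣ v)) → ∃ λ w → ¬ (+ oddℕ ρ ∣ w) × legendre ρ w ≡ Sign.-
      go (e , u , ea , nu) (f , v , eb , nv) = pick (odd e) (odd f) (tame-target ρ rr (yes refl) e f ea eb nu nv)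
        where
        pick : ∀ x y → tameSymbol (legendre ρ) x u y v ≡ Sign.- → ∃ λ w → ¬ (+ oddℕ ρ ∣ w) × legendre ρ w ≡ Sign.-
        pick false false ()
        pick true  false t = v , nv , t
        pick false true  t = u , nu , t
        pick true  true  t = - (u * v) , ∤-neg (∤-* rr nu nv) , t

  -- If x² − D were a square for every x, the squares would be closed under x ↦ x − D, so everything would be a square.
  module ChooseTrace (ρ : ℕ) (rr : Prime (oddℕ ρ)) (w : ℤ) (nw : ¬ (+ oddℕ ρ ∣ w)) (lw : legendre ρ w ≡ Sign.-)
                     (D : ℤ) (nD : ¬ (+ oddℕ ρ ∣ D)) where

    private
      r = oddℕ ρ

      Square : ℤ → Set
      Square x = ∃ λ y → y * y ≋ x mod r

      Good : ℕ → Set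
      Good t = ¬ (+ r ∣ + t * + t - D) × legendre ρ (+ t * + t - D) ≡ Sign.-

      good? : ∀ t → Good t ⊎ Square (+ t * + t - D)
      good? t with ∣? {r} (+ t * + t - D)
      ... | yes e = inj₂ (+ 0 , ≋-sym (∣⇒≋0 e))
      ... | no ne with legendre ρ (+ t * + t - D) in l
      ...   | Sign.- = inj₁ (ne , refl)
      ...   | Sign.+ = inj₂ (Half.legendre-+⇒square ρ rr ne l)

      search : ∀ n → (∃ λ t → t ℕ.≤ n × Good t) ⊎ (∀ t → t ℕ.≤ n → Square (+ t * + t - D))
      search zero with good? 0
      ... | inj₁ g = inj₁ (0 , ℕ.z≤n , g)
      ... | inj₂ s = inj₂ (λ { zero ℕ.z≤n → s })
      search (suc n) with search n | good? (suc n)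
      ... | inj₁ (t , l , g) | _ = inj₁ (t , ℕP.m≤n⇒m≤1+n l , g)
      ... | inj₂ _ | inj₁ g = inj₁ (suc n , ℕP.≤-refl , g)
      ... | inj₂ h | inj₂ s = inj₂ (λ t l → step t (ℕP.m≤n⇒m<n∨m≡n l))
        where
        step : ∀ t → t ℕ.< suc n ⊎ t ≡ suc n → Square (+ t * + t - D)
        step t (inj₁ (ℕ.s≤s l)) = h t l
        step t (inj₂ refl) = s

      module _ (all-squares : ∀ t → t ℕ.≤ ρ → Square (+ t * + t - D)) where

        shift-square : ∀ {x} → Square x → Square (x - D)
        -- A search up to ρ = (r - 1)/2 is enough: y may be replaced by the absolute value of its
        -- least residue without changing y² mod r.
        shift-square {x} (y , e) = shift (all-squares (Half.a ρ y) (Half.a≤h ρ y))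
          where
          A ε : ℤ
          A = + Half.a ρ y
          ε = ⟦ Half.ε ρ y ⟧
          ring : ∀ ε A → ε * A * (ε * A) ≡ ε * ε * (A * A)
          ring = solve-∀
          A²≋x : A * A ≋ x mod r
          A²≋x = ≋-trans (≋-sym (≋-trans (≋-* (Half.signed ρ y) (Half.signed ρ y)) (≋-reflexive (trans (ring ε A) (trans (cong (_* (A * A)) (⟦⟧-square (Half.ε ρ y))) (ℤP.*-identityˡ (A * A))))))) e
          shift : Square (A * A - D) → Square (x - D)
          shift (s , f) = s , ≋-trans f (≋-- A²≋x (≋-refl {x = D}))

        multiples : ∀ k → Square (- (+ k * D))
        multiples zero    = + 0 , ≋-reflexive refl
        multiples (suc k) = subst Square (ring (+ k) D) (shift-square (multiples k))
          where ring : ∀ k D → - (k * D) - D ≡ - ((+ 1 + k) * D)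
                ring = solve-∀

        contradict : (∃ λ v → D * v ≋ + 1 mod r) → ⊥
        contradict (v , e) = absurd (multiples k)
          where
          -- With v inverse to D this makes -k D ≡ w, so the nonresidue w would be a square.
          k = (- (w * v)) %ℕ r
          ring : ∀ w v D → - (- (w * v) * D) ≡ w * (D * v)
          ring = solve-∀
          kD≋w : - (+ k * D) ≋ w mod r
          kD≋w = ≋-trans (≋-neg {x = + k * D} { - (w * v) * D} (≋-* (≋-sym (≋-%ℕ r (- (w * v)))) (≋-refl {x = D})))
            (≋-trans (≋-reflexive (ring w v D)) (≋-trans (≋-*ˡ w e) (≋-reflexive (ℤP.*-identityʳ w))))
          absurd : Square (- (+ k * D)) → ⊥
          absurd (y , f) = -≢+ (trans (sym lw) (trans (Half.legendre-cong ρ {w} {y * y} (≋-sym y²≋w)) (Half.legendre-square ρ rr ny)))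
            where
            y²≋w : y * y ≋ w mod r
            y²≋w = ≋-trans f kD≋w
            ny : ¬ (+ r ∣ y)
            ny d = nw (≋-∣ (≋-sym y²≋w) (∣n⇒∣m*n y d))

    trace : ∃ λ t → t ℕ.≤ ρ × ¬ (+ r ∣ + t * + t - D) × legendre ρ (+ t * + t - D) ≡ Sign.-
    trace with search ρ
    ... | inj₁ g = g
    ... | inj₂ h = ⊥-elim (contradict h (Local.inverse ρ rr nD))

  -- Here the constant r² / 16 originates: 2 t ≤ 2ρ < r gives 4 t² ≤ r² < 16 m.
  t²<4m : ∀ {ρ t m} → t ℕ.≤ ρ → oddℕ ρ ℕ.^ 2 ℕ.< 16 ℕ.* m → + t * + t - + 4 * + m ℤ.< + 0
  t²<4m {ρ} {t} {m} t≤ρ h = subst (ℤ._< + 0) (cong₂ _-_ (ℤP.pos-* t t) (ℤP.pos-* 4 m)) (difference (ℕP.*-cancelˡ-< 4 (t ℕ.* t) (4 ℕ.* m) (ℕP.≤-<-trans 4t²≤r² (subst (oddℕ ρ ℕ.^ 2 ℕ.<_) (ℕP.*-assoc 4 4 m) h))))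
    where
    ring : ∀ t → 4 ℕ.* (t ℕ.* t) ≡ (t ℕ.+ t) ℕ.* ((t ℕ.+ t) ℕ.* 1)
    ring = ℕRing.solve-∀
    2t≤r : t ℕ.+ t ℕ.≤ oddℕ ρ
    2t≤r = ℕP.≤-trans (ℕP.+-mono-≤ t≤ρ t≤ρ) (ℕP.n≤1+n (ρ ℕ.+ ρ))
    4t²≤r² : 4 ℕ.* (t ℕ.* t) ℕ.≤ oddℕ ρ ℕ.^ 2
    4t²≤r² = ℕP.≤-trans (ℕP.≤-reflexive (ring t)) (ℕP.*-mono-≤ 2t≤r (ℕP.*-monoˡ-≤ 1 2t≤r))
    difference : ∀ {x y} → x ℕ.< y → + x - + y ℤ.< + 0
    difference {x} {y} l = subst (+ x - + y ℤ.<_) (ℤP.+-inverseʳ (+ y)) (ℤP.+-monoˡ-< (- (+ y)) (+<+ l))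

  not-outlier : (r : ℕ) → Prime r → r ℕ.> 2 →
      (a b : ℤ) → RamifiedExactlyAt a b r →
      (m : ℕ) → m ℕ.> 0 → Coprime m r →
      16 ℕ.* m ℕ.> r ℕ.^ 2 →
      ¬ IsOutlier a b m
  not-outlier r rr 2<r a b ram m 0<m coprime bound outlier = go (odd-prime rr 2<r)
    where
    go : (∃ λ ρ → r ≡ oddℕ ρ) → ⊥
    go (ρ , refl) = choose (Ramified.nonresidue {a} {b} {ρ} ram rr)
      where
      -- Coprimality of m and r enters here: D = 4 m must be invertible mod r, so that its multiples
      -- exhaust all residues in the choice of the trace.
      r∤4m : ¬ (+ r ∣ + 4 * + m)
      r∤4m = ∤-* rr r∤4 (λ e → ∤1 rr (∣ᵤ⇒∣ (ℕD.∣-reflexive (coprime (∣⇒∣ᵤ e , ℕD.∣-refl)))))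
        where
        r∤2 : ¬ (+ r ∣ + 2)
        r∤2 = ∤-small (ℕ.s≤s ℕ.z≤n) 2<r
        r∤4 : ¬ (+ r ∣ + 4)
        r∤4 = ∤-* rr {+ 2} {+ 2} r∤2 r∤2
      choose : (∃ λ w → ¬ (+ r ∣ w) × legendre ρ w ≡ Sign.-) → ⊥
      choose (w , nw , lw) = with-trace (ChooseTrace.trace ρ rr w nw lw (+ 4 * + m) r∤4m)
        where
        with-trace : (∃ λ t → t ℕ.≤ ρ × ¬ (+ r ∣ + t * + t - + 4 * + m) × legendre ρ (+ t * + t - + 4 * + m) ≡ Sign.-) → ⊥
        with-trace (t , t≤ρ , r∤d , inert) = Ramified.represents {a} {b} {ρ} ram rr {d} d<0 r∤d inert λ (x , y , z , w , w≢0 , eq) →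
          outlier (integer-of-norm a b d t m x y z w refl (λ e → ℤP.<-irrefl e d<0) w≢0 eq)
          where
          d : ℤ
          d = + t * + t - + 4 * + m
          d<0 : d ℤ.< + 0
          d<0 = t²<4m {ρ} {t} {m} t≤ρ bound

open import Data.Nat using (_>_; _*_; _^_)
open import Data.Nat.Coprimality using (Coprime)
open import Data.Integer using (ℤ)

theorem5p10 : (r : ℕ) → Prime r → r > 2 →
    (a b : ℤ) → RamifiedExactlyAt a b r →
    (m : ℕ) → m > 0 → Coprime m r →
    16 * m > r ^ 2 →
    ¬ IsOutlier a b m
theorem5p10 = Outliers.not-outlier
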